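{- Let $n$ be a power of $2$ and let $f:[n]^d\to\{0,1\}$ be $\varepsilon$-far from being monotone. Then the tester described below, run on $f$ and $\varepsilon$, detects a violation (i.e. finds a pair $x\preceq y$ with $f(x)>f(y)$, and rejects) with probability $\Omega\!\left(\frac{\varepsilon^{4/3}}{d^{5/6}\log^{3/2}d\,\log^{4/3} n}\right)$. The tester: (1) Let $p$ be the largest integer with $2^p\le\sqrt{d/(10\log d)}$; choose $t\in\{0,1,\dots,p\}$ uniformly at random and set $\tau:=2^t$. (2) Choose $x\in[n]^d$ uniformly at random. (3) For each $i\in[d]$ independently choose $a_i\in\{0,1,\dots,\log_2 n-1\}$ and $c_i\in\{0,1\}$ uniformly at random and let $H_i:=H^{c_i}_{i,a_i}$. (4) Let $S\subseteq[d]$ be the set of coordinates $i$ such that $x$ is the lower endpoint of an edge of $H_i$. (5) If $|S|<\tau$, set $y=x$; otherwise choose $T\subseteq S$ with $|T|=\tau$ uniformly at random and set $y_i:=x_i+2^{a_i}$ for $i\in T$ and $y_j:=x_j$ for $j\notin T$. (6) If $f(x)>f(y)$ reject, otherwise accept.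
   Context: $[n]^d$ is partially ordered coordinatewise ($x\preceq y$ iff $x_i\le y_i$ for all $i$). $f$ is monotone if $f(x)\le f(y)$ whenever $x\preceq y$; $f$ is $\varepsilon$-far from monotone if $f$ differs from every monotone function on at least an $\varepsilon$ fraction of $[n]^d$. For $i\in[d]$, $a\ge 0$ an integer: $H^0_{i,a}$ is the set of pairs $(x,y)$ with $y_i-x_i=2^a$, $x_j=y_j$ for all $j\neq i$, and $x_i \bmod 2^{a+1}<2^a$; $H^1_{i,a}$ is the set of pairs $(x,y)$ with $y_i-x_i=2^a$, $x_j=y_j$ for $j\ne i$, and $x_i\bmod 2^{a+1}\ge 2^a$. In a pair $(x,y)$, $x$ is the lower and $y$ the upper endpoint. -}

module Defs where

open import Data.Bool using (Bool; true; false; _∧_; not; if_then_else_)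
import Data.Bool as B
open import Data.Nat as ℕ using (ℕ; zero; suc; _+_; _*_; _^_; _≤ᵇ_; _<ᵇ_; _%_)
open import Data.Nat.Properties using (m^n≢0)
open import Data.Fin as F using (Fin; toℕ; fromℕ<)
open import Data.Vec as V using (Vec; []; _∷_; lookup; tabulate)
open import Data.List as L using (List; []; _∷_; [_]; concatMap; map; length; allFin; upTo; filterᵇ)
open import Data.Integer using (+_)
open import Data.Rational as ℚ using (ℚ; 0ℚ; 1ℚ; _/_)
open import Relation.Nullary.Decidable using (yes; no)

ℕtoℚ : ℕ → ℚ
ℕtoℚ k = + k / 1

-- Points of [n]^d.  A point is a vector of Fin n; the coordinate value of
-- the entry j : Fin n is  toℕ j + 1  (so [n] = {1,…,n}).
Point : ℕ → ℕ → Set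
Point n d = Vec (Fin n) d

val : {n : ℕ} → Fin n → ℕ
val j = suc (toℕ j)

_⪯_ : {n d : ℕ} → Point n d → Point n d → Set
x ⪯ y = ∀ i → val (lookup x i) ℕ.≤ val (lookup y i)

Monotone : {n d : ℕ} → (Point n d → Bool) → Set
Monotone {n} {d} f = ∀ (x y : Point n d) → x ⪯ y → f x B.≤ f y

allVecs : {A : Set} → List A → (d : ℕ) → List (Vec A d)
allVecs xs zero = [ [] ]
allVecs xs (suc d) = concatMap (λ a → map (a ∷_) (allVecs xs d)) xs

allPoints : (n d : ℕ) → List (Point n d)
allPoints n d = allVecs (allFin n) d

bools : List Bool
bools = false ∷ true ∷ []

differ : Bool → Bool → Bool
differ true true = false
differ false false = false
differ _ _ = true

distance : {n d : ℕ} → (Point n d → Bool) → (Point n d → Bool) → ℕ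
distance {n} {d} f g = length (filterᵇ (λ x → differ (f x) (g x)) (allPoints n d))

FarFromMonotone : {n d : ℕ} → ℚ → (Point n d → Bool) → Set
FarFromMonotone {n} {d} ε f =
  ∀ (g : Point n d → Bool) → Monotone g →
    ε ℚ.* ℕtoℚ (n ^ d) ℚ.≤ ℕtoℚ (distance f g)

violates : Bool → Bool → Bool
violates fx fy = fx ∧ not fy

ratio : ℕ → ℕ → ℚ
ratio a zero = 0ℚ
ratio a (suc b) = + a / suc b

sumℚ : List ℚ → ℚ
sumℚ = L.foldr ℚ._+_ 0ℚ

avg : List ℚ → ℚ
avg [] = 0ℚ
avg (q ∷ qs) = sumℚ (q ∷ qs) ℚ.* (+ 1 / suc (length qs))

countTrue : {k : ℕ} → Vec Bool k → ℕ
countTrue [] = 0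
countTrue (true ∷ v) = suc (countTrue v)
countTrue (false ∷ v) = countTrue v

subsetᵇ : {k : ℕ} → Vec Bool k → Vec Bool k → Bool
subsetᵇ [] [] = true
subsetᵇ (true ∷ u) (false ∷ v) = false
subsetᵇ (_ ∷ u) (_ ∷ v) = subsetᵇ u v

-- Step 1: p = largest integer with 2^p ≤ sqrt(d / (10 log₂ d)).
-- For d ≥ 2 this is equivalent to  d ^ (10 * 4 ^ p) ≤ 2 ^ d  (exact in ℕ);
-- every such p satisfies p ≤ d, so we search downwards from d.
pValid : ℕ → ℕ → Bool
pValid d q = d ^ (10 * 4 ^ q) ≤ᵇ 2 ^ d

pOf : ℕ → ℕ
pOf d = go d
  where
  go : ℕ → ℕ
  go zero = 0
  go (suc q) = if pValid d (suc q) then suc q else go q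

-- embed a natural number into Fin n, falling back to a default value
-- (the fallback is never used by the tester: only in-range points are built)
toFin : {n : ℕ} → ℕ → Fin n → Fin n
toFin {n} k dflt with k ℕ.<? n
... | yes k<n = fromℕ< k<n
... | no _ = dflt

-- Step 4: i ∈ S iff x is the lower endpoint of an edge of H^{c_i}_{i,a_i}
-- (here n = 2^m, a_i ∈ {0,…,m-1} encoded as Fin m).
lowerEndpoint : (n : ℕ) → ℕ → ℕ → Bool → Bool
lowerEndpoint n v A c =
  (v + 2 ^ A ≤ᵇ n) ∧
  (if c then not low else low)
  where
  low : Bool
  low = _%_ v (2 ^ suc A) {{m^n≢0 2 (suc A)}} <ᵇ 2 ^ A

setS : {m d : ℕ} → Point (2 ^ m) d → Vec (Fin m) d → Vec Bool d → Vec Bool d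
setS {m} x a c =
  tabulate (λ i → lowerEndpoint (2 ^ m) (val (lookup x i)) (toℕ (lookup a i)) (lookup c i))

moveUp : {m d : ℕ} → Point (2 ^ m) d → Vec (Fin m) d → Vec Bool d → Point (2 ^ m) d
moveUp x a T =
  tabulate (λ i → if lookup T i
                  then toFin (toℕ (lookup x i) + 2 ^ toℕ (lookup a i)) (lookup x i)
                  else lookup x i)

-- conditional rejection probability given τ, x, (a_i), (c_i):
-- uniform over T ⊆ S with |T| = τ (or y = x if |S| < τ)
stepsFiveSix : {m d : ℕ} → (Point (2 ^ m) d → Bool) → ℕ →
               Point (2 ^ m) d → Vec (Fin m) d → Vec Bool d → ℚ
stepsFiveSix {m} {d} f τ x a c =
  if countTrue S <ᵇ τ
  then (if violates (f x) (f x) then 1ℚ else 0ℚ)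
  else ratio (length (filterᵇ (λ T → violates (f x) (f (moveUp x a T))) Ts)) (length Ts)
  where
  S : Vec Bool d
  S = setS x a c
  Ts : List (Vec Bool d)
  Ts = filterᵇ (λ T → subsetᵇ T S ∧ (countTrue T ℕ.≡ᵇ τ)) (allVecs bools d)

rejectProb : (m d : ℕ) → (Point (2 ^ m) d → Bool) → ℚ
rejectProb m d f =
  avg (map (λ t →
    avg (map (λ x →
      avg (map (λ a →
        avg (map (λ c → stepsFiveSix f (2 ^ t) x a c)
                 (allVecs bools d)))
               (allVecs (allFin m) d)))
             (allPoints (2 ^ m) d)))
      (upTo (suc (pOf d))))

powℚ : ℚ → ℕ → ℚ
powℚ q zero = 1ℚ
powℚ q (suc k) = q ℚ.* powℚ q k

{-# OPTIONS --safe #-}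
module Submission where

-- Let n = 2^m.  For a class h = (a , c) the edges of the H^c_{i,a}, i ∈ [d], form a graph on [n]^d that is a
-- disjoint union of cubes; let E_h be the number of its edges violated by f, and W_h the size of a maximal
-- matching of violated edges.
--
-- Isoperimetry.  Sorting f along random sets of directions turns one class into a question about functions on
-- {0,1}^d, for which a robust form of Margulis' inequality is proved by Fourier analysis.  It follows that f is,
-- for every K > 0, at distance O(K W_h + E_h / K) from a function sorted along the class h.  Functions sorted
-- along the single classes can be merged into a monotone one, so ε² = O(m² Γ e), where e and Γ are the densities
-- of the violated and of the matched edges among all classes.
--
-- Tester.  A walk of length 1 rejects with probability at least e/d.  In a walk of length τ, moving the step
-- along a matched edge to the front leaves a walk of length τ - 1 that starts at a zero of f, and the tester
-- rejects unless that walk reaches a one.  Reversing the walk bounds the chance of this by τ/d times the number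
-- of bichromatic edges, which is controlled by e and by a second moment.  Hence a walk of length τ rejects with
-- probability at least τΓ/(4d) if τ² is at most a small constant times Γ²d / log d.  For the largest such τ = 2^t,
-- the two bounds combine to (Γe)⁴ = O(q⁶ d⁵ log d), where q is the sum of the rejection probabilities over t.

open import Algebra.Solver.Ring.AlmostCommutativeRing using (_-Raw-AlmostCommutative⟶_; AlmostCommutativeRing; fromCommutativeRing)
open import Algebra.Structures using (IsCommutativeRing)
open import Data.Bool as B using (Bool; true; false; _∧_; _∨_; not; _xor_; T; f≤t; b≤b; if_then_else_)
open import Data.Bool.ListAction using (any)
open import Data.Empty using (⊥-elim)
open import Data.Fin using (Fin; zero; suc; toℕ; fromℕ<)
open import Data.Integer as ℤ using () renaming (+_ to pos)
open import Data.List as List using (List; []; _∷_; _++_; length; allFin; upTo; concatMap; filterᵇ)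
open import Data.List.Membership.Propositional using (_∈_)
open import Data.List.Membership.Propositional.Properties using (∈-allFin; ∈-concatMap⁺; ∈-map⁺; ∈-filter⁺; ∈-filter⁻)
open import Data.List.Relation.Unary.All as All using (All; []; _∷_)
open import Data.List.Relation.Unary.AllPairs using (AllPairs; []; _∷_)
open import Data.List.Relation.Unary.Any as Any using (Any; here; there)
open import Data.Nat as ℕ using (ℕ; zero; suc; _%_; _<ᵇ_; _≡ᵇ_; z≤n; s≤s)
open import Data.Nat.Logarithm using (⌊log₂_⌋; ⌊log₂⌋-mono-≤; ⌊log₂[2^n]⌋≡n)
open import Data.Nat.Solver using (module +-*-Solver)
open import Data.Product using (Σ-syntax; ∃; _×_; _,_; proj₁; proj₂)
open import Data.Rational as ℚ using (ℚ; 0ℚ; 1ℚ; ½; -½; _≤_; _<_; _/_)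
open import Data.Sum using (_⊎_; inj₁; inj₂)
open import Data.Unit using (⊤; tt)
open import Data.Vec as Vec using (Vec; []; _∷_; lookup; _[_]≔_)
open import Data.Vec.N-ary using (N-ary; _$ⁿ_)
open import Defs
open import Function using (_∘_; id)
open import Level using (0ℓ)
open import Relation.Binary.Consequences using (dec⇒weaklyDec)
open import Relation.Binary.Definitions using (DecidableEquality)
open import Relation.Binary.PropositionalEquality
open import Relation.Nullary using (¬_; yes; no)
open import Relation.Nullary.Decidable using (does; dec-true; dec-false; map′; _×-dec_)
import Algebra.Solver.Ring as RingSolver
import Data.Bool.Properties as Boolₚ
import Data.Fin.Properties as Finₚ
import Data.Integer.Properties as ℤₚ
import Data.List.Properties as Listₚ
import Data.Nat.DivMod as DM
import Data.Nat.Properties as ℕₚ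
import Data.Rational.Properties as ℚₚ
import Data.Rational.Unnormalised.Base as ℚᵘ
import Data.Rational.Unnormalised.Properties as ℚᵘₚ
import Data.Vec.Properties as Vecₚ

-- All quantities are rational, so no square root is ever taken: a bound by √(AB) is stated as k A +
-- κ B for all positive k and κ with k κ = 1, and k is chosen only where the bound is used. Both
-- isoperimetric inductions pass to random halves of a set of directions. The number of violated or
-- sensitive edges halves on average, but a set of points covering them need not shrink, so √(cover
-- · edges) gains only a factor √½ per halving. The losses of each round (4/3 on the cube, 2 for
-- three halvings when sorting) have to stay below this gain. Neither induction reaches a trivial
-- case; each is stopped after J rounds by a crude bound linear in the number of edges, which by
-- then carries the factor (2/3)^J. The obstacle in the analysis of long walks is dependence:
-- knowing that the first step uses a matched edge fixes the class of its direction, which could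
-- bias the rest of the walk. At the upper end of such an edge this class offers no way up, and at
-- least half of all classes offer none either. The walk cannot distinguish between them, so the
-- class can be drawn afresh at the cost of a factor 2.

module Development where
  open ℚₚ using (≤-refl; ≤-trans; ≤-reflexive; ≤-total; _<?_; ≮⇒≥; <⇒≤; <-≤-trans; <-irrefl; ≤ᵇ⇒≤)

  private variable
    A B : Set
    d : ℕ

  -- Rational arithmetic

  infixl 7 _*_
  infixl 6 _+_ _-_
  infix 8 -_

  -- Arithmetic is made opaque so that unification does not unfold the normalisation of fractions.
  opaque
    _+_ _*_ : ℚ → ℚ → ℚ
    _+_ = ℚ._+_
    _*_ = ℚ._*_

    -_ : ℚ → ℚ
    -_ = ℚ.-_

    ⟪_⟫ : ℕ → ℚ
    ⟪_⟫ = ℕtoℚ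

  _-_ : ℚ → ℚ → ℚ
  p - q = p + (- q)

  opaque
    unfolding _+_

    +-*-isCommutativeRing : IsCommutativeRing _≡_ _+_ _*_ -_ 0ℚ 1ℚ
    +-*-isCommutativeRing = ℚₚ.+-*-isCommutativeRing

    neg-def : ∀ p → - p ≡ ℚ.- p
    neg-def p = refl

    +-def : ∀ p q → p + q ≡ p ℚ.+ q
    +-def p q = refl

    *-def : ∀ p q → p * q ≡ p ℚ.* q
    *-def p q = refl

    ⟪⟫-def : ∀ k → ⟪ k ⟫ ≡ ℕtoℚ k
    ⟪⟫-def k = refl

    +-assoc : ∀ p q r → (p + q) + r ≡ p + (q + r)
    +-assoc = ℚₚ.+-assoc
    +-comm : ∀ p q → p + q ≡ q + p
    +-comm = ℚₚ.+-comm
    +-identityˡ : ∀ p → 0ℚ + p ≡ p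
    +-identityˡ = ℚₚ.+-identityˡ
    +-identityʳ : ∀ p → p + 0ℚ ≡ p
    +-identityʳ = ℚₚ.+-identityʳ
    +-inverseʳ : ∀ p → p - p ≡ 0ℚ
    +-inverseʳ = ℚₚ.+-inverseʳ
    neg-distrib-+ : ∀ p q → - (p + q) ≡ (- p) + (- q)
    neg-distrib-+ = ℚₚ.neg-distrib-+
    -0≡0 : - 0ℚ ≡ 0ℚ
    -0≡0 = refl
    *-assoc : ∀ p q r → (p * q) * r ≡ p * (q * r)
    *-assoc = ℚₚ.*-assoc
    *-comm : ∀ p q → p * q ≡ q * p
    *-comm = ℚₚ.*-comm
    *-identityˡ : ∀ p → 1ℚ * p ≡ p
    *-identityˡ = ℚₚ.*-identityˡ
    *-identityʳ : ∀ p → p * 1ℚ ≡ p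
    *-identityʳ = ℚₚ.*-identityʳ
    *-zeroˡ : ∀ p → 0ℚ * p ≡ 0ℚ
    *-zeroˡ = ℚₚ.*-zeroˡ
    *-zeroʳ : ∀ p → p * 0ℚ ≡ 0ℚ
    *-zeroʳ = ℚₚ.*-zeroʳ
    *-distribˡ-+ : ∀ p q r → p * (q + r) ≡ p * q + p * r
    *-distribˡ-+ = ℚₚ.*-distribˡ-+
    +-mono-≤ : ∀ {p q r s} → p ≤ q → r ≤ s → p + r ≤ q + s
    +-mono-≤ = ℚₚ.+-mono-≤
    +-monoˡ-≤ : ∀ r {p q} → p ≤ q → p + r ≤ q + r
    +-monoˡ-≤ = ℚₚ.+-monoˡ-≤
    +-monoʳ-≤ : ∀ r {p q} → p ≤ q → r + p ≤ r + q
    +-monoʳ-≤ = ℚₚ.+-monoʳ-≤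
    +-mono-<-≤ : ∀ {p q r s} → p < q → r ≤ s → p + r < q + s
    +-mono-<-≤ = ℚₚ.+-mono-<-≤
    neg-antimono-≤ : ∀ {p} → p ≤ 0ℚ → 0ℚ ≤ - p
    neg-antimono-≤ = ℚₚ.neg-antimono-≤
    *-monoˡ : ∀ {r p q} → 0ℚ ≤ r → p ≤ q → r * p ≤ r * q
    *-monoˡ {r} 0≤r = ℚₚ.*-monoˡ-≤-nonNeg r {{ℚ.nonNegative 0≤r}}
    *-monoʳ : ∀ {r p q} → 0ℚ ≤ r → p ≤ q → p * r ≤ q * r
    *-monoʳ {r} 0≤r = ℚₚ.*-monoʳ-≤-nonNeg r {{ℚ.nonNegative 0≤r}}
    *-cancelˡ : ∀ {r p q} → 0ℚ < r → r * p ≤ r * q → p ≤ q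
    *-cancelˡ {r} 0<r = ℚₚ.*-cancelˡ-≤-pos r {{ℚ.positive 0<r}}
    *-pos : ∀ {p q} → 0ℚ < p → 0ℚ < q → 0ℚ < p * q
    *-pos {p} {q} 0<p 0<q = ℚₚ.positive⁻¹ (p * q) {{ℚₚ.pos*pos⇒pos p {{ℚ.positive 0<p}} q {{ℚ.positive 0<q}}}}
    inverse : ∀ {p} → 0ℚ < p → Σ[ q ∈ ℚ ] (0ℚ < q) × (p * q ≡ 1ℚ)
    inverse {p} 0<p = ℚ.1/_ p {{nz}} , ℚₚ.positive⁻¹ (ℚ.1/_ p {{nz}}) {{ℚₚ.1/pos⇒pos p {{ℚ.positive 0<p}}}} , ℚₚ.*-inverseʳ p {{nz}}
      where
      nz : ℚ.NonZero p
      nz = ℚₚ.pos⇒nonZero p {{ℚ.positive 0<p}}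

  private
    acr : AlmostCommutativeRing 0ℓ 0ℓ
    acr = fromCommutativeRing (record { isCommutativeRing = +-*-isCommutativeRing })

    coefficients : ℚ.+-*-rawRing -Raw-AlmostCommutative⟶ acr
    coefficients = record { ⟦_⟧ = id ; +-homo = λ p q → sym (+-def p q) ; *-homo = λ p q → sym (*-def p q)
      ; -‿homo = λ p → sym (neg-def p) ; 0-homo = refl ; 1-homo = refl }

  module Solver = RingSolver ℚ.+-*-rawRing acr coefficients (dec⇒weaklyDec ℚₚ._≟_)
  open Solver using (solve; con; _:+_; _:*_; _:-_; :-_; _:=_; Polynomial; normalise; ⟦_⟧; ⟦_⟧N; correct)

  2ℚ 3ℚ 4ℚ : ℚ
  2ℚ = pos 2 / 1
  3ℚ = pos 3 / 1
  4ℚ = pos 4 / 1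

  0≤1 : 0ℚ ≤ 1ℚ
  0≤1 = ≤ᵇ⇒≤ tt

  *-nonNeg : ∀ {p q} → 0ℚ ≤ p → 0ℚ ≤ q → 0ℚ ≤ p * q
  *-nonNeg {p} {q} 0≤p 0≤q =
    subst (_≤ p * q) (*-zeroʳ p) (*-monoˡ 0≤p 0≤q)

  *-mono : ∀ {p q r s} → 0ℚ ≤ p → 0ℚ ≤ r → p ≤ q → r ≤ s → p * r ≤ q * s
  *-mono 0≤p 0≤r p≤q r≤s = ≤-trans (*-monoʳ 0≤r p≤q) (*-monoˡ (≤-trans 0≤p p≤q) r≤s)

  +-nonNeg : ∀ {p q} → 0ℚ ≤ p → 0ℚ ≤ q → 0ℚ ≤ p + q
  +-nonNeg {p} {q} 0≤p 0≤q = subst (_≤ p + q) (+-identityˡ 0ℚ) (+-mono-≤ 0≤p 0≤q)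

  +-pos : ∀ {p q} → 0ℚ < p → 0ℚ ≤ q → 0ℚ < p + q
  +-pos {p} {q} 0<p 0≤q = subst (_< p + q) (+-identityˡ 0ℚ) (+-mono-<-≤ 0<p 0≤q)

  slack : ∀ {p q} → p ≤ q → 0ℚ ≤ q - p
  slack {p} {q} p≤q = subst (_≤ q - p) (+-inverseʳ p) (+-monoˡ-≤ (- p) p≤q)

  by-slack : ∀ {p q} r → 0ℚ ≤ r → q - p ≡ r → p ≤ q
  by-slack {p} {q} r 0≤r eq = subst₂ _≤_ (+-identityˡ p) (solve 2 (λ p q → (q :- p) :+ p := q) refl p q)
    (+-monoˡ-≤ p (subst (0ℚ ≤_) (sym eq) 0≤r))

  sq-nonNeg : ∀ p → 0ℚ ≤ p * p
  sq-nonNeg p with ≤-total 0ℚ p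
  ... | inj₁ 0≤p = *-nonNeg 0≤p 0≤p
  ... | inj₂ p≤0 = subst (0ℚ ≤_) (solve 1 (λ p → (:- p) :* (:- p) := p :* p) refl p)
                     (*-nonNeg (neg-antimono-≤ p≤0) (neg-antimono-≤ p≤0))

  vars : ∀ n → Vec (Polynomial n) n
  vars n = Vec.map Solver.var (Vec.allFin n)

  record Ineq (n : ℕ) : Set where
    constructor _⊑_by_
    field lhs rhs gap : Polynomial n
  infix 4 _⊑_by_

  -- lhs ≤ rhs because rhs - lhs is, as a polynomial, a visibly nonnegative expression.
  le : ∀ n (f : N-ary n (Polynomial n) (Ineq n)) → let open Ineq (f $ⁿ vars n) in
    normalise (rhs :- lhs) ≡ normalise gap → (ρ : Vec ℚ n) → 0ℚ ≤ ⟦ gap ⟧ ρ → ⟦ lhs ⟧ ρ ≤ ⟦ rhs ⟧ ρ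
  le n f eq ρ 0≤gap = by-slack (⟦ gap ⟧ ρ) 0≤gap
    (trans (sym (correct (rhs :- lhs) ρ)) (trans (cong (λ nf → ⟦ nf ⟧N ρ) eq) (correct gap ρ)))
    where open Ineq (f $ⁿ vars n)

  -- Identities checked by comparing polynomial normal forms.
  rg : ∀ n (f : N-ary n (Polynomial n) (Polynomial n × Polynomial n)) → let (l , r) = f $ⁿ vars n in
    normalise l ≡ normalise r → (ρ : Vec ℚ n) → ⟦ l ⟧ ρ ≡ ⟦ r ⟧ ρ
  rg n f eq ρ = let (l , r) = f $ⁿ vars n in
    trans (sym (correct l ρ)) (trans (cong (λ nf → ⟦ nf ⟧N ρ) eq) (correct r ρ))

  infixl 7 _·_ _⊛_
  infixl 6 _⊕_

  -- With `_⊛_` and `_·_` this reproduces the shape of a `gap` polynomial, so that the nonnegativity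
  -- asked for by `le` is assembled term by term.
  _⊕_ : ∀ {p q} → 0ℚ ≤ p → 0ℚ ≤ q → 0ℚ ≤ p + q
  _⊕_ = +-nonNeg

  _⊛_ : ∀ {p q} → 0ℚ ≤ p → 0ℚ ≤ q → 0ℚ ≤ p * q
  _⊛_ = *-nonNeg

  const≥0 : ∀ c → {T (0ℚ ℚ.≤ᵇ c)} → 0ℚ ≤ c
  const≥0 c {t} = ≤ᵇ⇒≤ t

  _·_ : ∀ {q} c → {T (0ℚ ℚ.≤ᵇ c)} → 0ℚ ≤ q → 0ℚ ≤ c * q
  _·_ c {t} 0≤q = *-nonNeg (const≥0 c {t}) 0≤q

  toℚᵘ-/ : ∀ a b → ℚ.toℚᵘ (pos a / suc b) ℚᵘ.≃ ℚᵘ.mkℚᵘ (pos a) b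
  toℚᵘ-/ a b = ℚₚ.toℚᵘ-fromℚᵘ (ℚᵘ.mkℚᵘ (pos a) b)

  opaque
    unfolding _+_

    ⟪⟫-+ : ∀ a b → ⟪ a ℕ.+ b ⟫ ≡ ⟪ a ⟫ + ⟪ b ⟫
    ⟪⟫-+ a b = ℚₚ.toℚᵘ-injective (ℚᵘₚ.≃-trans (toℚᵘ-/ (a ℕ.+ b) 0)
      (ℚᵘₚ.≃-trans (ℚᵘ.*≡* {ℚᵘ.mkℚᵘ (pos (a ℕ.+ b)) 0} {ℚᵘ.mkℚᵘ (pos a) 0 ℚᵘ.+ ℚᵘ.mkℚᵘ (pos b) 0} (cong (ℤ._* pos 1)
         (cong₂ ℤ._+_ (sym (ℤₚ.*-identityʳ (pos a))) (sym (ℤₚ.*-identityʳ (pos b))))))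
      (ℚᵘₚ.≃-sym (ℚᵘₚ.≃-trans (ℚₚ.toℚᵘ-homo-+ (ℕtoℚ a) (ℕtoℚ b)) (ℚᵘₚ.+-cong (toℚᵘ-/ a 0) (toℚᵘ-/ b 0))))))

    ratio-* : ∀ a b → ratio a (suc b) * ⟪ suc b ⟫ ≡ ⟪ a ⟫
    ratio-* a b = ℚₚ.toℚᵘ-injective (ℚᵘₚ.≃-trans (ℚₚ.toℚᵘ-homo-* (pos a / suc b) (ℕtoℚ (suc b)))
      (ℚᵘₚ.≃-trans (ℚᵘₚ.*-cong (toℚᵘ-/ a b) (toℚᵘ-/ (suc b) 0))
      (ℚᵘₚ.≃-trans (ℚᵘ.*≡* {ℚᵘ.mkℚᵘ (pos a) b ℚᵘ.* ℚᵘ.mkℚᵘ (pos (suc b)) 0} {ℚᵘ.mkℚᵘ (pos a) 0}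
          (trans (ℤₚ.*-identityʳ (pos a ℤ.* pos (suc b))) (cong (λ z → pos a ℤ.* pos (suc z)) (sym (ℕₚ.*-identityʳ b)))))
        (ℚᵘₚ.≃-sym (toℚᵘ-/ a 0)))))

    0≤⟪⟫ : ∀ a → 0ℚ ≤ ⟪ a ⟫
    0≤⟪⟫ a = ℚₚ.nonNegative⁻¹ (ℕtoℚ a) {{ℚₚ.normalize-nonNeg a 1}}

    0<⟪⟫ : ∀ a → 0ℚ < ⟪ suc a ⟫
    0<⟪⟫ a = ℚₚ.positive⁻¹ (ℕtoℚ (suc a)) {{ℚₚ.normalize-pos (suc a) 1}}

    ⟪0⟫ : ⟪ 0 ⟫ ≡ 0ℚ
    ⟪0⟫ = refl

    ⟪1⟫ : ⟪ 1 ⟫ ≡ 1ℚ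
    ⟪1⟫ = refl

  ⟪⟫-suc : ∀ a → ⟪ suc a ⟫ ≡ 1ℚ + ⟪ a ⟫
  ⟪⟫-suc a = trans (⟪⟫-+ 1 a) (cong (_+ ⟪ a ⟫) ⟪1⟫)

  ⟪⟫-* : ∀ a b → ⟪ a ℕ.* b ⟫ ≡ ⟪ a ⟫ * ⟪ b ⟫
  ⟪⟫-* zero b = trans ⟪0⟫ (trans (sym (*-zeroˡ ⟪ b ⟫)) (cong (_* ⟪ b ⟫) (sym ⟪0⟫)))
  ⟪⟫-* (suc a) b = begin
    ⟪ b ℕ.+ a ℕ.* b ⟫          ≡⟨ ⟪⟫-+ b (a ℕ.* b) ⟩
    ⟪ b ⟫ + ⟪ a ℕ.* b ⟫        ≡⟨ cong (⟪ b ⟫ +_) (⟪⟫-* a b) ⟩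
    ⟪ b ⟫ + ⟪ a ⟫ * ⟪ b ⟫      ≡⟨ solve 2 (λ a b → b :+ a :* b := (con 1ℚ :+ a) :* b) refl ⟪ a ⟫ ⟪ b ⟫ ⟩
    (1ℚ + ⟪ a ⟫) * ⟪ b ⟫       ≡⟨ cong (_* ⟪ b ⟫) (sym (⟪⟫-suc a)) ⟩
    ⟪ suc a ⟫ * ⟪ b ⟫          ∎
    where open ≡-Reasoning

  ⟪⟫-mono : ∀ {a b} → a ℕ.≤ b → ⟪ a ⟫ ≤ ⟪ b ⟫
  ⟪⟫-mono {a} {b} a≤b = subst (λ z → ⟪ a ⟫ ≤ ⟪ z ⟫) (ℕₚ.m+[n∸m]≡n a≤b)
    (subst₂ _≤_ (+-identityʳ ⟪ a ⟫) (sym (⟪⟫-+ a (b ℕ.∸ a))) (+-monoʳ-≤ ⟪ a ⟫ (0≤⟪⟫ (b ℕ.∸ a))))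

  ⟪⟫-cancel : ∀ {a b} → ⟪ a ⟫ ≤ ⟪ b ⟫ → a ℕ.≤ b
  ⟪⟫-cancel {a} {b} a≤b with a ℕ.≤? b
  ... | yes p = p
  ... | no ¬p = ⊥-elim (<-irrefl refl (<-≤-trans
    (subst₂ _<_ (+-identityˡ ⟪ b ⟫) (sym (⟪⟫-suc b)) (+-mono-<-≤ (ℚₚ.positive⁻¹ 1ℚ) ≤-refl))
    (≤-trans (⟪⟫-mono (ℕₚ.≰⇒> ¬p)) a≤b)))

  -- Finite sums and enumerated types

  Σ : List A → (A → ℚ) → ℚ
  Σ [] f = 0ℚ
  Σ (x ∷ xs) f = f x + Σ xs f

  Σ-cong : ∀ (xs : List A) {f g : A → ℚ} → (∀ x → f x ≡ g x) → Σ xs f ≡ Σ xs g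
  Σ-cong [] eq = refl
  Σ-cong (x ∷ xs) eq = cong₂ _+_ (eq x) (Σ-cong xs eq)

  Σ-mono : ∀ (xs : List A) {f g : A → ℚ} → (∀ x → f x ≤ g x) → Σ xs f ≤ Σ xs g
  Σ-mono [] le = ≤-refl
  Σ-mono (x ∷ xs) le = +-mono-≤ (le x) (Σ-mono xs le)

  Σ-nonNeg : ∀ (xs : List A) {f : A → ℚ} → (∀ x → 0ℚ ≤ f x) → 0ℚ ≤ Σ xs f
  Σ-nonNeg [] le = ≤-refl
  Σ-nonNeg (x ∷ xs) le = +-nonNeg (le x) (Σ-nonNeg xs le)

  Σ-0 : ∀ (xs : List A) → Σ xs (λ _ → 0ℚ) ≡ 0ℚ
  Σ-0 [] = refl
  Σ-0 (x ∷ xs) = trans (+-identityˡ _) (Σ-0 xs)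

  Σ-+ : ∀ (xs : List A) (f g : A → ℚ) → Σ xs (λ x → f x + g x) ≡ Σ xs f + Σ xs g
  Σ-+ [] f g = sym (+-identityˡ 0ℚ)
  Σ-+ (x ∷ xs) f g = trans (cong (f x + g x +_) (Σ-+ xs f g))
    (solve 4 (λ a b c d → a :+ b :+ (c :+ d) := a :+ c :+ (b :+ d)) refl (f x) (g x) (Σ xs f) (Σ xs g))

  Σ-*ˡ : ∀ (xs : List A) c (f : A → ℚ) → Σ xs (λ x → c * f x) ≡ c * Σ xs f
  Σ-*ˡ [] c f = sym (*-zeroʳ c)
  Σ-*ˡ (x ∷ xs) c f = trans (cong (c * f x +_) (Σ-*ˡ xs c f)) (sym (*-distribˡ-+ c (f x) (Σ xs f)))

  Σ-*ʳ : ∀ (xs : List A) c (f : A → ℚ) → Σ xs (λ x → f x * c) ≡ Σ xs f * c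
  Σ-*ʳ xs c f = trans (Σ-cong xs (λ x → *-comm (f x) c)) (trans (Σ-*ˡ xs c f) (*-comm c (Σ xs f)))

  Σ-neg : ∀ (xs : List A) (f : A → ℚ) → Σ xs (λ x → - f x) ≡ - Σ xs f
  Σ-neg [] f = sym -0≡0
  Σ-neg (x ∷ xs) f = trans (cong (- f x +_) (Σ-neg xs f)) (sym (neg-distrib-+ (f x) (Σ xs f)))

  Σ-- : ∀ (xs : List A) (f g : A → ℚ) → Σ xs (λ x → f x - g x) ≡ Σ xs f - Σ xs g
  Σ-- xs f g = trans (Σ-+ xs f (λ x → - g x)) (cong (Σ xs f +_) (Σ-neg xs g))

  Σ-swap : ∀ (xs : List A) (ys : List B) (f : A → B → ℚ) →
    Σ xs (λ x → Σ ys (f x)) ≡ Σ ys (λ y → Σ xs (λ x → f x y))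
  Σ-swap [] ys f = sym (Σ-0 ys)
  Σ-swap (x ∷ xs) ys f = trans (cong (Σ ys (f x) +_) (Σ-swap xs ys f)) (sym (Σ-+ ys (f x) (λ y → Σ xs (λ x → f x y))))

  Σ-++ : ∀ (xs ys : List A) (f : A → ℚ) → Σ (xs ++ ys) f ≡ Σ xs f + Σ ys f
  Σ-++ [] ys f = sym (+-identityˡ _)
  Σ-++ (x ∷ xs) ys f = trans (cong (f x +_) (Σ-++ xs ys f)) (sym (+-assoc (f x) (Σ xs f) (Σ ys f)))

  Σ-map : ∀ (g : A → B) (xs : List A) (f : B → ℚ) → Σ (List.map g xs) f ≡ Σ xs (f ∘ g)
  Σ-map g [] f = refl
  Σ-map g (x ∷ xs) f = cong (f (g x) +_) (Σ-map g xs f)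

  Σ-concatMap : ∀ (g : A → List B) (xs : List A) (f : B → ℚ) → Σ (concatMap g xs) f ≡ Σ xs (λ x → Σ (g x) f)
  Σ-concatMap g [] f = refl
  Σ-concatMap g (x ∷ xs) f = trans (Σ-++ (g x) (concatMap g xs) f) (cong (Σ (g x) f +_) (Σ-concatMap g xs f))

  Σ-const : ∀ (xs : List A) c → Σ xs (λ _ → c) ≡ ⟪ length xs ⟫ * c
  Σ-const [] c = trans (sym (*-zeroˡ c)) (cong (_* c) (sym ⟪0⟫))
  Σ-const (x ∷ xs) c = begin
    c + Σ xs (λ _ → c)                  ≡⟨ cong (c +_) (Σ-const xs c) ⟩
    c + ⟪ length xs ⟫ * c            ≡⟨ solve 2 (λ a c → c :+ a :* c := (con 1ℚ :+ a) :* c) refl (⟪ length xs ⟫) c ⟩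
    (1ℚ + ⟪ length xs ⟫) * c         ≡⟨ cong (_* c) (sym (⟪⟫-suc (length xs))) ⟩
    ⟪ length (x ∷ xs) ⟫ * c          ∎
    where open ≡-Reasoning

  ι : Bool → ℚ
  ι true = 1ℚ
  ι false = 0ℚ

  0≤ι : ∀ b → 0ℚ ≤ ι b
  0≤ι true = 0≤1
  0≤ι false = ≤-refl

  ι≤1 : ∀ b → ι b ≤ 1ℚ
  ι≤1 true = ≤-refl
  ι≤1 false = 0≤1

  ⟪⟫-filter : ∀ (p : A → Bool) xs → ⟪ length (filterᵇ p xs) ⟫ ≡ Σ xs (ι ∘ p)
  ⟪⟫-filter p [] = ⟪0⟫
  ⟪⟫-filter p (x ∷ xs) with p x
  ... | true = trans (⟪⟫-suc _) (cong (1ℚ +_) (⟪⟫-filter p xs))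
  ... | false = trans (⟪⟫-filter p xs) (sym (+-identityˡ _))

  Σ-allFin-suc : ∀ n (f : Fin (suc n) → ℚ) → Σ (allFin (suc n)) f ≡ f zero + Σ (allFin n) (f ∘ suc)
  Σ-allFin-suc n f = cong (f zero +_) (trans (cong (λ xs → Σ xs f) (sym (Listₚ.map-tabulate id suc))) (Σ-map suc (allFin n) f))

  Σ-vec : ∀ (xs : List A) d (f : Vec A (suc d) → ℚ) →
    Σ (allVecs xs (suc d)) f ≡ Σ xs (λ a → Σ (allVecs xs d) (λ v → f (a ∷ v)))
  Σ-vec xs d f = trans (Σ-concatMap (λ a → List.map (a ∷_) (allVecs xs d)) xs f)
    (Σ-cong xs (λ a → Σ-map (a ∷_) (allVecs xs d) f))

  pairs : List A → List B → List (A × B)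
  pairs xs ys = concatMap (λ a → List.map (a ,_) ys) xs

  Σ-pairs : ∀ (xs : List A) (ys : List B) f → Σ (pairs xs ys) f ≡ Σ xs (λ a → Σ ys (λ b → f (a , b)))
  Σ-pairs xs ys f = trans (Σ-concatMap (λ a → List.map (a ,_) ys) xs f) (Σ-cong xs (λ a → Σ-map (a ,_) ys f))

  -- The field sift says that every element is listed exactly once.
  record Enum (A : Set) : Set where
    field
      elems : List A
      _≟_ : DecidableEquality A
      sift : ∀ q (h : A → ℚ) → Σ elems (λ a → ι (does (a ≟ q)) * h a) ≡ h q

    sift-const : ∀ q c → Σ elems (λ a → ι (does (a ≟ q)) * c) ≡ c
    sift-const q c = sift q (λ _ → c)

    does-sym : ∀ a b → does (a ≟ b) ≡ does (b ≟ a)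
    does-sym a b with a ≟ b
    ... | yes refl = sym (dec-true (a ≟ a) refl)
    ... | no ne = sym (dec-false (b ≟ a) (ne ∘ sym))

    -- Expanding `g (π a)` with `sift` gives a double sum over the pairs with b = π a. For an
    -- involution this relation is symmetric, so the other order of summation sifts back to g.
    Σ-involution : (π : A → A) → (∀ a → π (π a) ≡ a) → ∀ (g : A → ℚ) → Σ elems (g ∘ π) ≡ Σ elems g
    Σ-involution π inv g = begin
      Σ elems (g ∘ π)                                                   ≡⟨ Σ-cong elems (λ a → sym (sift (π a) g)) ⟩
      Σ elems (λ a → Σ elems (λ b → ι (does (b ≟ π a)) * g b))          ≡⟨ Σ-swap elems elems _ ⟩
      Σ elems (λ b → Σ elems (λ a → ι (does (b ≟ π a)) * g b))          ≡⟨ Σ-cong elems (λ b → Σ-cong elems (λ a → cong (λ z → ι z * g b) (flip b a))) ⟩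
      Σ elems (λ b → Σ elems (λ a → ι (does (a ≟ π b)) * g b))          ≡⟨ Σ-cong elems (λ b → sift-const (π b) (g b)) ⟩
      Σ elems g                                                         ∎
      where
      open ≡-Reasoning
      flip : ∀ b a → does (b ≟ π a) ≡ does (a ≟ π b)
      flip b a with b ≟ π a
      ... | yes refl = sym (dec-true (a ≟ π (π a)) (sym (inv a)))
      ... | no ne = sym (dec-false (a ≟ π b) (λ { refl → ne (sym (inv b)) }))

  open Enum public using (elems)

  Enum-Fin : ∀ n → Enum (Fin n)
  Enum-Fin n = record { elems = allFin n ; _≟_ = Finₚ._≟_ ; sift = sift n }
    where
    sift : ∀ n q (h : Fin n → ℚ) → Σ (allFin n) (λ a → ι (does (a Finₚ.≟ q)) * h a) ≡ h q
    sift (suc n) zero h = trans (Σ-allFin-suc n _) (trans (cong₂ _+_ (*-identityˡ (h zero))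
      (trans (Σ-cong (allFin n) (λ a → *-zeroˡ (h (suc a)))) (Σ-0 (allFin n)))) (+-identityʳ (h zero)))
    sift (suc n) (suc q) h = trans (Σ-allFin-suc n _) (trans (cong₂ _+_ (*-zeroˡ (h zero)) (sift n q (h ∘ suc))) (+-identityˡ (h (suc q))))

  Enum-Bool : Enum Bool
  Enum-Bool = record { elems = bools ; _≟_ = Boolₚ._≟_ ; sift = λ
    { false h → trans (cong₂ _+_ (*-identityˡ (h false)) (trans (+-identityʳ _) (*-zeroˡ (h true)))) (+-identityʳ (h false))
    ; true h → trans (cong₂ _+_ (*-zeroˡ (h false)) (trans (+-identityʳ _) (*-identityˡ (h true)))) (+-identityˡ (h true)) } }

  ι-∧ : ∀ a b → ι (a ∧ b) ≡ ι a * ι b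
  ι-∧ true b = sym (*-identityˡ (ι b))
  ι-∧ false b = sym (*-zeroˡ (ι b))

  ×-≡-dec : DecidableEquality A → DecidableEquality B → DecidableEquality (A × B)
  ×-≡-dec _≟_ _≟′_ (a , b) (p , q) = map′ (λ { (refl , refl) → refl }) (λ { refl → refl , refl }) ((a ≟ p) ×-dec (b ≟′ q))

  Vec-≡-dec : DecidableEquality A → ∀ {d} → DecidableEquality (Vec A d)
  Vec-≡-dec _≟_ [] [] = yes refl
  Vec-≡-dec _≟_ (a ∷ v) (p ∷ q) = map′ (λ { (refl , refl) → refl }) (λ { refl → refl , refl }) ((a ≟ p) ×-dec Vec-≡-dec _≟_ v q)

  Enum-× : Enum A → Enum B → Enum (A × B)
  Enum-× EA EB = record
    { elems = pairs EA.elems EB.elems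
    ; _≟_ = ×-≡-dec EA._≟_ EB._≟_
    ; sift = λ (p , q) h → trans (Σ-pairs EA.elems EB.elems _) (trans (Σ-cong EA.elems (λ a → trans
        (Σ-cong EB.elems (λ b → trans (cong (λ z → z * h (a , b)) (ι-∧ (does (a EA.≟ p)) (does (b EB.≟ q)))) (*-assoc (ι (does (a EA.≟ p))) (ι (does (b EB.≟ q))) (h (a , b)))))
        (trans (Σ-*ˡ EB.elems _ _) (cong (ι (does (a EA.≟ p)) *_) (EB.sift q (λ b → h (a , b)))))))
        (EA.sift p (λ a → h (a , q)))) }
    where
    module EA = Enum EA
    module EB = Enum EB

  Enum-Vec : Enum A → ∀ d → Enum (Vec A d)
  Enum-Vec EA d = record { elems = allVecs (elems EA) d ; _≟_ = Vec-≡-dec (Enum._≟_ EA) ; sift = sift d }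
    where
    open Enum EA using (_≟_)
    sift : ∀ d q (h : Vec _ d → ℚ) → Σ (allVecs (elems EA) d) (λ a → ι (does (Vec-≡-dec _≟_ a q)) * h a) ≡ h q
    sift zero [] h = trans (+-identityʳ _) (*-identityˡ (h []))
    sift (suc d) (q ∷ qs) h = trans (Σ-vec (elems EA) d _) (trans (Σ-cong (elems EA) (λ a → trans
      (Σ-cong (allVecs (elems EA) d) (λ v → trans (cong (λ z → z * h (a ∷ v)) (ι-∧ (does (a ≟ q)) (does (Vec-≡-dec _≟_ v qs)))) (*-assoc (ι (does (a ≟ q))) _ (h (a ∷ v)))))
      (trans (Σ-*ˡ (allVecs (elems EA) d) _ _) (cong (ι (does (a ≟ q)) *_) (sift d qs (λ v → h (a ∷ v)))))))
      (Enum.sift EA q (λ a → h (a ∷ qs))))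

  -- Fourier analysis on the cube

  Cube : ℕ → Set
  Cube = Vec Bool

  -- `𝔼` averages over points of the cube, while `𝕊` sums over sets of coordinates, the Fourier
  -- indices; both are encoded as `Cube d`.
  𝔼 : ∀ d → (Cube d → ℚ) → ℚ
  𝔼 zero f = f []
  𝔼 (suc d) f = ½ * (𝔼 d (f ∘ (false ∷_)) + 𝔼 d (f ∘ (true ∷_)))

  𝕊 : ∀ d → (Cube d → ℚ) → ℚ
  𝕊 zero f = f []
  𝕊 (suc d) f = 𝕊 d (f ∘ (false ∷_)) + 𝕊 d (f ∘ (true ∷_))

  0≤½ : 0ℚ ≤ ½
  0≤½ = ≤ᵇ⇒≤ tt

  𝔼-cong : ∀ d {f g : Cube d → ℚ} → (∀ v → f v ≡ g v) → 𝔼 d f ≡ 𝔼 d g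
  𝔼-cong zero eq = eq []
  𝔼-cong (suc d) eq = cong₂ (λ a b → ½ * (a + b)) (𝔼-cong d (eq ∘ (false ∷_))) (𝔼-cong d (eq ∘ (true ∷_)))

  𝔼-mono : ∀ d {f g : Cube d → ℚ} → (∀ v → f v ≤ g v) → 𝔼 d f ≤ 𝔼 d g
  𝔼-mono zero le = le []
  𝔼-mono (suc d) le = *-monoˡ 0≤½ (+-mono-≤ (𝔼-mono d (le ∘ (false ∷_))) (𝔼-mono d (le ∘ (true ∷_))))

  𝔼-const : ∀ d c → 𝔼 d (λ _ → c) ≡ c
  𝔼-const zero c = refl
  𝔼-const (suc d) c = trans (cong (λ z → ½ * (z + z)) (𝔼-const d c)) (solve 1 (λ c → con ½ :* (c :+ c) := c) refl c)

  𝔼-nonNeg : ∀ d {f : Cube d → ℚ} → (∀ v → 0ℚ ≤ f v) → 0ℚ ≤ 𝔼 d f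
  𝔼-nonNeg d {f} le = subst (_≤ 𝔼 d f) (𝔼-const d 0ℚ) (𝔼-mono d le)

  𝔼-+ : ∀ d (f g : Cube d → ℚ) → 𝔼 d (λ v → f v + g v) ≡ 𝔼 d f + 𝔼 d g
  𝔼-+ zero f g = refl
  𝔼-+ (suc d) f g = trans (cong₂ (λ a b → ½ * (a + b)) (𝔼-+ d _ _) (𝔼-+ d _ _))
    (solve 4 (λ a b c e → con ½ :* ((a :+ b) :+ (c :+ e)) := con ½ :* (a :+ c) :+ con ½ :* (b :+ e)) refl
      (𝔼 d (f ∘ (false ∷_))) (𝔼 d (g ∘ (false ∷_))) (𝔼 d (f ∘ (true ∷_))) (𝔼 d (g ∘ (true ∷_))))

  𝔼-*ˡ : ∀ d c (f : Cube d → ℚ) → 𝔼 d (λ v → c * f v) ≡ c * 𝔼 d f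
  𝔼-*ˡ zero c f = refl
  𝔼-*ˡ (suc d) c f = trans (cong₂ (λ a b → ½ * (a + b)) (𝔼-*ˡ d c _) (𝔼-*ˡ d c _))
    (solve 3 (λ c a b → con ½ :* (c :* a :+ c :* b) := c :* (con ½ :* (a :+ b))) refl c (𝔼 d (f ∘ (false ∷_))) (𝔼 d (f ∘ (true ∷_))))

  𝔼-Σ : ∀ d (xs : List A) (f : Cube d → A → ℚ) → 𝔼 d (λ v → Σ xs (f v)) ≡ Σ xs (λ x → 𝔼 d (λ v → f v x))
  𝔼-Σ d [] f = 𝔼-const d 0ℚ
  𝔼-Σ d (x ∷ xs) f = trans (𝔼-+ d (λ v → f v x) (λ v → Σ xs (f v))) (cong (𝔼 d (λ v → f v x) +_) (𝔼-Σ d xs f))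

  𝔼-pigeonhole : ∀ d (f : Cube d → ℚ) → ∃ λ v → f v ≤ 𝔼 d f
  𝔼-pigeonhole zero f = [] , ≤-refl
  𝔼-pigeonhole (suc d) f with ≤-total (𝔼 d (f ∘ (false ∷_))) (𝔼 d (f ∘ (true ∷_)))
  ... | inj₁ le₀ = let v , p = 𝔼-pigeonhole d (f ∘ (false ∷_)) in false ∷ v , ≤-trans p
    (le 2 (λ a b → a ⊑ con ½ :* (a :+ b) by con ½ :* (b :- a)) refl (_ ∷ _ ∷ []) (½ · slack le₀))
  ... | inj₂ le₁ = let v , p = 𝔼-pigeonhole d (f ∘ (true ∷_)) in true ∷ v , ≤-trans p
    (le 2 (λ a b → b ⊑ con ½ :* (a :+ b) by con ½ :* (a :- b)) refl (_ ∷ _ ∷ []) (½ · slack le₁))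

  𝕊-cong : ∀ d {f g : Cube d → ℚ} → (∀ v → f v ≡ g v) → 𝕊 d f ≡ 𝕊 d g
  𝕊-cong zero eq = eq []
  𝕊-cong (suc d) eq = cong₂ _+_ (𝕊-cong d (eq ∘ (false ∷_))) (𝕊-cong d (eq ∘ (true ∷_)))

  𝕊-mono : ∀ d {f g : Cube d → ℚ} → (∀ v → f v ≤ g v) → 𝕊 d f ≤ 𝕊 d g
  𝕊-mono zero le = le []
  𝕊-mono (suc d) le = +-mono-≤ (𝕊-mono d (le ∘ (false ∷_))) (𝕊-mono d (le ∘ (true ∷_)))

  𝕊-+ : ∀ d (f g : Cube d → ℚ) → 𝕊 d (λ v → f v + g v) ≡ 𝕊 d f + 𝕊 d g
  𝕊-+ zero f g = refl
  𝕊-+ (suc d) f g = trans (cong₂ _+_ (𝕊-+ d _ _) (𝕊-+ d _ _))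
    (solve 4 (λ a b c e → (a :+ b) :+ (c :+ e) := (a :+ c) :+ (b :+ e)) refl
      (𝕊 d (f ∘ (false ∷_))) (𝕊 d (g ∘ (false ∷_))) (𝕊 d (f ∘ (true ∷_))) (𝕊 d (g ∘ (true ∷_))))

  𝕊-*ˡ : ∀ d c (f : Cube d → ℚ) → 𝕊 d (λ v → c * f v) ≡ c * 𝕊 d f
  𝕊-*ˡ zero c f = refl
  𝕊-*ˡ (suc d) c f = trans (cong₂ _+_ (𝕊-*ˡ d c _) (𝕊-*ˡ d c _)) (sym (*-distribˡ-+ c (𝕊 d (f ∘ (false ∷_))) (𝕊 d (f ∘ (true ∷_)))))

  𝕊-𝔼 : ∀ d e (f : Cube d → Cube e → ℚ) → 𝕊 d (λ S → 𝔼 e (f S)) ≡ 𝔼 e (λ b → 𝕊 d (λ S → f S b))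
  𝕊-𝔼 zero e f = refl
  𝕊-𝔼 (suc d) e f = trans (cong₂ _+_ (𝕊-𝔼 d e _) (𝕊-𝔼 d e _)) (sym (𝔼-+ e _ _))

  even odd : (Cube (suc d) → ℚ) → Cube d → ℚ
  even G v = ½ * (G (false ∷ v) + G (true ∷ v))
  odd G v = ½ * (G (false ∷ v) - G (true ∷ v))

  -- Fourier coefficients for the characters with values ±1: a set containing the first coordinate
  -- sees only the odd part in it, any other set only the even part.
  hat : (Cube d → ℚ) → Cube d → ℚ
  hat G [] = G []
  hat G (false ∷ S) = hat (even G) S
  hat G (true ∷ S) = hat (odd G) S

  hat-cong : ∀ {f g : Cube d → ℚ} → (∀ v → f v ≡ g v) → ∀ S → hat f S ≡ hat g S
  hat-cong eq [] = eq []
  hat-cong eq (false ∷ S) = hat-cong (λ v → cong₂ (λ a b → ½ * (a + b)) (eq (false ∷ v)) (eq (true ∷ v))) S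
  hat-cong eq (true ∷ S) = hat-cong (λ v → cong₂ (λ a b → ½ * (a - b)) (eq (false ∷ v)) (eq (true ∷ v))) S

  hat-linear : ∀ p q (f g : Cube d → ℚ) S → hat (λ v → p * f v + q * g v) S ≡ p * hat f S + q * hat g S
  hat-linear p q f g [] = refl
  hat-linear p q f g (false ∷ S) = trans (hat-cong (λ v → solve 6 (λ p q a b c e → con ½ :* ((p :* a :+ q :* b) :+ (p :* c :+ q :* e)) :=
      p :* (con ½ :* (a :+ c)) :+ q :* (con ½ :* (b :+ e))) refl p q (f (false ∷ v)) (g (false ∷ v)) (f (true ∷ v)) (g (true ∷ v))) S)
    (hat-linear p q (even f) (even g) S)
  hat-linear p q f g (true ∷ S) = trans (hat-cong (λ v → solve 6 (λ p q a b c e → con ½ :* ((p :* a :+ q :* b) :- (p :* c :+ q :* e)) :=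
      p :* (con ½ :* (a :- c)) :+ q :* (con ½ :* (b :- e))) refl p q (f (false ∷ v)) (g (false ∷ v)) (f (true ∷ v)) (g (true ∷ v))) S)
    (hat-linear p q (odd f) (odd g) S)

  energy : (Cube d → ℚ) → (Cube d → ℚ) → ℚ
  energy {d} c G = 𝕊 d (λ S → c S * (hat G S * hat G S))

  -- The even and odd parts are (G₀ ± G₁)/2 and `hat` is linear, so this is the parallelogram law
  -- for each coefficient. It turns the energy identities that follow into inductions over the
  -- coordinates.
  energy-parallelogram : ∀ (c : Cube d → ℚ) (G : Cube (suc d) → ℚ) →
    energy c (even G) + energy c (odd G) ≡ ½ * (energy c (G ∘ (false ∷_)) + energy c (G ∘ (true ∷_)))
  energy-parallelogram {d} c G = trans (sym (𝕊-+ d _ _)) (trans (𝕊-cong d pointwise)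
    (trans (𝕊-*ˡ d ½ _) (cong (½ *_) (𝕊-+ d _ _))))
    where
    G₀ = G ∘ (false ∷_)
    G₁ = G ∘ (true ∷_)
    hat-even : ∀ S → hat (even G) S ≡ ½ * hat G₀ S + ½ * hat G₁ S
    hat-even S = trans (hat-cong (λ v → *-distribˡ-+ ½ (G₀ v) (G₁ v)) S) (hat-linear ½ ½ G₀ G₁ S)
    hat-odd : ∀ S → hat (odd G) S ≡ ½ * hat G₀ S + -½ * hat G₁ S
    hat-odd S = trans (hat-cong (λ v → solve 2 (λ a b → con ½ :* (a :- b) := con ½ :* a :+ con -½ :* b) refl (G₀ v) (G₁ v)) S) (hat-linear ½ -½ G₀ G₁ S)
    pointwise : ∀ S → c S * (hat (even G) S * hat (even G) S) + c S * (hat (odd G) S * hat (odd G) S)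
      ≡ ½ * (c S * (hat G₀ S * hat G₀ S) + c S * (hat G₁ S * hat G₁ S))
    pointwise S = trans (cong₂ (λ u w → c S * (u * u) + c S * (w * w)) (hat-even S) (hat-odd S)) (rg 3 (λ c a b →
      c :* ((con ½ :* a :+ con ½ :* b) :* (con ½ :* a :+ con ½ :* b)) :+ c :* ((con ½ :* a :+ con -½ :* b) :* (con ½ :* a :+ con -½ :* b))
      := con ½ :* (c :* (a :* a) :+ c :* (b :* b))) refl (c S ∷ hat G₀ S ∷ hat G₁ S ∷ []))

  -- Parseval's identity.
  energy-one : ∀ (G : Cube d → ℚ) → energy (λ _ → 1ℚ) G ≡ 𝔼 d (λ v → G v * G v)
  energy-one {zero} G = *-identityˡ _
  energy-one {suc d} G = trans (energy-parallelogram (λ _ → 1ℚ) G) (cong (½ *_) (cong₂ _+_ (energy-one (G ∘ (false ∷_))) (energy-one (G ∘ (true ∷_)))))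

  infixr 6 _∩_
  _∩_ : Cube d → Cube d → Cube d
  [] ∩ [] = []
  (a ∷ S) ∩ (b ∷ R) = (a ∧ b) ∷ (S ∩ R)

  isEmpty isSingle : Cube d → Bool
  isEmpty [] = true
  isEmpty (true ∷ S) = false
  isEmpty (false ∷ S) = isEmpty S
  isSingle [] = false
  isSingle (true ∷ S) = isEmpty S
  isSingle (false ∷ S) = isSingle S

  size : Cube d → ℚ
  size [] = 0ℚ
  size (b ∷ S) = ι b + size S

  -- avg R G averages out the coordinates of R; dsq R G is the sum of the squared degree-one
  -- coefficients of the restriction of G to the subcube of directions R.
  avg′ : Cube d → (Cube d → ℚ) → Cube d → ℚ
  avg′ [] G [] = G []
  avg′ (true ∷ R) G (b ∷ v) = avg′ R (even G) v
  avg′ (false ∷ R) G (b ∷ v) = avg′ R (G ∘ (b ∷_)) v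

  dbil : Cube d → (Cube d → ℚ) → (Cube d → ℚ) → Cube d → ℚ
  dbil [] G F [] = 0ℚ
  dbil (true ∷ R) G F (b ∷ v) = avg′ R (odd G) v * avg′ R (odd F) v + dbil R (even G) (even F) v
  dbil (false ∷ R) G F (b ∷ v) = dbil R (G ∘ (b ∷_)) (F ∘ (b ∷_)) v

  dsq : Cube d → (Cube d → ℚ) → Cube d → ℚ
  dsq R G = dbil R G G

  -- Averaging over the coordinates of R removes exactly the coefficients of the sets that meet R.
  energy-avg : ∀ (R : Cube d) (G : Cube d → ℚ) →
    energy (λ S → ι (isEmpty (S ∩ R))) G ≡ 𝔼 d (λ v → avg′ R G v * avg′ R G v)
  energy-avg [] G = *-identityˡ _
  energy-avg {suc d} (false ∷ R) G = trans (energy-parallelogram (λ S → ι (isEmpty (S ∩ R))) G)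
    (cong₂ (λ a b → ½ * (a + b)) (energy-avg R (G ∘ (false ∷_))) (energy-avg R (G ∘ (true ∷_))))
  energy-avg {suc d} (true ∷ R) G = trans (cong₂ _+_ (energy-avg R (even G))
      (trans (𝕊-cong d (λ S → *-zeroˡ _)) (trans (trans (sym (𝕊-cong d (λ S → *-zeroˡ 0ℚ))) (𝕊-*ˡ d 0ℚ (λ _ → 0ℚ))) (*-zeroˡ _))))
    (solve 1 (λ a → a :+ con 0ℚ := con ½ :* (a :+ a)) refl _)

  energy-dsq : ∀ (R : Cube d) (G : Cube d → ℚ) →
    energy (λ S → ι (isSingle (S ∩ R))) G ≡ 𝔼 d (dsq R G)
  energy-dsq [] G = *-zeroˡ _
  energy-dsq {suc d} (false ∷ R) G = trans (energy-parallelogram (λ S → ι (isSingle (S ∩ R))) G)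
    (cong₂ (λ a b → ½ * (a + b)) (energy-dsq R (G ∘ (false ∷_))) (energy-dsq R (G ∘ (true ∷_))))
  energy-dsq {suc d} (true ∷ R) G = trans (cong₂ _+_ (energy-dsq R (even G)) (energy-avg R (odd G)))
    (trans (solve 2 (λ a b → a :+ b := con ½ :* ((b :+ a) :+ (b :+ a))) refl _ _)
    (cong (λ z → ½ * (z + z)) (sym (𝔼-+ d _ _))))

  sens : Cube d → (Cube d → Bool) → Cube d → ℚ
  sens [] F [] = 0ℚ
  sens (r ∷ R) F (b ∷ v) = ι r * ι (F (false ∷ v) xor F (true ∷ v)) + sens R (F ∘ (b ∷_)) v

  -- The Fourier formula for total influence. For values in {0,1} a sensitive edge contributes
  -- (1/2)² to the square of the odd part, hence the factor 4.
  energy-size : ∀ (R : Cube d) (F : Cube d → Bool) → 4ℚ * energy (λ S → size (S ∩ R)) (ι ∘ F) ≡ 𝔼 d (sens R F)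
  energy-size [] F = trans (cong (4ℚ *_) (*-zeroˡ _)) (*-zeroʳ 4ℚ)
  energy-size {suc d} (r ∷ R) F = begin
    4ℚ * (energy (λ S → ι false + size (S ∩ R)) (even G) + energy (λ S → ι r + size (S ∩ R)) (odd G))
      ≡⟨ cong₂ (λ a b → 4ℚ * (a + b)) (𝕊-cong d (λ S → cong (_* (hat (even G) S * hat (even G) S)) (+-identityˡ (size (S ∩ R)))))
          (trans (𝕊-cong d (λ S → rg 3 (λ r s h → (r :+ s) :* h := r :* (con 1ℚ :* h) :+ s :* h) refl (ι r ∷ size (S ∩ R) ∷ _ ∷ [])))
            (trans (𝕊-+ d _ _) (cong (λ z → z + energy w (odd G)) (trans (𝕊-*ˡ d (ι r) _) (cong (ι r *_) (energy-one (odd G))))))) ⟩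
    4ℚ * (energy w (even G) + (ι r * 𝔼 d (λ v → odd G v * odd G v) + energy w (odd G)))
      ≡⟨ rg 4 (λ a b c r → con 4ℚ :* (a :+ (r :* b :+ c)) := con 4ℚ :* (a :+ c) :+ r :* (con 4ℚ :* b)) refl
          (energy w (even G) ∷ 𝔼 d (λ v → odd G v * odd G v) ∷ energy w (odd G) ∷ ι r ∷ []) ⟩
    4ℚ * (energy w (even G) + energy w (odd G)) + ι r * (4ℚ * 𝔼 d (λ v → odd G v * odd G v))
      ≡⟨ cong₂ (λ a b → 4ℚ * a + ι r * b) (energy-parallelogram w G) (trans (sym (𝔼-*ˡ d 4ℚ _)) (𝔼-cong d (λ v → square (F (false ∷ v)) (F (true ∷ v))))) ⟩
    4ℚ * (½ * (energy w (G ∘ (false ∷_)) + energy w (G ∘ (true ∷_)))) + ι r * 𝔼 d D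
      ≡⟨ rg 4 (λ a b r e → con 4ℚ :* (con ½ :* (a :+ b)) :+ r :* e := con ½ :* ((r :* e :+ con 4ℚ :* a) :+ (r :* e :+ con 4ℚ :* b))) refl
          (energy w (G ∘ (false ∷_)) ∷ energy w (G ∘ (true ∷_)) ∷ ι r ∷ 𝔼 d D ∷ []) ⟩
    ½ * ((ι r * 𝔼 d D + 4ℚ * energy w (G ∘ (false ∷_))) + (ι r * 𝔼 d D + 4ℚ * energy w (G ∘ (true ∷_))))
      ≡⟨ cong₂ (λ a b → ½ * (a + b)) (half false) (half true) ⟩
    𝔼 (suc d) (sens (r ∷ R) F) ∎
    where
    open ≡-Reasoning
    G = ι ∘ F
    w = λ S → size (S ∩ R)
    D = λ v → ι (F (false ∷ v) xor F (true ∷ v))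
    square : ∀ a b → 4ℚ * (½ * (ι a - ι b) * (½ * (ι a - ι b))) ≡ ι (a xor b)
    square true true = rg 0 (con 4ℚ :* (con ½ :* (con 1ℚ :- con 1ℚ) :* (con ½ :* (con 1ℚ :- con 1ℚ))) := con 0ℚ) refl []
    square true false = rg 0 (con 4ℚ :* (con ½ :* (con 1ℚ :- con 0ℚ) :* (con ½ :* (con 1ℚ :- con 0ℚ))) := con 1ℚ) refl []
    square false true = rg 0 (con 4ℚ :* (con ½ :* (con 0ℚ :- con 1ℚ) :* (con ½ :* (con 0ℚ :- con 1ℚ))) := con 1ℚ) refl []
    square false false = rg 0 (con 4ℚ :* (con ½ :* (con 0ℚ :- con 0ℚ) :* (con ½ :* (con 0ℚ :- con 0ℚ))) := con 0ℚ) refl []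
    half : ∀ b → ι r * 𝔼 d D + 4ℚ * energy w (G ∘ (b ∷_)) ≡ 𝔼 d (λ v → ι r * D v + sens R (F ∘ (b ∷_)) v)
    half b = trans (cong₂ _+_ (sym (𝔼-*ˡ d (ι r) D)) (energy-size R (F ∘ (b ∷_)))) (sym (𝔼-+ d _ _))

  avg′-cong : ∀ (R : Cube d) {f g : Cube d → ℚ} → (∀ v → f v ≡ g v) → ∀ v → avg′ R f v ≡ avg′ R g v
  avg′-cong [] eq [] = eq []
  avg′-cong (true ∷ R) eq (b ∷ v) = avg′-cong R (λ u → cong₂ (λ x y → ½ * (x + y)) (eq (false ∷ u)) (eq (true ∷ u))) v
  avg′-cong (false ∷ R) eq (b ∷ v) = avg′-cong R (eq ∘ (b ∷_)) v

  avg′-mono : ∀ (R : Cube d) {f g : Cube d → ℚ} → (∀ v → f v ≤ g v) → ∀ v → avg′ R f v ≤ avg′ R g v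
  avg′-mono [] le [] = le []
  avg′-mono (true ∷ R) le (b ∷ v) = avg′-mono R (λ u → *-monoˡ 0≤½ (+-mono-≤ (le (false ∷ u)) (le (true ∷ u)))) v
  avg′-mono (false ∷ R) le (b ∷ v) = avg′-mono R (le ∘ (b ∷_)) v

  avg′-const : ∀ (R : Cube d) c v → avg′ R (λ _ → c) v ≡ c
  avg′-const [] c [] = refl
  avg′-const (true ∷ R) c (b ∷ v) = trans (avg′-cong R (λ _ → rg 1 (λ c → con ½ :* (c :+ c) := c) refl (c ∷ [])) v) (avg′-const R c v)
  avg′-const (false ∷ R) c (b ∷ v) = avg′-const R c v

  avg′-+ : ∀ (R : Cube d) (f g : Cube d → ℚ) v → avg′ R (λ u → f u + g u) v ≡ avg′ R f v + avg′ R g v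
  avg′-+ [] f g [] = refl
  avg′-+ (true ∷ R) f g (b ∷ v) = trans (avg′-cong R (λ u → rg 4 (λ a b c e → con ½ :* ((a :+ b) :+ (c :+ e)) := con ½ :* (a :+ c) :+ con ½ :* (b :+ e)) refl
    (f (false ∷ u) ∷ g (false ∷ u) ∷ f (true ∷ u) ∷ g (true ∷ u) ∷ [])) v) (avg′-+ R (even f) (even g) v)
  avg′-+ (false ∷ R) f g (b ∷ v) = avg′-+ R (f ∘ (b ∷_)) (g ∘ (b ∷_)) v

  dsq-nonNeg : ∀ (R : Cube d) (G : Cube d → ℚ) v → 0ℚ ≤ dsq R G v
  dsq-nonNeg [] G [] = ≤-refl
  dsq-nonNeg (true ∷ R) G (b ∷ v) = sq-nonNeg (avg′ R (odd G) v) ⊕ dsq-nonNeg R (even G) v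
  dsq-nonNeg (false ∷ R) G (b ∷ v) = dsq-nonNeg R (G ∘ (b ∷_)) v

  -- Bessel's inequality on each subcube with directions R, for the constant and the degree-one
  -- characters.
  bessel : ∀ (R : Cube d) (G : Cube d → ℚ) v → avg′ R G v * avg′ R G v + dsq R G v ≤ avg′ R (λ u → G u * G u) v
  bessel [] G [] = ≤-reflexive (+-identityʳ _)
  bessel (true ∷ R) G (b ∷ v) = ≤-trans
    (le 5 (λ e o t p q → e :+ (o :+ t) ⊑ p :+ q by (p :- (e :+ t)) :+ (q :- o)) refl
      (avg′ R (even G) v * avg′ R (even G) v ∷ avg′ R (odd G) v * avg′ R (odd G) v ∷ dsq R (even G) v
        ∷ avg′ R (λ u → even G u * even G u) v ∷ avg′ R (λ u → odd G u * odd G u) v ∷ [])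
      (slack (bessel R (even G) v) ⊕ slack (≤-trans
        (le 2 (λ o t → o ⊑ o :+ t by t) refl (avg′ R (odd G) v * avg′ R (odd G) v ∷ dsq R (odd G) v ∷ []) (dsq-nonNeg R (odd G) v))
        (bessel R (odd G) v))))
    (≤-reflexive (trans (sym (avg′-+ R _ _ v)) (avg′-cong R (λ u → rg 2 (λ a b →
      con ½ :* (a :+ b) :* (con ½ :* (a :+ b)) :+ con ½ :* (a :- b) :* (con ½ :* (a :- b)) := con ½ :* (a :* a :+ b :* b)) refl
      (G (false ∷ u) ∷ G (true ∷ u) ∷ [])) v)))
  bessel (false ∷ R) G (b ∷ v) = bessel R (G ∘ (b ∷_)) v

  dsq≤1 : ∀ (R : Cube d) (F : Cube d → Bool) v → dsq R (ι ∘ F) v ≤ 1ℚ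
  dsq≤1 R F v = ≤-trans
    (le 2 (λ a t → t ⊑ a :+ t by a) refl (avg′ R (ι ∘ F) v * avg′ R (ι ∘ F) v ∷ dsq R (ι ∘ F) v ∷ []) (sq-nonNeg (avg′ R (ι ∘ F) v)))
    (≤-trans (bessel R (ι ∘ F) v) (≤-trans (avg′-mono R (λ u → ≤-trans (≤-reflexive (sym (ι-∧ (F u) (F u)))) (ι≤1 (F u ∧ F u))) v) (≤-reflexive (avg′-const R 1ℚ v))))

  -- Averaging over a set of coordinates is an orthogonal projection.
  avg′-adjoint : ∀ (R : Cube d) (G F : Cube d → ℚ) → 𝔼 d (λ v → avg′ R G v * F v) ≡ 𝔼 d (λ v → avg′ R G v * avg′ R F v)
  avg′-adjoint [] G F = refl
  avg′-adjoint {suc d} (false ∷ R) G F = cong₂ (λ a b → ½ * (a + b)) (avg′-adjoint R (G ∘ (false ∷_)) (F ∘ (false ∷_))) (avg′-adjoint R (G ∘ (true ∷_)) (F ∘ (true ∷_)))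
  avg′-adjoint {suc d} (true ∷ R) G F = begin
    ½ * (𝔼 d (λ v → g v * F (false ∷ v)) + 𝔼 d (λ v → g v * F (true ∷ v)))   ≡⟨ cong (½ *_) (sym (𝔼-+ d _ _)) ⟩
    ½ * 𝔼 d (λ v → g v * F (false ∷ v) + g v * F (true ∷ v))                 ≡⟨ sym (𝔼-*ˡ d ½ _) ⟩
    𝔼 d (λ v → ½ * (g v * F (false ∷ v) + g v * F (true ∷ v)))               ≡⟨ 𝔼-cong d (λ v → rg 3 (λ g a b → con ½ :* (g :* a :+ g :* b) := g :* (con ½ :* (a :+ b))) refl (g v ∷ F (false ∷ v) ∷ F (true ∷ v) ∷ [])) ⟩
    𝔼 d (λ v → g v * even F v)                                               ≡⟨ avg′-adjoint R (even G) (even F) ⟩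
    𝔼 d (λ v → g v * avg′ R (even F) v)                                      ≡⟨ rg 1 (λ a → a := con ½ :* (a :+ a)) refl (_ ∷ []) ⟩
    ½ * (𝔼 d (λ v → g v * avg′ R (even F) v) + 𝔼 d (λ v → g v * avg′ R (even F) v)) ∎
    where
    open ≡-Reasoning
    g = avg′ R (even G)

  -- As dbil, but pairing the averaged derivatives of G with the pointwise derivatives of F.
  dpair : Cube d → (Cube d → ℚ) → (Cube d → ℚ) → Cube d → ℚ
  dpair [] G F [] = 0ℚ
  dpair (true ∷ R) G F (b ∷ v) = avg′ R (odd G) v * odd F v + dpair R (even G) (F ∘ (b ∷_)) v
  dpair (false ∷ R) G F (b ∷ v) = dpair R (G ∘ (b ∷_)) (F ∘ (b ∷_)) v

  dpair-even : ∀ (R : Cube d) (G : Cube d → ℚ) (F : Cube (suc d) → ℚ) v →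
    ½ * (dpair R G (F ∘ (false ∷_)) v + dpair R G (F ∘ (true ∷_)) v) ≡ dpair R G (even F) v
  dpair-even [] G F [] = rg 0 (con ½ :* (con 0ℚ :+ con 0ℚ) := con 0ℚ) refl []
  dpair-even (true ∷ R) G F (b ∷ v) = trans
    (rg 5 (λ g p q x y → con ½ :* ((g :* p :+ x) :+ (g :* q :+ y)) := g :* (con ½ :* (p :+ q)) :+ con ½ :* (x :+ y)) refl
      (avg′ R (odd G) v ∷ odd (F ∘ (false ∷_)) v ∷ odd (F ∘ (true ∷_)) v ∷ dpair R (even G) (λ u → F (false ∷ b ∷ u)) v ∷ dpair R (even G) (λ u → F (true ∷ b ∷ u)) v ∷ []))
    (cong₂ (λ a c → avg′ R (odd G) v * a + c)
      (rg 4 (λ a b c e → con ½ :* (con ½ :* (a :- b) :+ con ½ :* (c :- e)) := con ½ :* (con ½ :* (a :+ c) :- con ½ :* (b :+ e))) refl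
        (F (false ∷ false ∷ v) ∷ F (false ∷ true ∷ v) ∷ F (true ∷ false ∷ v) ∷ F (true ∷ true ∷ v) ∷ []))
      (dpair-even R (even G) (λ { (a ∷ u) → F (a ∷ b ∷ u) }) v))
  dpair-even (false ∷ R) G F (b ∷ v) = dpair-even R (G ∘ (b ∷_)) (λ { (a ∷ u) → F (a ∷ b ∷ u) }) v

  -- By the projection property it does not matter for the mean whether the derivatives of F are
  -- averaged too. The one-sided form is the useful one, since the pointwise derivative of F
  -- vanishes off the bichromatic edges.
  𝔼-dpair : ∀ (R : Cube d) (G F : Cube d → ℚ) → 𝔼 d (dpair R G F) ≡ 𝔼 d (dbil R G F)
  𝔼-dpair [] G F = refl
  𝔼-dpair {suc d} (false ∷ R) G F = cong₂ (λ a b → ½ * (a + b)) (𝔼-dpair R (G ∘ (false ∷_)) (F ∘ (false ∷_))) (𝔼-dpair R (G ∘ (true ∷_)) (F ∘ (true ∷_)))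
  𝔼-dpair {suc d} (true ∷ R) G F = begin
    ½ * (𝔼 d (λ v → g v * odd F v + dpair R (even G) (F ∘ (false ∷_)) v) + 𝔼 d (λ v → g v * odd F v + dpair R (even G) (F ∘ (true ∷_)) v))
      ≡⟨ cong (½ *_) (cong₂ _+_ (𝔼-+ d _ _) (𝔼-+ d _ _)) ⟩
    ½ * ((X + 𝔼 d (dpair R (even G) (F ∘ (false ∷_)))) + (X + 𝔼 d (dpair R (even G) (F ∘ (true ∷_)))))
      ≡⟨ rg 3 (λ x a b → con ½ :* ((x :+ a) :+ (x :+ b)) := x :+ con ½ :* (a :+ b)) refl (X ∷ _ ∷ _ ∷ []) ⟩
    X + ½ * (𝔼 d (dpair R (even G) (F ∘ (false ∷_))) + 𝔼 d (dpair R (even G) (F ∘ (true ∷_))))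
      ≡⟨ cong₂ _+_ (avg′-adjoint R (odd G) (odd F)) (trans (cong (½ *_) (sym (𝔼-+ d _ _))) (trans (sym (𝔼-*ˡ d ½ _)) (trans (𝔼-cong d (dpair-even R (even G) F)) (𝔼-dpair R (even G) (even F))))) ⟩
    𝔼 d (λ v → g v * avg′ R (odd F) v) + 𝔼 d (dbil R (even G) (even F))
      ≡⟨ sym (𝔼-+ d _ _) ⟩
    𝔼 d (λ v → g v * avg′ R (odd F) v + dbil R (even G) (even F) v)
      ≡⟨ rg 1 (λ a → a := con ½ :* (a :+ a)) refl (_ ∷ []) ⟩
    𝔼 (suc d) (dbil (true ∷ R) G F) ∎
    where
    open ≡-Reasoning
    g = avg′ R (odd G)
    X = 𝔼 d (λ v → g v * odd F v)

  -- C is a vertex cover of the bichromatic edges of F: the inequality forces one endpoint of such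
  -- an edge into C.
  Covers : Cube d → (Cube d → Bool) → (Cube d → Bool) → Set
  Covers [] C F = ⊤
  Covers (r ∷ R) C F = (∀ v → ι (F (false ∷ v) xor F (true ∷ v)) ≤ ι (C (false ∷ v)) + ι (C (true ∷ v)))
    × (∀ b → Covers R (C ∘ (b ∷_)) (F ∘ (b ∷_)))

  amgm : ∀ {k κ} g → 0ℚ ≤ k → k * κ ≡ 1ℚ → 2ℚ * g ≤ k * (g * g) + κ
  amgm {k} {κ} g 0≤k kκ = subst (_≤ k * (g * g) + κ) (trans (cong (λ z → 2ℚ * z * g) kκ) (cong (_* g) (*-identityʳ 2ℚ))) (subst (2ℚ * (k * κ) * g ≤_)
    (trans (rg 3 (λ k κ g → k :* (g :* g) :+ k :* κ :* κ := k :* (g :* g) :+ (k :* κ) :* κ) refl (k ∷ κ ∷ g ∷ [])) (trans (cong (λ z → k * (g * g) + z * κ) kκ) (cong (k * (g * g) +_) (*-identityˡ κ))))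
    (le 3 (λ k κ g → con 2ℚ :* (k :* κ) :* g ⊑ k :* (g :* g) :+ k :* κ :* κ by k :* ((g :- κ) :* (g :- κ))) refl (k ∷ κ ∷ g ∷ []) (0≤k ⊛ sq-nonNeg (g - κ))))

  module _ {k κ : ℚ} (0≤k : 0ℚ ≤ k) (0≤κ : 0ℚ ≤ κ) (kκ : k * κ ≡ 1ℚ) where

    -- On a bichromatic edge `amgm` pays for the left side with k g² and κ, and an endpoint in C can
    -- be charged for the first of these. On any other edge the left side is 0.
    pair-bound : ∀ g a b c₀ c₁ → ι (a xor b) ≤ ι c₀ + ι c₁ →
      g * (½ * (ι a - ι b)) ≤ ½ * ½ * k * (ι c₀ * (g * g) + ι c₁ * (g * g)) + ½ * ½ * κ * ι (a xor b)
    pair-bound g a b c₀ c₁ cov = ≤-trans (step a b) (le 5 (λ s c e h κ → con ½ :* con ½ :* (h :* s :+ κ :* s) ⊑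
        con ½ :* con ½ :* (h :* (c :+ e)) :+ con ½ :* con ½ :* (κ :* s) by con ½ :* (con ½ :* (h :* (c :+ e :- s)))) refl
        (ι (a xor b) ∷ ι c₀ ∷ ι c₁ ∷ k * (g * g) ∷ κ ∷ []) (½ · (½ · ((0≤k ⊛ sq-nonNeg g) ⊛ slack cov))) ⟨≤≡⟩
        rg 6 (λ s c e k g κ → con ½ :* con ½ :* (k :* g :* (c :+ e)) :+ con ½ :* con ½ :* (κ :* s) := con ½ :* con ½ :* k :* (c :* g :+ e :* g) :+ con ½ :* con ½ :* κ :* s) refl
        (ι (a xor b) ∷ ι c₀ ∷ ι c₁ ∷ k ∷ g * g ∷ κ ∷ []))
      where
      _⟨≤≡⟩_ : ∀ {x y z} → x ≤ y → y ≡ z → x ≤ z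
      p ⟨≤≡⟩ refl = p
      zero-case : g * (½ * 0ℚ) ≤ ½ * ½ * (k * (g * g) * 0ℚ + κ * 0ℚ)
      zero-case = le 3 (λ g h κ → g :* (con ½ :* con 0ℚ) ⊑ con ½ :* con ½ :* (h :* con 0ℚ :+ κ :* con 0ℚ) by con 0ℚ) refl (g ∷ k * (g * g) ∷ κ ∷ []) ≤-refl
      step : ∀ a b → g * (½ * (ι a - ι b)) ≤ ½ * ½ * (k * (g * g) * ι (a xor b) + κ * ι (a xor b))
      step true true = subst (λ z → g * (½ * z) ≤ ½ * ½ * (k * (g * g) * 0ℚ + κ * 0ℚ)) (sym (+-inverseʳ 1ℚ)) zero-case
      step false false = subst (λ z → g * (½ * z) ≤ ½ * ½ * (k * (g * g) * 0ℚ + κ * 0ℚ)) (sym (+-inverseʳ 0ℚ)) zero-case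
      step true false = le 3 (λ g h κ → g :* (con ½ :* (con 1ℚ :- con 0ℚ)) ⊑ con ½ :* con ½ :* (h :* con 1ℚ :+ κ :* con 1ℚ) by con ½ :* (con ½ :* (h :+ κ :- con 2ℚ :* g))) refl
        (g ∷ k * (g * g) ∷ κ ∷ []) (½ · (½ · slack (amgm g 0≤k kκ)))
      step false true = le 3 (λ g h κ → g :* (con ½ :* (con 0ℚ :- con 1ℚ)) ⊑ con ½ :* con ½ :* (h :* con 1ℚ :+ κ :* con 1ℚ) by con ½ :* (con ½ :* (h :+ κ :- con 2ℚ :* (:- g)))) refl
        (g ∷ k * (g * g) ∷ κ ∷ []) (½ · (½ · slack (subst (λ z → 2ℚ * (- g) ≤ k * z + κ) (rg 1 (λ g → (:- g) :* (:- g) := g :* g) refl (g ∷ [])) (amgm (- g) 0≤k kκ))))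

    dpair-bound : ∀ (R : Cube d) (G : Cube d → ℚ) (F C : Cube d → Bool) → Covers R C F →
      𝔼 d (dpair R G (ι ∘ F)) ≤ ½ * k * 𝔼 d (λ v → ι (C v) * dsq R G v) + ½ * ½ * κ * 𝔼 d (sens R F)
    dpair-bound [] G F C _ = le 3 (λ k κ c → con 0ℚ ⊑ con ½ :* k :* (c :* con 0ℚ) :+ con ½ :* con ½ :* κ :* con 0ℚ by con 0ℚ) refl (k ∷ κ ∷ ι (C []) ∷ []) ≤-refl
    dpair-bound {suc d} (false ∷ R) G F C (_ , cov) = ≤-trans
      (*-monoˡ 0≤½ (+-mono-≤ (dpair-bound R (G ∘ (false ∷_)) (F ∘ (false ∷_)) (C ∘ (false ∷_)) (cov false))
                              (dpair-bound R (G ∘ (true ∷_)) (F ∘ (true ∷_)) (C ∘ (true ∷_)) (cov true))))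
      (≤-reflexive (trans (rg 6 (λ k κ a b s t → con ½ :* ((con ½ :* k :* a :+ con ½ :* con ½ :* κ :* s) :+ (con ½ :* k :* b :+ con ½ :* con ½ :* κ :* t)) :=
        con ½ :* k :* (con ½ :* (a :+ b)) :+ con ½ :* con ½ :* κ :* (con ½ :* (s :+ t))) refl
        (k ∷ κ ∷ _ ∷ _ ∷ 𝔼 d (sens R (F ∘ (false ∷_))) ∷ 𝔼 d (sens R (F ∘ (true ∷_))) ∷ []))
        (cong (λ z → ½ * k * 𝔼 (suc d) (λ v → ι (C v) * dsq (false ∷ R) G v) + ½ * ½ * κ * z)
          (cong₂ (λ a b → ½ * (a + b)) (𝔼-cong d (drop false)) (𝔼-cong d (drop true))))))
      where
      drop : ∀ b v → sens R (F ∘ (b ∷_)) v ≡ 0ℚ * ι (F (false ∷ v) xor F (true ∷ v)) + sens R (F ∘ (b ∷_)) v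
      drop b v = rg 2 (λ s x → s := con 0ℚ :* x :+ s) refl (sens R (F ∘ (b ∷_)) v ∷ ι (F (false ∷ v) xor F (true ∷ v)) ∷ [])
    dpair-bound {suc d} (true ∷ R) G F C (cov₀ , cov) = ≤-trans
      (≤-reflexive (trans (cong (½ *_) (cong₂ _+_ (𝔼-+ d _ _) (𝔼-+ d _ _)))
        (rg 3 (λ x a b → con ½ :* ((x :+ a) :+ (x :+ b)) := x :+ con ½ :* (a :+ b)) refl
          (𝔼 d (λ v → g v * odd (ι ∘ F) v) ∷ 𝔼 d (dpair R (even G) (ι ∘ F ∘ (false ∷_))) ∷ 𝔼 d (dpair R (even G) (ι ∘ F ∘ (true ∷_))) ∷ []))))
      (≤-trans (+-mono-≤ head (*-monoˡ 0≤½ (+-mono-≤ (dpair-bound R (even G) (F ∘ (false ∷_)) (C ∘ (false ∷_)) (cov false))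
                              (dpair-bound R (even G) (F ∘ (true ∷_)) (C ∘ (true ∷_)) (cov true)))))
        (≤-reflexive (trans
          (rg 9 (λ k κ a₀ a₁ s b₀ b₁ t₀ t₁ → (con ½ :* con ½ :* k :* (a₀ :+ a₁) :+ con ½ :* con ½ :* κ :* s) :+
              con ½ :* ((con ½ :* k :* b₀ :+ con ½ :* con ½ :* κ :* t₀) :+ (con ½ :* k :* b₁ :+ con ½ :* con ½ :* κ :* t₁)) :=
              con ½ :* k :* (con ½ :* ((a₀ :+ b₀) :+ (a₁ :+ b₁))) :+ con ½ :* con ½ :* κ :* (con ½ :* ((s :+ t₀) :+ (s :+ t₁)))) refl
            (k ∷ κ ∷ 𝔼 d (cg false) ∷ 𝔼 d (cg true) ∷ 𝔼 d s ∷ 𝔼 d (cd false) ∷ 𝔼 d (cd true) ∷ 𝔼 d (sens R (F ∘ (false ∷_))) ∷ 𝔼 d (sens R (F ∘ (true ∷_))) ∷ []))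
          (cong₂ (λ x y → ½ * k * x + ½ * ½ * κ * y)
            (cong₂ (λ a b → ½ * (a + b)) (join false) (join true))
            (cong₂ (λ a b → ½ * (a + b)) (sjoin false) (sjoin true))))))
      where
      g = avg′ R (odd G)
      s = λ v → ι (F (false ∷ v) xor F (true ∷ v))
      cg cd : Bool → Cube d → ℚ
      cg b v = ι (C (b ∷ v)) * (g v * g v)
      cd b v = ι (C (b ∷ v)) * dsq R (even G) v
      head : 𝔼 d (λ v → g v * odd (ι ∘ F) v) ≤ ½ * ½ * k * (𝔼 d (cg false) + 𝔼 d (cg true)) + ½ * ½ * κ * 𝔼 d s
      head = ≤-trans (𝔼-mono d (λ v → pair-bound (g v) (F (false ∷ v)) (F (true ∷ v)) (C (false ∷ v)) (C (true ∷ v)) (cov₀ v)))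
        (≤-reflexive (trans (𝔼-+ d _ _) (cong₂ _+_ (trans (𝔼-*ˡ d (½ * ½ * k) _) (cong (½ * ½ * k *_) (𝔼-+ d _ _))) (𝔼-*ˡ d (½ * ½ * κ) s))))
      join : ∀ b → 𝔼 d (cg b) + 𝔼 d (cd b) ≡ 𝔼 d (λ v → ι (C (b ∷ v)) * (g v * g v + dsq R (even G) v))
      join b = trans (sym (𝔼-+ d _ _)) (𝔼-cong d (λ v → sym (*-distribˡ-+ (ι (C (b ∷ v))) (g v * g v) (dsq R (even G) v))))
      sjoin : ∀ b → 𝔼 d s + 𝔼 d (sens R (F ∘ (b ∷_))) ≡ 𝔼 d (λ v → 1ℚ * s v + sens R (F ∘ (b ∷_)) v)
      sjoin b = trans (sym (𝔼-+ d _ _)) (𝔼-cong d (λ v → cong (_+ sens R (F ∘ (b ∷_)) v) (sym (*-identityˡ (s v)))))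

    -- The level-one energy is the mean of `dpair`, which lives on the bichromatic edges. Charging
    -- each of them to an endpoint in C leaves `dsq` at the points of C, and Bessel bounds `dsq` by
    -- 1. Optimised over k, the level-one energy is O(√(density of C · influence)).
    level-one : ∀ (R : Cube d) (F C : Cube d → Bool) → Covers R C F →
      energy (λ S → ι (isSingle (S ∩ R))) (ι ∘ F) ≤ ½ * k * 𝔼 d (ι ∘ C) + ½ * ½ * κ * 𝔼 d (sens R F)
    level-one {d} R F C cov = ≤-trans (≤-reflexive (trans (energy-dsq R (ι ∘ F)) (sym (𝔼-dpair R (ι ∘ F) (ι ∘ F)))))
      (≤-trans (dpair-bound R (ι ∘ F) F C cov)
        (+-monoˡ-≤ _ (*-monoˡ (½ · 0≤k) (𝔼-mono d (λ v → subst (ι (C v) * dsq R (ι ∘ F) v ≤_) (*-identityʳ _) (*-monoˡ (0≤ι (C v)) (dsq≤1 R F v)))))))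

  infixr 8 _^^_
  _^^_ : ℚ → ℕ → ℚ
  q ^^ zero = 1ℚ
  q ^^ suc k = q * q ^^ k

  ^^-nonNeg : ∀ {q} k → 0ℚ ≤ q → 0ℚ ≤ q ^^ k
  ^^-nonNeg zero 0≤q = 0≤1
  ^^-nonNeg (suc k) 0≤q = 0≤q ⊛ ^^-nonNeg k 0≤q

  archimedean : ∀ q → ∃ λ n → q ≤ ⟪ n ⟫
  archimedean q = ℤ.∣ ℚ.↥ q ∣ , subst (q ≤_) (sym (⟪⟫-def _)) (ℚₚ.toℚᵘ-cancel-≤ (ℚᵘₚ.≤-respʳ-≃ (ℚᵘₚ.≃-sym (toℚᵘ-/ _ 0)) (bound q)))
    where
    bound : ∀ q → ℚ.toℚᵘ q ℚᵘ.≤ ℚᵘ.mkℚᵘ (ℤ.+ ℤ.∣ ℚ.↥ q ∣) 0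
    bound (ℚ.mkℚ (ℤ.+ n) e _) = ℚᵘ.*≤* (subst₂ ℤ._≤_ (sym (ℤₚ.*-identityʳ (ℤ.+ n))) (ℤₚ.pos-* n (suc e)) (ℤ.+≤+ (ℕₚ.m≤m*n n (suc e))))
    bound (ℚ.mkℚ ℤ.-[1+ n ] e _) = ℚᵘ.*≤* (ℤₚ.≤-trans (ℤₚ.≤-reflexive (ℤₚ.*-identityʳ ℤ.-[1+ n ])) ℤ.-≤+)

  ⅔ : ℚ
  ⅔ = pos 2 / 3

  ⅔^-bernoulli : ∀ J → ⅔ ^^ J * (1ℚ + ½ * ⟪ J ⟫) ≤ 1ℚ
  ⅔^-bernoulli zero = ≤-reflexive (trans (*-identityˡ _) (trans (cong (λ z → 1ℚ + ½ * z) ⟪0⟫) (rg 0 (con 1ℚ :+ con ½ :* con 0ℚ := con 1ℚ) refl [])))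
  ⅔^-bernoulli (suc J) = ≤-trans (≤-reflexive (cong (λ z → ⅔ * ⅔ ^^ J * (1ℚ + ½ * z)) (⟪⟫-suc J)))
    (≤-trans (le 2 (λ p j → con ⅔ :* p :* (con 1ℚ :+ con ½ :* (con 1ℚ :+ j)) ⊑ p :* (con 1ℚ :+ con ½ :* j) by con (pos 1 / 6) :* (p :* j)) refl
      (⅔ ^^ J ∷ ⟪ J ⟫ ∷ []) ((pos 1 / 6) · (^^-nonNeg J (≤ᵇ⇒≤ tt) ⊛ 0≤⟪⟫ J))) (⅔^-bernoulli J))

  ⅔^-small : ∀ {κ} → 0ℚ < κ → ∃ λ J → ⅔ ^^ J ≤ κ
  ⅔^-small {κ} 0<κ =
    let q , 0<q , κq = inverse 0<κ
        n , q≤n = archimedean q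
        J = n ℕ.+ n
        p = ⅔ ^^ J
        0≤p = ^^-nonNeg J (≤ᵇ⇒≤ tt)
        q≤ : q ≤ 1ℚ + ½ * ⟪ J ⟫
        q≤ = subst (λ z → q ≤ 1ℚ + ½ * z) (sym (⟪⟫-+ n n)) (le 2 (λ q n → q ⊑ con 1ℚ :+ con ½ :* (n :+ n) by (n :- q) :+ con 1ℚ) refl (q ∷ ⟪ n ⟫ ∷ []) (slack q≤n ⊕ 0≤1))
    in J , subst₂ _≤_ (trans (rg 3 (λ p κ q → κ :* (p :* q) := p :* (κ :* q)) refl (p ∷ κ ∷ q ∷ [])) (trans (cong (p *_) κq) (*-identityʳ p))) (*-identityʳ κ)
         (*-monoˡ (<⇒≤ 0<κ) (≤-trans (*-monoˡ 0≤p q≤) (⅔^-bernoulli J)))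

  -- The chance that a uniformly random set misses S, that is, 2 to the power -|S|.
  miss : Cube d → ℚ
  miss {d} S = 𝔼 d (λ b → ι (isEmpty (S ∩ b)))

  miss-false : ∀ (S : Cube d) → miss (false ∷ S) ≡ miss S
  miss-false S = rg 1 (λ a → con ½ :* (a :+ a) := a) refl (miss S ∷ [])

  miss-true : ∀ (S : Cube d) → miss (true ∷ S) ≡ ½ * miss S
  miss-true {d} S = trans (cong (λ z → ½ * (miss S + z)) (𝔼-const d 0ℚ)) (cong (½ *_) (+-identityʳ _))

  miss≤1 : ∀ (S : Cube d) → miss S ≤ 1ℚ
  miss≤1 {d} S = ≤-trans (𝔼-mono d (λ b → ι≤1 (isEmpty (S ∩ b)))) (≤-reflexive (𝔼-const d 1ℚ))

  miss≤½ : ∀ (S : Cube d) → isEmpty S ≡ false → miss S ≤ ½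
  miss≤½ (false ∷ S) ne = subst (_≤ ½) (sym (miss-false S)) (miss≤½ S ne)
  miss≤½ (true ∷ S) ne = subst₂ _≤_ (sym (miss-true S)) (*-identityʳ ½) (*-monoˡ 0≤½ (miss≤1 S))

  miss≤¼ : ∀ (S : Cube d) → isEmpty S ≡ false → isSingle S ≡ false → miss S ≤ pos 1 / 4
  miss≤¼ (false ∷ S) ne ns = subst (_≤ pos 1 / 4) (sym (miss-false S)) (miss≤¼ S ne ns)
  miss≤¼ (true ∷ S) ne ns = subst₂ _≤_ (sym (miss-true S)) (rg 0 (con ½ :* con ½ := con (pos 1 / 4)) refl []) (*-monoˡ 0≤½ (miss≤½ S ns))

  ι-not : ∀ b → ι (not b) ≡ 1ℚ - ι b
  ι-not true = rg 0 (con 0ℚ := con 1ℚ :- con 1ℚ) refl []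
  ι-not false = rg 0 (con 1ℚ := con 1ℚ :- con 0ℚ) refl []

  hits : Cube d → ℚ
  hits S = ι (not (isEmpty S))

  -- A random half of the coordinates still meets S with probability 1/2 if |S| = 1 and at least 3/4
  -- if |S| ≥ 2. The factor 4/3 is what larger sets need, and the second term supplies the missing
  -- 1/3 for singletons.
  hits-halving : ∀ (S : Cube d) → hits S ≤ (pos 4 / 3) * 𝔼 d (λ b → hits (S ∩ b)) + (pos 1 / 3) * ι (isSingle S)
  hits-halving {d} S = subst (λ z → hits S ≤ (pos 4 / 3) * z + (pos 1 / 3) * ι (isSingle S)) (sym eq) (bound (isEmpty S) refl (isSingle S) refl)
    where
    eq : 𝔼 d (λ b → hits (S ∩ b)) ≡ 1ℚ - miss S
    eq = trans (𝔼-cong d (λ b → trans (ι-not (isEmpty (S ∩ b))) (rg 1 (λ a → con 1ℚ :- a := con 1ℚ :+ con (pos 0 / 1) :+ con ℚ.-½ :* (a :+ a)) refl (_ ∷ []))))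
      (trans (𝔼-+ d _ _) (trans (cong₂ _+_ (𝔼-const d (1ℚ + 0ℚ)) (trans (𝔼-*ˡ d ℚ.-½ _) (cong (ℚ.-½ *_) (𝔼-+ d _ _))))
        (rg 1 (λ a → con 1ℚ :+ con 0ℚ :+ con ℚ.-½ :* (a :+ a) := con 1ℚ :- a) refl (miss S ∷ []))))
    bound : ∀ e → isEmpty S ≡ e → ∀ s → isSingle S ≡ s → ι (not (isEmpty S)) ≤ (pos 4 / 3) * (1ℚ - miss S) + (pos 1 / 3) * ι (isSingle S)
    bound true e s _ rewrite e = (pos 4 / 3) · slack (miss≤1 S) ⊕ (pos 1 / 3) · 0≤ι (isSingle S)
    bound false e true s rewrite e | s = le 1 (λ m → con 1ℚ ⊑ con (pos 4 / 3) :* (con 1ℚ :- m) :+ con (pos 1 / 3) :* con 1ℚ by con (pos 4 / 3) :* (con ½ :- m)) refl (miss S ∷ []) ((pos 4 / 3) · slack (miss≤½ S e))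
    bound false e false s = subst₂ (λ x y → ι (not x) ≤ (pos 4 / 3) * (1ℚ - miss S) + (pos 1 / 3) * ι y) (sym e) (sym s)
      (le 1 (λ m → con 1ℚ ⊑ con (pos 4 / 3) :* (con 1ℚ :- m) :+ con (pos 1 / 3) :* con 0ℚ by con (pos 4 / 3) :* (con (pos 1 / 4) :- m)) refl (miss S ∷ []) ((pos 4 / 3) · slack (miss≤¼ S e s)))

  ∩-assoc : ∀ (S R b : Cube d) → (S ∩ R) ∩ b ≡ S ∩ (R ∩ b)
  ∩-assoc [] [] [] = refl
  ∩-assoc (x ∷ S) (y ∷ R) (z ∷ b) = cong₂ _∷_ (Boolₚ.∧-assoc x y z) (∩-assoc S R b)

  energy-mono : ∀ {c c′ : Cube d → ℚ} (G : Cube d → ℚ) → (∀ S → c S ≤ c′ S) → energy c G ≤ energy c′ G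
  energy-mono {d} G le = 𝕊-mono d (λ S → *-monoʳ (sq-nonNeg (hat G S)) (le S))

  -- The mean of the variances of F on the subcubes with directions R.
  variance : Cube d → (Cube d → Bool) → ℚ
  variance R F = energy (λ S → hits (S ∩ R)) (ι ∘ F)

  variance-halving : ∀ (R : Cube d) F → variance R F ≤ (pos 4 / 3) * 𝔼 d (λ b → variance (R ∩ b) F) + (pos 1 / 3) * energy (λ S → ι (isSingle (S ∩ R))) (ι ∘ F)
  variance-halving {d} R F = ≤-trans (energy-mono (ι ∘ F) (λ S → hits-halving (S ∩ R)))
    (≤-reflexive (trans (𝕊-cong d (λ S → rg 3 (λ x y w → (con (pos 4 / 3) :* x :+ con (pos 1 / 3) :* y) :* w := con (pos 4 / 3) :* (w :* x) :+ con (pos 1 / 3) :* (y :* w)) refl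
        (𝔼 d (λ b → hits ((S ∩ R) ∩ b)) ∷ ι (isSingle (S ∩ R)) ∷ W S ∷ [])))
      (trans (𝕊-+ d _ _) (cong₂ _+_ (trans (𝕊-*ˡ d (pos 4 / 3) _) (cong ((pos 4 / 3) *_)
        (trans (𝕊-cong d (λ S → trans (sym (𝔼-*ˡ d (W S) _)) (𝔼-cong d (λ b → trans (cong (λ z → W S * hits z) (∩-assoc S R b)) (*-comm (W S) _))))) (𝕊-𝔼 d d _))))
        (𝕊-*ˡ d (pos 1 / 3) _)))))
    where W = λ S → hat (ι ∘ F) S * hat (ι ∘ F) S

  𝔼-sens : ∀ (R : Cube d) (F : Cube d → Bool) v → 𝔼 d (λ b → sens (R ∩ b) F v) ≡ ½ * sens R F v
  𝔼-sens [] F [] = sym (*-zeroʳ ½)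
  𝔼-sens {suc d} (r ∷ R) F (c ∷ v) = begin
    ½ * (𝔼 d (λ b → ι (r ∧ false) * s + sens (R ∩ b) F′ v) + 𝔼 d (λ b → ι (r ∧ true) * s + sens (R ∩ b) F′ v))
      ≡⟨ cong₂ (λ x y → ½ * (x + y)) (part (r ∧ false)) (part (r ∧ true)) ⟩
    ½ * ((ι (r ∧ false) * s + ½ * sens R F′ v) + (ι (r ∧ true) * s + ½ * sens R F′ v))
      ≡⟨ cong₂ (λ x y → ½ * ((ι x * s + ½ * sens R F′ v) + (ι y * s + ½ * sens R F′ v))) (Boolₚ.∧-zeroʳ r) (Boolₚ.∧-identityʳ r) ⟩
    ½ * ((0ℚ * s + ½ * sens R F′ v) + (ι r * s + ½ * sens R F′ v))
      ≡⟨ rg 3 (λ r s t → con ½ :* ((con 0ℚ :* s :+ con ½ :* t) :+ (r :* s :+ con ½ :* t)) := con ½ :* (r :* s :+ t)) refl (ι r ∷ s ∷ sens R F′ v ∷ []) ⟩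
    ½ * (ι r * s + sens R F′ v) ∎
    where
    open ≡-Reasoning
    F′ = F ∘ (c ∷_)
    s = ι (F (false ∷ v) xor F (true ∷ v))
    part : ∀ x → 𝔼 d (λ b → ι x * s + sens (R ∩ b) F′ v) ≡ ι x * s + ½ * sens R F′ v
    part x = trans (𝔼-+ d _ _) (cong₂ _+_ (𝔼-const d _) (𝔼-sens R F′ v))

  𝔼-swap : ∀ d e (f : Cube d → Cube e → ℚ) → 𝔼 d (λ u → 𝔼 e (f u)) ≡ 𝔼 e (λ v → 𝔼 d (λ u → f u v))
  𝔼-swap zero e f = refl
  𝔼-swap (suc d) e f = trans (cong₂ (λ a b → ½ * (a + b)) (𝔼-swap d e _) (𝔼-swap d e _)) (trans (cong (½ *_) (sym (𝔼-+ e _ _))) (sym (𝔼-*ˡ e ½ _)))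

  Covers-mask : ∀ (R R′ : Cube d) (C F : Cube d → Bool) → Covers R C F → Covers R′ C F
  Covers-mask [] [] C F cov = tt
  Covers-mask (_ ∷ R) (_ ∷ R′) C F (cov₀ , cov) = cov₀ , λ b → Covers-mask R R′ (C ∘ (b ∷_)) (F ∘ (b ∷_)) (cov b)

  hits≤size : ∀ (S : Cube d) → hits S ≤ size S × 0ℚ ≤ size S
  hits≤size [] = ≤-refl , ≤-refl
  hits≤size (true ∷ S) = let _ , 0≤ = hits≤size S in le 1 (λ s → con 1ℚ ⊑ con 1ℚ :+ s by s) refl (size S ∷ []) 0≤ , 0≤1 ⊕ 0≤
  hits≤size (false ∷ S) = let h , 0≤ = hits≤size S in subst (hits S ≤_) (sym (+-identityˡ _)) h , ≤-refl ⊕ 0≤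

  𝕊-nonNeg : ∀ d {f : Cube d → ℚ} → (∀ v → 0ℚ ≤ f v) → 0ℚ ≤ 𝕊 d f
  𝕊-nonNeg zero le = le []
  𝕊-nonNeg (suc d) le = 𝕊-nonNeg d (le ∘ (false ∷_)) ⊕ 𝕊-nonNeg d (le ∘ (true ∷_))

  sens-nonNeg : ∀ (R : Cube d) (F : Cube d → Bool) v → 0ℚ ≤ sens R F v
  sens-nonNeg [] F [] = ≤-refl
  sens-nonNeg (r ∷ R) F (b ∷ v) = 0≤ι r ⊛ 0≤ι (F (false ∷ v) xor F (true ∷ v)) ⊕ sens-nonNeg R (F ∘ (b ∷_)) v

  -- J rounds of `variance-halving`, each paying for `level-one`. At the end variance is bounded by
  -- influence, which carries the weight (4/3 · 1/2)^J.
  variance-bound : ∀ J {k κ} → 0ℚ ≤ k → 0ℚ ≤ κ → k * κ ≡ 1ℚ → ∀ (R : Cube d) (F C : Cube d → Bool) → Covers R C F →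
    variance R F ≤ 3ℚ * (k * 𝔼 d (ι ∘ C) + κ * 𝔼 d (sens R F)) + ⅔ ^^ J * 𝔼 d (sens R F)
  variance-bound {d} zero {k} {κ} 0≤k 0≤κ kκ R F C cov = ≤-trans (energy-mono (ι ∘ F) (λ S → proj₁ (hits≤size (S ∩ R))))
    (≤-trans (le 1 (λ e → e ⊑ con 4ℚ :* e by con 3ℚ :* e) refl (E ∷ []) (3ℚ · 0≤E)) (≤-trans (≤-reflexive (energy-size R F))
    (le 3 (λ a b I → I ⊑ con 3ℚ :* (a :+ b :* I) :+ con 1ℚ :* I by con 3ℚ :* (a :+ b :* I)) refl (k * 𝔼 d (ι ∘ C) ∷ κ ∷ I ∷ [])
      (3ℚ · (0≤k ⊛ 𝔼-nonNeg d (λ v → 0≤ι (C v)) ⊕ 0≤κ ⊛ 𝔼-nonNeg d (sens-nonNeg R F))))))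
    where
    I = 𝔼 d (sens R F)
    E = energy (λ S → size (S ∩ R)) (ι ∘ F)
    0≤E = 𝕊-nonNeg d (λ S → proj₂ (hits≤size (S ∩ R)) ⊛ sq-nonNeg (hat (ι ∘ F) S))
  variance-bound {d} (suc J) {k} {κ} 0≤k 0≤κ kκ R F C cov = ≤-trans (variance-halving R F)
    (≤-trans (+-mono-≤ (*-monoˡ (≤ᵇ⇒≤ tt) (𝔼-mono d ih)) (*-monoˡ (≤ᵇ⇒≤ tt) (level-one 0≤k 0≤κ kκ R F C cov)))
    (≤-trans (≤-reflexive (cong (λ z → (pos 4 / 3) * z + (pos 1 / 3) * (½ * k * δ + ½ * ½ * κ * I)) avg-ih))
    (le 5 (λ k κ δ I p → con (pos 4 / 3) :* (con 3ℚ :* ((con ρ :* k) :* δ) :+ (con 3ℚ :* (con ρ⁻¹ :* κ) :+ p) :* (con ½ :* I)) :+ con (pos 1 / 3) :* (con ½ :* k :* δ :+ con ½ :* con ½ :* κ :* I)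
        ⊑ con 3ℚ :* (k :* δ :+ κ :* I) :+ con ⅔ :* p :* I by con (pos 1 / 30) :* (k :* δ) :+ con (pos 5 / 84) :* (κ :* I)) refl
      (k ∷ κ ∷ δ ∷ I ∷ ⅔ ^^ J ∷ []) ((pos 1 / 30) · (0≤k ⊛ 𝔼-nonNeg d (λ v → 0≤ι (C v))) ⊕ (pos 5 / 84) · (0≤κ ⊛ 𝔼-nonNeg d (sens-nonNeg R F))))))
    where
    -- Halving R halves the influence but not the cover, so the weights k and κ are rebalanced. A
    -- round multiplies the two terms by (4/3) ρ and (2/3) / ρ; both are below 1 for 2/3 < ρ < 3/4,
    -- and 7/10 leaves room for the level-one term.
    ρ ρ⁻¹ : ℚ
    ρ = pos 7 / 10
    ρ⁻¹ = pos 10 / 7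
    δ = 𝔼 d (ι ∘ C)
    I = 𝔼 d (sens R F)
    I′ = λ b → 𝔼 d (sens (R ∩ b) F)
    ih : ∀ b → variance (R ∩ b) F ≤ 3ℚ * ((ρ * k) * δ) + (3ℚ * (ρ⁻¹ * κ) + ⅔ ^^ J) * I′ b
    ih b = ≤-trans (variance-bound J (ρ · 0≤k) (ρ⁻¹ · 0≤κ) (trans (rg 2 (λ k κ → con ρ :* k :* (con ρ⁻¹ :* κ) := k :* κ) refl (k ∷ κ ∷ [])) kκ) (R ∩ b) F C (Covers-mask R (R ∩ b) C F cov))
      (≤-reflexive (rg 4 (λ x y p I → con 3ℚ :* (x :+ y :* I) :+ p :* I := con 3ℚ :* x :+ (con 3ℚ :* y :+ p) :* I) refl ((ρ * k) * δ ∷ ρ⁻¹ * κ ∷ ⅔ ^^ J ∷ I′ b ∷ [])))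
    avg-ih : 𝔼 d (λ b → 3ℚ * ((ρ * k) * δ) + (3ℚ * (ρ⁻¹ * κ) + ⅔ ^^ J) * I′ b) ≡ 3ℚ * ((ρ * k) * δ) + (3ℚ * (ρ⁻¹ * κ) + ⅔ ^^ J) * (½ * I)
    avg-ih = trans (𝔼-+ d _ _) (cong₂ _+_ (𝔼-const d _) (trans (𝔼-*ˡ d _ I′) (cong ((3ℚ * (ρ⁻¹ * κ) + ⅔ ^^ J) *_)
      (trans (𝔼-swap d d _) (trans (𝔼-cong d (𝔼-sens R F)) (𝔼-*ˡ d ½ _))))))

  bar : Cube d → Cube d
  bar = Vec.map not

  sgn : Cube d → ℚ
  sgn [] = 1ℚ
  sgn (false ∷ S) = sgn S
  sgn (true ∷ S) = - sgn S

  hat-bar : ∀ (G : Cube d → ℚ) S → hat (G ∘ bar) S ≡ sgn S * hat G S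
  hat-bar G [] = sym (*-identityˡ _)
  hat-bar G (false ∷ S) = trans (hat-cong (λ v → cong (½ *_) (+-comm _ _)) S) (hat-bar (even G) S)
  hat-bar G (true ∷ S) = begin
    hat (odd (G ∘ bar)) S                                 ≡⟨ hat-cong (λ v → rg 2 (λ a b → con ½ :* (b :- a) := con (ℚ.- 1ℚ) :* (con ½ :* (a :- b)) :+ con 0ℚ :* (con ½ :* (a :- b))) refl (G (false ∷ bar v) ∷ G (true ∷ bar v) ∷ [])) S ⟩
    hat (λ v → (ℚ.- 1ℚ) * odd G (bar v) + 0ℚ * odd G (bar v)) S ≡⟨ hat-linear (ℚ.- 1ℚ) 0ℚ (odd G ∘ bar) (odd G ∘ bar) S ⟩
    (ℚ.- 1ℚ) * hat (odd G ∘ bar) S + 0ℚ * hat (odd G ∘ bar) S ≡⟨ cong (λ z → (ℚ.- 1ℚ) * z + 0ℚ * z) (hat-bar (odd G) S) ⟩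
    (ℚ.- 1ℚ) * (sgn S * hat (odd G) S) + 0ℚ * (sgn S * hat (odd G) S) ≡⟨ rg 2 (λ s h → con (ℚ.- 1ℚ) :* (s :* h) :+ con 0ℚ :* (s :* h) := (:- s) :* h) refl (sgn S ∷ hat (odd G) S ∷ []) ⟩
    (- sgn S) * hat (odd G) S ∎
    where open ≡-Reasoning

  sgn² : ∀ (S : Cube d) → sgn S * sgn S ≡ 1ℚ
  sgn² [] = *-identityˡ 1ℚ
  sgn² (false ∷ S) = sgn² S
  sgn² (true ∷ S) = trans (rg 1 (λ s → (:- s) :* (:- s) := s :* s) refl (sgn S ∷ [])) (sgn² S)

  sgn-empty : ∀ (S : Cube d) → isEmpty S ≡ true → sgn S ≡ 1ℚ
  sgn-empty [] _ = refl
  sgn-empty (false ∷ S) e = sgn-empty S e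

  full : ∀ d → Cube d
  full d = Vec.replicate d true

  ∩-full : ∀ (S : Cube d) → S ∩ full d ≡ S
  ∩-full [] = refl
  ∩-full (b ∷ S) = cong₂ _∷_ (Boolₚ.∧-identityʳ b) (∩-full S)

  -- `g` is F minus its reflection, so its mean square is the left side. Its coefficients are those
  -- of F times 1 - `sgn S`, a factor that is 0 at the empty set and at most 2 elsewhere.
  antipodal-variance : ∀ (F : Cube d → Bool) → 𝔼 d (λ b → ι (F b xor F (bar b))) ≤ 4ℚ * variance (full d) F
  antipodal-variance {d} F = ≤-trans (≤-reflexive (trans (𝔼-cong d (λ b → sym (square (F b) (F (bar b))))) (sym (energy-one g))))
    (≤-trans (𝕊-mono d bound) (≤-reflexive (𝕊-*ˡ d 4ℚ _)))
    where
    G = ι ∘ F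
    g = λ b → 1ℚ * G b + (ℚ.- 1ℚ) * G (bar b)
    square : ∀ a b → (1ℚ * ι a + (ℚ.- 1ℚ) * ι b) * (1ℚ * ι a + (ℚ.- 1ℚ) * ι b) ≡ ι (a xor b)
    square true true = rg 0 ((con 1ℚ :* con 1ℚ :+ con (ℚ.- 1ℚ) :* con 1ℚ) :* (con 1ℚ :* con 1ℚ :+ con (ℚ.- 1ℚ) :* con 1ℚ) := con 0ℚ) refl []
    square true false = rg 0 ((con 1ℚ :* con 1ℚ :+ con (ℚ.- 1ℚ) :* con 0ℚ) :* (con 1ℚ :* con 1ℚ :+ con (ℚ.- 1ℚ) :* con 0ℚ) := con 1ℚ) refl []
    square false true = rg 0 ((con 1ℚ :* con 0ℚ :+ con (ℚ.- 1ℚ) :* con 1ℚ) :* (con 1ℚ :* con 0ℚ :+ con (ℚ.- 1ℚ) :* con 1ℚ) := con 1ℚ) refl []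
    square false false = rg 0 ((con 1ℚ :* con 0ℚ :+ con (ℚ.- 1ℚ) :* con 0ℚ) :* (con 1ℚ :* con 0ℚ :+ con (ℚ.- 1ℚ) :* con 0ℚ) := con 0ℚ) refl []
    hat-g : ∀ S → hat g S ≡ (1ℚ - sgn S) * hat G S
    hat-g S = trans (hat-linear 1ℚ (ℚ.- 1ℚ) G (G ∘ bar) S) (trans (cong (λ z → 1ℚ * hat G S + (ℚ.- 1ℚ) * z) (hat-bar G S))
      (rg 2 (λ h s → con 1ℚ :* h :+ con (ℚ.- 1ℚ) :* (s :* h) := (con 1ℚ :- s) :* h) refl (hat G S ∷ sgn S ∷ [])))
    weight : ∀ S → (1ℚ - sgn S) * (1ℚ - sgn S) ≤ 4ℚ * hits S
    weight S with isEmpty S in e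
    ... | true = ≤-reflexive (trans (cong (λ z → (1ℚ - z) * (1ℚ - z)) (sgn-empty S e)) (rg 0 ((con 1ℚ :- con 1ℚ) :* (con 1ℚ :- con 1ℚ) := con 4ℚ :* con 0ℚ) refl []))
    ... | false = subst (λ z → (1ℚ - sgn S) * (1ℚ - sgn S) ≤ 4ℚ * z) (*-identityˡ 1ℚ) (subst (λ z → (1ℚ - sgn S) * (1ℚ - sgn S) ≤ 4ℚ * (1ℚ * z)) (sgn² S)
      (le 1 (λ s → (con 1ℚ :- s) :* (con 1ℚ :- s) ⊑ con 4ℚ :* (con 1ℚ :* (s :* s)) by (con 1ℚ :+ s) :* (con 1ℚ :+ s) :+ con 2ℚ :* (s :* s :- con 1ℚ)) refl (sgn S ∷ [])
        (sq-nonNeg (1ℚ + sgn S) ⊕ 2ℚ · slack (≤-reflexive (sym (sgn² S))))))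
    bound : ∀ S → 1ℚ * (hat g S * hat g S) ≤ 4ℚ * (hits (S ∩ full d) * (hat G S * hat G S))
    bound S = subst₂ _≤_ (trans (rg 2 (λ w h → (w :* w) :* (h :* h) := con 1ℚ :* ((w :* h) :* (w :* h))) refl (1ℚ - sgn S ∷ hat G S ∷ [])) (cong (λ z → 1ℚ * (z * z)) (sym (hat-g S))))
      (trans (*-assoc 4ℚ (hits S) _) (cong (λ z → 4ℚ * (hits z * (hat G S * hat G S))) (sym (∩-full S)))) (*-monoʳ (sq-nonNeg (hat G S)) (weight S))

  -- A robust form of Margulis' inequality on the cube.
  margulis : ∀ {k κ} → 0ℚ < k → 0ℚ < κ → k * κ ≡ 1ℚ → ∀ (F C : Cube d → Bool) → Covers (full d) C F →
    𝔼 d (λ b → ι (F b xor F (bar b))) ≤ (pos 16 / 1) * (k * 𝔼 d (ι ∘ C) + κ * 𝔼 d (sens (full d) F))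
  -- J is so large that the remainder (2/3)^J of `variance-bound` is at most κ and merges with the
  -- influence term.
  margulis {d} {k} {κ} 0<k 0<κ kκ F C cov = let J , small = ⅔^-small 0<κ in
    ≤-trans (antipodal-variance F) (≤-trans (*-monoˡ (≤ᵇ⇒≤ tt) (variance-bound J (<⇒≤ 0<k) (<⇒≤ 0<κ) kκ (full d) F C cov))
    (le 4 (λ a κ I p → con 4ℚ :* (con 3ℚ :* (a :+ κ :* I) :+ p :* I) ⊑ con (pos 16 / 1) :* (a :+ κ :* I) by con 4ℚ :* a :+ con 4ℚ :* ((κ :- p) :* I)) refl
      (k * 𝔼 d (ι ∘ C) ∷ κ ∷ 𝔼 d (sens (full d) F) ∷ ⅔ ^^ J ∷ [])
      (4ℚ · (<⇒≤ 0<k ⊛ 𝔼-nonNeg d (λ v → 0≤ι (C v))) ⊕ 4ℚ · (slack small ⊛ 𝔼-nonNeg d (sens-nonNeg (full d) F)))))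

  -- Sorting along a matching

  infix 4 _≼_
  _≼_ : Bool → Bool → Set
  _≼_ = B._≤_

  ≼-refl : ∀ {a} → a ≼ a
  ≼-refl = b≤b

  ≼-trans : ∀ {a b c} → a ≼ b → b ≼ c → a ≼ c
  ≼-trans = Boolₚ.≤-trans

  ≼-∧ : ∀ {a b c} → a ≼ b → a ≼ c → a ≼ b ∧ c
  ≼-∧ {false} _ _ = Boolₚ.≤-minimum _
  ≼-∧ {true} b≤b b≤b = b≤b

  ∧-≼ˡ : ∀ a b → a ∧ b ≼ a
  ∧-≼ˡ false b = b≤b
  ∧-≼ˡ true b = Boolₚ.≤-maximum b

  ∧-≼ʳ : ∀ a b → a ∧ b ≼ b
  ∧-≼ʳ false b = Boolₚ.≤-minimum b
  ∧-≼ʳ true b = b≤b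

  ≼-∨ˡ : ∀ a b → a ≼ a ∨ b
  ≼-∨ˡ false b = Boolₚ.≤-minimum b
  ≼-∨ˡ true b = b≤b

  ≼-∨ʳ : ∀ a b → b ≼ a ∨ b
  ≼-∨ʳ false b = b≤b
  ≼-∨ʳ true b = Boolₚ.≤-maximum b

  ∨-≼ : ∀ {a b c} → a ≼ c → b ≼ c → a ∨ b ≼ c
  ∨-≼ {false} _ q = q
  ∨-≼ {true} p _ = p

  ι-mono : ∀ {a b} → a ≼ b → ι a ≤ ι b
  ι-mono f≤t = 0≤1
  ι-mono b≤b = ≤-refl

  ≼∧→≡ : ∀ {a b} → a ≼ b → a ∧ b ≡ a
  ≼∧→≡ {false} _ = refl
  ≼∧→≡ {true} b≤b = refl

  ≼∨→≡ : ∀ {a b} → b ≼ a → a ∨ b ≡ a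
  ≼∨→≡ {false} b≤b = refl
  ≼∨→≡ {true} _ = refl

  ι-xor-triangle : ∀ a b c → ι (a xor c) ≤ ι (a xor b) + ι (b xor c)
  ι-xor-triangle true b true = 0≤ι (not b) ⊕ 0≤ι (b xor true)
  ι-xor-triangle false b false = 0≤ι b ⊕ 0≤ι (b xor false)
  ι-xor-triangle true true false = ≤-reflexive (sym (+-identityˡ 1ℚ))
  ι-xor-triangle true false false = ≤-reflexive (sym (+-identityʳ 1ℚ))
  ι-xor-triangle false true true = ≤-reflexive (sym (+-identityʳ 1ℚ))
  ι-xor-triangle false false true = ≤-reflexive (sym (+-identityˡ 1ℚ))

  data Status : Set where
    lo hi fx : Status

  isLo isHi : Status → Bool
  isLo lo = true
  isLo _ = false
  isHi hi = true
  isHi _ = false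

  -- A finite set with a partial matching, the two ends of each matched pair being labelled lo and hi.
  record Line (A : Set) : Set where
    field
      enum : Enum A
      π : A → A
      st : A → Status
      π-inv : ∀ a → π (π a) ≡ a
      st-lo : ∀ a → st a ≡ lo → st (π a) ≡ hi
      st-hi : ∀ a → st a ≡ hi → st (π a) ≡ lo
      st-fx : ∀ a → st a ≡ fx → π a ≡ a

  -- The new value at a point, from its own value and that of its partner: sorting puts the minimum
  -- at the `lo` end and the maximum at the `hi` end.
  merge : Status → Bool → Bool → Bool
  merge lo a b = a ∧ b
  merge hi a b = a ∨ b
  merge fx a b = a

  merge-mono : ∀ s {a a′ b b′} → a ≼ a′ → b ≼ b′ → merge s a b ≼ merge s a′ b′
  merge-mono lo {a} {a′} {b} p q = ≼-∧ (≼-trans (∧-≼ˡ a b) p) (≼-trans (∧-≼ʳ a b) q)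
  merge-mono hi {a} {a′} {b} {b′} p q = ∨-≼ (≼-trans p (≼-∨ˡ a′ b′)) (≼-trans q (≼-∨ʳ a′ b′))
  merge-mono fx p q = p

  module Sorting {A : Set} (𝓛 : Line A) where
    open Line 𝓛 public

    xs : List A
    xs = elems enum

    pts : ∀ d → List (Vec A d)
    pts = allVecs xs

    Fun : ℕ → Set
    Fun d = Vec A d → Bool

    infix 4 _⊴_
    _⊴_ : Fun d → Fun d → Set
    f ⊴ g = ∀ x → f x ≼ g x

    -- Summing over p and over π p counts everything twice, so it is enough to compare pairs, and
    -- the pairs themselves need not be enumerated.
    Σ-pair-≡ : ∀ {φ ψ : A → ℚ} → (∀ p → φ p + φ (π p) ≡ ψ p + ψ (π p)) → Σ xs φ ≡ Σ xs ψ
    Σ-pair-≡ {φ} {ψ} eq = trans (double φ) (trans (cong (½ *_) (Σ-cong xs eq)) (sym (double ψ)))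
      where
      double : ∀ φ → Σ xs φ ≡ ½ * Σ xs (λ p → φ p + φ (π p))
      double φ = trans (rg 1 (λ a → a := con ½ :* (a :+ a)) refl (Σ xs φ ∷ []))
        (cong (½ *_) (trans (cong (Σ xs φ +_) (sym (Enum.Σ-involution enum π π-inv φ))) (sym (Σ-+ xs φ (φ ∘ π)))))

    hd : Bool → Fun (suc d) → Fun (suc d)
    hd false f = f
    hd true f (p ∷ x) = merge (st p) (f (p ∷ x)) (f (π p ∷ x))

    -- Sorts along the directions in R, the last coordinate first.
    M : Vec Bool d → Fun d → Fun d
    tl : Vec Bool d → Fun (suc d) → Fun (suc d)
    M [] f = f
    M (r ∷ R) f = hd r (tl R f)
    tl R f (p ∷ x) = M R (λ y → f (p ∷ y)) x

    hd-mono : ∀ r {f g : Fun (suc d)} → f ⊴ g → hd r f ⊴ hd r g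
    hd-mono false le = le
    hd-mono true le (p ∷ x) = merge-mono (st p) (le (p ∷ x)) (le (π p ∷ x))

    M-mono : ∀ (R : Vec Bool d) {f g : Fun d} → f ⊴ g → M R f ⊴ M R g
    M-mono [] le = le
    M-mono (r ∷ R) le = hd-mono r (λ { (p ∷ x) → M-mono R (λ y → le (p ∷ y)) x })

    count : Fun d → ℚ
    count {d} f = Σ (pts d) (ι ∘ f)

    merge-pair : ∀ p a b → ι (merge (st p) a b) + ι (merge (st (π p)) b a) ≡ ι a + ι b
    merge-pair p a b with st p in e
    merge-pair p a b | lo rewrite st-lo p e = lemma a b
      where
      lemma : ∀ a b → ι (a ∧ b) + ι (b ∨ a) ≡ ι a + ι b
      lemma true true = refl
      lemma true false = +-comm 0ℚ 1ℚ
      lemma false true = refl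
      lemma false false = refl
    merge-pair p a b | hi rewrite st-hi p e = lemma a b
      where
      lemma : ∀ a b → ι (a ∨ b) + ι (b ∧ a) ≡ ι a + ι b
      lemma true true = refl
      lemma true false = refl
      lemma false true = +-comm 1ℚ 0ℚ
      lemma false false = refl
    merge-pair p a b | fx rewrite st-fx p e | e = refl

    count-hd : ∀ r (f : Fun (suc d)) → count (hd r f) ≡ count f
    count-hd false f = refl
    count-hd {d} true f = trans (Σ-vec xs d _) (trans (Σ-pair-≡ pairing) (sym (Σ-vec xs d _)))
      where
      pairing : ∀ p → Σ (pts d) (λ x → ι (merge (st p) (f (p ∷ x)) (f (π p ∷ x)))) + Σ (pts d) (λ x → ι (merge (st (π p)) (f (π p ∷ x)) (f (π (π p) ∷ x))))
        ≡ Σ (pts d) (λ x → ι (f (p ∷ x))) + Σ (pts d) (λ x → ι (f (π p ∷ x)))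
      pairing p = trans (sym (Σ-+ (pts d) _ _)) (trans (Σ-cong (pts d) (λ x →
        trans (cong (λ z → ι (merge (st p) (f (p ∷ x)) (f (π p ∷ x))) + ι (merge (st (π p)) (f (π p ∷ x)) (f (z ∷ x)))) (π-inv p))
              (merge-pair p (f (p ∷ x)) (f (π p ∷ x))))) (Σ-+ (pts d) _ _))

    count-M : ∀ (R : Vec Bool d) (f : Fun d) → count (M R f) ≡ count f
    count-M [] f = refl
    count-M {suc d} (r ∷ R) f = trans (count-hd r (tl R f)) (trans (Σ-vec xs d _) (trans (Σ-cong xs (λ p → count-M R (λ y → f (p ∷ y)))) (sym (Σ-vec xs d _))))

    V D : Fun d → Fun d → ℚ
    V {d} f g = Σ (pts d) (λ x → ι (f x ∧ not (g x)))
    D {d} f g = Σ (pts d) (λ x → ι (f x xor g x))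

    V-nonNeg : ∀ (f g : Fun d) → 0ℚ ≤ V f g
    V-nonNeg {d} f g = Σ-nonNeg (pts d) (λ x → 0≤ι (f x ∧ not (g x)))

    D-nonNeg : ∀ (f g : Fun d) → 0ℚ ≤ D f g
    D-nonNeg {d} f g = Σ-nonNeg (pts d) (λ x → 0≤ι (f x xor g x))

    V-count : ∀ (f g : Fun d) → V f g ≡ count f - count (λ x → f x ∧ g x)
    V-count {d} f g = trans (Σ-cong (pts d) (λ x → lemma (f x) (g x))) (Σ-- (pts d) _ _)
      where
      lemma : ∀ a b → ι (a ∧ not b) ≡ ι a - ι (a ∧ b)
      lemma true true = sym (+-inverseʳ 1ℚ)
      lemma true false = rg 0 (con 1ℚ := con 1ℚ :- con 0ℚ) refl []
      lemma false b = sym (+-inverseʳ 0ℚ)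

    D-V : ∀ (f g : Fun d) → D f g ≡ V f g + V g f
    D-V {d} f g = trans (Σ-cong (pts d) (λ x → lemma (f x) (g x))) (Σ-+ (pts d) _ _)
      where
      lemma : ∀ a b → ι (a xor b) ≡ ι (a ∧ not b) + ι (b ∧ not a)
      lemma true true = sym (+-identityˡ 0ℚ)
      lemma true false = sym (+-identityʳ 1ℚ)
      lemma false true = sym (+-identityˡ 1ℚ)
      lemma false false = sym (+-identityˡ 0ℚ)

    D-sym : ∀ (f g : Fun d) → D f g ≡ D g f
    D-sym {d} f g = Σ-cong (pts d) (λ x → cong ι (Boolₚ.xor-comm (f x) (g x)))

    D-triangle : ∀ (f g h : Fun d) → D f h ≤ D f g + D g h
    D-triangle {d} f g h = ≤-trans (Σ-mono (pts d) (λ x → ι-xor-triangle (f x) (g x) (h x))) (≤-reflexive (Σ-+ (pts d) _ _))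

    D-congˡ : ∀ {f f′ : Fun d} (g : Fun d) → (∀ x → f x ≡ f′ x) → D f g ≡ D f′ g
    D-congˡ {d} g eq = Σ-cong (pts d) (λ x → cong (λ z → ι (z xor g x)) (eq x))

    D-refl : ∀ (f : Fun d) → D f f ≡ 0ℚ
    D-refl {d} f = trans (Σ-cong (pts d) (λ x → cong ι (Boolₚ.xor-same (f x)))) (Σ-0 (pts d))

    -- Sorting is monotone and preserves the number of ones, hence does not increase distances.
    module Contraction (Op : Fun d → Fun d) (mono : ∀ {f g} → f ⊴ g → Op f ⊴ Op g) (cnt : ∀ f → count (Op f) ≡ count f) where
      -- V f g is the count of f minus the count of f ∧ g. Sorting keeps both counts, and the sorted
      -- meet lies below the meet of the sorted functions.
      V-contract : ∀ f g → V (Op f) (Op g) ≤ V f g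
      V-contract f g = subst₂ _≤_ (sym (V-count (Op f) (Op g))) (sym (V-count f g))
        (le 4 (λ a b c e → a :- c ⊑ b :- e by (b :- a) :+ (c :- e)) refl
          (count (Op f) ∷ count f ∷ count (λ x → Op f x ∧ Op g x) ∷ count (λ x → f x ∧ g x) ∷ [])
          (slack (≤-reflexive (cnt f)) ⊕ slack (≤-trans (≤-reflexive (sym (cnt (λ x → f x ∧ g x))))
            (Σ-mono (pts d) (λ x → ι-mono (≼-∧ (mono (λ x → ∧-≼ˡ (f x) (g x)) x) (mono (λ x → ∧-≼ʳ (f x) (g x)) x)))))))

      D-contract : ∀ f g → D (Op f) (Op g) ≤ D f g
      D-contract f g = subst₂ _≤_ (sym (D-V (Op f) (Op g))) (sym (D-V f g)) (+-mono-≤ (V-contract f g) (V-contract g f))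

    module MC {d} (R : Vec Bool d) = Contraction {d} (M R) (M-mono R) (count-M R)
    module HC {d} (r : Bool) = Contraction {suc d} (hd r) (hd-mono r) (count-hd r)

    vh : Fun (suc d) → ℚ
    vh f = Σ xs (λ p → ι (isLo (st p)) * V (λ x → f (p ∷ x)) (λ x → f (π p ∷ x)))

    Viol : Vec Bool d → Fun d → ℚ
    Viol [] f = 0ℚ
    Viol (r ∷ R) f = ι r * vh f + Σ xs (λ p → Viol R (λ x → f (p ∷ x)))

    vh-nonNeg : ∀ (f : Fun (suc d)) → 0ℚ ≤ vh f
    vh-nonNeg f = Σ-nonNeg xs (λ p → 0≤ι (isLo (st p)) ⊛ V-nonNeg (λ x → f (p ∷ x)) (λ x → f (π p ∷ x)))

    Viol-nonNeg : ∀ (R : Vec Bool d) (f : Fun d) → 0ℚ ≤ Viol R f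
    Viol-nonNeg [] f = ≤-refl
    Viol-nonNeg (r ∷ R) f = 0≤ι r ⊛ vh-nonNeg f ⊕ Σ-nonNeg xs (λ p → Viol-nonNeg R (λ x → f (p ∷ x)))

    -- Sorting exchanges the values of each violated pair, changing two points, and leaves all other
    -- pairs alone.
    D-hd : ∀ (f : Fun (suc d)) → D f (hd true f) ≡ 2ℚ * vh f
    D-hd {d} f = begin
      D f (hd true f)                                ≡⟨ Σ-vec xs d _ ⟩
      Σ xs (λ p → Σ (pts d) (λ x → ι (f (p ∷ x) xor merge (st p) (f (p ∷ x)) (f (π p ∷ x)))))  ≡⟨ Σ-pair-≡ pairing ⟩
      Σ xs (λ p → 2ℚ * W p)                          ≡⟨ Σ-*ˡ xs 2ℚ W ⟩
      2ℚ * vh f                                      ∎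
      where
      open ≡-Reasoning
      W : A → ℚ
      W p = ι (isLo (st p)) * V (λ x → f (p ∷ x)) (λ x → f (π p ∷ x))
      Δ : A → ℚ
      Δ p = Σ (pts d) (λ x → ι (f (p ∷ x) xor merge (st p) (f (p ∷ x)) (f (π p ∷ x))))
      W-lo : ∀ p → st p ≡ lo → Δ p ≡ W p
      W-lo p e = trans (Σ-cong (pts d) (λ x → trans (cong (λ s → ι (f (p ∷ x) xor merge s (f (p ∷ x)) (f (π p ∷ x)))) e) (lemma (f (p ∷ x)) (f (π p ∷ x)))))
        (trans (sym (*-identityˡ _)) (cong (λ s → ι (isLo s) * V (λ x → f (p ∷ x)) (λ x → f (π p ∷ x))) (sym e)))
        where
        lemma : ∀ a b → ι (a xor (a ∧ b)) ≡ ι (a ∧ not b)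
        lemma true b = refl
        lemma false b = refl
      W-hi : ∀ p → st p ≡ hi → Δ p ≡ W (π p)
      W-hi p e = trans (Σ-cong (pts d) (λ x → trans (cong (λ s → ι (f (p ∷ x) xor merge s (f (p ∷ x)) (f (π p ∷ x)))) e) (lemma (f (p ∷ x)) (f (π p ∷ x)))))
        (trans (sym (*-identityˡ _)) (cong₂ (λ s q → ι (isLo s) * V (λ x → f (π p ∷ x)) (λ x → f (q ∷ x))) (sym (st-hi p e)) (sym (π-inv p))))
        where
        lemma : ∀ a b → ι (a xor (a ∨ b)) ≡ ι (b ∧ not a)
        lemma true true = refl
        lemma true false = refl
        lemma false true = refl
        lemma false false = refl
      W-0 : ∀ p → isLo (st p) ≡ false → W p ≡ 0ℚ
      W-0 p e = trans (cong (λ b → ι b * V (λ x → f (p ∷ x)) (λ x → f (π p ∷ x))) e) (*-zeroˡ _)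
      pairing : ∀ p → Δ p + Δ (π p) ≡ 2ℚ * W p + 2ℚ * W (π p)
      pairing p = case (st p) refl
        where
        case : ∀ s → st p ≡ s → Δ p + Δ (π p) ≡ 2ℚ * W p + 2ℚ * W (π p)
        case lo e = trans (cong₂ _+_ (W-lo p e) (trans (W-hi (π p) (st-lo p e)) (cong W (π-inv p))))
          (trans (rg 1 (λ a → a :+ a := con 2ℚ :* a :+ con 2ℚ :* con 0ℚ) refl (W p ∷ []))
            (cong (λ z → 2ℚ * W p + 2ℚ * z) (sym (W-0 (π p) (cong isLo (st-lo p e))))))
        case hi e = trans (cong₂ _+_ (W-hi p e) (W-lo (π p) (st-hi p e)))
          (trans (rg 1 (λ a → a :+ a := con 2ℚ :* con 0ℚ :+ con 2ℚ :* a) refl (W (π p) ∷ []))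
            (cong (λ z → 2ℚ * z + 2ℚ * W (π p)) (sym (W-0 p (cong isLo e)))))
        case fx e = trans (cong₂ _+_ (Δ-0 p e) (Δ-0 (π p) (trans (cong st (st-fx p e)) e)))
          (trans (rg 0 (con 0ℚ :+ con 0ℚ := con 2ℚ :* con 0ℚ :+ con 2ℚ :* con 0ℚ) refl [])
            (cong₂ (λ a b → 2ℚ * a + 2ℚ * b) (sym (W-0 p (cong isLo e))) (sym (W-0 (π p) (cong isLo (trans (cong st (st-fx p e)) e))))))
          where
          Δ-0 : ∀ p → st p ≡ fx → Δ p ≡ 0ℚ
          Δ-0 p e = trans (Σ-cong (pts d) (λ x → trans (cong (λ s → ι (f (p ∷ x) xor merge s (f (p ∷ x)) (f (π p ∷ x)))) e) (cong ι (Boolₚ.xor-same (f (p ∷ x)))))) (Σ-0 (pts d))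

    -- Sorting in other directions creates no violations in the first: these are counted by V of two
    -- slices, and both slices are sorted alike.
    vh-tl : ∀ (R : Vec Bool d) (f : Fun (suc d)) → vh (tl R f) ≤ vh f
    vh-tl R f = Σ-mono xs (λ p → *-monoˡ (0≤ι (isLo (st p))) (MC.V-contract R (λ x → f (p ∷ x)) (λ x → f (π p ∷ x))))

    -- For f⁻ ≤ f ≤ f⁺ this says that the points where f⁻ and f⁺ differ cover all violated edges of
    -- f. Being stated by inequalities between f⁻ and f⁺ alone, it can be followed through sorting.
    Cov : Fun d → Fun d → Set
    Cov {zero} f⁻ f⁺ = f⁻ [] ≼ f⁺ []
    Cov {suc d} f⁻ f⁺ = (∀ p → Cov (λ x → f⁻ (p ∷ x)) (λ x → f⁺ (p ∷ x))) × (∀ p → st p ≡ lo → ∀ x → f⁻ (p ∷ x) ≼ f⁺ (π p ∷ x))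

    Cov⇒⊴ : ∀ (f⁻ f⁺ : Fun d) → Cov f⁻ f⁺ → f⁻ ⊴ f⁺
    Cov⇒⊴ f⁻ f⁺ c [] = c
    Cov⇒⊴ f⁻ f⁺ (c , _) (p ∷ x) = Cov⇒⊴ _ _ (c p) x

    flipAt : Vec A d → Fin d → Vec A d
    flipAt (p ∷ x) zero = π p ∷ x
    flipAt (p ∷ x) (suc i) = p ∷ flipAt x i

    isViol : Fun d → Vec A d → Fin d → Bool
    isViol f x i = isLo (st (lookup x i)) ∧ (f x ∧ not (f (flipAt x i)))

    Viol-edges : ∀ (f : Fun d) → Viol (full d) f ≡ Σ (pts d) (λ x → Σ (allFin d) (λ i → ι (isViol f x i)))
    Viol-edges {zero} f = sym (+-identityʳ 0ℚ)
    Viol-edges {suc d} f = sym (trans (Σ-vec xs d _) (trans (Σ-cong xs (λ p → trans (Σ-cong (pts d) (λ x → Σ-allFin-suc d _)) (Σ-+ (pts d) _ _)))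
      (trans (Σ-+ xs _ _) (cong₂ _+_ (trans (Σ-cong xs (λ p → trans (Σ-cong (pts d) (λ x → ι-∧ (isLo (st p)) _)) (Σ-*ˡ (pts d) (ι (isLo (st p))) _))) (sym (*-identityˡ (vh f))))
        (Σ-cong xs (λ p → sym (Viol-edges (λ y → f (p ∷ y)))))))))

    isHi-π : ∀ p → isHi (st (π p)) ≡ isLo (st p)
    isHi-π p = case (st p) refl
      where
      case : ∀ s → st p ≡ s → isHi (st (π p)) ≡ isLo (st p)
      case lo e = trans (cong isHi (st-lo p e)) (sym (cong isLo e))
      case hi e = trans (cong isHi (st-hi p e)) (sym (cong isLo e))
      case fx e = trans (cong (isHi ∘ st) (st-fx p e)) (trans (cong isHi e) (sym (cong isLo e)))

    flipAt-inv : ∀ (x : Vec A d) i → flipAt (flipAt x i) i ≡ x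
    flipAt-inv (p ∷ x) zero = cong (_∷ x) (π-inv p)
    flipAt-inv (p ∷ x) (suc i) = cong (p ∷_) (flipAt-inv x i)

    lookup-flipAt : ∀ (x : Vec A d) i → lookup (flipAt x i) i ≡ π (lookup x i)
    lookup-flipAt (p ∷ x) zero = refl
    lookup-flipAt (p ∷ x) (suc i) = lookup-flipAt x i

  data Adj : ∀ {d} → Cube d → Cube d → Set where
    here : ∀ {d} (v : Cube d) → Adj (false ∷ v) (true ∷ v)
    there : ∀ {d} b {u v : Cube d} → Adj u v → Adj (b ∷ u) (b ∷ v)

  Adj⇒Covers : ∀ (C F : Cube d → Bool) → (∀ {u v} → Adj u v → ι (F u xor F v) ≤ ι (C u) + ι (C v)) → ∀ R → Covers R C F
  Adj⇒Covers C F h [] = tt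
  Adj⇒Covers C F h (_ ∷ R) = (λ v → h (here v)) , λ b → Adj⇒Covers (C ∘ (b ∷_)) (F ∘ (b ∷_)) (λ a → h (there b a)) R

  -- Isoperimetry for one class

  ∩-comm : ∀ (a b : Cube d) → a ∩ b ≡ b ∩ a
  ∩-comm [] [] = refl
  ∩-comm (x ∷ a) (y ∷ b) = cong₂ _∷_ (Boolₚ.∧-comm x y) (∩-comm a b)

  ∩-swap : ∀ (R a b : Cube d) → (R ∩ a) ∩ b ≡ (R ∩ b) ∩ a
  ∩-swap R a b = trans (∩-assoc R a b) (trans (cong (R ∩_) (∩-comm a b)) (sym (∩-assoc R b a)))

  𝔼-bar : ∀ d (f : Cube d → ℚ) → 𝔼 d (f ∘ bar) ≡ 𝔼 d f
  𝔼-bar zero f = refl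
  𝔼-bar (suc d) f = trans (cong₂ (λ a b → ½ * (a + b)) (𝔼-bar d (f ∘ (true ∷_))) (𝔼-bar d (f ∘ (false ∷_)))) (cong (½ *_) (+-comm _ _))

  -- The sum of Δ over the d edges of the cube at the given point, each taken from its `false` end
  -- to its `true` end.
  edgeSum : (Cube d → Cube d → ℚ) → Cube d → ℚ
  edgeSum Δ [] = 0ℚ
  edgeSum Δ (b ∷ v) = Δ (false ∷ v) (true ∷ v) + edgeSum (λ u w → Δ (b ∷ u) (b ∷ w)) v

  edgeSum-mono : ∀ {Δ Δ′ : Cube d → Cube d → ℚ} → (∀ u w → Δ u w ≤ Δ′ u w) → ∀ b → edgeSum Δ b ≤ edgeSum Δ′ b
  edgeSum-mono le [] = ≤-refl
  edgeSum-mono le (b ∷ v) = +-mono-≤ (le (false ∷ v) (true ∷ v)) (edgeSum-mono (λ u w → le (b ∷ u) (b ∷ w)) v)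

  edgeSum-Σ : ∀ {X : Set} (xs : List X) (Δ : X → Cube d → Cube d → ℚ) b →
    edgeSum (λ u w → Σ xs (λ x → Δ x u w)) b ≡ Σ xs (λ x → edgeSum (Δ x) b)
  edgeSum-Σ xs Δ [] = sym (Σ-0 xs)
  edgeSum-Σ xs Δ (b ∷ v) = trans (cong (Σ xs (λ x → Δ x (false ∷ v) (true ∷ v)) +_) (edgeSum-Σ xs (λ x u w → Δ x (b ∷ u) (b ∷ w)) v)) (sym (Σ-+ xs _ _))

  sens-edgeSum : ∀ (F : Cube d → Bool) b → sens (full d) F b ≡ edgeSum (λ u w → ι (F u xor F w)) b
  sens-edgeSum F [] = refl
  sens-edgeSum F (b ∷ v) = cong₂ _+_ (*-identityˡ _) (sens-edgeSum (F ∘ (b ∷_)) v)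

  𝔼³ : ∀ d → (Cube d → Cube d → Cube d → ℚ) → ℚ
  𝔼³ d f = 𝔼 d (λ a → 𝔼 d (λ b → 𝔼 d (f a b)))

  𝔼³-+ : ∀ d (f g : Cube d → Cube d → Cube d → ℚ) → 𝔼³ d (λ a b e → f a b e + g a b e) ≡ 𝔼³ d f + 𝔼³ d g
  𝔼³-+ d f g = trans (𝔼-cong d (λ a → trans (𝔼-cong d (λ b → 𝔼-+ d _ _)) (𝔼-+ d _ _))) (𝔼-+ d _ _)

  𝔼³-*ˡ : ∀ d c (f : Cube d → Cube d → Cube d → ℚ) → 𝔼³ d (λ a b e → c * f a b e) ≡ c * 𝔼³ d f
  𝔼³-*ˡ d c f = trans (𝔼-cong d (λ a → trans (𝔼-cong d (λ b → 𝔼-*ˡ d c _)) (𝔼-*ˡ d c _))) (𝔼-*ˡ d c _)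

  𝔼³-bar₂ : ∀ d (f : Cube d → Cube d → Cube d → ℚ) → 𝔼³ d (λ a b e → f a (bar b) e) ≡ 𝔼³ d f
  𝔼³-bar₂ d f = 𝔼-cong d (λ a → 𝔼-bar d (λ b → 𝔼 d (f a b)))

  𝔼³-bar₃ : ∀ d (f : Cube d → Cube d → Cube d → ℚ) → 𝔼³ d (λ a b e → f a b (bar e)) ≡ 𝔼³ d f
  𝔼³-bar₃ d f = 𝔼-cong d (λ a → 𝔼-cong d (λ b → 𝔼-bar d (f a b)))

  𝔼³-pigeonhole : ∀ d (f : Cube d → Cube d → Cube d → ℚ) → ∃ λ a → ∃ λ b → ∃ λ e → f a b e ≤ 𝔼³ d f
  𝔼³-pigeonhole d f =
    let a , p = 𝔼-pigeonhole d (λ a → 𝔼 d (λ b → 𝔼 d (f a b)))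
        b , q = 𝔼-pigeonhole d (λ b → 𝔼 d (f a b))
        e , r = 𝔼-pigeonhole d (f a b)
    in a , b , e , ≤-trans r (≤-trans q p)

  module Isoperimetry {A : Set} (𝓛 : Line A) where
    open Sorting 𝓛

    Srt : Cube d → Fun d → Set
    Srt [] f = ⊤
    Srt (r ∷ R) f = (∀ p → Srt R (λ x → f (p ∷ x))) × (r ≡ true → ∀ p → st p ≡ lo → ∀ x → f (p ∷ x) ≼ f (π p ∷ x))

    Srt-merge : ∀ s (R : Cube d) (g h : Fun d) → Srt R g → Srt R h → Srt R (λ x → merge s (g x) (h x))
    Srt-merge s [] g h _ _ = tt
    Srt-merge s (r ∷ R) g h (gs , g₀) (hs , h₀) = (λ p → Srt-merge s R _ _ (gs p) (hs p)) , λ r≡ p e x → merge-mono s (g₀ r≡ p e x) (h₀ r≡ p e x)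

    merge-sorted : ∀ p → st p ≡ lo → ∀ (g h : A → Bool) → merge (st p) (g p) (g (π p)) ≼ merge (st (π p)) (g (π p)) (g (π (π p)))
    merge-sorted p e g h = subst₂ (λ s t → merge s (g p) (g (π p)) ≼ merge t (g (π p)) (g (π (π p)))) (sym e) (sym (st-lo p e))
      (≼-trans (∧-≼ʳ (g p) (g (π p))) (≼-∨ˡ (g (π p)) (g (π (π p)))))

    hd-slices : ∀ r (R : Cube d) (t : Fun (suc d)) → (∀ p → Srt R (λ x → t (p ∷ x))) → ∀ p → Srt R (λ x → hd r t (p ∷ x))
    hd-slices false R t ts p = ts p
    hd-slices true R t ts p = Srt-merge (st p) R _ _ (ts p) (ts (π p))

    M-Srt : ∀ (R : Cube d) f → Srt R (M R f)
    M-Srt [] f = tt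
    M-Srt (r ∷ R) f = hd-slices r R (tl R f) (λ p → M-Srt R (λ x → f (p ∷ x))) , λ { refl p e x → merge-sorted p e (λ q → tl R f (q ∷ x)) (λ _ → true) }

    -- A sort in another direction is monotone and acts alike on the two slices being compared, so
    -- it keeps their order.
    M-preserves : ∀ (R R′ : Cube d) f → Srt R f → Srt R (M R′ f)
    M-preserves [] [] f s = tt
    M-preserves (r ∷ R) (r′ ∷ R′) f (fs , f₀) = hd-slices r′ R (tl R′ f) (λ p → M-preserves R R′ _ (fs p)) , head r′
      where
      head : ∀ r′ → r ≡ true → ∀ p → st p ≡ lo → ∀ x → hd r′ (tl R′ f) (p ∷ x) ≼ hd r′ (tl R′ f) (π p ∷ x)
      head false r≡ p e x = M-mono R′ (f₀ r≡ p e) x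
      head true r≡ p e x = merge-sorted p e (λ q → tl R′ f (q ∷ x)) (λ _ → true)

    hd-cong : ∀ r {f g : Fun (suc d)} → (∀ x → f x ≡ g x) → ∀ x → hd r f x ≡ hd r g x
    hd-cong false eq x = eq x
    hd-cong true eq (p ∷ x) = cong₂ (merge (st p)) (eq (p ∷ x)) (eq (π p ∷ x))

    M-fix : ∀ (R : Cube d) f → Srt R f → ∀ x → M R f x ≡ f x
    M-fix [] f s x = refl
    M-fix (r ∷ R) f (fs , f₀) x = trans (hd-cong r (λ { (p ∷ x) → M-fix R _ (fs p) x }) x) (head r x f₀)
      where
      head : ∀ r (x : Vec A _) → (r ≡ true → ∀ p → st p ≡ lo → ∀ x → f (p ∷ x) ≼ f (π p ∷ x)) → hd r f x ≡ f x
      head false x _ = refl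
      head true (p ∷ x) f₀ = case (st p) refl
        where
        case : ∀ s → st p ≡ s → merge (st p) (f (p ∷ x)) (f (π p ∷ x)) ≡ f (p ∷ x)
        case lo e = trans (cong (λ s → merge s (f (p ∷ x)) (f (π p ∷ x))) e) (≼∧→≡ (f₀ refl p e x))
        case hi e = trans (cong (λ s → merge s (f (p ∷ x)) (f (π p ∷ x))) e) (≼∨→≡ (subst (λ q → f (π p ∷ x) ≼ f (q ∷ x)) (π-inv p) (f₀ refl (π p) (st-hi p e) x)))
        case fx e = cong (λ s → merge s (f (p ∷ x)) (f (π p ∷ x))) e

    Srt-join : ∀ (R b : Cube d) f → Srt (R ∩ b) f → Srt (R ∩ bar b) f → Srt R f
    Srt-join [] [] f _ _ = tt
    Srt-join (r ∷ R) (true ∷ b) f (s , s₀) (t , t₀) = (λ p → Srt-join R b _ (s p) (t p)) , λ { refl → s₀ refl }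
    Srt-join (r ∷ R) (false ∷ b) f (s , s₀) (t , t₀) = (λ p → Srt-join R b _ (s p) (t p)) , λ { refl → t₀ refl }

    -- `M R` fixes h and does not increase distances, so M R f is as close to h as f is.
    D-M : ∀ (R : Cube d) f h → Srt R h → D f (M R f) ≤ 2ℚ * D f h
    D-M R f h s = ≤-trans (D-triangle f h (M R f)) (le 2 (λ a b → a :+ b ⊑ con 2ℚ :* a by a :- b) refl (D f h ∷ D h (M R f) ∷ [])
      (slack (subst₂ _≤_ (D-congˡ (M R f) (M-fix R h s)) (D-sym h f) (MC.D-contract R h f))))

    D-M-join : ∀ (R : Cube d) u w → D u (M R w) ≤ D u (M R u) + D u w
    D-M-join R u w = ≤-trans (D-triangle u (M R u) (M R w)) (+-monoʳ-≤ (D u (M R u)) (MC.D-contract R u w))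

    Viol-halving : ∀ (R : Cube d) f → 𝔼 d (λ b → Viol (R ∩ b) f) ≡ ½ * Viol R f
    Viol-halving [] f = sym (*-zeroʳ ½)
    Viol-halving {suc d} (r ∷ R) f = begin
      ½ * (𝔼 d (λ b → ι (r ∧ false) * vh f + tails b) + 𝔼 d (λ b → ι (r ∧ true) * vh f + tails b))
        ≡⟨ cong₂ (λ x y → ½ * (x + y)) (part (r ∧ false)) (part (r ∧ true)) ⟩
      ½ * ((ι (r ∧ false) * vh f + ½ * S) + (ι (r ∧ true) * vh f + ½ * S))
        ≡⟨ cong₂ (λ x y → ½ * ((ι x * vh f + ½ * S) + (ι y * vh f + ½ * S))) (Boolₚ.∧-zeroʳ r) (Boolₚ.∧-identityʳ r) ⟩
      ½ * ((0ℚ * vh f + ½ * S) + (ι r * vh f + ½ * S))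
        ≡⟨ rg 3 (λ r s t → con ½ :* ((con 0ℚ :* s :+ con ½ :* t) :+ (r :* s :+ con ½ :* t)) := con ½ :* (r :* s :+ t)) refl (ι r ∷ vh f ∷ S ∷ []) ⟩
      ½ * (ι r * vh f + S) ∎
      where
      open ≡-Reasoning
      tails = λ b → Σ xs (λ p → Viol (R ∩ b) (λ x → f (p ∷ x)))
      S = Σ xs (λ p → Viol R (λ x → f (p ∷ x)))
      part : ∀ x → 𝔼 d (λ b → ι x * vh f + tails b) ≡ ι x * vh f + ½ * S
      part x = trans (𝔼-+ d _ _) (cong₂ _+_ (𝔼-const d _) (trans (𝔼-Σ d xs _) (trans (Σ-cong xs (λ p → Viol-halving R _)) (Σ-*ˡ xs ½ _))))

    D-tl : ∀ (R R′ : Cube d) (f : Fun (suc d)) → D (tl R f) (tl R′ f) ≡ Σ xs (λ p → D (M R (λ x → f (p ∷ x))) (M R′ (λ x → f (p ∷ x))))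
    D-tl {d} R R′ f = Σ-vec xs d _

    -- Adding a direction to the sorted set changes two points per violated edge of that direction.
    -- Sorts made before do not increase the number of these edges (`vh-tl`), and sorts made
    -- afterwards are contractions.
    edgeSum-M : ∀ (R : Cube d) f b → edgeSum (λ u w → D (M (R ∩ u) f) (M (R ∩ w) f)) b ≤ 2ℚ * Viol R f
    edgeSum-M [] f [] = ≤-reflexive (sym (*-zeroʳ 2ℚ))
    edgeSum-M {suc d} (r ∷ R) f (b ∷ v) = ≤-trans (+-mono-≤ (head r) tail)
      (≤-reflexive (sym (*-distribˡ-+ 2ℚ (ι r * vh f) (Σ xs (λ p → Viol R (λ x → f (p ∷ x)))))))
      where
      t = tl (R ∩ v) f
      head : ∀ r → D (hd (r ∧ false) t) (hd (r ∧ true) t) ≤ 2ℚ * (ι r * vh f)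
      head false = ≤-reflexive (trans (D-refl t) (rg 1 (λ a → con 0ℚ := con 2ℚ :* (con 0ℚ :* a)) refl (vh f ∷ [])))
      head true = ≤-trans (≤-reflexive (D-hd t)) (*-monoˡ (≤ᵇ⇒≤ tt) (≤-trans (vh-tl (R ∩ v) f) (≤-reflexive (sym (*-identityˡ (vh f))))))
      tail : edgeSum (λ u w → D (hd (r ∧ b) (tl (R ∩ u) f)) (hd (r ∧ b) (tl (R ∩ w) f))) v ≤ 2ℚ * Σ xs (λ p → Viol R (λ x → f (p ∷ x)))
      tail = ≤-trans (edgeSum-mono (λ u w → ≤-trans (HC.D-contract (r ∧ b) (tl (R ∩ u) f) (tl (R ∩ w) f)) (≤-reflexive (D-tl (R ∩ u) (R ∩ w) f))) v)
        (≤-trans (≤-reflexive (edgeSum-Σ xs _ v)) (≤-trans (Σ-mono xs (λ p → edgeSum-M R (λ x → f (p ∷ x)) v)) (≤-reflexive (Σ-*ˡ xs 2ℚ _))))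

    -- One more sort replaces a value by its minimum or maximum with the partner's value, and `Cov`
    -- bounds f⁻ by f⁺ both at the point and across the edge. So the comparison holds whichever of
    -- the two functions gets the additional sort. For a fixed point it makes the sets of directions
    -- at which the sorted f⁺ and f⁻ differ a vertex cover in the cube of all such sets.
    Cov-M : ∀ (R : Cube d) (f⁻ f⁺ : Fun d) → Cov f⁻ f⁺ → ∀ {u v} → Adj u v →
      (M (R ∩ u) f⁻ ⊴ M (R ∩ v) f⁺) × (M (R ∩ v) f⁻ ⊴ M (R ∩ u) f⁺)
    Cov-M (r ∷ R) f⁻ f⁺ (cs , c₀) (there b {u} {v} a) =
      hd-mono (r ∧ b) (λ { (p ∷ x) → proj₁ (Cov-M R _ _ (cs p) a) x }) , hd-mono (r ∧ b) (λ { (p ∷ x) → proj₂ (Cov-M R _ _ (cs p) a) x })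
    Cov-M (false ∷ R) f⁻ f⁺ (cs , c₀) (here v) = same , same
      where
      same : tl (R ∩ v) f⁻ ⊴ tl (R ∩ v) f⁺
      same (p ∷ x) = M-mono (R ∩ v) (Cov⇒⊴ _ _ (cs p)) x
    Cov-M {suc d} (true ∷ R) f⁻ f⁺ (cs , c₀) (here v) = up , down
      where
      t⁻ = tl (R ∩ v) f⁻
      t⁺ = tl (R ∩ v) f⁺
      same : t⁻ ⊴ t⁺
      same (p ∷ x) = M-mono (R ∩ v) (Cov⇒⊴ _ _ (cs p)) x
      edge : ∀ p → st p ≡ lo → ∀ x → t⁻ (p ∷ x) ≼ t⁺ (π p ∷ x)
      edge p e = M-mono (R ∩ v) (c₀ p e)
      up : t⁻ ⊴ hd true t⁺
      up (p ∷ x) = case (st p) refl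
        where
        case : ∀ s → st p ≡ s → t⁻ (p ∷ x) ≼ merge (st p) (t⁺ (p ∷ x)) (t⁺ (π p ∷ x))
        case lo e = subst (λ s → t⁻ (p ∷ x) ≼ merge s (t⁺ (p ∷ x)) (t⁺ (π p ∷ x))) (sym e) (≼-∧ (same (p ∷ x)) (edge p e x))
        case hi e = subst (λ s → t⁻ (p ∷ x) ≼ merge s (t⁺ (p ∷ x)) (t⁺ (π p ∷ x))) (sym e) (≼-trans (same (p ∷ x)) (≼-∨ˡ _ _))
        case fx e = subst (λ s → t⁻ (p ∷ x) ≼ merge s (t⁺ (p ∷ x)) (t⁺ (π p ∷ x))) (sym e) (same (p ∷ x))
      down : hd true t⁻ ⊴ t⁺
      down (p ∷ x) = case (st p) refl
        where
        case : ∀ s → st p ≡ s → merge (st p) (t⁻ (p ∷ x)) (t⁻ (π p ∷ x)) ≼ t⁺ (p ∷ x)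
        case lo e = subst (λ s → merge s (t⁻ (p ∷ x)) (t⁻ (π p ∷ x)) ≼ t⁺ (p ∷ x)) (sym e) (≼-trans (∧-≼ˡ _ _) (same (p ∷ x)))
        case hi e = subst (λ s → merge s (t⁻ (p ∷ x)) (t⁻ (π p ∷ x)) ≼ t⁺ (p ∷ x)) (sym e)
          (∨-≼ (same (p ∷ x)) (subst (λ q → t⁻ (π p ∷ x) ≼ t⁺ (q ∷ x)) (π-inv p) (edge (π p) (st-hi p e) x)))
        case fx e = subst (λ s → merge s (t⁻ (p ∷ x)) (t⁻ (π p ∷ x)) ≼ t⁺ (p ∷ x)) (sym e) (same (p ∷ x))

    D-M-Viol : ∀ (R : Cube d) f → D f (M R f) ≤ 2ℚ * Viol R f
    D-M-Viol [] f = ≤-reflexive (trans (D-refl f) (sym (*-zeroʳ 2ℚ)))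
    D-M-Viol {suc d} (r ∷ R) f = ≤-trans (D-triangle f (tl R f) (hd r (tl R f)))
      (≤-trans (+-mono-≤ (≤-trans (≤-reflexive (Σ-vec xs d _)) (≤-trans (Σ-mono xs (λ p → D-M-Viol R (λ x → f (p ∷ x)))) (≤-reflexive (Σ-*ˡ xs 2ℚ _)))) (head r))
      (≤-reflexive (rg 2 (λ a b → con 2ℚ :* a :+ con 2ℚ :* b := con 2ℚ :* (b :+ a)) refl (_ ∷ ι r * vh f ∷ []))))
      where
      head : ∀ r → D (tl R f) (hd r (tl R f)) ≤ 2ℚ * (ι r * vh f)
      head false = ≤-reflexive (trans (D-refl (tl R f)) (rg 1 (λ a → con 0ℚ := con 2ℚ :* (con 0ℚ :* a)) refl (vh f ∷ [])))
      head true = ≤-trans (≤-reflexive (D-hd (tl R f))) (*-monoˡ (≤ᵇ⇒≤ tt) (≤-trans (vh-tl R f) (≤-reflexive (sym (*-identityˡ (vh f))))))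

    sortAll : List (Cube d) → Fun d → Fun d
    sortAll [] u = u
    sortAll (P ∷ Ps) u = M P (sortAll Ps u)

    sortAll-preserves : ∀ (Q : Cube d) Ps u → Srt Q u → Srt Q (sortAll Ps u)
    sortAll-preserves Q [] u s = s
    sortAll-preserves Q (P ∷ Ps) u s = M-preserves Q P _ (sortAll-preserves Q Ps u s)

    sortAll-Srt : ∀ (Ps : List (Cube d)) u → All (λ P → Srt P (sortAll Ps u)) Ps
    sortAll-Srt [] u = []
    sortAll-Srt (P ∷ Ps) u = M-Srt P _ ∷ All.map (λ {Q} → M-preserves Q P _) (sortAll-Srt Ps u)

    -- `M P f` is sorted along P, so by `D-M` sorting u along P costs at most twice the distance
    -- from u to `M P f`; by contraction the costs of the single sorts add up.
    D-sortAll : ∀ (f u : Fun d) Ps → D u (sortAll Ps u) ≤ 2ℚ * Σ Ps (λ P → D u (M P f))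
    D-sortAll f u [] = ≤-reflexive (trans (D-refl u) (sym (*-zeroʳ 2ℚ)))
    D-sortAll f u (P ∷ Ps) = ≤-trans (D-M-join P u (sortAll Ps u))
      (≤-trans (+-mono-≤ (D-M P u (M P f) (M-Srt P f)) (D-sortAll f u Ps)) (≤-reflexive (sym (*-distribˡ-+ 2ℚ _ _))))

    module _ {d} (f f⁻ f⁺ : Fun d) (f⁻≤f : f⁻ ⊴ f) (f≤f⁺ : f ⊴ f⁺) (cov : Cov f⁻ f⁺) where

      c : ℚ
      c = V f⁺ f⁻

      -- For a fixed point x, the value at x of f sorted along R ∩ b is a Boolean function of b, and
      -- `margulis` applies to it with the cover from `Cov-M`. Summed over x, the cover has at most
      -- c points for every b, because sorting does not increase V, and the sensitivity is at most 2
      -- Viol by `edgeSum-M`.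
      antipodal : ∀ (R : Cube d) {k κ} → 0ℚ < k → 0ℚ < κ → k * κ ≡ 1ℚ →
        𝔼 d (λ b → D (M (R ∩ b) f) (M (R ∩ bar b) f)) ≤ (pos 32 / 1) * (k * c + κ * Viol R f)
      antipodal R {k} {κ} 0<k 0<κ kκ = begin
        𝔼 d (λ b → Σ (pts d) (λ x → ι (F x b xor F x (bar b))))   ≡⟨ 𝔼-Σ d (pts d) _ ⟩
        Σ (pts d) (λ x → 𝔼 d (λ b → ι (F x b xor F x (bar b))))   ≤⟨ Σ-mono (pts d) (λ x → margulis 0<k 0<κ kκ (F x) (C x) (covers x)) ⟩
        Σ (pts d) (λ x → s16 * (k * 𝔼 d (ι ∘ C x) + κ * 𝔼 d (sens (full d) (F x))))  ≡⟨ Σ-*ˡ (pts d) s16 _ ⟩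
        s16 * Σ (pts d) (λ x → k * 𝔼 d (ι ∘ C x) + κ * 𝔼 d (sens (full d) (F x)))    ≡⟨ cong (s16 *_) (trans (Σ-+ (pts d) _ _) (cong₂ _+_ (trans (Σ-*ˡ (pts d) k _) (cong (k *_) (sym (𝔼-Σ d (pts d) _)))) (trans (Σ-*ˡ (pts d) κ _) (cong (κ *_) (sym (𝔼-Σ d (pts d) _)))))) ⟩
        s16 * (k * 𝔼 d (λ b → Σ (pts d) (λ x → ι (C x b))) + κ * 𝔼 d (λ b → Σ (pts d) (λ x → sens (full d) (F x) b)))
          ≤⟨ *-monoˡ (≤ᵇ⇒≤ tt) (+-mono-≤ (*-monoˡ (<⇒≤ 0<k) (≤-trans (𝔼-mono d (λ b → MC.V-contract (R ∩ b) f⁺ f⁻)) (≤-reflexive (𝔼-const d c))))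
              (*-monoˡ (<⇒≤ 0<κ) (≤-trans (𝔼-mono d (λ b → ≤-trans (≤-reflexive (trans (Σ-cong (pts d) (λ x → sens-edgeSum (F x) b)) (sym (edgeSum-Σ (pts d) _ b)))) (edgeSum-M R f b))) (≤-reflexive (𝔼-const d (2ℚ * Viol R f)))))) ⟩
        s16 * (k * c + κ * (2ℚ * Viol R f))                        ≤⟨ le 3 (λ a κ v → con s16 :* (a :+ κ :* (con 2ℚ :* v)) ⊑ con (pos 32 / 1) :* (a :+ κ :* v) by con s16 :* a) refl (k * c ∷ κ ∷ Viol R f ∷ []) (s16 · (<⇒≤ 0<k ⊛ V-nonNeg f⁺ f⁻)) ⟩
        (pos 32 / 1) * (k * c + κ * Viol R f) ∎
        where
        open ℚₚ.≤-Reasoning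
        s16 : ℚ
        s16 = pos 16 / 1
        F : Vec A d → Cube d → Bool
        F x b = M (R ∩ b) f x
        C : Vec A d → Cube d → Bool
        C x b = M (R ∩ b) f⁺ x ∧ not (M (R ∩ b) f⁻ x)
        covers : ∀ x → Covers (full d) (C x) (F x)
        covers x = Adj⇒Covers (C x) (F x) (λ {u} {v} a → let p , q = Cov-M R f⁻ f⁺ cov a in
          lemma (F x u) (F x v) (M (R ∩ u) f⁻ x) (M (R ∩ v) f⁻ x) (M (R ∩ u) f⁺ x) (M (R ∩ v) f⁺ x)
            (M-mono (R ∩ u) f⁻≤f x) (M-mono (R ∩ v) f⁻≤f x) (M-mono (R ∩ u) f≤f⁺ x) (M-mono (R ∩ v) f≤f⁺ x) (p x) (q x)) (full d)
          where
          lemma : ∀ a b l l′ h h′ → l ≼ a → l′ ≼ b → a ≼ h → b ≼ h′ → l ≼ h′ → l′ ≼ h → ι (a xor b) ≤ ι (h ∧ not l) + ι (h′ ∧ not l′)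
          lemma true true l l′ h h′ _ _ _ _ _ _ = 0≤ι (h ∧ not l) ⊕ 0≤ι (h′ ∧ not l′)
          lemma false false l l′ h h′ _ _ _ _ _ _ = 0≤ι (h ∧ not l) ⊕ 0≤ι (h′ ∧ not l′)
          lemma true false false l′ true h′ _ _ _ _ _ _ = le 1 (λ a → con 1ℚ ⊑ con 1ℚ :+ a by a) refl (ι (h′ ∧ not l′) ∷ []) (0≤ι (h′ ∧ not l′))
          lemma true false true false true true _ _ _ _ _ _ = ≤ᵇ⇒≤-0+1
            where ≤ᵇ⇒≤-0+1 = ≤-reflexive (sym (+-identityˡ 1ℚ))
          lemma false true l false h true _ _ _ _ _ _ = le 1 (λ a → con 1ℚ ⊑ a :+ con 1ℚ by a) refl (ι (h ∧ not l) ∷ []) (0≤ι (h ∧ not l))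
          lemma false true false true true true _ _ _ _ _ _ = ≤-reflexive (sym (+-identityʳ 1ℚ))

      -- Fixed by the induction in `sorted-J`: the recursive call contributes 2 · 3/8 = 3/4 of it,
      -- and the antipodal distances contribute 2 · 12 · 32 = 768, the remaining quarter.
      𝔸 : ℚ
      𝔸 = pos 3072 / 1

      -- Cut R into eight random parts.  The functions obtained by sorting f along single parts
      -- differ little on average, so sorting one of them along the other parts changes it little.
      sorted-J : ∀ J (R : Cube d) {k κ} → 0ℚ < k → 0ℚ < κ → k * κ ≡ 1ℚ →
        ∃ λ h → Srt R h × D f h ≤ 𝔸 * (k * c + κ * Viol R f) + ⅔ ^^ J * (2ℚ * Viol R f)
      sorted-J zero R {k} {κ} 0<k 0<κ kκ = M R f , M-Srt R f , ≤-trans (D-M-Viol R f)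
        (le 2 (λ x v → v ⊑ con 𝔸 :* x :+ con 1ℚ :* v by con 𝔸 :* x) refl (k * c + κ * Viol R f ∷ 2ℚ * Viol R f ∷ [])
          (𝔸 · (<⇒≤ 0<k ⊛ V-nonNeg f⁺ f⁻ ⊕ <⇒≤ 0<κ ⊛ Viol-nonNeg R f)))
      sorted-J (suc J) R {k} {κ} 0<k 0<κ kκ =
        let a , b , e , bound = 𝔼³-pigeonhole d total
        in sortAll (others a b e) (v a b e) , sorted a b e , ≤-trans (D-total a b e) (≤-trans bound average)
        where
        P : Cube d → Cube d → Cube d → Cube d
        P a b e = ((R ∩ a) ∩ b) ∩ e
        v : Cube d → Cube d → Cube d → Fun d
        v a b e = M (P a b e) f
        others : Cube d → Cube d → Cube d → List (Cube d)
        others a b e = P a b (bar e) ∷ P a (bar b) e ∷ P a (bar b) (bar e) ∷ P (bar a) b e ∷ P (bar a) b (bar e) ∷ P (bar a) (bar b) e ∷ P (bar a) (bar b) (bar e) ∷ []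
        sorted : ∀ a b e → Srt R (sortAll (others a b e) (v a b e))
        sorted a b e with sortAll-Srt (others a b e) (v a b e)
        ... | s₁ ∷ s₂ ∷ s₃ ∷ s₄ ∷ s₅ ∷ s₆ ∷ s₇ ∷ [] =
          Srt-join R a _ (Srt-join (R ∩ a) b _ (Srt-join _ e _ (sortAll-preserves (P a b e) (others a b e) (v a b e) (M-Srt (P a b e) f)) s₁) (Srt-join _ e _ s₂ s₃))
            (Srt-join (R ∩ bar a) b _ (Srt-join _ e _ s₄ s₅) (Srt-join _ e _ s₆ s₇))
        X₁ X₂ X₃ S bnd total : Cube d → Cube d → Cube d → ℚ
        X₁ a b e = D (v a b e) (v (bar a) b e)
        X₂ a b e = D (v a b e) (v a (bar b) e)
        X₃ a b e = D (v a b e) (v a b (bar e))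
        -- The seven other parts are reached from `P a b e` by complementing e, then b, then a, as
        -- far as they differ. On these paths steps of the first kind occur four times, of the
        -- second 2 + 2 times and of the third four times, in all twelve antipodal distances.
        S a b e = 4ℚ * X₃ a b e + (2ℚ * X₂ a b e + (2ℚ * X₂ a b (bar e) + (X₁ a b e + (X₁ a b (bar e) + (X₁ a (bar b) e + X₁ a (bar b) (bar e))))))
        -- Three cuts leave an eighth of the violations on average, and `D-M` loses a factor 2. The
        -- recursion closes if 2 k′ < k and 2 κ′ / 8 < κ, that is, 1/4 < k′/k < 1/2. With four parts
        -- the two conditions would contradict each other.
        k′ κ′ : ℚ
        k′ = (pos 3 / 8) * k
        κ′ = (pos 8 / 3) * κ
        bnd a b e = 𝔸 * (k′ * c) + (𝔸 * κ′ + ⅔ ^^ J * 2ℚ) * Viol (P a b e) f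
        total a b e = 2ℚ * bnd a b e + 2ℚ * S a b e
        D-v : ∀ a b e → D f (v a b e) ≤ 2ℚ * bnd a b e
        D-v a b e = let h , s , h≤ = sorted-J J (P a b e) (*-pos {pos 3 / 8} (ℚₚ.positive⁻¹ _) 0<k) (*-pos {pos 8 / 3} (ℚₚ.positive⁻¹ _) 0<κ)
                                       (trans (rg 2 (λ k κ → con (pos 3 / 8) :* k :* (con (pos 8 / 3) :* κ) := k :* κ) refl (k ∷ κ ∷ [])) kκ)
          in ≤-trans (D-M (P a b e) f h s) (*-monoˡ (≤ᵇ⇒≤ tt) (≤-trans h≤ (≤-reflexive
            (rg 4 (λ x κ p w → con 𝔸 :* (x :+ κ :* w) :+ p :* (con 2ℚ :* w) := con 𝔸 :* x :+ (con 𝔸 :* κ :+ p :* con 2ℚ) :* w) refl (k′ * c ∷ κ′ ∷ ⅔ ^^ J ∷ Viol (P a b e) f ∷ [])))))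
        D-others : ∀ a b e → Σ (others a b e) (λ Q → D (v a b e) (M Q f)) ≤ S a b e
        D-others a b e = le 11 (λ d₃ d₂ d₂₃ d₁ d₁₃ d₁₂ d₁₂₃ x₂ y₁ z₁ w₁ →
            d₃ :+ (d₂ :+ (d₂₃ :+ (d₁ :+ (d₁₃ :+ (d₁₂ :+ (d₁₂₃ :+ con 0ℚ)))))) ⊑
            con 4ℚ :* d₃ :+ (con 2ℚ :* d₂ :+ (con 2ℚ :* x₂ :+ (d₁ :+ (y₁ :+ (z₁ :+ w₁)))))
            by ((d₃ :+ x₂) :- d₂₃) :+ ((d₃ :+ y₁) :- d₁₃) :+ ((d₂ :+ z₁) :- d₁₂) :+ ((d₃ :+ (x₂ :+ w₁)) :- d₁₂₃)) refl
          (X₃ a b e ∷ X₂ a b e ∷ D (v a b e) (v a (bar b) (bar e)) ∷ X₁ a b e ∷ D (v a b e) (v (bar a) b (bar e)) ∷ D (v a b e) (v (bar a) (bar b) e) ∷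
            D (v a b e) (v (bar a) (bar b) (bar e)) ∷ X₂ a b (bar e) ∷ X₁ a b (bar e) ∷ X₁ a (bar b) e ∷ X₁ a (bar b) (bar e) ∷ [])
          (slack (D-triangle u (v a b (bar e)) (v a (bar b) (bar e))) ⊕ slack (D-triangle u (v a b (bar e)) (v (bar a) b (bar e)))
            ⊕ slack (D-triangle u (v a (bar b) e) (v (bar a) (bar b) e))
            ⊕ slack (≤-trans (D-triangle u (v a b (bar e)) (v (bar a) (bar b) (bar e))) (+-monoʳ-≤ (X₃ a b e) (D-triangle (v a b (bar e)) (v a (bar b) (bar e)) (v (bar a) (bar b) (bar e))))))
          where u = v a b e
        D-total : ∀ a b e → D f (sortAll (others a b e) (v a b e)) ≤ total a b e
        D-total a b e = ≤-trans (D-triangle f (v a b e) _) (+-mono-≤ (D-v a b e) (≤-trans (D-sortAll f (v a b e) (others a b e)) (*-monoˡ (≤ᵇ⇒≤ tt) (D-others a b e))))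
        w : ℚ
        w = Viol R f
        Φ : ℚ
        Φ = (pos 32 / 1) * (k * c + κ * (½ * (½ * w)))
        quarter : 𝔼 d (λ a → 𝔼 d (λ b → (pos 32 / 1) * (k * c + κ * Viol ((R ∩ a) ∩ b) f))) ≡ Φ
        quarter = trans (𝔼-cong d (λ a → trans (affine (λ b → Viol ((R ∩ a) ∩ b) f)) (cong (λ z → (pos 32 / 1) * (k * c + κ * z)) (Viol-halving (R ∩ a) f))))
          (trans (affine (λ a → ½ * Viol (R ∩ a) f)) (cong (λ z → (pos 32 / 1) * (k * c + κ * z)) (trans (𝔼-*ˡ d ½ _) (cong (½ *_) (Viol-halving R f)))))
          where
          affine : ∀ g → 𝔼 d (λ b → (pos 32 / 1) * (k * c + κ * g b)) ≡ (pos 32 / 1) * (k * c + κ * 𝔼 d g)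
          affine g = trans (𝔼-*ˡ d (pos 32 / 1) _) (cong ((pos 32 / 1) *_) (trans (𝔼-+ d _ _) (cong₂ _+_ (𝔼-const d _) (𝔼-*ˡ d κ g))))
        x₃ : 𝔼³ d X₃ ≤ Φ
        x₃ = ≤-trans (𝔼-mono d (λ a → 𝔼-mono d (λ b → antipodal ((R ∩ a) ∩ b) 0<k 0<κ kκ))) (≤-reflexive quarter)
        x₂ : 𝔼³ d X₂ ≤ Φ
        x₂ = ≤-trans (≤-reflexive (𝔼-cong d (λ a → 𝔼-swap d d _))) (≤-trans (𝔼-mono d (λ a → 𝔼-mono d (λ e →
          ≤-trans (≤-reflexive (𝔼-cong d (λ b → cong₂ (λ Q Q′ → D (M Q f) (M Q′ f)) (∩-swap (R ∩ a) b e) (∩-swap (R ∩ a) (bar b) e)))) (antipodal ((R ∩ a) ∩ e) 0<k 0<κ kκ)))) (≤-reflexive quarter))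
        x₁ : 𝔼³ d X₁ ≤ Φ
        x₁ = ≤-trans (≤-reflexive (trans (𝔼-swap d d _) (𝔼-cong d (λ b → 𝔼-swap d d _)))) (≤-trans (𝔼-mono d (λ b → 𝔼-mono d (λ e →
          ≤-trans (≤-reflexive (𝔼-cong d (λ a → cong₂ (λ Q Q′ → D (M Q f) (M Q′ f)) (front a b e) (front (bar a) b e)))) (antipodal ((R ∩ b) ∩ e) 0<k 0<κ kκ)))) (≤-reflexive quarter))
          where
          front : ∀ a b e → P a b e ≡ ((R ∩ b) ∩ e) ∩ a
          front a b e = trans (cong (_∩ e) (∩-swap R a b)) (∩-swap (R ∩ b) a e)
        bnd-avg : 𝔼³ d bnd ≡ 𝔸 * (k′ * c) + (𝔸 * κ′ + ⅔ ^^ J * 2ℚ) * (½ * (½ * (½ * w)))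
        bnd-avg = trans (𝔼-cong d (λ a → trans (𝔼-cong d (λ b → trans (affine _) (cong (λ z → 𝔸 * (k′ * c) + (𝔸 * κ′ + ⅔ ^^ J * 2ℚ) * z) (Viol-halving ((R ∩ a) ∩ b) f))))
           (trans (affine _) (cong (λ z → 𝔸 * (k′ * c) + (𝔸 * κ′ + ⅔ ^^ J * 2ℚ) * z) (trans (𝔼-*ˡ d ½ _) (cong (½ *_) (Viol-halving (R ∩ a) f)))))))
          (trans (affine _) (cong (λ z → 𝔸 * (k′ * c) + (𝔸 * κ′ + ⅔ ^^ J * 2ℚ) * z) (trans (𝔼-*ˡ d ½ _) (cong (½ *_) (trans (𝔼-*ˡ d ½ _) (cong (½ *_) (Viol-halving R f)))))))
          where
          affine : ∀ (g : Cube d → ℚ) → 𝔼 d (λ b → 𝔸 * (k′ * c) + (𝔸 * κ′ + ⅔ ^^ J * 2ℚ) * g b) ≡ 𝔸 * (k′ * c) + (𝔸 * κ′ + ⅔ ^^ J * 2ℚ) * 𝔼 d g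
          affine g = trans (𝔼-+ d _ _) (cong₂ _+_ (𝔼-const d _) (𝔼-*ˡ d _ g))
        S-avg : 𝔼³ d S ≤ (pos 12 / 1) * Φ
        S-avg = ≤-trans (≤-reflexive
          (trans (𝔼³-+ d _ _) (cong₂ _+_ (𝔼³-*ˡ d 4ℚ X₃)
          (trans (𝔼³-+ d _ _) (cong₂ _+_ (𝔼³-*ˡ d 2ℚ X₂)
          (trans (𝔼³-+ d _ _) (cong₂ _+_ (trans (𝔼³-*ˡ d 2ℚ _) (cong (2ℚ *_) (𝔼³-bar₃ d X₂)))
          (trans (𝔼³-+ d X₁ _) (cong (𝔼³ d X₁ +_)
          (trans (𝔼³-+ d _ _) (cong₂ _+_ (𝔼³-bar₃ d X₁)
          (trans (𝔼³-+ d _ _) (cong₂ _+_ (𝔼³-bar₂ d X₁) (trans (𝔼³-bar₂ d (λ a b e → X₁ a b (bar e))) (𝔼³-bar₃ d X₁)))))))))))))))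
          (le 4 (λ a b e φ → con 4ℚ :* a :+ (con 2ℚ :* b :+ (con 2ℚ :* b :+ (e :+ (e :+ (e :+ e))))) ⊑ con (pos 12 / 1) :* φ by con 4ℚ :* (φ :- a) :+ con 4ℚ :* (φ :- b) :+ con 4ℚ :* (φ :- e)) refl
            (𝔼³ d X₃ ∷ 𝔼³ d X₂ ∷ 𝔼³ d X₁ ∷ Φ ∷ []) (4ℚ · slack x₃ ⊕ 4ℚ · slack x₂ ⊕ 4ℚ · slack x₁))
        average : 𝔼³ d total ≤ 𝔸 * (k * c + κ * w) + ⅔ ^^ suc J * (2ℚ * w)
        average = ≤-trans (≤-reflexive (trans (𝔼³-+ d _ _) (cong₂ _+_ (trans (𝔼³-*ˡ d 2ℚ bnd) (cong (2ℚ *_) bnd-avg)) (𝔼³-*ˡ d 2ℚ S))))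
          (≤-trans (+-monoʳ-≤ _ (*-monoˡ (≤ᵇ⇒≤ tt) S-avg))
          (le 5 (λ k κ c p w → con 2ℚ :* (con 𝔸 :* (con (pos 3 / 8) :* k :* c) :+ (con 𝔸 :* (con (pos 8 / 3) :* κ) :+ p :* con 2ℚ) :* (con ½ :* (con ½ :* (con ½ :* w)))) :+
               con 2ℚ :* (con (pos 12 / 1) :* (con (pos 32 / 1) :* (k :* c :+ κ :* (con ½ :* (con ½ :* w)))))
               ⊑ con 𝔸 :* (k :* c :+ κ :* w) :+ con ⅔ :* p :* (con 2ℚ :* w) by con (pos 832 / 1) :* (κ :* w) :+ con (pos 5 / 6) :* (p :* w)) refl
            (k ∷ κ ∷ c ∷ ⅔ ^^ J ∷ w ∷ []) ((pos 832 / 1) · (<⇒≤ 0<κ ⊛ Viol-nonNeg R f) ⊕ (pos 5 / 6) · (^^-nonNeg J (≤ᵇ⇒≤ tt) ⊛ Viol-nonNeg R f))))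

      -- With (2/3)^J ≤ κ the remainder of `sorted-J` is at most 2 κ Viol, which adds 2 to the
      -- constant 3072.
      sorted-near : ∀ (R : Cube d) {k κ} → 0ℚ < k → 0ℚ < κ → k * κ ≡ 1ℚ → ∃ λ h → Srt R h × D f h ≤ (pos 3074 / 1) * (k * c + κ * Viol R f)
      sorted-near R {k} {κ} 0<k 0<κ kκ =
        let J , small = ⅔^-small 0<κ
            h , s , h≤ = sorted-J J R 0<k 0<κ kκ
        in h , s , ≤-trans h≤ (le 4 (λ a κ p w → con 𝔸 :* (a :+ κ :* w) :+ p :* (con 2ℚ :* w) ⊑ con (pos 3074 / 1) :* (a :+ κ :* w) by con 2ℚ :* a :+ con 2ℚ :* ((κ :- p) :* w)) refl
             (k * c ∷ κ ∷ ⅔ ^^ J ∷ Viol R f ∷ []) (2ℚ · (<⇒≤ 0<k ⊛ V-nonNeg f⁺ f⁻) ⊕ 2ℚ · (slack small ⊛ Viol-nonNeg R f)))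

  -- The matchings H^c_a

  low : ℕ → ℕ → Bool
  low a v = _%_ v (2 ℕ.^ suc a) {{ℕₚ.m^n≢0 2 (suc a)}} <ᵇ 2 ℕ.^ a

  <ᵇ-true : ∀ {m n} → m ℕ.< n → (m <ᵇ n) ≡ true
  <ᵇ-true {m} {n} p with m <ᵇ n | ℕₚ.<⇒<ᵇ p
  ... | true | _ = refl

  <ᵇ-false : ∀ {m n} → n ℕ.≤ m → (m <ᵇ n) ≡ false
  <ᵇ-false {m} {n} p with m <ᵇ n in e
  ... | false = refl
  ... | true = ⊥-elim (ℕₚ.<⇒≱ (ℕₚ.<ᵇ⇒< m n (subst T (sym e) tt)) p)

  -- Adding half of the modulus moves a residue from one half of the period to the other.
  low-shift : ∀ a v → low a (v ℕ.+ 2 ℕ.^ a) ≡ not (low a v)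
  low-shift a v = case (ℕₚ.<-≤-connex r s)
    where
    s n : ℕ
    s = 2 ℕ.^ a
    n = 2 ℕ.^ suc a
    instance
      nz : ℕ.NonZero n
      nz = ℕₚ.m^n≢0 2 (suc a)
    r : ℕ
    r = v % n
    n≡ : n ≡ s ℕ.+ s
    n≡ = cong (s ℕ.+_) (ℕₚ.+-identityʳ s)
    0<s : 0 ℕ.< s
    0<s = ℕₚ.m^n>0 2 a
    reduce : (v ℕ.+ s) % n ≡ (r ℕ.+ s) % n
    reduce = trans (DM.%-distribˡ-+ v s n) (trans (cong (λ z → (z ℕ.+ s % n) % n) (sym (DM.m%n%n≡m%n v n))) (sym (DM.%-distribˡ-+ r s n)))
    case : r ℕ.< s ⊎ s ℕ.≤ r → low a (v ℕ.+ s) ≡ not (low a v)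
    case (inj₁ r<s) = trans (cong (_<ᵇ s) (trans reduce (DM.m<n⇒m%n≡m (subst (r ℕ.+ s ℕ.<_) (sym n≡) (ℕₚ.+-monoˡ-< s r<s)))))
      (trans (<ᵇ-false (ℕₚ.m≤n+m s r)) (cong not (sym (<ᵇ-true r<s))))
    case (inj₂ s≤r) = trans (cong (_<ᵇ s) (trans reduce (trans (cong (_% n) eq) (trans (DM.[m+n]%n≡m%n (r ℕ.∸ s) n) (DM.m<n⇒m%n≡m (ℕₚ.<-trans small (subst (s ℕ.<_) (sym n≡) (ℕₚ.m<m+n s 0<s))))))))
      (trans (<ᵇ-true small) (cong not (sym (<ᵇ-false s≤r))))
      where
      eq : r ℕ.+ s ≡ (r ℕ.∸ s) ℕ.+ n
      eq = trans (cong (ℕ._+ s) (sym (ℕₚ.m∸n+n≡m s≤r))) (trans (ℕₚ.+-assoc (r ℕ.∸ s) s s) (cong ((r ℕ.∸ s) ℕ.+_) (sym n≡)))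
      small : r ℕ.∸ s ℕ.< s
      small = ℕₚ.+-cancelʳ-< s (r ℕ.∸ s) s (subst₂ ℕ._<_ (sym (ℕₚ.m∸n+n≡m s≤r)) n≡ (DM.m%n<n v n))

  -- The matching H^c_a on {1,…,n}; positions are shifted by one as in `val`.
  module Match (n a : ℕ) (c : Bool) where

    s : ℕ
    s = 2 ℕ.^ a

    cls : ℕ → Bool
    cls k = if c then not (low a (suc k)) else low a (suc k)

    cls-shift : ∀ k → cls (k ℕ.+ s) ≡ not (cls k)
    cls-shift k = lemma c
      where
      lemma : ∀ c → (if c then not (low a (suc (k ℕ.+ s))) else low a (suc (k ℕ.+ s))) ≡ not (if c then not (low a (suc k)) else low a (suc k))
      lemma true = cong not (low-shift a (suc k))
      lemma false = low-shift a (suc k)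

    -- Selects x at a `lo` position, y at a `hi` position and z at an unmatched one. The Booleans
    -- say whether the position is in the lower class, whether a partner above is in range, and
    -- whether one below is out of range.
    sel : {X : Set} → X → X → X → Bool → Bool → Bool → X
    sel x y z true true _ = x
    sel x y z true false _ = z
    sel x y z false _ true = z
    sel x y z false _ false = y

    stN : ℕ → Status
    stN k = sel lo hi fx (cls k) (k ℕ.+ s <ᵇ n) (k <ᵇ s)

    πN : ℕ → ℕ
    πN k = sel (k ℕ.+ s) (k ℕ.∸ s) k (cls k) (k ℕ.+ s <ᵇ n) (k <ᵇ s)

    module _ {X : Set} {x y z : X} {k : ℕ} where
      sel-lo : cls k ≡ true → k ℕ.+ s ℕ.< n → sel x y z (cls k) (k ℕ.+ s <ᵇ n) (k <ᵇ s) ≡ x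
      sel-lo e p = cong₂ (λ u w → sel x y z u w (k <ᵇ s)) e (<ᵇ-true p)

      sel-out : cls k ≡ true → n ℕ.≤ k ℕ.+ s → sel x y z (cls k) (k ℕ.+ s <ᵇ n) (k <ᵇ s) ≡ z
      sel-out e p = cong₂ (λ u w → sel x y z u w (k <ᵇ s)) e (<ᵇ-false p)

      sel-low : cls k ≡ false → k ℕ.< s → sel x y z (cls k) (k ℕ.+ s <ᵇ n) (k <ᵇ s) ≡ z
      sel-low e p = cong₂ (λ u w → sel x y z u (k ℕ.+ s <ᵇ n) w) e (<ᵇ-true p)

      sel-hi : cls k ≡ false → s ℕ.≤ k → sel x y z (cls k) (k ℕ.+ s <ᵇ n) (k <ᵇ s) ≡ y
      sel-hi e p = cong₂ (λ u w → sel x y z u (k ℕ.+ s <ᵇ n) w) e (<ᵇ-false p)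

    data View (k : ℕ) : Set where
      is-lo : cls k ≡ true → k ℕ.+ s ℕ.< n → stN k ≡ lo → πN k ≡ k ℕ.+ s → View k
      is-hi : cls k ≡ false → s ℕ.≤ k → stN k ≡ hi → πN k ≡ k ℕ.∸ s → View k
      is-fx : stN k ≡ fx → πN k ≡ k → View k

    view : ∀ k → View k
    view k = cases (cls k) refl (ℕₚ.<-≤-connex (k ℕ.+ s) n) (ℕₚ.<-≤-connex k s)
      where
      cases : ∀ b → cls k ≡ b → k ℕ.+ s ℕ.< n ⊎ n ℕ.≤ k ℕ.+ s → k ℕ.< s ⊎ s ℕ.≤ k → View k
      cases true e (inj₁ p) _ = is-lo e p (sel-lo e p) (sel-lo e p)
      cases true e (inj₂ p) _ = is-fx (sel-out e p) (sel-out e p)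
      cases false e _ (inj₁ p) = is-fx (sel-low e p) (sel-low e p)
      cases false e _ (inj₂ p) = is-hi e p (sel-hi e p) (sel-hi e p)

    stN-lo : ∀ {k} → cls k ≡ true → k ℕ.+ s ℕ.< n → stN k ≡ lo
    stN-lo = sel-lo

    stN-hi : ∀ {k} → cls k ≡ false → s ℕ.≤ k → stN k ≡ hi
    stN-hi = sel-hi

    πN-lo : ∀ {k} → cls k ≡ true → k ℕ.+ s ℕ.< n → πN k ≡ k ℕ.+ s
    πN-lo = sel-lo

    πN-hi : ∀ {k} → cls k ≡ false → s ℕ.≤ k → πN k ≡ k ℕ.∸ s
    πN-hi = sel-hi

    πN-bound : ∀ k → k ℕ.< n → πN k ℕ.< n
    πN-bound k k<n with view k
    ... | is-lo _ p _ e = subst (ℕ._< n) (sym e) p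
    ... | is-hi _ _ _ e = subst (ℕ._< n) (sym e) (ℕₚ.≤-<-trans (ℕₚ.m∸n≤m k s) k<n)
    ... | is-fx _ e = subst (ℕ._< n) (sym e) k<n

    cls-down : ∀ {k} → cls k ≡ false → s ℕ.≤ k → cls (k ℕ.∸ s) ≡ true
    cls-down {k} e p = Boolₚ.not-injective (trans (sym (cls-shift (k ℕ.∸ s))) (trans (cong cls (ℕₚ.m∸n+n≡m p)) e))

    πN-inv : ∀ k → k ℕ.< n → πN (πN k) ≡ k
    πN-inv k k<n with view k
    ... | is-lo c p _ e = trans (cong πN e) (trans (πN-hi (trans (cls-shift k) (cong not c)) (ℕₚ.m≤n+m s k)) (ℕₚ.m+n∸n≡m k s))
    ... | is-hi c p _ e = trans (cong πN e) (trans (πN-lo (cls-down c p) (subst (ℕ._< n) (sym (ℕₚ.m∸n+n≡m p)) k<n)) (ℕₚ.m∸n+n≡m p))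
    ... | is-fx _ e = trans (cong πN e) e

    stN-lo-π : ∀ k → k ℕ.< n → stN k ≡ lo → stN (πN k) ≡ hi
    stN-lo-π k k<n l with view k
    ... | is-lo c p _ e = trans (cong stN e) (stN-hi (trans (cls-shift k) (cong not c)) (ℕₚ.m≤n+m s k))
    ... | is-hi _ _ h _ with () ← trans (sym h) l
    ... | is-fx h _ with () ← trans (sym h) l

    stN-hi-π : ∀ k → k ℕ.< n → stN k ≡ hi → stN (πN k) ≡ lo
    stN-hi-π k k<n l with view k
    ... | is-lo _ _ h _ with () ← trans (sym h) l
    ... | is-hi c p _ e = trans (cong stN e) (stN-lo (cls-down c p) (subst (ℕ._< n) (sym (ℕₚ.m∸n+n≡m p)) k<n))
    ... | is-fx h _ with () ← trans (sym h) l

    stN-fx-π : ∀ k → stN k ≡ fx → πN k ≡ k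
    stN-fx-π k l with view k
    ... | is-lo _ _ h _ with () ← trans (sym h) l
    ... | is-hi _ _ h _ with () ← trans (sym h) l
    ... | is-fx _ e = e

    πF : Fin n → Fin n
    πF p = fromℕ< (πN-bound (toℕ p) (Finₚ.toℕ<n p))

    toℕ-π : ∀ p → toℕ (πF p) ≡ πN (toℕ p)
    toℕ-π p = Finₚ.toℕ-fromℕ< _

    line : Line (Fin n)
    line = record
      { enum = Enum-Fin n
      ; π = πF
      ; st = λ p → stN (toℕ p)
      ; π-inv = λ p → Finₚ.toℕ-injective (trans (toℕ-π (πF p)) (trans (cong πN (toℕ-π p)) (πN-inv (toℕ p) (Finₚ.toℕ<n p))))
      ; st-lo = λ p e → trans (cong stN (toℕ-π p)) (stN-lo-π (toℕ p) (Finₚ.toℕ<n p) e)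
      ; st-hi = λ p e → trans (cong stN (toℕ-π p)) (stN-hi-π (toℕ p) (Finₚ.toℕ<n p) e)
      ; st-fx = λ p e → Finₚ.toℕ-injective (trans (toℕ-π p) (stN-fx-π (toℕ p) e)) }

  -- One-sided repairs: either lower the lo ends or raise the hi ends.
  half : Bool → Status → Bool → Bool → Bool
  half false lo a b = a ∧ b
  half true hi a b = a ∨ b
  half _ _ a b = a

  half-mono : ∀ c s {a a′ b b′} → a ≼ a′ → b ≼ b′ → half c s a b ≼ half c s a′ b′
  half-mono false lo p q = merge-mono lo p q
  half-mono false hi p q = p
  half-mono false fx p q = p
  half-mono true lo p q = p
  half-mono true hi p q = merge-mono hi p q
  half-mono true fx p q = p

  -- Merging functions sorted along single classes into a monotone one

  Rel : {A : Set} → Fin d → (A → A → Set) → (Vec A d → Bool) → Set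
  Rel zero ρ f = ∀ p q → ρ p q → ∀ x → f (p ∷ x) ≼ f (q ∷ x)
  Rel (suc i) ρ f = ∀ p → Rel i ρ (λ x → f (p ∷ x))

  Rel-cover : {A : Set} {ρ ρ₁ ρ₂ : A → A → Set} → (∀ p q → ρ p q → ρ₁ p q ⊎ ρ₂ p q) →
    ∀ (i : Fin d) f → Rel i ρ₁ f → Rel i ρ₂ f → Rel i ρ f
  Rel-cover sub zero f r₁ r₂ p q pq x with sub p q pq
  ... | inj₁ e = r₁ p q e x
  ... | inj₂ e = r₂ p q e x
  Rel-cover sub (suc i) f r₁ r₂ p = Rel-cover sub i _ (r₁ p) (r₂ p)

  module Repair {A : Set} (𝓛 : Line A) where
    open Sorting 𝓛
    open Isoperimetry 𝓛

    opAt : Fin d → Bool → Fun d → Fun d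
    opAt zero c f (p ∷ x) = half c (st p) (f (p ∷ x)) (f (π p ∷ x))
    opAt (suc i) c f (p ∷ x) = opAt i c (λ y → f (p ∷ y)) x

    opAt-mono : ∀ (i : Fin d) c {f g : Fun d} → f ⊴ g → opAt i c f ⊴ opAt i c g
    opAt-mono zero c le (p ∷ x) = half-mono c (st p) (le (p ∷ x)) (le (π p ∷ x))
    opAt-mono (suc i) c le (p ∷ x) = opAt-mono i c (λ y → le (p ∷ y)) x

    Rel-half : ∀ (j : Fin d) ρ c s (f g : Fun d) → Rel j ρ f → Rel j ρ g → Rel j ρ (λ x → half c s (f x) (g x))
    Rel-half zero ρ c s f g rf rg p q pq x = half-mono c s (rf p q pq x) (rg p q pq x)
    Rel-half (suc j) ρ c s f g rf rg p = Rel-half j ρ c s _ _ (rf p) (rg p)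

    -- In another direction the repair combines whole slices by a monotone operation, which keeps
    -- order relations between their values.
    Rel-other : ∀ (i j : Fin d) c ρ f → i ≢ j → Rel j ρ f → Rel j ρ (opAt i c f)
    Rel-other zero zero c ρ f i≢j r = ⊥-elim (i≢j refl)
    Rel-other zero (suc j) c ρ f i≢j r p = Rel-half j ρ c (st p) _ _ (r p) (r (π p))
    Rel-other (suc i) zero c ρ f i≢j r p q pq x = opAt-mono i c (r p q pq) x
    Rel-other (suc i) (suc j) c ρ f i≢j r p = Rel-other i j c ρ _ (λ { refl → i≢j refl }) (r p)

    lineOp : Bool → (A → Bool) → A → Bool
    lineOp c φ p = half c (st p) (φ p) (φ (π p))

    Rel-same : ∀ (i : Fin d) c {ρ ρ′ : A → A → Set} f →
      (∀ φ → (∀ p q → ρ p q → φ p ≼ φ q) → ∀ p q → ρ′ p q → lineOp c φ p ≼ lineOp c φ q) → Rel i ρ f → Rel i ρ′ (opAt i c f)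
    Rel-same zero c f claim r p q pq x = claim (λ z → f (z ∷ x)) (λ p q pq → r p q pq x) p q pq
    Rel-same (suc i) c f claim r p = Rel-same i c _ claim (r p)

    K : A → A → Set
    K p q = st p ≡ lo × q ≡ π p

    Srt⇒Rel : ∀ (f : Fun d) → Srt (full d) f → ∀ i → Rel i K f
    Srt⇒Rel f (s , s₀) zero p q (e , refl) x = s₀ refl p e x
    Srt⇒Rel f (s , s₀) (suc i) p = Srt⇒Rel _ (s p) i

    -- Each repair changes only one end of the pair. Hence the two distances to (a, b) add up to
    -- that of the original pair plus that of the sorted pair, and the latter is no larger because
    -- (a, b) is itself sorted.
    pair-bound′ : ∀ p a b a′ b′ → (st p ≡ lo → a ≼ b) → (st p ≡ hi → b ≼ a) →
      (ι (a xor half false (st p) a′ b′) + ι (a xor half true (st p) a′ b′)) + (ι (b xor half false (st (π p)) b′ a′) + ι (b xor half true (st (π p)) b′ a′))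
      ≤ (ι (a xor a′) + ι (a xor a′)) + (ι (b xor b′) + ι (b xor b′))
    pair-bound′ p a b a′ b′ l h = case (st p) refl
      where
      Goal : Status → Status → Set
      Goal s t = (ι (a xor half false s a′ b′) + ι (a xor half true s a′ b′)) + (ι (b xor half false t b′ a′) + ι (b xor half true t b′ a′))
        ≤ (ι (a xor a′) + ι (a xor a′)) + (ι (b xor b′) + ι (b xor b′))
      table : ∀ a b a′ b′ → a ≼ b → ι (a xor (a′ ∧ b′)) + ι (b xor (b′ ∨ a′)) ≤ ι (a xor a′) + ι (b xor b′)
      table false false false b′ _ = ≤-reflexive (cong (λ z → 0ℚ + ι z) (Boolₚ.∨-identityʳ b′))
      table false false true false _ = ≤-reflexive (+-comm 0ℚ 1ℚ)
      table false false true true _ = ≤-refl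
      table false true false true _ = ≤-refl
      table false true false false _ = ≤-refl
      table false true true true _ = ≤-refl
      table false true true false _ = le 0 (con 0ℚ :+ con 0ℚ ⊑ con 1ℚ :+ con 1ℚ by con 2ℚ) refl [] (≤ᵇ⇒≤ tt)
      table true true false false _ = ≤-refl
      table true true false true _ = ≤-refl
      table true true true false _ = ≤-reflexive (+-comm 1ℚ 0ℚ)
      table true true true true _ = ≤-refl
      case : ∀ s → st p ≡ s → Goal (st p) (st (π p))
      case lo e = subst₂ Goal (sym e) (sym (st-lo p e)) (le 4 (λ u v w x → (u :+ v) :+ (w :+ x) ⊑ (v :+ v) :+ (w :+ w) by (v :+ w) :- (u :+ x)) refl
        (ι (a xor (a′ ∧ b′)) ∷ ι (a xor a′) ∷ ι (b xor b′) ∷ ι (b xor (b′ ∨ a′)) ∷ []) (slack (table a b a′ b′ (l e))))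
      case hi e = subst₂ Goal (sym e) (sym (st-hi p e)) (le 4 (λ u v w x → (v :+ u) :+ (x :+ w) ⊑ (v :+ v) :+ (w :+ w) by (w :+ v) :- (x :+ u)) refl
        (ι (a xor (a′ ∨ b′)) ∷ ι (a xor a′) ∷ ι (b xor b′) ∷ ι (b xor (b′ ∧ a′)) ∷ []) (slack (table b a b′ a′ (h e))))
      case fx e = subst₂ Goal (sym e) (sym (trans (cong st (st-fx p e)) e)) ≤-refl

    D-opAt : ∀ (i : Fin d) (h g : Fun d) → Rel i K h → D h (opAt i false g) + D h (opAt i true g) ≤ 2ℚ * D h g
    D-opAt {suc d} zero h g r = ≤-trans (≤-reflexive (trans (cong₂ _+_ (Σ-vec xs d _) (Σ-vec xs d _)) (sym (Σ-+ xs _ _))))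
      (≤-trans (Σ-pair-≤ pairing) (≤-reflexive (trans (Σ-+ xs _ _) (trans (rg 1 (λ a → a :+ a := con 2ℚ :* a) refl (_ ∷ [])) (cong (2ℚ *_) (sym (Σ-vec xs d _)))))))
      where
      Σ-pair-≤ : ∀ {φ ψ : A → ℚ} → (∀ p → φ p + φ (π p) ≤ ψ p + ψ (π p)) → Σ xs φ ≤ Σ xs ψ
      Σ-pair-≤ {φ} {ψ} q = subst₂ _≤_ (halve φ) (halve ψ) (*-monoˡ 0≤½ (Σ-mono xs q))
        where
        halve : ∀ φ → ½ * Σ xs (λ p → φ p + φ (π p)) ≡ Σ xs φ
        halve φ = trans (cong (½ *_) (trans (Σ-+ xs φ (φ ∘ π)) (cong (Σ xs φ +_) (Enum.Σ-involution enum π π-inv φ)))) (rg 1 (λ a → con ½ :* (a :+ a) := a) refl (Σ xs φ ∷ []))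
      φ ψ : A → ℚ
      φ p = Σ (pts d) (λ x → ι (h (p ∷ x) xor half false (st p) (g (p ∷ x)) (g (π p ∷ x)))) + Σ (pts d) (λ x → ι (h (p ∷ x) xor half true (st p) (g (p ∷ x)) (g (π p ∷ x))))
      ψ p = Σ (pts d) (λ x → ι (h (p ∷ x) xor g (p ∷ x))) + Σ (pts d) (λ x → ι (h (p ∷ x) xor g (p ∷ x)))
      pairing : ∀ p → φ p + φ (π p) ≤ ψ p + ψ (π p)
      pairing p = subst₂ _≤_ (trans (Σ-+ (pts d) _ _) (cong₂ _+_ (Σ-+ (pts d) _ _) (Σ-+ (pts d) _ _))) (trans (Σ-+ (pts d) _ _) (cong₂ _+_ (Σ-+ (pts d) _ _) (Σ-+ (pts d) _ _)))
        (Σ-mono (pts d) (λ x → subst (λ q → (ι (h (p ∷ x) xor half false (st p) (g (p ∷ x)) (g (π p ∷ x))) + ι (h (p ∷ x) xor half true (st p) (g (p ∷ x)) (g (π p ∷ x))))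
            + (ι (h (π p ∷ x) xor half false (st (π p)) (g (π p ∷ x)) (g (q ∷ x))) + ι (h (π p ∷ x) xor half true (st (π p)) (g (π p ∷ x)) (g (q ∷ x)))) ≤ (ι (h (p ∷ x) xor g (p ∷ x)) + ι (h (p ∷ x) xor g (p ∷ x))) + (ι (h (π p ∷ x) xor g (π p ∷ x)) + ι (h (π p ∷ x) xor g (π p ∷ x)))) (sym (π-inv p))
          (pair-bound′ p (h (p ∷ x)) (h (π p ∷ x)) (g (p ∷ x)) (g (π p ∷ x)) (λ e → r p (π p) (e , refl) x)
            (λ e → r (π p) p (st-hi p e , sym (π-inv p)) x))))
    D-opAt {suc d} (suc i) h g r = ≤-trans (≤-reflexive (trans (cong₂ _+_ (Σ-vec xs d _) (Σ-vec xs d _)) (sym (Σ-+ xs _ _))))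
      (≤-trans (Σ-mono xs (λ p → D-opAt i _ _ (r p))) (≤-reflexive (trans (Σ-*ˡ xs 2ℚ _) (cong (2ℚ *_) (sym (Σ-vec xs d _))))))

    -- h is a fixed function sorted for the matching; its presence makes one of the two repairs cost nothing.
    module _ (I : A → A → Set)
      (keep : ∀ c φ → (∀ p q → I p q → φ p ≼ φ q) → ∀ p q → I p q → lineOp c φ p ≼ lineOp c φ q) where

      lineOp-K : ∀ c φ p q → K p q → lineOp c φ p ≼ lineOp c φ q
      lineOp-K false φ p q (e , refl) = subst₂ (λ s t → half false s (φ p) (φ (π p)) ≼ half false t (φ (π p)) (φ (π (π p)))) (sym e) (sym (st-lo p e)) (∧-≼ʳ (φ p) (φ (π p)))
      lineOp-K true φ p q (e , refl) = subst₂ (λ s t → half true s (φ p) (φ (π p)) ≼ half true t (φ (π p)) (φ (π (π p)))) (sym e) (sym (st-lo p e))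
        (subst (λ z → φ p ≼ φ (π p) ∨ φ z) (sym (π-inv p)) (≼-∨ʳ (φ (π p)) (φ p)))

      preserve : ∀ {ρ : A → A → Set} → (∀ c φ → (∀ p q → ρ p q → φ p ≼ φ q) → ∀ p q → ρ p q → lineOp c φ p ≼ lineOp c φ q) →
        ∀ (i : Fin d) c g → ∀ j → Rel j ρ g → Rel j ρ (opAt i c g)
      preserve claim i c g j r with i Finₚ.≟ j
      ... | yes refl = Rel-same i c g (claim c) r
      ... | no i≢j = Rel-other i j c _ g i≢j r

      -- By `D-opAt` the two repairs cost nothing on average, so the better one does not move away
      -- from h. Either choice preserves I and, in the directions already treated, K.
      repair : ∀ (L : List (Fin d)) (h g : Fun d) → (∀ i → Rel i K h) → (∀ i → Rel i I g) →
        ∃ λ g′ → (∀ i → Rel i I g′) × All (λ i → Rel i K g′) L × D h g′ ≤ D h g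
      repair [] h g hs gs = g , gs , [] , ≤-refl
      repair (i ∷ L) h g hs gs with repair L h g hs gs
      ... | g₁ , g₁I , g₁K , g₁≤ with ≤-total (D h (opAt i false g₁)) (D h (opAt i true g₁))
      ... | inj₁ p = opAt i false g₁ , (λ j → preserve keep i false g₁ j (g₁I j))
        , Rel-same i false g₁ (λ φ _ → lineOp-K false φ) (g₁I i) ∷ All.map (λ {j} → preserve (λ c φ _ → lineOp-K c φ) i false g₁ j) g₁K
        , ≤-trans (le 3 (λ a b e → a ⊑ e by con ½ :* (con 2ℚ :* e :- (a :+ b)) :+ con ½ :* (b :- a)) refl (_ ∷ _ ∷ _ ∷ []) (½ · slack (D-opAt i h g₁ (hs i)) ⊕ ½ · slack p)) g₁≤
      ... | inj₂ p = opAt i true g₁ , (λ j → preserve keep i true g₁ j (g₁I j))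
        , Rel-same i true g₁ (λ φ _ → lineOp-K true φ) (g₁I i) ∷ All.map (λ {j} → preserve (λ c φ _ → lineOp-K c φ) i true g₁ j) g₁K
        , ≤-trans (le 3 (λ a b e → b ⊑ e by con ½ :* (con 2ℚ :* e :- (a :+ b)) :+ con ½ :* (a :- b)) refl (_ ∷ _ ∷ _ ∷ []) (½ · slack (D-opAt i h g₁ (hs i)) ⊕ ½ · slack p)) g₁≤

  module Descent (n : ℕ) where

    open Sorting (Match.line n 0 false) public using (D; D-triangle; D-sym; D-nonNeg; D-refl)

    ρ : ℕ → Fin n → Fin n → Set
    ρ s p q = toℕ q ≡ toℕ p ℕ.+ s

    SortedFor : ℕ → Bool → (Vec (Fin n) d → Bool) → Set
    SortedFor {d} a c f = Isoperimetry.Srt (Match.line n a c) (full d) f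

    module _ (a : ℕ) where
      private
        s : ℕ
        s = 2 ℕ.^ a
        2s≡ : 2 ℕ.^ suc a ≡ s ℕ.+ s
        2s≡ = cong (s ℕ.+_) (ℕₚ.+-identityʳ s)

      module _ (c : Bool) where
        open Match n a c hiding (s)
        open Repair line using (lineOp)

        cls-shift² : ∀ k → cls (k ℕ.+ 2 ℕ.^ suc a) ≡ cls k
        cls-shift² k = trans (cong cls (trans (cong (k ℕ.+_) 2s≡) (sym (ℕₚ.+-assoc k s s)))) (trans (cls-shift (k ℕ.+ s)) (trans (cong not (cls-shift k)) (Boolₚ.not-involutive (cls k))))

        A≼ : ∀ (φ : Fin n → Bool) p → lineOp false φ p ≼ φ p
        A≼ φ p with stN (toℕ p)
        ... | lo = ∧-≼ˡ _ _
        ... | hi = ≼-refl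
        ... | fx = ≼-refl

        ≼B : ∀ (φ : Fin n → Bool) p → φ p ≼ lineOp true φ p
        ≼B φ p with stN (toℕ p)
        ... | lo = ≼-refl
        ... | hi = ≼-∨ˡ _ _
        ... | fx = ≼-refl

        A-lo : ∀ (φ : Fin n → Bool) {p} → stN (toℕ p) ≡ lo → lineOp false φ p ≡ φ p ∧ φ (πF p)
        A-lo φ {p} e = cong (λ z → half false z (φ p) (φ (πF p))) e

        B-hi : ∀ (φ : Fin n → Bool) {p} → stN (toℕ p) ≡ hi → lineOp true φ p ≡ φ p ∨ φ (πF p)
        B-hi φ {p} e = cong (λ z → half true z (φ p) (φ (πF p))) e

        A-hi : ∀ (φ : Fin n → Bool) {p} → stN (toℕ p) ≡ hi → lineOp false φ p ≡ φ p
        A-hi φ {p} e = cong (λ z → half false z (φ p) (φ (πF p))) e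

        A-fx : ∀ (φ : Fin n → Bool) {p} → stN (toℕ p) ≡ fx → lineOp false φ p ≡ φ p
        A-fx φ {p} e = cong (λ z → half false z (φ p) (φ (πF p))) e

        B-lo : ∀ (φ : Fin n → Bool) {p} → stN (toℕ p) ≡ lo → lineOp true φ p ≡ φ p
        B-lo φ {p} e = cong (λ z → half true z (φ p) (φ (πF p))) e

        B-fx : ∀ (φ : Fin n → Bool) {p} → stN (toℕ p) ≡ fx → lineOp true φ p ≡ φ p
        B-fx φ {p} e = cong (λ z → half true z (φ p) (φ (πF p))) e

        -- The class of a position has period 2^(a+1), so p and q have the same one. If the repair
        -- changes the end that could spoil the order, it changes the other end as well, and the
        -- partners are again 2^(a+1) apart. Otherwise it moves only in the harmless direction.
        keep-double : ∀ b (φ : Fin n → Bool) → (∀ p q → ρ (2 ℕ.^ suc a) p q → φ p ≼ φ q) → ∀ p q → ρ (2 ℕ.^ suc a) p q → lineOp b φ p ≼ lineOp b φ q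
        keep-double false φ srt p q pq with view (toℕ q)
        ... | is-hi _ _ e _ = subst (lineOp false φ p ≼_) (sym (A-hi φ e)) (≼-trans (A≼ φ p) (srt p q pq))
        ... | is-fx e _ = subst (lineOp false φ p ≼_) (sym (A-fx φ e)) (≼-trans (A≼ φ p) (srt p q pq))
        ... | is-lo cq q+s<n e πq = subst₂ _≼_ (sym (A-lo φ st-p)) (sym (A-lo φ e)) (merge-mono lo (srt p q pq) (srt (πF p) (πF q) ππ))
          where
          cp : cls (toℕ p) ≡ true
          cp = trans (sym (cls-shift² (toℕ p))) (trans (cong cls (sym pq)) cq)
          p+s<n : toℕ p ℕ.+ s ℕ.< n
          p+s<n = ℕₚ.≤-<-trans (ℕₚ.+-monoˡ-≤ s (subst (toℕ p ℕ.≤_) (sym pq) (ℕₚ.m≤m+n (toℕ p) _))) q+s<n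
          st-p : stN (toℕ p) ≡ lo
          st-p = stN-lo cp p+s<n
          ππ : ρ (2 ℕ.^ suc a) (πF p) (πF q)
          ππ = trans (toℕ-π q) (trans πq (trans (cong (ℕ._+ s) pq) (trans (ℕₚ.+-assoc (toℕ p) _ s) (trans (cong (toℕ p ℕ.+_) (ℕₚ.+-comm _ s)) (trans (sym (ℕₚ.+-assoc (toℕ p) s _)) (cong (ℕ._+ 2 ℕ.^ suc a) (sym (trans (toℕ-π p) (πN-lo cp p+s<n)))))))))
        keep-double true φ srt p q pq with view (toℕ p)
        ... | is-lo _ _ e _ = subst (_≼ lineOp true φ q) (sym (B-lo φ e)) (≼-trans (srt p q pq) (≼B φ q))
        ... | is-fx e _ = subst (_≼ lineOp true φ q) (sym (B-fx φ e)) (≼-trans (srt p q pq) (≼B φ q))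
        ... | is-hi cp s≤p e πp = subst₂ _≼_ (sym (B-hi φ e)) (sym (B-hi φ st-q)) (merge-mono hi (srt p q pq) (srt (πF p) (πF q) ππ))
          where
          cq : cls (toℕ q) ≡ false
          cq = trans (cong cls pq) (trans (cls-shift² (toℕ p)) cp)
          s≤q : s ℕ.≤ toℕ q
          s≤q = ℕₚ.≤-trans s≤p (subst (toℕ p ℕ.≤_) (sym pq) (ℕₚ.m≤m+n (toℕ p) _))
          st-q : stN (toℕ q) ≡ hi
          st-q = stN-hi cq s≤q
          ππ : ρ (2 ℕ.^ suc a) (πF p) (πF q)
          ππ = trans (toℕ-π q) (trans (πN-hi cq s≤q) (trans (cong (ℕ._∸ s) pq) (trans (ℕₚ.+-∸-comm (2 ℕ.^ suc a) s≤p) (cong (ℕ._+ 2 ℕ.^ suc a) (sym (trans (toℕ-π p) πp))))))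

      module M₀ = Match n a false
      module M₁ = Match n a true
      module R₀ = Repair M₀.line
      module R₁ = Repair M₁.line

      Inv : Fin n → Fin n → Set
      Inv p q = ρ (2 ℕ.^ suc a) p q ⊎ R₀.K p q

      K₀-view : ∀ {p q} → R₀.K p q → M₀.cls (toℕ p) ≡ true × toℕ p ℕ.+ s ℕ.< n × toℕ q ≡ toℕ p ℕ.+ s
      K₀-view {p} (e , refl) with M₀.view (toℕ p)
      ... | M₀.is-lo c b _ eq = c , b , trans (M₀.toℕ-π p) eq
      ... | M₀.is-hi _ _ h _ with () ← trans (sym e) h
      ... | M₀.is-fx h _ with () ← trans (sym e) h

      -- In an edge of the first matching, the lower end p can only be a `hi` end of the second
      -- matching and the upper end q only a `lo` end. Lowering q compares p with the point 2^a
      -- above q, and raising p compares q with the point 2^a below p; both are jumps of 2^(a+1),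
      -- which are already sorted. A full sort would do both and need a jump of 3 · 2^a, and this is
      -- why repairs are one-sided.
      keep-Inv : ∀ b φ → (∀ p q → Inv p q → φ p ≼ φ q) → ∀ p q → Inv p q → R₁.lineOp b φ p ≼ R₁.lineOp b φ q
      keep-Inv b φ srt p q (inj₁ pq) = keep-double true b φ (λ p q e → srt p q (inj₁ e)) p q pq
      keep-Inv false φ srt p q (inj₂ k) with K₀-view {p} {q} k
      ... | cp , p+s<n , qp with M₁.view (toℕ q)
      ...   | M₁.is-hi _ _ e _ = subst (R₁.lineOp false φ p ≼_) (sym (A-hi true φ e)) (≼-trans (A≼ true φ p) (srt p q (inj₂ k)))
      ...   | M₁.is-fx e _ = subst (R₁.lineOp false φ p ≼_) (sym (A-fx true φ e)) (≼-trans (A≼ true φ p) (srt p q (inj₂ k)))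
      ...   | M₁.is-lo cq q+s<n e πq = subst (R₁.lineOp false φ p ≼_) (sym (A-lo true φ e)) (≼-trans (A≼ true φ p) (≼-∧ (srt p q (inj₂ k)) (srt p (M₁.πF q) (inj₁ jump))))
        where
        jump : ρ (2 ℕ.^ suc a) p (M₁.πF q)
        jump = trans (M₁.toℕ-π q) (trans πq (trans (cong (ℕ._+ s) qp) (trans (ℕₚ.+-assoc (toℕ p) s s) (cong (toℕ p ℕ.+_) (sym 2s≡)))))
      keep-Inv true φ srt p q (inj₂ k) with K₀-view {p} {q} k
      ... | cp , p+s<n , qp with M₁.view (toℕ p)
      ...   | M₁.is-lo _ _ e _ = subst (_≼ R₁.lineOp true φ q) (sym (B-lo true φ e)) (≼-trans (srt p q (inj₂ k)) (≼B true φ q))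
      ...   | M₁.is-fx e _ = subst (_≼ R₁.lineOp true φ q) (sym (B-fx true φ e)) (≼-trans (srt p q (inj₂ k)) (≼B true φ q))
      ...   | M₁.is-hi _ s≤p e πp = subst (_≼ R₁.lineOp true φ q) (sym (B-hi true φ e)) (≼-trans (∨-≼ (srt p q (inj₂ k)) (srt (M₁.πF p) q (inj₁ jump))) (≼B true φ q))
        where
        jump : ρ (2 ℕ.^ suc a) (M₁.πF p) q
        jump = trans qp (trans (cong (ℕ._+ s) (sym (ℕₚ.m∸n+n≡m s≤p))) (trans (ℕₚ.+-assoc (toℕ p ℕ.∸ s) s s) (cong₂ ℕ._+_ (sym (trans (M₁.toℕ-π p) πp)) (sym 2s≡))))

      s-step : ∀ p q → ρ s p q → Inv p q ⊎ R₁.K p q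
      s-step p q pq = cases (M₀.cls (toℕ p)) refl
        where
        p+s<n : toℕ p ℕ.+ s ℕ.< n
        p+s<n = subst (ℕ._< n) pq (Finₚ.toℕ<n q)
        cases : ∀ b → M₀.cls (toℕ p) ≡ b → Inv p q ⊎ R₁.K p q
        cases true e = inj₁ (inj₂ (M₀.stN-lo e p+s<n , Finₚ.toℕ-injective (trans pq (sym (trans (M₀.toℕ-π p) (M₀.πN-lo e p+s<n))))))
        cases false e = inj₂ (M₁.stN-lo (cong not e) p+s<n , Finₚ.toℕ-injective (trans pq (sym (trans (M₁.toℕ-π p) (M₁.πN-lo (cong not e) p+s<n)))))

      -- The first matching is repaired with h₀ as guide, the second with h₁. A pass guided by h
      -- adds at most 2 D f h to the distance from f, by going through h.
      descend : ∀ (f g h₀ h₁ : Vec (Fin n) d → Bool) → SortedFor a false h₀ → SortedFor a true h₁ → (∀ i → Rel i (ρ (2 ℕ.^ suc a)) g) →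
        ∃ λ g′ → (∀ i → Rel i (ρ s) g′) × D f g′ ≤ 2ℚ * (D f h₀ + D f h₁) + D f g
      descend {d} f g h₀ h₁ s₀ s₁ gs =
        let g₁ , g₁I , g₁K , g₁≤ = R₀.repair (ρ (2 ℕ.^ suc a)) (keep-double false) (allFin d) h₀ g (R₀.Srt⇒Rel h₀ s₀) gs
            g₂ , g₂I , g₂K , g₂≤ = R₁.repair Inv keep-Inv (allFin d) h₁ g₁ (R₁.Srt⇒Rel h₁ s₁)
                                     (λ i → Rel-cover (λ p q e → e) i g₁ (g₁I i) (All.lookup g₁K (∈-allFin i)))
        in g₂ , (λ i → Rel-cover s-step i g₂ (g₂I i) (All.lookup g₂K (∈-allFin i)))
           , le 7 (λ fg fh₀ fh₁ h₀g h₀g₁ fg₁ fg₂ → fg₂ ⊑ con 2ℚ :* (fh₀ :+ fh₁) :+ fg by (con 2ℚ :* fh₁ :+ fg₁ :- fg₂) :+ (con 2ℚ :* fh₀ :+ fg :- fg₁)) refl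
               (D f g ∷ D f h₀ ∷ D f h₁ ∷ D h₀ g ∷ D h₀ g₁ ∷ D f g₁ ∷ D f g₂ ∷ [])
               (slack (through f h₁ g₁ g₂ g₂≤) ⊕ slack (through f h₀ g g₁ g₁≤))
        where
        through : ∀ f h g g′ → D h g′ ≤ D h g → D f g′ ≤ 2ℚ * D f h + D f g
        through f h g g′ q = le 5 (λ fg′ fh hg′ hg fg → fg′ ⊑ con 2ℚ :* fh :+ fg by (fh :+ hg′ :- fg′) :+ (hg :- hg′) :+ (fh :+ fg :- hg)) refl
          (D f g′ ∷ D f h ∷ D h g′ ∷ D h g ∷ D f g ∷ [])
          (slack (D-triangle f h g′) ⊕ slack q ⊕ slack (subst (λ z → D h g ≤ z + D f g) (D-sym h f) (D-triangle h f g)))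

    unit-steps : ∀ (φ : Fin n → Bool) → (∀ p q → ρ 1 p q → φ p ≼ φ q) → ∀ k p q → toℕ q ≡ toℕ p ℕ.+ k → φ p ≼ φ q
    unit-steps φ srt zero p q e = subst (λ z → φ p ≼ φ z) (Finₚ.toℕ-injective (sym (trans e (ℕₚ.+-identityʳ _)))) ≼-refl
    unit-steps φ srt (suc k) p q e = ≼-trans (srt p r (trans (Finₚ.toℕ-fromℕ< r<n) (ℕₚ.+-comm 1 (toℕ p)))) (unit-steps φ srt k r q (trans e (trans (ℕₚ.+-suc (toℕ p) k) (cong (ℕ._+ k) (sym (Finₚ.toℕ-fromℕ< r<n))))))
      where
      r<n : suc (toℕ p) ℕ.< n
      r<n = ℕₚ.≤-<-trans (subst (suc (toℕ p) ℕ.≤_) (sym (trans e (ℕₚ.+-suc (toℕ p) k))) (s≤s (ℕₚ.m≤m+n (toℕ p) k))) (Finₚ.toℕ<n q)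
      r : Fin n
      r = fromℕ< r<n

    Rel⇒Monotone : ∀ (f : Vec (Fin n) d → Bool) → (∀ i → Rel i (ρ 1) f) → Monotone f
    Rel⇒Monotone f r [] [] _ = ≼-refl
    Rel⇒Monotone f r (p ∷ x) (q ∷ y) x⪯y = ≼-trans
      (unit-steps (λ z → f (z ∷ x)) (λ p q pq → r zero p q pq x) (toℕ q ℕ.∸ toℕ p) p q (sym (ℕₚ.m+[n∸m]≡n (ℕ.s≤s⁻¹ (x⪯y zero)))))
      (Rel⇒Monotone (λ z → f (q ∷ z)) (λ i → r (suc i) q) x y (λ i → x⪯y (suc i)))

  module _ (m : ℕ) where
    open Descent (2 ℕ.^ m)

    sumFrom : (ℕ → ℚ) → ℕ → ℕ → ℚ
    sumFrom t k zero = 0ℚ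
    sumFrom t k (suc r) = t k + sumFrom t (suc k) r

    sumFrom-Σ : ∀ t r k → sumFrom t k r ≡ Σ (allFin r) (λ i → t (k ℕ.+ toℕ i))
    sumFrom-Σ t zero k = refl
    sumFrom-Σ t (suc r) k = sym (trans (Σ-allFin-suc r _) (cong₂ _+_ (cong t (ℕₚ.+-identityʳ k)) (trans (Σ-cong (allFin r) (λ i → cong t (ℕₚ.+-suc k (toℕ i)))) (sym (sumFrom-Σ t r (suc k))))))

    monotone-near : ∀ (f : Vec (Fin (2 ℕ.^ m)) d → Bool) (h : ℕ → Bool → Vec (Fin (2 ℕ.^ m)) d → Bool) → (∀ a c → SortedFor a c (h a c)) →
      ∃ λ g → Monotone g × D f g ≤ 2ℚ * Σ (pairs (allFin m) bools) (λ (a , c) → D f (h (toℕ a) c))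
    monotone-near {d} f h hs = let g , gs , g≤ = down m 0 refl in g , Rel⇒Monotone g gs , ≤-trans g≤ (≤-reflexive (cong (2ℚ *_)
        (trans (sumFrom-Σ t m 0) (sym (trans (Σ-pairs (allFin m) bools _) (Σ-cong (allFin m) (λ a → cong (D f (h (toℕ a) false) +_) (+-identityʳ _))))))))
      where
      t : ℕ → ℚ
      t a = D f (h a false) + D f (h a true)
      down : ∀ r k → k ℕ.+ r ≡ m → ∃ λ g → (∀ i → Rel i (ρ (2 ℕ.^ k)) g) × D f g ≤ 2ℚ * sumFrom t k r
      -- At step length 2^m no two positions are related, so f itself is the start of the descent.
      down zero k e = f , (λ i → vacuous i f) , ≤-reflexive (trans (D-refl f) (sym (*-zeroʳ 2ℚ)))
        where
        none : ∀ p q → ¬ ρ (2 ℕ.^ k) p q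
        none p q pq = ℕₚ.<⇒≱ (Finₚ.toℕ<n q) (subst (λ z → 2 ℕ.^ z ℕ.≤ toℕ q) (trans (sym (ℕₚ.+-identityʳ k)) e) (subst (2 ℕ.^ k ℕ.≤_) (sym pq) (ℕₚ.m≤n+m (2 ℕ.^ k) (toℕ p))))
        vacuous : ∀ {d} (i : Fin d) f → Rel i (ρ (2 ℕ.^ k)) f
        vacuous zero f p q pq = ⊥-elim (none p q pq)
        vacuous (suc i) f p = vacuous i _
      down (suc r) k e = let g , gs , g≤ = down r (suc k) (trans (sym (ℕₚ.+-suc k r)) e)
                             g′ , gs′ , g′≤ = descend k f g (h k false) (h k true) (hs k false) (hs k true) gs
        in g′ , gs′ , ≤-trans g′≤ (≤-trans (+-monoʳ-≤ _ g≤) (≤-reflexive (sym (*-distribˡ-+ 2ℚ (t k) (sumFrom t (suc k) r)))))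

  -- Matchings of violated edges

  ∨-true : ∀ {a b} → a ∨ b ≡ true → a ≡ true ⊎ b ≡ true
  ∨-true {true} _ = inj₁ refl
  ∨-true {false} e = inj₂ e

  Σ-exclusive≤1 : {X : Set} (P : X → Bool) (R : X → X → Set) → (∀ {x y} → P x ≡ true → P y ≡ true → ¬ R x y) →
    ∀ {xs} → AllPairs R xs → Σ xs (ι ∘ P) ≤ 1ℚ
  Σ-exclusive≤1 P R ex [] = 0≤1
  Σ-exclusive≤1 P R ex {x ∷ xs} (r ∷ rs) = case (P x) refl
    where
    zeros : P x ≡ true → ∀ {ys} → All (R x) ys → Σ ys (ι ∘ P) ≡ 0ℚ
    zeros px [] = refl
    zeros px {y ∷ ys} (r ∷ rs) = trans (cong₂ _+_ (cong ι (Boolₚ.¬-not (λ py → ex px py r))) (zeros px rs)) (+-identityˡ 0ℚ)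
    case : ∀ b → P x ≡ b → ι (P x) + Σ xs (ι ∘ P) ≤ 1ℚ
    case false e = subst (_≤ 1ℚ) (sym (trans (cong (λ b → ι b + Σ xs (ι ∘ P)) e) (+-identityˡ _))) (Σ-exclusive≤1 P R ex rs)
    case true e = ≤-reflexive (trans (cong₂ _+_ (cong ι e) (zeros e r)) (+-identityʳ 1ℚ))

  ι-any : {X : Set} (P : X → Bool) (xs : List X) → ι (any P xs) ≤ Σ xs (ι ∘ P)
  ι-any P [] = ≤-refl
  ι-any P (x ∷ xs) with P x
  ... | true = le 1 (λ s → con 1ℚ ⊑ con 1ℚ :+ s by s) refl (Σ xs (ι ∘ P) ∷ []) (Σ-nonNeg xs (λ y → 0≤ι (P y)))
  ... | false = ≤-trans (ι-any P xs) (≤-reflexive (sym (+-identityˡ _)))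

  any-false : {X : Set} (P : X → Bool) (xs : List X) → any P xs ≡ false → All (λ x → P x ≡ false) xs
  any-false P [] e = []
  any-false P (x ∷ xs) e with P x in px
  ... | false = px ∷ any-false P xs e

  ≤ι-any : {X : Set} (P : X → Bool) (xs : List X) → Σ xs (ι ∘ P) ≤ 1ℚ → Σ xs (ι ∘ P) ≤ ι (any P xs)
  ≤ι-any P xs q = go (any P xs) refl
    where
    zeros : ∀ {ys} → All (λ x → P x ≡ false) ys → Σ ys (ι ∘ P) ≡ 0ℚ
    zeros [] = refl
    zeros (e ∷ es) = trans (cong₂ _+_ (cong ι e) (zeros es)) (+-identityˡ 0ℚ)
    go : ∀ b → any P xs ≡ b → Σ xs (ι ∘ P) ≤ ι b
    go true _ = q
    go false e = ≤-reflexive (zeros (any-false P xs e))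

  any-true : {X : Set} (P : X → Bool) (xs : List X) → any P xs ≡ true → Any (λ x → P x ≡ true) xs
  any-true P (x ∷ xs) e with P x in px
  ... | true = here px
  ... | false = there (any-true P xs e)

  ∈-allVecs : {A : Set} {xs : List A} → (∀ a → a ∈ xs) → (v : Vec A d) → v ∈ allVecs xs d
  ∈-allVecs h [] = here refl
  ∈-allVecs {xs = xs} h (a ∷ v) = ∈-concatMap⁺ (λ a → List.map (a ∷_) (allVecs xs _)) (Any.map (λ { refl → ∈-map⁺ (a ∷_) (∈-allVecs h v) }) (h a))

  module Matching {A : Set} (𝓛 : Line A) (complete : ∀ a → a ∈ elems (Line.enum 𝓛)) where
    open Sorting 𝓛
    open Isoperimetry 𝓛

    Cov-intro : ∀ (f⁻ f⁺ : Fun d) → f⁻ ⊴ f⁺ → (∀ x i → st (lookup x i) ≡ lo → f⁻ x ≼ f⁺ (flipAt x i)) → Cov f⁻ f⁺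
    Cov-intro {zero} f⁻ f⁺ le e = le []
    Cov-intro {suc d} f⁻ f⁺ le e = (λ p → Cov-intro _ _ (λ x → le (p ∷ x)) (λ x i → e (p ∷ x) (suc i))) , λ p s x → e (p ∷ x) zero s

    module _ {d} (f : Fun d) where
      Edge : Set
      Edge = Vec A d × Fin d

      bot top : Edge → Vec A d
      bot (x , i) = x
      top (x , i) = flipAt x i

      open Enum (Enum-Vec enum d) using (_≟_; sift-const; does-sym)

      eqb : Vec A d → Vec A d → Bool
      eqb x y = does (x ≟ y)

      eqb-refl : ∀ x → eqb x x ≡ true
      eqb-refl x = dec-true (x ≟ x) refl

      eqb-≡ : ∀ {x y} → eqb x y ≡ true → x ≡ y
      eqb-≡ {x} {y} e with x ≟ y
      ... | yes p = p

      at : Vec A d → Edge → Bool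
      at x e = eqb x (bot e) ∨ eqb x (top e)

      conflict : Edge → Edge → Bool
      conflict e e′ = at (bot e) e′ ∨ at (top e) e′

      greedy : List Edge → List Edge
      greedy [] = []
      greedy (e ∷ es) = if any (conflict e) (greedy es) then greedy es else e ∷ greedy es

      greedy-pairs : ∀ es → AllPairs (λ e e′ → conflict e e′ ≡ false) (greedy es)
      greedy-pairs [] = []
      greedy-pairs (e ∷ es) with any (conflict e) (greedy es) in eq
      ... | true = greedy-pairs es
      ... | false = any-false (conflict e) (greedy es) eq ∷ greedy-pairs es

      greedy-All : ∀ {P : Edge → Set} es → All P es → All P (greedy es)
      greedy-All [] [] = []
      greedy-All (e ∷ es) (p ∷ ps) with any (conflict e) (greedy es)
      ... | true = greedy-All es ps
      ... | false = p ∷ greedy-All es ps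

      greedy-maximal : ∀ es {e} → e ∈ es → any (conflict e) (greedy es) ≡ true
      greedy-maximal (e ∷ es) (here refl) with any (conflict e) (greedy es) in eq
      ... | true = eq
      ... | false rewrite eqb-refl (bot e) = refl
      greedy-maximal (e₀ ∷ es) {e} (there m) with any (conflict e₀) (greedy es)
      ... | true = greedy-maximal es m
      ... | false with conflict e e₀
      ...   | true = refl
      ...   | false = greedy-maximal es m

      candidates matching : List Edge
      candidates = filterᵇ (λ e → isViol f (bot e) (proj₂ e)) (pairs (pts d) (allFin d))
      matching = greedy candidates

      ∈-candidates : ∀ x i → isViol f x i ≡ true → (x , i) ∈ candidates
      ∈-candidates x i v = ∈-filter⁺ _ (∈-concatMap⁺ (λ a → List.map (a ,_) (allFin d)) (Any.map (λ { refl → ∈-map⁺ (x ,_) (∈-allFin i) }) (∈-allVecs complete x))) (subst T (sym v) tt)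

      matching-viol : All (λ e → isViol f (bot e) (proj₂ e) ≡ true) matching
      matching-viol = greedy-All candidates (All.tabulate (λ m → T⇒≡ (proj₂ (∈-filter⁻ _ {xs = pairs (pts d) (allFin d)} m))))
        where
        T⇒≡ : ∀ {b} → T b → b ≡ true
        T⇒≡ {true} _ = refl

      C : Fun d
      C x = any (at x) matching

      f⁻ f⁺ : Fun d
      f⁻ x = f x ∧ not (C x)
      f⁺ x = f x ∨ C x

      -- By maximality every violated edge shares an endpoint with the matching, where f⁻ is 0 and
      -- f⁺ is 1.
      cover : Cov f⁻ f⁺
      cover = Cov-intro f⁻ f⁺ (λ x → ≼-trans (∧-≼ˡ (f x) _) (≼-∨ˡ (f x) _)) edge
        where
        table : ∀ a b c e → (a ≡ true → b ≡ false → c ≡ true ⊎ e ≡ true) → a ∧ not c ≼ b ∨ e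
        table false b c e h = Boolₚ.≤-minimum _
        table true true c e h = Boolₚ.≤-maximum _
        table true false c e h with h refl refl
        ... | inj₁ refl = Boolₚ.≤-minimum e
        ... | inj₂ refl = Boolₚ.≤-maximum (not c)
        edge : ∀ x i → st (lookup x i) ≡ lo → f⁻ x ≼ f⁺ (flipAt x i)
        edge x i e = table (f x) (f (flipAt x i)) (C x) (C (flipAt x i)) λ fx fy →
          split (any-true (conflict (x , i)) matching (greedy-maximal candidates (∈-candidates x i (cong₂ _∧_ (cong isLo e) (cong₂ _∧_ fx (cong not fy))))))
          where
          split : Any (λ e′ → conflict (x , i) e′ ≡ true) matching → C x ≡ true ⊎ C (flipAt x i) ≡ true
          split a = go matching a
            where
            go : ∀ es → Any (λ e′ → conflict (x , i) e′ ≡ true) es → any (at x) es ≡ true ⊎ any (at (flipAt x i)) es ≡ true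
            go (e ∷ es) (here p) with ∨-true {at x e} p
            ... | inj₁ q rewrite q = inj₁ refl
            ... | inj₂ q rewrite q = inj₂ refl
            go (e ∷ es) (there a) with go es a
            ... | inj₁ q rewrite q = inj₁ (Boolₚ.∨-zeroʳ (at x e))
            ... | inj₂ q rewrite q = inj₂ (Boolₚ.∨-zeroʳ (at (flipAt x i) e))

      msize : ℚ
      msize = Σ matching (λ _ → 1ℚ)

      cover-size : V f⁺ f⁻ ≤ 2ℚ * msize
      cover-size = begin
        Σ (pts d) (λ x → ι ((f x ∨ C x) ∧ not (f x ∧ not (C x))))    ≤⟨ Σ-mono (pts d) (λ x → ≤-trans (ι-mono (table (f x) (C x))) (≤-trans (ι-any (at x) matching) (Σ-mono matching (λ e → ι-∨ (eqb x (bot e)) (eqb x (top e)))))) ⟩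
        Σ (pts d) (λ x → Σ matching (λ e → ι (eqb x (bot e)) + ι (eqb x (top e))))  ≡⟨ Σ-swap (pts d) matching _ ⟩
        Σ matching (λ e → Σ (pts d) (λ x → ι (eqb x (bot e)) + ι (eqb x (top e))))  ≡⟨ Σ-cong matching (λ e → trans (Σ-+ (pts d) _ _) (trans (cong₂ _+_ (one (bot e)) (one (top e))) (sym (*-identityʳ 2ℚ′)))) ⟩
        Σ matching (λ e → 2ℚ′ * 1ℚ)     ≡⟨ Σ-*ˡ matching 2ℚ′ _ ⟩
        2ℚ′ * msize                     ≡⟨ cong (_* msize) (rg 0 (con 1ℚ :+ con 1ℚ := con 2ℚ) refl []) ⟩
        2ℚ * msize                      ∎
        where
        open ℚₚ.≤-Reasoning
        2ℚ′ = 1ℚ + 1ℚ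
        table : ∀ a c → (a ∨ c) ∧ not (a ∧ not c) ≼ c
        table true true = b≤b
        table true false = b≤b
        table false true = b≤b
        table false false = b≤b
        ι-∨ : ∀ a b → ι (a ∨ b) ≤ ι a + ι b
        ι-∨ true b = le 1 (λ s → con 1ℚ ⊑ con 1ℚ :+ s by s) refl (ι b ∷ []) (0≤ι b)
        ι-∨ false b = ≤-reflexive (sym (+-identityˡ _))
        one : ∀ y → Σ (pts d) (λ x → ι (eqb x y)) ≡ 1ℚ
        one y = trans (Σ-cong (pts d) (λ x → sym (*-identityʳ _))) (sift-const y 1ℚ)

      -- The constant is 2 · 3074, as the cover has two points for each matched edge.
      matched-near : ∀ {k κ} → 0ℚ < k → 0ℚ < κ → k * κ ≡ 1ℚ →
        ∃ λ h → Srt (full d) h × D f h ≤ (pos 6148 / 1) * (k * msize + κ * Viol (full d) f)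
      matched-near {k} {κ} 0<k 0<κ kκ =
        let h , s , h≤ = sorted-near f f⁻ f⁺ (λ x → ∧-≼ˡ (f x) _) (λ x → ≼-∨ˡ (f x) _) cover (full d) 0<k 0<κ kκ
        in h , s , ≤-trans h≤ (le 5 (λ k κ c w v → con (pos 3074 / 1) :* (k :* c :+ κ :* v) ⊑ con (pos 6148 / 1) :* (k :* w :+ κ :* v) by
             con (pos 3074 / 1) :* (k :* (con 2ℚ :* w :- c)) :+ con (pos 3074 / 1) :* (κ :* v)) refl (k ∷ κ ∷ V f⁺ f⁻ ∷ msize ∷ Viol (full d) f ∷ [])
             ((pos 3074 / 1) · (<⇒≤ 0<k ⊛ slack cover-size) ⊕ (pos 3074 / 1) · (<⇒≤ 0<κ ⊛ Viol-nonNeg (full d) f)))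

      bots≤1 : ∀ x → Σ matching (λ e → ι (eqb x (bot e))) ≤ 1ℚ
      bots≤1 x = Σ-exclusive≤1 (λ e → eqb x (bot e)) (λ e e′ → conflict e e′ ≡ false) (λ {e} {e′} p q r → clash {e} {e′} (eqb-≡ p) (eqb-≡ q) r) (greedy-pairs candidates)
        where
        clash : ∀ {e e′} → x ≡ bot e → x ≡ bot e′ → ¬ conflict e e′ ≡ false
        clash {e} {e′} refl p r with trans (sym r) (cong (_∨ at (top e) e′) (cong (_∨ eqb x (top e′)) (trans (cong (eqb x) (sym p)) (eqb-refl x))))
        ... | ()

      tops≤1 : ∀ x → Σ matching (λ e → ι (eqb x (top e))) ≤ 1ℚ
      tops≤1 x = Σ-exclusive≤1 (λ e → eqb x (top e)) (λ e e′ → conflict e e′ ≡ false) (λ {e} {e′} p q r → clash {e} {e′} (eqb-≡ p) (eqb-≡ q) r) (greedy-pairs candidates)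
        where
        clash : ∀ {e e′} → x ≡ top e → x ≡ top e′ → ¬ conflict e e′ ≡ false
        clash {e} {e′} p q r with trans (sym r) (trans (cong (at (bot e) e′ ∨_) (trans (cong (λ z → eqb z (bot e′) ∨ eqb z (top e′)) (sym p))
          (trans (cong (λ z → eqb x (bot e′) ∨ eqb x z) (sym q)) (trans (cong (eqb x (bot e′) ∨_) (eqb-refl x)) (Boolₚ.∨-zeroʳ _))))) (Boolₚ.∨-zeroʳ _))
        ... | ()

      inMatching : Vec A d → Fin d → Bool
      inMatching x i = any (λ e → eqb x (bot e) ∧ does (proj₂ e Finₚ.≟ i)) matching

      inMatching-viol : ∀ x i → inMatching x i ≡ true → isViol f x i ≡ true
      inMatching-viol x i e = go matching matching-viol (any-true _ matching e)
        where
        go : ∀ es → All (λ e → isViol f (bot e) (proj₂ e) ≡ true) es → Any (λ e → eqb x (bot e) ∧ does (proj₂ e Finₚ.≟ i) ≡ true) es → isViol f x i ≡ true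
        go ((y , j) ∷ es) (v ∷ vs) (there a) = go es vs a
        go ((y , j) ∷ es) (v ∷ vs) (here a) with x ≟ y | j Finₚ.≟ i
        ... | yes refl | yes refl = v

      Σ-direction : ∀ j (h : Fin d → ℚ) → Σ (allFin d) (λ i → h i * ι (does (j Finₚ.≟ i))) ≡ h j
      Σ-direction j h = trans (Σ-cong (allFin d) (λ i → trans (*-comm (h i) _) (cong (λ b → ι b * h i) (Enum.does-sym (Enum-Fin d) j i)))) (Enum.sift (Enum-Fin d) j h)

      inMatching-bots : ∀ x → Σ (allFin d) (λ i → ι (inMatching x i)) ≤ 1ℚ
      inMatching-bots x = ≤-trans (Σ-mono (allFin d) (λ i → ι-any _ matching)) (≤-trans (≤-reflexive (trans (Σ-swap (allFin d) matching _)
        (Σ-cong matching (λ e → trans (Σ-cong (allFin d) (λ i → ι-∧ (eqb x (bot e)) _)) (Σ-direction (proj₂ e) (λ _ → ι (eqb x (bot e)))))))) (bots≤1 x))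

      inMatching-tops : ∀ y → Σ (allFin d) (λ i → ι (inMatching (flipAt y i) i)) ≤ 1ℚ
      inMatching-tops y = ≤-trans (Σ-mono (allFin d) (λ i → ι-any _ matching)) (≤-trans (≤-reflexive (trans (Σ-swap (allFin d) matching _)
        (Σ-cong matching (λ e → trans (Σ-cong (allFin d) (λ i → ι-∧ (eqb (flipAt y i) (bot e)) _)) (Σ-direction (proj₂ e) (λ i → ι (eqb (flipAt y i) (bot e))))))))
        (≤-trans (Σ-mono matching (λ e → unflip e (eqb (flipAt y (proj₂ e)) (bot e)) refl)) (tops≤1 y)))
        where
        unflip : ∀ e b → eqb (flipAt y (proj₂ e)) (bot e) ≡ b → ι b ≤ ι (eqb y (top e))
        unflip e false _ = 0≤ι (eqb y (top e))
        unflip (x , i) true q = ≤-reflexive (cong ι (sym (dec-true (y ≟ flipAt x i) (trans (sym (flipAt-inv y i)) (cong (λ z → flipAt z i) (eqb-≡ {flipAt y i} {x} q))))))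

      msize≤ : msize ≤ Σ (pts d) (λ x → Σ (allFin d) (λ i → ι (inMatching x i)))
      msize≤ = begin
        Σ matching (λ _ → 1ℚ)
          ≡⟨ Σ-cong matching (λ e → sym (trans (Σ-cong (pts d) (λ x → trans (Σ-cong (allFin d) (λ i → ι-∧ (eqb x (bot e)) _)) (trans (Σ-direction (proj₂ e) (λ _ → ι (eqb x (bot e)))) (sym (*-identityʳ _))))) (sift-const (bot e) 1ℚ))) ⟩
        Σ matching (λ e → Σ (pts d) (λ x → Σ (allFin d) (λ i → ι (P x i e))))
          ≡⟨ trans (Σ-swap matching (pts d) _) (Σ-cong (pts d) (λ x → Σ-swap matching (allFin d) _)) ⟩
        Σ (pts d) (λ x → Σ (allFin d) (λ i → Σ matching (ι ∘ P x i)))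
          ≤⟨ Σ-mono (pts d) (λ x → Σ-mono (allFin d) (λ i → ≤ι-any (P x i) matching (≤-trans (Σ-mono matching (λ e → ι-mono (∧-≼ˡ (eqb x (bot e)) _))) (bots≤1 x)))) ⟩
        Σ (pts d) (λ x → Σ (allFin d) (λ i → ι (inMatching x i))) ∎
        where
        open ℚₚ.≤-Reasoning
        P : Vec A d → Fin d → Edge → Bool
        P x i e = eqb x (bot e) ∧ does (proj₂ e Finₚ.≟ i)

  -- Take k = δ / (2aw).
  optimise : ∀ {a w e δ} → 0ℚ < a → 0ℚ ≤ w → 0ℚ ≤ e → 0ℚ < δ →
    (∀ {k κ} → 0ℚ < k → 0ℚ < κ → k * κ ≡ 1ℚ → δ ≤ a * (k * w + κ * e)) → δ * δ ≤ 4ℚ * (a * a) * (w * e)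
  optimise {a} {w} {e} {δ} 0<a 0≤w 0≤e 0<δ bound with 0ℚ <? w | inverse 0<δ
  ... | yes 0<w | δ⁻¹ , 0<δ⁻¹ , δδ⁻¹ = large
    where
    t : ℚ
    t = 2ℚ * a * w
    0<t : 0ℚ < t
    0<t = *-pos (*-pos {2ℚ} (ℚₚ.positive⁻¹ 2ℚ) 0<a) 0<w
    X : ℚ
    X = 2ℚ * (a * a) * (w * e)
    large : δ * δ ≤ 4ℚ * (a * a) * (w * e)
    large with inverse 0<t
    ... | u , 0<u , tu = ≤-trans (le 3 (λ δ x v → δ :* δ ⊑ con 2ℚ :* (x :* (δ :* v)) by con 2ℚ :* (δ :* (con ½ :* δ :* con 1ℚ :+ x :* v :- δ))) refl (δ ∷ X ∷ δ⁻¹ ∷ []) (2ℚ · (<⇒≤ 0<δ ⊛ slack base′)))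
         (≤-reflexive (trans (cong (λ z → 2ℚ * (X * z)) δδ⁻¹) (rg 2 (λ z a → con 2ℚ :* (con 2ℚ :* (a :* a) :* z :* con 1ℚ) := con 4ℚ :* (a :* a) :* z) refl (w * e ∷ a ∷ []))))
      where
      unit : δ * u * (t * δ⁻¹) ≡ 1ℚ
      unit = trans (rg 4 (λ δ u w v → δ :* u :* (w :* v) := (w :* u) :* (δ :* v)) refl (δ ∷ u ∷ t ∷ δ⁻¹ ∷ [])) (trans (cong₂ _*_ tu δδ⁻¹) (*-identityˡ 1ℚ))
      base : δ ≤ ½ * δ * (t * u) + X * δ⁻¹
      base = ≤-trans (bound (*-pos 0<δ 0<u) (*-pos 0<t 0<δ⁻¹) unit)
        (≤-reflexive (rg 6 (λ δ u w e v a → a :* (δ :* u :* w :+ con 2ℚ :* a :* w :* v :* e) := con ½ :* δ :* (con 2ℚ :* a :* w :* u) :+ con 2ℚ :* (a :* a) :* (w :* e) :* v) refl (δ ∷ u ∷ w ∷ e ∷ δ⁻¹ ∷ a ∷ [])))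
      base′ : δ ≤ ½ * δ * 1ℚ + X * δ⁻¹
      base′ = subst (λ z → δ ≤ ½ * δ * z + X * δ⁻¹) tu base
  -- If w = 0, the hypothesis with κ = δ / (2a(e + 1)) gives δ ≤ aκe ≤ δ/2, a contradiction.
  ... | no w≯0 | δ⁻¹ , 0<δ⁻¹ , δδ⁻¹ = ⊥-elim (<-irrefl refl (<-≤-trans (*-pos {½} (ℚₚ.positive⁻¹ ½) 0<δ) δ≤0))
    where
    t : ℚ
    t = 2ℚ * a * (e + 1ℚ)
    0<t : 0ℚ < t
    0<t = *-pos (*-pos {2ℚ} (ℚₚ.positive⁻¹ 2ℚ) 0<a) (subst (0ℚ <_) (+-comm 1ℚ e) (+-pos (ℚₚ.positive⁻¹ 1ℚ) 0≤e))
    δ≤0 : ½ * δ ≤ 0ℚ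
    δ≤0 with inverse 0<t
    ... | u , 0<u , tu = le 1 (λ δ → con ½ :* δ ⊑ con 0ℚ by con ½ :* δ :* con 1ℚ :- δ) refl (δ ∷ []) (slack (subst (λ z → δ ≤ ½ * δ * z) tu base))
      where
      unit : t * δ⁻¹ * (δ * u) ≡ 1ℚ
      unit = trans (rg 4 (λ δ u w v → w :* v :* (δ :* u) := (w :* u) :* (δ :* v)) refl (δ ∷ u ∷ t ∷ δ⁻¹ ∷ [])) (trans (cong₂ _*_ tu δδ⁻¹) (*-identityˡ 1ℚ))
      base : δ ≤ ½ * δ * (t * u)
      base = ≤-trans (bound (*-pos 0<t 0<δ⁻¹) (*-pos 0<δ 0<u) unit)
        (le 6 (λ δ u w e y a → a :* (y :* w :+ δ :* u :* e) ⊑ con ½ :* δ :* (con 2ℚ :* a :* (e :+ con 1ℚ) :* u) by a :* (y :* (con 0ℚ :- w)) :+ a :* (δ :* u)) refl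
          (δ ∷ u ∷ w ∷ e ∷ t * δ⁻¹ ∷ a ∷ []) (<⇒≤ 0<a ⊛ (<⇒≤ (*-pos 0<t 0<δ⁻¹) ⊛ slack (≮⇒≥ w≯0)) ⊕ <⇒≤ 0<a ⊛ (<⇒≤ 0<δ ⊛ <⇒≤ 0<u)))

  module Matchings (m d : ℕ) (f : Vec (Fin (2 ℕ.^ m)) d → Bool) where
    n : ℕ
    n = 2 ℕ.^ m

    module Mt (a : ℕ) (c : Bool) = Matching (Match.line n a c) ∈-allFin

    open Descent n using (D)

    classes : List (Fin m × Bool)
    classes = pairs (allFin m) bools

    E W : ℚ
    E = Σ classes (λ (a , c) → Sorting.Viol (Match.line n (toℕ a) c) (full d) f)
    W = Σ classes (λ (a , c) → Mt.msize (toℕ a) c f)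

    0≤W : 0ℚ ≤ W
    0≤W = Σ-nonNeg classes (λ (a , c) → Σ-nonNeg (Mt.matching (toℕ a) c f) (λ _ → 0≤1))

    0≤E : 0ℚ ≤ E
    0≤E = Σ-nonNeg classes (λ (a , c) → Sorting.Viol-nonNeg (Match.line n (toℕ a) c) (full d) f)

    -- This is 2 · 6148, with the factor 2 of `monotone-near`.
    a₁ : ℚ
    a₁ = pos 12296 / 1

    near : ∀ {k κ} → 0ℚ < k → 0ℚ < κ → k * κ ≡ 1ℚ → ∃ λ g → Monotone g × D f g ≤ a₁ * (k * W + κ * E)
    near {k} {κ} 0<k 0<κ kκ =
      let h = λ a c → Mt.matched-near a c f 0<k 0<κ kκ
          g , mono , g≤ = monotone-near m f (λ a c → proj₁ (h a c)) (λ a c → proj₁ (proj₂ (h a c)))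
      in g , mono , ≤-trans g≤ (≤-trans (*-monoˡ (≤ᵇ⇒≤ tt) (Σ-mono classes (λ (a , c) → proj₂ (proj₂ (h (toℕ a) c)))))
           (≤-reflexive (trans (cong (2ℚ *_) (trans (Σ-*ˡ classes (pos 6148 / 1) _) (cong ((pos 6148 / 1) *_) (trans (Σ-+ classes _ _) (cong₂ _+_ (Σ-*ˡ classes k _) (Σ-*ˡ classes κ _))))))
             (rg 1 (λ z → con 2ℚ :* (con (pos 6148 / 1) :* z) := con a₁ :* z) refl (_ ∷ [])))))

    isoperimetric : ∀ {δ} → 0ℚ < δ → (∀ g → Monotone g → δ ≤ D f g) → δ * δ ≤ 4ℚ * (a₁ * a₁) * (W * E)
    isoperimetric 0<δ far = optimise (ℚₚ.positive⁻¹ a₁) 0≤W 0≤E 0<δ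
      (λ 0<k 0<κ kκ → let g , mono , g≤ = near 0<k 0<κ kκ in ≤-trans (far g mono) g≤)

  -- Subsets of a given size

  bin : ℕ → ℕ → ℕ
  bin n zero = 1
  bin zero (suc k) = 0
  bin (suc n) (suc k) = bin n k ℕ.+ bin n (suc k)

  bin-absorb : ∀ n k → suc k ℕ.* bin (suc n) (suc k) ≡ suc n ℕ.* bin n k
  bin-absorb n zero = trans (ℕₚ.*-identityˡ (bin (suc n) 1)) (trans (bin-1 (suc n)) (sym (ℕₚ.*-identityʳ (suc n))))
    where
    bin-1 : ∀ n → bin n 1 ≡ n
    bin-1 zero = refl
    bin-1 (suc n) = cong suc (bin-1 n)
  bin-absorb zero (suc k) = ℕₚ.*-zeroʳ (suc (suc k))
  bin-absorb (suc n) (suc k) = begin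
    suc (suc k) ℕ.* (bin (suc n) (suc k) ℕ.+ bin (suc n) (suc (suc k)))
      ≡⟨ ℕₚ.*-distribˡ-+ (suc (suc k)) (bin (suc n) (suc k)) _ ⟩
    (bin (suc n) (suc k) ℕ.+ suc k ℕ.* bin (suc n) (suc k)) ℕ.+ suc (suc k) ℕ.* bin (suc n) (suc (suc k))
      ≡⟨ cong₂ (λ a b → (bin (suc n) (suc k) ℕ.+ a) ℕ.+ b) (bin-absorb n k) (bin-absorb n (suc k)) ⟩
    (bin (suc n) (suc k) ℕ.+ suc n ℕ.* bin n k) ℕ.+ suc n ℕ.* bin n (suc k)
      ≡⟨ ℕₚ.+-assoc (bin (suc n) (suc k)) _ _ ⟩
    bin (suc n) (suc k) ℕ.+ (suc n ℕ.* bin n k ℕ.+ suc n ℕ.* bin n (suc k))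
      ≡⟨ cong (bin (suc n) (suc k) ℕ.+_) (sym (ℕₚ.*-distribˡ-+ (suc n) (bin n k) (bin n (suc k)))) ⟩
    suc (suc n) ℕ.* bin (suc n) (suc k) ∎
    where open ≡-Reasoning

  bin-step : ∀ n k → suc k ℕ.* bin n (suc k) ℕ.+ k ℕ.* bin n k ≡ n ℕ.* bin n k
  bin-step zero zero = refl
  bin-step zero (suc k) = trans (cong₂ ℕ._+_ (ℕₚ.*-zeroʳ (suc (suc k))) (ℕₚ.*-zeroʳ (suc k))) refl
  bin-step (suc n) zero = trans (ℕₚ.+-identityʳ _) (bin-absorb n 0)
  bin-step (suc n) (suc k) = begin
    suc (suc k) ℕ.* bin (suc n) (suc (suc k)) ℕ.+ suc k ℕ.* bin (suc n) (suc k)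
      ≡⟨ cong₂ ℕ._+_ (bin-absorb n (suc k)) (bin-absorb n k) ⟩
    suc n ℕ.* bin n (suc k) ℕ.+ suc n ℕ.* bin n k
      ≡⟨ trans (sym (ℕₚ.*-distribˡ-+ (suc n) (bin n (suc k)) (bin n k))) (cong (suc n ℕ.*_) (ℕₚ.+-comm (bin n (suc k)) (bin n k))) ⟩
    suc n ℕ.* bin (suc n) (suc k) ∎
    where open ≡-Reasoning

  bin-pos : ∀ {n k} → k ℕ.≤ n → 0 ℕ.< bin n k
  bin-pos z≤n = s≤s z≤n
  bin-pos {suc n} {suc k} (s≤s k≤n) = ℕₚ.<-≤-trans (bin-pos k≤n) (ℕₚ.m≤m+n (bin n k) _)

  -- The quotient of the two binomials is a product of the j ratios (w - i) / (v + j - i), each at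
  -- most w / v.
  bin-compare : ∀ v w j → bin w j ℕ.* v ℕ.^ j ℕ.≤ bin (v ℕ.+ j) j ℕ.* w ℕ.^ j
  bin-compare v w zero = ℕₚ.≤-refl
  bin-compare v w (suc j) = ℕₚ.*-cancelˡ-≤ (suc j) (begin
    suc j ℕ.* (bin w (suc j) ℕ.* (v ℕ.* v ℕ.^ j))         ≡⟨ sym (ℕₚ.*-assoc (suc j) (bin w (suc j)) _) ⟩
    suc j ℕ.* bin w (suc j) ℕ.* (v ℕ.* v ℕ.^ j)           ≤⟨ ℕₚ.*-monoˡ-≤ (v ℕ.* v ℕ.^ j) (subst (suc j ℕ.* bin w (suc j) ℕ.≤_) (bin-step w j) (ℕₚ.m≤m+n _ _)) ⟩
    w ℕ.* bin w j ℕ.* (v ℕ.* v ℕ.^ j)                     ≡⟨ interchange w (bin w j) v (v ℕ.^ j) ⟩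
    w ℕ.* v ℕ.* (bin w j ℕ.* v ℕ.^ j)                     ≤⟨ ℕₚ.*-monoʳ-≤ (w ℕ.* v) (bin-compare v w j) ⟩
    w ℕ.* v ℕ.* (bin (v ℕ.+ j) j ℕ.* w ℕ.^ j)             ≡⟨ trans (cong (ℕ._* (bin (v ℕ.+ j) j ℕ.* w ℕ.^ j)) (ℕₚ.*-comm w v)) (interchange v w (bin (v ℕ.+ j) j) (w ℕ.^ j)) ⟩
    v ℕ.* bin (v ℕ.+ j) j ℕ.* (w ℕ.* w ℕ.^ j)             ≤⟨ ℕₚ.*-monoˡ-≤ (w ℕ.* w ℕ.^ j) (ℕₚ.*-monoˡ-≤ (bin (v ℕ.+ j) j) (ℕₚ.≤-trans (ℕₚ.m≤m+n v j) (ℕₚ.n≤1+n _))) ⟩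
    suc (v ℕ.+ j) ℕ.* bin (v ℕ.+ j) j ℕ.* (w ℕ.* w ℕ.^ j) ≡⟨ cong (ℕ._* (w ℕ.* w ℕ.^ j)) (sym (bin-absorb (v ℕ.+ j) j)) ⟩
    suc j ℕ.* bin (suc (v ℕ.+ j)) (suc j) ℕ.* (w ℕ.* w ℕ.^ j) ≡⟨ cong (λ z → suc j ℕ.* bin z (suc j) ℕ.* (w ℕ.* w ℕ.^ j)) (sym (ℕₚ.+-suc v j)) ⟩
    suc j ℕ.* bin (v ℕ.+ suc j) (suc j) ℕ.* (w ℕ.* w ℕ.^ j)   ≡⟨ ℕₚ.*-assoc (suc j) (bin (v ℕ.+ suc j) (suc j)) (w ℕ.* w ℕ.^ j) ⟩
    suc j ℕ.* (bin (v ℕ.+ suc j) (suc j) ℕ.* (w ℕ.* w ℕ.^ j)) ∎)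
    where
    open ℕₚ.≤-Reasoning
    interchange : ∀ a b c e → a ℕ.* b ℕ.* (c ℕ.* e) ≡ a ℕ.* c ℕ.* (b ℕ.* e)
    interchange a b c e = trans (ℕₚ.*-assoc a b _) (trans (cong (a ℕ.*_) (trans (sym (ℕₚ.*-assoc b c e)) (trans (cong (ℕ._* e) (ℕₚ.*-comm b c)) (ℕₚ.*-assoc c b e)))) (sym (ℕₚ.*-assoc a c _)))

  ⟪⟫-^ : ∀ a k → ⟪ a ℕ.^ k ⟫ ≡ ⟪ a ⟫ ^^ k
  ⟪⟫-^ a zero = ⟪1⟫
  ⟪⟫-^ a (suc k) = trans (⟪⟫-* a (a ℕ.^ k)) (cong (⟪ a ⟫ *_) (⟪⟫-^ a k))

  -- (1 + D/v)^j (1 - jD/v) ≤ 1 with denominators cleared: a further factor 1 + D/v is made up for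
  -- by lowering the linear factor by D/v.
  power-bernoulli : ∀ {v w} D j → 0ℚ ≤ v → 0ℚ ≤ w → w ≤ v + D → 0ℚ ≤ D → ⟪ j ⟫ * D ≤ v → w ^^ j * (v - ⟪ j ⟫ * D) ≤ v ^^ j * v
  power-bernoulli {v} {w} D zero 0≤v 0≤w w≤ 0≤D jD = ≤-reflexive (trans (cong (λ z → 1ℚ * (v - z * D)) ⟪0⟫) (rg 2 (λ v D → con 1ℚ :* (v :- con 0ℚ :* D) := con 1ℚ :* v) refl (v ∷ D ∷ [])))
  power-bernoulli {v} {w} D (suc j) 0≤v 0≤w w≤ 0≤D jD = subst (λ z → w * w ^^ j * (v - z * D) ≤ v * v ^^ j * v) (sym (⟪⟫-suc j))
    (≤-trans (le 5 (λ v w D j p → w :* p :* (v :- (con 1ℚ :+ j) :* D) ⊑ v :* (p :* (v :- j :* D)) by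
        (p :* ((v :+ D) :- w)) :* (v :- (con 1ℚ :+ j) :* D) :+ p :* ((con 1ℚ :+ j) :* (D :* D))) refl (v ∷ w ∷ D ∷ ⟪ j ⟫ ∷ w ^^ j ∷ [])
        ((^^-nonNeg j 0≤w ⊛ slack w≤) ⊛ slack jD′ ⊕ ^^-nonNeg j 0≤w ⊛ ((0≤1 ⊕ 0≤⟪⟫ j) ⊛ (0≤D ⊛ 0≤D))))
      (≤-trans (*-monoˡ 0≤v (power-bernoulli D j 0≤v 0≤w w≤ 0≤D (≤-trans (le 2 (λ j D → j :* D ⊑ (con 1ℚ :+ j) :* D by D) refl (⟪ j ⟫ ∷ D ∷ []) 0≤D) jD′))) (≤-reflexive (sym (*-assoc v (v ^^ j) v)))))
    where
    jD′ : (1ℚ + ⟪ j ⟫) * D ≤ v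
    jD′ = subst (λ z → z * D ≤ v) (⟪⟫-suc j) jD

  ⟪⟫-pos : ∀ {k} → 0 ℕ.< k → 0ℚ < ⟪ k ⟫
  ⟪⟫-pos {suc k} _ = 0<⟪⟫ k

  ^^-pos : ∀ {x} k → 0ℚ < x → 0ℚ < x ^^ k
  ^^-pos zero 0<x = ℚₚ.positive⁻¹ 1ℚ
  ^^-pos (suc k) 0<x = *-pos 0<x (^^-pos k 0<x)

  bin-double : ∀ v w j D → 0 ℕ.< v → w ℕ.≤ v ℕ.+ D → 2 ℕ.* (j ℕ.* D) ℕ.≤ v → bin w j ℕ.≤ 2 ℕ.* bin (v ℕ.+ j) j
  bin-double v w j D 0<v w≤ 2jD = ⟪⟫-cancel (subst (⟪ bin w j ⟫ ≤_) (sym (⟪⟫-* 2 _)) (*-cancelˡ 0<vj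
    (≤-trans compare (≤-trans (*-monoˡ (0≤⟪⟫ _) w^≤) (≤-reflexive (rg 3 (λ b p t → b :* (t :* p) := p :* (t :* b)) refl (⟪ bin (v ℕ.+ j) j ⟫ ∷ ⟪ v ⟫ ^^ j ∷ ⟪ 2 ⟫ ∷ [])))))))
    where
    0<vj : 0ℚ < ⟪ v ⟫ ^^ j
    0<vj = ^^-pos j (⟪⟫-pos 0<v)
    compare : ⟪ v ⟫ ^^ j * ⟪ bin w j ⟫ ≤ ⟪ bin (v ℕ.+ j) j ⟫ * ⟪ w ⟫ ^^ j
    compare = subst₂ _≤_ (trans (⟪⟫-* (bin w j) (v ℕ.^ j)) (trans (*-comm _ _) (cong (_* ⟪ bin w j ⟫) (⟪⟫-^ v j)))) (trans (⟪⟫-* _ (w ℕ.^ j)) (cong (⟪ bin (v ℕ.+ j) j ⟫ *_) (⟪⟫-^ w j))) (⟪⟫-mono (bin-compare v w j))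
    2jD′ : 2ℚ * (⟪ j ⟫ * ⟪ D ⟫) ≤ ⟪ v ⟫
    2jD′ = subst (_≤ ⟪ v ⟫) (trans (⟪⟫-* 2 _) (cong₂ _*_ (⟪⟫-def 2) (⟪⟫-* j D))) (⟪⟫-mono 2jD)
    w^≤ : ⟪ w ⟫ ^^ j ≤ ⟪ 2 ⟫ * ⟪ v ⟫ ^^ j
    w^≤ = *-cancelˡ (⟪⟫-pos 0<v) (≤-trans (le 3 (λ v p x → v :* p ⊑ con 2ℚ :* (p :* (v :- x)) by p :* (v :- con 2ℚ :* x)) refl (⟪ v ⟫ ∷ ⟪ w ⟫ ^^ j ∷ ⟪ j ⟫ * ⟪ D ⟫ ∷ []) (^^-nonNeg j (0≤⟪⟫ w) ⊛ slack 2jD′))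
      (≤-trans (*-monoˡ (≤ᵇ⇒≤ tt) (power-bernoulli ⟪ D ⟫ j (0≤⟪⟫ v) (0≤⟪⟫ w) (subst (⟪ w ⟫ ≤_) (⟪⟫-+ v D) (⟪⟫-mono w≤)) (0≤⟪⟫ D)
          (≤-trans (le 1 (λ x → x ⊑ con 2ℚ :* x by x) refl (⟪ j ⟫ * ⟪ D ⟫ ∷ []) (0≤⟪⟫ j ⊛ 0≤⟪⟫ D)) 2jD′)))
        (≤-reflexive (trans (rg 2 (λ p v → con 2ℚ :* (p :* v) := v :* (con 2ℚ :* p)) refl (⟪ v ⟫ ^^ j ∷ ⟪ v ⟫ ∷ [])) (cong (λ z → ⟪ v ⟫ * (z * ⟪ v ⟫ ^^ j)) (sym (⟪⟫-def 2)))))))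

  -- Sum of g over the subsets of S with s elements.
  Sub : Cube d → ℕ → (Cube d → ℚ) → ℚ
  -- The same over the subsets with s - 1 elements, and 0 for s = 0: what remains to be chosen once
  -- the first coordinate is in the subset.
  Sub⁺ : Cube d → ℕ → (Cube d → ℚ) → ℚ
  Sub [] zero g = g []
  Sub [] (suc s) g = 0ℚ
  Sub (b ∷ S) s g = Sub S s (g ∘ (false ∷_)) + ι b * Sub⁺ S s (g ∘ (true ∷_))
  Sub⁺ S zero g = 0ℚ
  Sub⁺ S (suc s) g = Sub S s g

  Sub-list : ∀ (S : Cube d) s g → Σ (allVecs bools d) (λ T → ι (subsetᵇ T S ∧ (countTrue T ≡ᵇ s)) * g T) ≡ Sub S s g
  Sub⁺-list : ∀ (S : Cube d) s g → Σ (allVecs bools d) (λ T → ι (subsetᵇ T S ∧ (suc (countTrue T) ≡ᵇ s)) * g T) ≡ Sub⁺ S s g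
  Sub-list [] zero g = trans (+-identityʳ _) (*-identityˡ (g []))
  Sub-list [] (suc s) g = trans (+-identityʳ _) (*-zeroˡ (g []))
  Sub-list {suc d} (b ∷ S) s g = trans (Σ-vec bools d _) (cong₂ _+_ (Sub-list S s (g ∘ (false ∷_))) (trans (+-identityʳ _) (tail b)))
    where
    tail : ∀ b → Σ (allVecs bools d) (λ T → ι (subsetᵇ (true ∷ T) (b ∷ S) ∧ (suc (countTrue T) ≡ᵇ s)) * g (true ∷ T)) ≡ ι b * Sub⁺ S s (g ∘ (true ∷_))
    tail true = trans (Sub⁺-list S s (g ∘ (true ∷_))) (sym (*-identityˡ _))
    tail false = trans (Σ-cong (allVecs bools d) (λ T → *-zeroˡ _)) (trans (Σ-0 (allVecs bools d)) (sym (*-zeroˡ _)))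
  Sub⁺-list {d} S zero g = trans (Σ-cong (allVecs bools d) (λ T → trans (cong (λ z → ι z * g T) (Boolₚ.∧-zeroʳ (subsetᵇ T S))) (*-zeroˡ (g T)))) (Σ-0 (allVecs bools d))
  Sub⁺-list S (suc s) g = Sub-list S s g

  Sub-mono-on : ∀ (S : Cube d) s {g h : Cube d → ℚ} → (∀ T → subsetᵇ T S ≡ true → countTrue T ≡ s → g T ≤ h T) → Sub S s g ≤ Sub S s h
  Sub⁺-mono-on : ∀ (S : Cube d) s {g h : Cube d → ℚ} → (∀ T → subsetᵇ T S ≡ true → suc (countTrue T) ≡ s → g T ≤ h T) → Sub⁺ S s g ≤ Sub⁺ S s h
  Sub-mono-on [] zero q = q [] refl refl
  Sub-mono-on [] (suc s) q = ≤-refl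
  Sub-mono-on (true ∷ S) s q = +-mono-≤ (Sub-mono-on S s (λ T → q (false ∷ T))) (*-monoˡ 0≤1 (Sub⁺-mono-on S s (λ T → q (true ∷ T))))
  Sub-mono-on (false ∷ S) s {g} {h} q = +-mono-≤ (Sub-mono-on S s (λ T → q (false ∷ T))) (≤-reflexive (trans (*-zeroˡ _) (sym (*-zeroˡ _))))
  Sub⁺-mono-on S zero q = ≤-refl
  Sub⁺-mono-on S (suc s) q = Sub-mono-on S s (λ T p e → q T p (cong suc e))

  Sub-cong-on : ∀ (S : Cube d) s {g h : Cube d → ℚ} → (∀ T → subsetᵇ T S ≡ true → countTrue T ≡ s → g T ≡ h T) → Sub S s g ≡ Sub S s h
  Sub-cong-on S s q = ℚₚ.≤-antisym (Sub-mono-on S s (λ T p e → ≤-reflexive (q T p e))) (Sub-mono-on S s (λ T p e → ≤-reflexive (sym (q T p e))))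

  Sub-cong : ∀ (S : Cube d) s {g h : Cube d → ℚ} → (∀ T → g T ≡ h T) → Sub S s g ≡ Sub S s h
  Sub-cong S s q = Sub-cong-on S s (λ T _ _ → q T)

  Sub-*ˡ : ∀ (S : Cube d) s c g → Sub S s (λ T → c * g T) ≡ c * Sub S s g
  Sub⁺-*ˡ : ∀ (S : Cube d) s c g → Sub⁺ S s (λ T → c * g T) ≡ c * Sub⁺ S s g
  Sub-*ˡ [] zero c g = refl
  Sub-*ˡ [] (suc s) c g = sym (*-zeroʳ c)
  Sub-*ˡ (b ∷ S) s c g = trans (cong₂ (λ x y → x + ι b * y) (Sub-*ˡ S s c _) (Sub⁺-*ˡ S s c _))
    (rg 4 (λ c x b y → c :* x :+ b :* (c :* y) := c :* (x :+ b :* y)) refl (c ∷ _ ∷ ι b ∷ _ ∷ []))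
  Sub⁺-*ˡ S zero c g = sym (*-zeroʳ c)
  Sub⁺-*ˡ S (suc s) c g = Sub-*ˡ S s c g

  Sub-+ : ∀ (S : Cube d) s g h → Sub S s (λ T → g T + h T) ≡ Sub S s g + Sub S s h
  Sub⁺-+ : ∀ (S : Cube d) s g h → Sub⁺ S s (λ T → g T + h T) ≡ Sub⁺ S s g + Sub⁺ S s h
  Sub-+ [] zero g h = refl
  Sub-+ [] (suc s) g h = sym (+-identityˡ 0ℚ)
  Sub-+ (b ∷ S) s g h = trans (cong₂ (λ x y → x + ι b * y) (Sub-+ S s _ _) (Sub⁺-+ S s _ _))
    (rg 5 (λ b x y z w → (x :+ y) :+ b :* (z :+ w) := (x :+ b :* z) :+ (y :+ b :* w)) refl (ι b ∷ _ ∷ _ ∷ _ ∷ _ ∷ []))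
  Sub⁺-+ S zero g h = sym (+-identityˡ 0ℚ)
  Sub⁺-+ S (suc s) g h = Sub-+ S s g h

  Sub-nonNeg : ∀ (S : Cube d) s {g : Cube d → ℚ} → (∀ T → 0ℚ ≤ g T) → 0ℚ ≤ Sub S s g
  Sub⁺-nonNeg : ∀ (S : Cube d) s {g : Cube d → ℚ} → (∀ T → 0ℚ ≤ g T) → 0ℚ ≤ Sub⁺ S s g
  Sub-nonNeg [] zero q = q []
  Sub-nonNeg [] (suc s) q = ≤-refl
  Sub-nonNeg (b ∷ S) s q = Sub-nonNeg S s (λ T → q (false ∷ T)) ⊕ 0≤ι b ⊛ Sub⁺-nonNeg S s (λ T → q (true ∷ T))
  Sub⁺-nonNeg S zero q = ≤-refl
  Sub⁺-nonNeg S (suc s) q = Sub-nonNeg S s q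

  Sub-one : ∀ (S : Cube d) s → Sub S s (λ _ → 1ℚ) ≡ ⟪ bin (countTrue S) s ⟫
  Sub-one [] zero = sym ⟪1⟫
  Sub-one [] (suc s) = sym ⟪0⟫
  Sub-one (false ∷ S) s = trans (cong₂ _+_ (Sub-one S s) (*-zeroˡ _)) (+-identityʳ _)
  Sub-one (true ∷ S) zero = trans (cong (_+ 1ℚ * 0ℚ) (Sub-one S 0)) (trans (cong (⟪ 1 ⟫ +_) (*-zeroʳ 1ℚ)) (+-identityʳ _))
  Sub-one (true ∷ S) (suc s) = trans (cong₂ _+_ (Sub-one S (suc s)) (trans (*-identityˡ _) (Sub-one S s))) (trans (+-comm _ _) (sym (⟪⟫-+ (bin (countTrue S) s) _)))

  Sub-const : ∀ (S : Cube d) s c → Sub S s (λ _ → c) ≡ ⟪ bin (countTrue S) s ⟫ * c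
  Sub-const S s c = trans (Sub-cong S s (λ _ → sym (*-identityʳ c))) (trans (Sub-*ˡ S s c _) (trans (cong (c *_) (Sub-one S s)) (*-comm c _)))

  Pt : Cube d → ℕ → (Fin d → Cube d → ℚ) → ℚ
  Pt {d} S s g = Σ (allFin d) (λ i → ι (lookup S i) * Sub (S [ i ]≔ false) s (g i))

  Pt⁺ : Cube d → ℕ → (Fin d → Cube d → ℚ) → ℚ
  Pt⁺ {d} S s g = Σ (allFin d) (λ i → ι (lookup S i) * Sub⁺ (S [ i ]≔ false) s (g i))

  Pt-cons : ∀ b (S : Cube d) s (g : Fin (suc d) → Cube (suc d) → ℚ) →
    Pt (b ∷ S) s g ≡ ι b * Sub S s (g zero ∘ (false ∷_)) + (Pt S s (λ i T → g (suc i) (false ∷ T)) + ι b * Pt⁺ S s (λ i T → g (suc i) (true ∷ T)))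
  Pt-cons {d} b S s g = trans (Σ-allFin-suc d _) (cong₂ _+_
    (cong (ι b *_) (rg 2 (λ x y → x :+ con 0ℚ :* y := x) refl (_ ∷ _ ∷ [])))
    (trans (Σ-cong (allFin d) (λ i → rg 4 (λ l x b y → l :* (x :+ b :* y) := l :* x :+ b :* (l :* y)) refl (ι (lookup S i) ∷ _ ∷ ι b ∷ _ ∷ []))) (trans (Σ-+ (allFin d) _ _) (cong (Pt S s (λ i T → g (suc i) (false ∷ T)) +_) (Σ-*ˡ (allFin d) (ι b) _)))))

  Pt⁺-zero : ∀ (S : Cube d) g → Pt⁺ S zero g ≡ 0ℚ
  Pt⁺-zero {d} S g = trans (Σ-cong (allFin d) (λ i → *-zeroʳ _)) (Σ-0 (allFin d))

  elemSum : Cube d → (Fin d → ℚ) → ℚ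
  elemSum {d} T g = Σ (allFin d) (λ i → ι (lookup T i) * g i)

  elemSum-cons : ∀ b (T : Cube d) g → elemSum (b ∷ T) g ≡ ι b * g zero + elemSum T (g ∘ suc)
  elemSum-cons {d} b T g = Σ-allFin-suc d _

  elemSum-const : ∀ (T : Cube d) c → elemSum T (λ _ → c) ≡ ⟪ countTrue T ⟫ * c
  elemSum-const [] c = trans (sym (*-zeroˡ c)) (cong (_* c) (sym ⟪0⟫))
  elemSum-const (false ∷ T) c = trans (elemSum-cons false T _) (trans (cong₂ _+_ (*-zeroˡ c) (elemSum-const T c)) (+-identityˡ _))
  elemSum-const (true ∷ T) c = trans (elemSum-cons true T _) (trans (cong₂ _+_ (*-identityˡ c) (elemSum-const T c)) (trans (rg 2 (λ c t → c :+ t :* c := (con 1ℚ :+ t) :* c) refl (c ∷ ⟪ countTrue T ⟫ ∷ [])) (cong (_* c) (sym (⟪⟫-suc _)))))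

  Sub-elemSum-0 : ∀ (S : Cube d) (g : Cube d → Fin d → ℚ) → Sub S 0 (λ T → elemSum T (g T)) ≡ 0ℚ
  Sub-elemSum-0 [] g = refl
  Sub-elemSum-0 (b ∷ S) g = trans (cong₂ _+_ (trans (Sub-cong S 0 (λ T → trans (elemSum-cons false T _) (trans (cong (_+ elemSum T (g (false ∷ T) ∘ suc)) (*-zeroˡ _)) (+-identityˡ _)))) (Sub-elemSum-0 S _)) (*-zeroʳ (ι b))) (+-identityʳ 0ℚ)

  -- Choosing a subset and an element of it, in either order.
  Sub-pointed : ∀ (S : Cube d) s (g : Fin d → Cube d → ℚ) → Sub S (suc s) (λ T → elemSum T (λ i → g i (T [ i ]≔ false))) ≡ Pt S s g
  Sub-pointed [] s g = refl
  Sub-pointed (b ∷ S) s g = begin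
    Sub S (suc s) (λ T → elemSum (false ∷ T) (λ i → g i ((false ∷ T) [ i ]≔ false))) + ι b * Sub S s (λ T → elemSum (true ∷ T) (λ i → g i ((true ∷ T) [ i ]≔ false)))
      ≡⟨ cong₂ (λ x y → x + ι b * y)
          (trans (Sub-cong S (suc s) (λ T → trans (elemSum-cons false T _) (trans (cong (_+ elemSum T (λ i → g (suc i) (false ∷ T [ i ]≔ false))) (*-zeroˡ _)) (+-identityˡ _)))) (Sub-pointed S s (λ i T → g (suc i) (false ∷ T))))
          (trans (Sub-cong S s (λ T → trans (elemSum-cons true T _) (cong (_+ elemSum T (λ i → g (suc i) (true ∷ T [ i ]≔ false))) (*-identityˡ _)))) (trans (Sub-+ S s _ _) (cong (Sub S s (g zero ∘ (false ∷_)) +_) (rest s)))) ⟩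
    Pt S s (λ i T → g (suc i) (false ∷ T)) + ι b * (Sub S s (g zero ∘ (false ∷_)) + Pt⁺ S s (λ i T → g (suc i) (true ∷ T)))
      ≡⟨ rg 4 (λ p b x q → p :+ b :* (x :+ q) := b :* x :+ (p :+ b :* q)) refl (_ ∷ ι b ∷ _ ∷ _ ∷ []) ⟩
    ι b * Sub S s (g zero ∘ (false ∷_)) + (Pt S s (λ i T → g (suc i) (false ∷ T)) + ι b * Pt⁺ S s (λ i T → g (suc i) (true ∷ T)))
      ≡⟨ sym (Pt-cons b S s g) ⟩
    Pt (b ∷ S) s g ∎
    where
    open ≡-Reasoning
    rest : ∀ s → Sub S s (λ T → elemSum T (λ i → g (suc i) (true ∷ T [ i ]≔ false))) ≡ Pt⁺ S s (λ i T → g (suc i) (true ∷ T))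
    rest zero = trans (Sub-elemSum-0 S (λ T i → g (suc i) (true ∷ T [ i ]≔ false))) (sym (Pt⁺-zero S (λ i T → g (suc i) (true ∷ T))))
    rest (suc s) = Sub-pointed S s (λ i T → g (suc i) (true ∷ T))

  -- Each T ⊆ S with s elements arises from the |S| - s elements of S outside it.
  Pt-const : ∀ (S : Cube d) s (g : Cube d → ℚ) → Pt S s (λ _ → g) ≡ (⟪ countTrue S ⟫ - ⟪ s ⟫) * Sub S s g
  Pt-const [] zero g = sym (trans (cong (λ z → (z - z) * g []) ⟪0⟫) (trans (cong (_* g []) (+-inverseʳ 0ℚ)) (*-zeroˡ (g []))))
  Pt-const [] (suc s) g = sym (*-zeroʳ _)
  Pt-const (false ∷ S) s g = trans (Pt-cons false S s _) (trans (rg 3 (λ x p q → con 0ℚ :* x :+ (p :+ con 0ℚ :* q) := p) refl (_ ∷ _ ∷ _ ∷ []))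
    (trans (Pt-const S s (g ∘ (false ∷_))) (cong ((⟪ countTrue S ⟫ - ⟪ s ⟫) *_) (rg 2 (λ x y → x := x :+ con 0ℚ :* y) refl (_ ∷ _ ∷ [])))))
  Pt-const (true ∷ S) zero g = trans (Pt-cons true S zero _) (trans (cong₂ (λ x y → 1ℚ * Sub S 0 (g ∘ (false ∷_)) + (x + 1ℚ * y)) (Pt-const S 0 (g ∘ (false ∷_))) (Pt⁺-zero S (λ _ → g ∘ (true ∷_))))
    (trans (rg 3 (λ x c s → con 1ℚ :* x :+ ((c :- s) :* x :+ con 1ℚ :* con 0ℚ) := ((con 1ℚ :+ c) :- s) :* (x :+ con 1ℚ :* con 0ℚ)) refl (Sub S 0 (g ∘ (false ∷_)) ∷ ⟪ countTrue S ⟫ ∷ ⟪ 0 ⟫ ∷ []))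
      (cong (λ z → (z - ⟪ 0 ⟫) * Sub (true ∷ S) 0 g) (sym (⟪⟫-suc (countTrue S))))))
  Pt-const (true ∷ S) (suc s) g = trans (Pt-cons true S (suc s) _) (trans (cong₂ (λ x y → 1ℚ * Sub S (suc s) (g ∘ (false ∷_)) + (x + 1ℚ * y))
      (trans (Pt-const S (suc s) (g ∘ (false ∷_))) (cong (λ z → (⟪ countTrue S ⟫ - z) * Sub S (suc s) (g ∘ (false ∷_))) (⟪⟫-suc s))) (Pt-const S s (g ∘ (true ∷_))))
    (trans (rg 4 (λ x y c s → con 1ℚ :* x :+ ((c :- (con 1ℚ :+ s)) :* x :+ con 1ℚ :* ((c :- s) :* y)) := ((con 1ℚ :+ c) :- (con 1ℚ :+ s)) :* (x :+ con 1ℚ :* y)) refl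
        (Sub S (suc s) (g ∘ (false ∷_)) ∷ Sub S s (g ∘ (true ∷_)) ∷ ⟪ countTrue S ⟫ ∷ ⟪ s ⟫ ∷ []))
      (cong₂ (λ z w → (z - w) * Sub (true ∷ S) (suc s) g) (sym (⟪⟫-suc (countTrue S))) (sym (⟪⟫-suc s)))))

  Pt-+ : ∀ (S : Cube d) s g h → Pt S s (λ i T → g i T + h i T) ≡ Pt S s g + Pt S s h
  Pt-+ {d} S s g h = trans (Σ-cong (allFin d) (λ i → trans (cong (ι (lookup S i) *_) (Sub-+ (S [ i ]≔ false) s (g i) (h i))) (*-distribˡ-+ _ _ _))) (Σ-+ (allFin d) _ _)

  _∖_ : Cube d → Cube d → Cube d
  _∖_ = Vec.zipWith (λ a b → a ∧ not b)

  Pt-dual : ∀ (S : Cube d) s g → Pt S s g ≡ Sub S s (λ T → elemSum (S ∖ T) (λ i → g i T))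
  Pt⁺-dual : ∀ (S : Cube d) s g → Pt⁺ S s g ≡ Sub⁺ S s (λ T → elemSum (S ∖ T) (λ i → g i T))
  Pt-dual [] zero g = refl
  Pt-dual [] (suc s) g = refl
  Pt-dual (b ∷ S) s g = trans (Pt-cons b S s g) (trans
    (cong₂ (λ x y → ι b * Sub S s (g zero ∘ (false ∷_)) + (x + ι b * y)) (Pt-dual S s (λ i T → g (suc i) (false ∷ T))) (Pt⁺-dual S s (λ i T → g (suc i) (true ∷ T))))
    (sym (trans (cong₂ _+_ outer inner) (+-assoc _ _ _))))
    where
    outer : Sub S s (λ T → elemSum ((b ∷ S) ∖ (false ∷ T)) (λ i → g i (false ∷ T))) ≡ ι b * Sub S s (g zero ∘ (false ∷_)) + Sub S s (λ T → elemSum (S ∖ T) (λ i → g (suc i) (false ∷ T)))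
    outer = trans (Sub-cong S s (λ T → trans (elemSum-cons (b ∧ true) (S ∖ T) _) (cong (λ z → ι z * g zero (false ∷ T) + elemSum (S ∖ T) (λ i → g (suc i) (false ∷ T))) (Boolₚ.∧-identityʳ b))))
      (trans (Sub-+ S s (λ T → ι b * g zero (false ∷ T)) _) (cong (_+ Sub S s (λ T → elemSum (S ∖ T) (λ i → g (suc i) (false ∷ T)))) (Sub-*ˡ S s (ι b) (g zero ∘ (false ∷_)))))
    drop : ∀ T → elemSum ((b ∷ S) ∖ (true ∷ T)) (λ i → g i (true ∷ T)) ≡ elemSum (S ∖ T) (λ i → g (suc i) (true ∷ T))
    drop T = trans (elemSum-cons (b ∧ false) (S ∖ T) _) (trans (cong (λ z → ι z * g zero (true ∷ T) + elemSum (S ∖ T) (λ i → g (suc i) (true ∷ T))) (Boolₚ.∧-zeroʳ b)) (trans (cong (_+ elemSum (S ∖ T) (λ i → g (suc i) (true ∷ T))) (*-zeroˡ _)) (+-identityˡ _)))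
    inner : ι b * Sub⁺ S s (λ T → elemSum ((b ∷ S) ∖ (true ∷ T)) (λ i → g i (true ∷ T))) ≡ ι b * Sub⁺ S s (λ T → elemSum (S ∖ T) (λ i → g (suc i) (true ∷ T)))
    inner = cong (ι b *_) (go s)
      where
      go : ∀ s → Sub⁺ S s (λ T → elemSum ((b ∷ S) ∖ (true ∷ T)) (λ i → g i (true ∷ T))) ≡ Sub⁺ S s (λ T → elemSum (S ∖ T) (λ i → g (suc i) (true ∷ T)))
      go zero = refl
      go (suc s) = Sub-cong S s drop
  Pt⁺-dual S zero g = Pt⁺-zero S g
  Pt⁺-dual S (suc s) g = Pt-dual S s g

  Sub-zero : ∀ (S : Cube d) g → Sub S 0 g ≡ g (Vec.replicate d false)
  Sub-zero [] g = refl
  Sub-zero (b ∷ S) g = trans (cong₂ _+_ (Sub-zero S (g ∘ (false ∷_))) (*-zeroʳ (ι b))) (+-identityʳ _)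

  -- The reciprocal, with the value 0 at 0 inherited from `ratio`. An average over an empty family
  -- of subsets is therefore 0, in agreement with a tester that stays at x when there are too few
  -- directions.
  rc : ℕ → ℚ
  rc k = ratio 1 k

  rc-inverse : ∀ {k} → 0 ℕ.< k → rc k * ⟪ k ⟫ ≡ 1ℚ
  rc-inverse {suc k} _ = trans (ratio-* 1 k) ⟪1⟫

  0≤rc : ∀ k → 0ℚ ≤ rc k
  0≤rc zero = ≤-refl
  0≤rc (suc k) = *-cancelˡ (0<⟪⟫ k) (subst₂ _≤_ (sym (*-zeroʳ _)) (trans (sym (rc-inverse (s≤s z≤n))) (*-comm _ _)) 0≤1)

  rc-unique : ∀ {k x} → 0 ℕ.< k → x * ⟪ k ⟫ ≡ 1ℚ → x ≡ rc k
  rc-unique {k} {x} 0<k e = begin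
    x                        ≡⟨ sym (*-identityʳ x) ⟩
    x * 1ℚ                   ≡⟨ cong (x *_) (sym (rc-inverse 0<k)) ⟩
    x * (rc k * ⟪ k ⟫)       ≡⟨ rg 3 (λ x r k → x :* (r :* k) := (x :* k) :* r) refl (x ∷ rc k ∷ ⟪ k ⟫ ∷ []) ⟩
    (x * ⟪ k ⟫) * rc k       ≡⟨ cong (_* rc k) e ⟩
    1ℚ * rc k                ≡⟨ *-identityˡ (rc k) ⟩
    rc k                     ∎
    where open ≡-Reasoning

  -- Moments of sums over independent coordinates

  module Independent {H : Set} (hs : List H) where
    M : ℚ
    M = Σ hs (λ _ → 1ℚ)

    0≤M : 0ℚ ≤ M
    0≤M = Σ-nonNeg hs (λ _ → 0≤1)

    vol : ℕ → ℚ
    vol d = Σ (allVecs hs d) (λ _ → 1ℚ)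

    0≤vol : ∀ d → 0ℚ ≤ vol d
    0≤vol d = Σ-nonNeg (allVecs hs d) (λ _ → 0≤1)

    Σ-const-M : ∀ c → Σ hs (λ _ → c) ≡ M * c
    Σ-const-M c = trans (Σ-cong hs (λ _ → sym (*-identityˡ c))) (Σ-*ʳ hs c (λ _ → 1ℚ))

    Σ-const-vol : ∀ d c → Σ (allVecs hs d) (λ _ → c) ≡ vol d * c
    Σ-const-vol d c = trans (Σ-cong (allVecs hs d) (λ _ → sym (*-identityˡ c))) (Σ-*ʳ (allVecs hs d) c (λ _ → 1ℚ))

    vol-suc : ∀ d → vol (suc d) ≡ M * vol d
    vol-suc d = trans (Σ-vec hs d _) (Σ-const-M (vol d))

    vol-power : ∀ d → vol d ≡ M ^^ d
    vol-power zero = +-identityʳ 1ℚ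
    vol-power (suc d) = trans (vol-suc d) (cong (M *_) (vol-power d))

    total : (Fin d → H → ℚ) → Vec H d → ℚ
    total {d} φ v = Σ (allFin d) (λ i → φ i (lookup v i))

    weight : (Fin d → H → ℚ) → ℚ
    weight {d} φ = Σ (allFin d) (λ i → Σ hs (φ i))

    total-mean : ∀ (φ : Fin d → H → ℚ) → M * Σ (allVecs hs d) (total φ) ≡ vol d * weight φ
    total-mean {zero} φ = rg 1 (λ m → m :* (con 0ℚ :+ con 0ℚ) := (con 1ℚ :+ con 0ℚ) :* con 0ℚ) refl (M ∷ [])
    total-mean {suc d} φ = begin
      M * Σ (allVecs hs (suc d)) (total φ)
        ≡⟨ cong (M *_) (trans (Σ-vec hs d _) (trans (Σ-cong hs (λ h → trans (Σ-cong (allVecs hs d) (λ v → Σ-allFin-suc d _)) (trans (Σ-+ (allVecs hs d) (λ _ → φ zero h) _) (cong (_+ S) (Σ-const-vol d (φ zero h)))))) (trans (Σ-+ hs _ _) (cong₂ _+_ (Σ-*ˡ hs (vol d) (φ zero)) (Σ-const-M S))))) ⟩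
      M * (vol d * Σ hs (φ zero) + M * S)
        ≡⟨ rg 4 (λ m v a s → m :* (v :* a :+ m :* s) := m :* (v :* a) :+ m :* (m :* s)) refl (M ∷ vol d ∷ Σ hs (φ zero) ∷ S ∷ []) ⟩
      M * (vol d * Σ hs (φ zero)) + M * (M * S)
        ≡⟨ cong (λ z → M * (vol d * Σ hs (φ zero)) + M * z) (total-mean (φ ∘ suc)) ⟩
      M * (vol d * Σ hs (φ zero)) + M * (vol d * weight (φ ∘ suc))
        ≡⟨ rg 4 (λ m v a s → m :* (v :* a) :+ m :* (v :* s) := m :* v :* (a :+ s)) refl (M ∷ vol d ∷ Σ hs (φ zero) ∷ weight (φ ∘ suc) ∷ []) ⟩
      M * vol d * (Σ hs (φ zero) + weight (φ ∘ suc))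
        ≡⟨ cong₂ _*_ (sym (vol-suc d)) (sym (Σ-allFin-suc d _)) ⟩
      vol (suc d) * weight φ ∎
      where
      open ≡-Reasoning
      S : ℚ
      S = Σ (allVecs hs d) (total (φ ∘ suc))

    -- A sum of independent terms with φ² ≤ φ has second moment at most mean + mean². The factors M
    -- and `vol` stand in for divisions by numbers of choices.
    total-square : ∀ (φ : Fin d → H → ℚ) → (∀ i h → φ i h * φ i h ≤ φ i h) →
      M * M * Σ (allVecs hs d) (λ v → total φ v * total φ v) ≤ vol d * (M * weight φ + weight φ * weight φ)
    total-square {zero} φ idem = ≤-reflexive (rg 1 (λ m → m :* m :* (con 0ℚ :* con 0ℚ :+ con 0ℚ) := (con 1ℚ :+ con 0ℚ) :* (m :* con 0ℚ :+ con 0ℚ :* con 0ℚ)) refl (M ∷ []))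
    total-square {suc d} φ idem = begin
      M * M * Σ (allVecs hs (suc d)) (λ v → total φ v * total φ v)
        ≡⟨ cong (M * M *_) (trans (Σ-vec hs d _) (Σ-cong hs (λ h → trans (Σ-cong (allVecs hs d) (λ v → trans (cong (λ z → z * z) (Σ-allFin-suc d (λ i → φ i (lookup (h ∷ v) i))))
             (rg 2 (λ a b → (a :+ b) :* (a :+ b) := a :* a :+ (con 2ℚ :* a :* b :+ b :* b)) refl (φ zero h ∷ total (φ ∘ suc) v ∷ []))))
             (trans (Σ-+ (allVecs hs d) (λ _ → φ zero h * φ zero h) _) (cong₂ _+_ (Σ-const-vol d _) (trans (Σ-+ (allVecs hs d) _ _) (cong (_+ S₂) (Σ-*ˡ (allVecs hs d) (2ℚ * φ zero h) _)))))))) ⟩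
      M * M * Σ hs (λ h → vol d * (φ zero h * φ zero h) + (2ℚ * φ zero h * S₁ + S₂))
        ≤⟨ *-monoˡ (0≤M ⊛ 0≤M) (Σ-mono hs (λ h → +-monoˡ-≤ (2ℚ * φ zero h * S₁ + S₂) (*-monoˡ (0≤vol d) (idem zero h)))) ⟩
      M * M * Σ hs (λ h → vol d * φ zero h + (2ℚ * φ zero h * S₁ + S₂))
        ≡⟨ cong (M * M *_) (trans (Σ-cong hs (λ h → rg 4 (λ v a s t → v :* a :+ (con 2ℚ :* a :* s :+ t) := (v :+ con 2ℚ :* s) :* a :+ t) refl (vol d ∷ φ zero h ∷ S₁ ∷ S₂ ∷ [])))
             (trans (Σ-+ hs _ _) (cong₂ _+_ (Σ-*ˡ hs (vol d + 2ℚ * S₁) (φ zero)) (Σ-const-M S₂)))) ⟩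
      M * M * ((vol d + 2ℚ * S₁) * q + M * S₂)
        ≡⟨ rg 5 (λ m v q s t → m :* m :* ((v :+ con 2ℚ :* s) :* q :+ m :* t) := m :* m :* v :* q :+ con 2ℚ :* m :* q :* (m :* s) :+ m :* (m :* m :* t)) refl (M ∷ vol d ∷ q ∷ S₁ ∷ S₂ ∷ []) ⟩
      M * M * vol d * q + 2ℚ * M * q * (M * S₁) + M * (M * M * S₂)
        ≤⟨ +-mono-≤ (≤-reflexive (cong (λ z → M * M * vol d * q + 2ℚ * M * q * z) (total-mean (φ ∘ suc)))) (*-monoˡ 0≤M (total-square (φ ∘ suc) (idem ∘ suc))) ⟩
      M * M * vol d * q + 2ℚ * M * q * (vol d * Q) + M * (vol d * (M * Q + Q * Q))
        ≤⟨ le 4 (λ m v q r → m :* m :* v :* q :+ con 2ℚ :* m :* q :* (v :* r) :+ m :* (v :* (m :* r :+ r :* r)) ⊑ m :* v :* (m :* (q :+ r) :+ (q :+ r) :* (q :+ r)) by m :* v :* (q :* q)) refl (M ∷ vol d ∷ q ∷ Q ∷ []) (0≤M ⊛ 0≤vol d ⊛ sq-nonNeg q) ⟩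
      M * vol d * (M * (q + Q) + (q + Q) * (q + Q))
        ≡⟨ cong₂ (λ v w → v * (M * w + w * w)) (sym (vol-suc d)) (sym (Σ-allFin-suc d (λ i → Σ hs (φ i)))) ⟩
      vol (suc d) * (M * weight φ + weight φ * weight φ) ∎
      where
      open ℚₚ.≤-Reasoning
      S₁ S₂ q Q : ℚ
      S₁ = Σ (allVecs hs d) (total (φ ∘ suc))
      S₂ = Σ (allVecs hs d) (λ v → total (φ ∘ suc) v * total (φ ∘ suc) v)
      q = Σ hs (φ zero)
      Q = weight (φ ∘ suc)

    resample : ∀ (i : Fin d) (F : Vec H d → ℚ) → M * Σ (allVecs hs d) F ≡ Σ (allVecs hs d) (λ v → Σ hs (λ h → F (v [ i ]≔ h)))
    resample {suc d} zero F = trans (cong (M *_) (trans (Σ-vec hs d F) (Σ-swap hs (allVecs hs d) _))) (sym (trans (Σ-vec hs d _) (Σ-const-M _)))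
    resample {suc d} (suc i) F = trans (cong (M *_) (Σ-vec hs d F)) (trans (sym (Σ-*ˡ hs M _)) (trans (Σ-cong hs (λ h → resample i (F ∘ (h ∷_)))) (sym (Σ-vec hs d _))))

  -- The upward walk

  ≤ᵇ-true : ∀ {a b} → (a ℕ.≤ᵇ b) ≡ true → a ℕ.≤ b
  ≤ᵇ-true {a} {b} e = ℕₚ.≤ᵇ⇒≤ a b (subst T (sym e) tt)

  ≤ᵇ-false : ∀ {a b} → (a ℕ.≤ᵇ b) ≡ false → b ℕ.< a
  ≤ᵇ-false e = ℕₚ.≰⇒> (λ q → subst T e (ℕₚ.≤⇒≤ᵇ q))

  isLo⇒lo : ∀ {s} → isLo s ≡ true → s ≡ lo
  isLo⇒lo {lo} _ = refl

  isHi⇒hi : ∀ {s} → isHi s ≡ true → s ≡ hi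
  isHi⇒hi {hi} _ = refl

  subset-cons : ∀ b {T S : Cube d} → subsetᵇ (true ∷ T) (b ∷ S) ≡ true → b ≡ true × subsetᵇ T S ≡ true
  subset-cons true e = refl , e

  ι*-mono : ∀ b {x y} → (b ≡ true → x ≤ y) → ι b * x ≤ ι b * y
  ι*-mono true q = *-monoˡ 0≤1 (q refl)
  ι*-mono false q = ≤-reflexive (trans (*-zeroˡ _) (sym (*-zeroˡ _)))

  square-mono : ∀ {x y} → 0ℚ ≤ x → x ≤ y → x * x ≤ y * y
  square-mono 0≤x x≤y = *-mono 0≤x 0≤x x≤y x≤y

  module Walk {A : Set} (𝓛 : Line A) where
    open Sorting 𝓛

    L U : Vec A d → Cube d
    L = Vec.map (isLo ∘ st)
    U = Vec.map (isHi ∘ st)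

    act : Bool → A → A
    act true p = π p
    act false p = p

    app : Cube d → Vec A d → Vec A d
    app = Vec.zipWith act

    -- The pairs of ω and T ⊆ L ω correspond bijectively to the pairs of z and T ⊆ U z by z = app T
    -- ω: π exchanges `lo` and `hi`, and applying T once more leads back.
    change : ∀ s (Ψ : Cube d → Vec A d → Vec A d → ℚ) →
      Σ (pts d) (λ ω → Sub (L ω) s (λ T → Ψ T ω (app T ω))) ≡ Σ (pts d) (λ z → Sub (U z) s (λ T → Ψ T (app T z) z))
    change⁺ : ∀ s (Ψ : Cube d → Vec A d → Vec A d → ℚ) →
      Σ (pts d) (λ ω → Sub⁺ (L ω) s (λ T → Ψ T ω (app T ω))) ≡ Σ (pts d) (λ z → Sub⁺ (U z) s (λ T → Ψ T (app T z) z))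
    change {zero} zero Ψ = refl
    change {zero} (suc s) Ψ = refl
    change {suc d} s Ψ = begin
      Σ (pts (suc d)) (λ ω → Sub (L ω) s (λ T → Ψ T ω (app T ω)))
        ≡⟨ Σ-vec xs d _ ⟩
      Σ xs (λ p → Σ (pts d) (λ ω → Sub (L ω) s (λ T → Ψ (false ∷ T) (p ∷ ω) (p ∷ app T ω)) + ι (isLo (st p)) * Sub⁺ (L ω) s (λ T → Ψ (true ∷ T) (p ∷ ω) (π p ∷ app T ω))))
        ≡⟨ Σ-cong xs (λ p → trans (Σ-+ (pts d) _ _) (cong₂ _+_ (change s (λ T ω z → Ψ (false ∷ T) (p ∷ ω) (p ∷ z)))
             (trans (Σ-*ˡ (pts d) _ _) (cong (ι (isLo (st p)) *_) (change⁺ s (λ T ω z → Ψ (true ∷ T) (p ∷ ω) (π p ∷ z))))))) ⟩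
      Σ xs (λ p → X p + ι (isLo (st p)) * Y p (π p))
        ≡⟨ Σ-+ xs _ _ ⟩
      Σ xs X + Σ xs (λ p → ι (isLo (st p)) * Y p (π p))
        ≡⟨ cong (Σ xs X +_) (trans (Σ-cong xs (λ p → cong₂ (λ b q → ι b * Y q (π p)) (sym (isHi-π p)) (sym (π-inv p)))) (Enum.Σ-involution enum π π-inv (λ q → ι (isHi (st q)) * Y (π q) q))) ⟩
      Σ xs X + Σ xs (λ q → ι (isHi (st q)) * Y (π q) q)
        ≡⟨ sym (trans (Σ-vec xs d _) (trans (Σ-cong xs (λ p → trans (Σ-+ (pts d) _ _) (cong (X p +_) (Σ-*ˡ (pts d) _ _)))) (Σ-+ xs _ _))) ⟩
      Σ (pts (suc d)) (λ z → Sub (U z) s (λ T → Ψ T (app T z) z)) ∎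
      where
      open ≡-Reasoning
      X : A → ℚ
      X p = Σ (pts d) (λ z → Sub (U z) s (λ T → Ψ (false ∷ T) (p ∷ app T z) (p ∷ z)))
      Y : A → A → ℚ
      Y p q = Σ (pts d) (λ z → Sub⁺ (U z) s (λ T → Ψ (true ∷ T) (p ∷ app T z) (q ∷ z)))
    change⁺ zero Ψ = refl
    change⁺ (suc s) Ψ = change s Ψ

    isLo-π-lo : ∀ {p} → isLo (st p) ≡ true → isLo (st (π p)) ≡ false
    isLo-π-lo e = cong isLo (st-lo _ (isLo⇒lo e))

    L-app : ∀ T (ω : Vec A d) → subsetᵇ T (L ω) ≡ true → L (app T ω) ≡ L ω ∖ T
    L-app [] [] e = refl
    L-app (false ∷ T) (p ∷ ω) e = cong₂ _∷_ (sym (Boolₚ.∧-identityʳ _)) (L-app T ω e)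
    L-app (true ∷ T) (p ∷ ω) e = let l , e′ = subset-cons (isLo (st p)) {T} {L ω} e in
      cong₂ _∷_ (trans (isLo-π-lo l) (sym (Boolₚ.∧-zeroʳ _))) (L-app T ω e′)

    countL-app : ∀ T (z : Vec A d) → subsetᵇ T (U z) ≡ true → countTrue (L (app T z)) ≡ countTrue (L z) ℕ.+ countTrue T
    countL-app [] [] e = refl
    countL-app (false ∷ T) (p ∷ z) e with isLo (st p)
    ... | true = cong suc (countL-app T z e)
    ... | false = countL-app T z e
    countL-app (true ∷ T) (p ∷ z) e = let h , e′ = subset-cons (isHi (st p)) {T} {U z} e in
      trans (cong (λ b → countTrue (b ∷ L (app T z))) (cong isLo (st-hi p (isHi⇒hi h))))
        (trans (cong suc (countL-app T z e′)) (trans (sym (ℕₚ.+-suc _ _)) (cong (λ b → countTrue (b ∷ L z) ℕ.+ suc (countTrue T)) (sym (cong isLo (isHi⇒hi h))))))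

    countU-app : ∀ T (z : Vec A d) → subsetᵇ T (U z) ≡ true → countTrue (U (app T z)) ℕ.+ countTrue T ≡ countTrue (U z)
    countU-app [] [] e = refl
    countU-app (false ∷ T) (p ∷ z) e with isHi (st p)
    ... | true = cong suc (countU-app T z e)
    ... | false = countU-app T z e
    countU-app (true ∷ T) (p ∷ z) e = let h , e′ = subset-cons (isHi (st p)) {T} {U z} e in
      trans (cong (λ b → countTrue (b ∷ U (app T z)) ℕ.+ suc (countTrue T)) (cong isHi (st-hi p (isHi⇒hi h))))
        (trans (ℕₚ.+-suc _ _) (trans (cong suc (countU-app T z e′)) (cong (λ b → countTrue (b ∷ U z)) (sym h))))

    app-flip : ∀ T (ω : Vec A d) i → lookup T i ≡ true → app T ω ≡ flipAt (app (T [ i ]≔ false) ω) i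
    app-flip (true ∷ T) (p ∷ ω) zero e = refl
    app-flip (b ∷ T) (p ∷ ω) (suc i) e = cong (act b p ∷_) (app-flip T ω i e)

    app-empty : ∀ (ω : Vec A d) → app (Vec.replicate d false) ω ≡ ω
    app-empty [] = refl
    app-empty (p ∷ ω) = cong (p ∷_) (app-empty ω)

    vsum : (A → ℚ) → Vec A d → ℚ
    vsum {d} ψ ω = Σ (allFin d) (λ i → ψ (lookup ω i))

    vsum-cons : ∀ ψ p (ω : Vec A d) → vsum ψ (p ∷ ω) ≡ ψ p + vsum ψ ω
    vsum-cons {d} ψ p ω = Σ-allFin-suc d _

    vsum-count : ∀ (b : A → Bool) (ω : Vec A d) → vsum (ι ∘ b) ω ≡ ⟪ countTrue (Vec.map b ω) ⟫
    vsum-count b [] = sym ⟪0⟫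
    vsum-count b (p ∷ ω) = trans (vsum-cons (ι ∘ b) p ω) (trans (cong (ι (b p) +_) (vsum-count b ω)) (case (b p)))
      where
      case : ∀ c → ι c + ⟪ countTrue (Vec.map b ω) ⟫ ≡ ⟪ countTrue (c ∷ Vec.map b ω) ⟫
      case true = sym (⟪⟫-suc _)
      case false = +-identityˡ _

    open Independent xs public using (vol; 0≤vol; Σ-const-vol; vol-suc)

    -- Independence and mean zero remove the cross terms, which leaves d terms of size at most 1.
    second-moment : ∀ ψ → Σ xs ψ ≡ 0ℚ → (∀ p → ψ p * ψ p ≤ 1ℚ) → ∀ d → Σ (pts d) (λ ω → vsum ψ ω * vsum ψ ω) ≤ ⟪ d ⟫ * vol d
    second-moment ψ mean0 ψ≤1 zero = ≤-reflexive (trans (trans (+-identityʳ _) (*-zeroˡ 0ℚ)) (sym (trans (cong (_* vol 0) ⟪0⟫) (*-zeroˡ _))))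
    second-moment ψ mean0 ψ≤1 (suc d) = begin
      Σ (pts (suc d)) (λ ω → vsum ψ ω * vsum ψ ω)
        ≡⟨ Σ-vec xs d _ ⟩
      Σ xs (λ p → Σ (pts d) (λ ω → vsum ψ (p ∷ ω) * vsum ψ (p ∷ ω)))
        ≡⟨ Σ-cong xs (λ p → trans (Σ-cong (pts d) (λ ω → trans (cong (λ z → z * z) (vsum-cons ψ p ω))
             (rg 2 (λ a b → (a :+ b) :* (a :+ b) := a :* a :+ (con 2ℚ :* a :* b :+ b :* b)) refl (ψ p ∷ vsum ψ ω ∷ []))))
             (trans (Σ-+ (pts d) (λ _ → ψ p * ψ p) _) (cong₂ _+_ (Σ-const-vol d _) (trans (Σ-+ (pts d) _ _) (cong (_+ S₂) (Σ-*ˡ (pts d) (2ℚ * ψ p) (vsum ψ))))))) ⟩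
      Σ xs (λ p → vol d * (ψ p * ψ p) + (2ℚ * ψ p * S₁ + S₂))
        ≤⟨ Σ-mono xs (λ p → +-monoˡ-≤ (2ℚ * ψ p * S₁ + S₂) (*-monoˡ (0≤vol d) (ψ≤1 p))) ⟩
      Σ xs (λ p → vol d * 1ℚ + (2ℚ * ψ p * S₁ + S₂))
        ≡⟨ Σ-cong xs (λ p → rg 4 (λ v a s t → v :* con 1ℚ :+ (con 2ℚ :* a :* s :+ t) := con 2ℚ :* s :* a :+ con 1ℚ :* (v :+ t)) refl (vol d ∷ ψ p ∷ S₁ ∷ S₂ ∷ [])) ⟩
      Σ xs (λ p → 2ℚ * S₁ * ψ p + 1ℚ * (vol d + S₂))
        ≡⟨ trans (Σ-+ xs _ _) (cong₂ _+_ (trans (Σ-*ˡ xs (2ℚ * S₁) ψ) (trans (cong (2ℚ * S₁ *_) mean0) (*-zeroʳ _))) (Σ-*ʳ xs (vol d + S₂) (λ _ → 1ℚ))) ⟩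
      0ℚ + Σ xs (λ _ → 1ℚ) * (vol d + S₂)
        ≤⟨ +-monoʳ-≤ 0ℚ (*-monoˡ (Σ-nonNeg xs (λ _ → 0≤1)) (+-monoʳ-≤ (vol d) (second-moment ψ mean0 ψ≤1 d))) ⟩
      0ℚ + Σ xs (λ _ → 1ℚ) * (vol d + ⟪ d ⟫ * vol d)
        ≡⟨ rg 3 (λ x v d → con 0ℚ :+ x :* (v :+ d :* v) := (con 1ℚ :+ d) :* (x :* v)) refl (Σ xs (λ _ → 1ℚ) ∷ vol d ∷ ⟪ d ⟫ ∷ []) ⟩
      (1ℚ + ⟪ d ⟫) * (Σ xs (λ _ → 1ℚ) * vol d)
        ≡⟨ cong₂ _*_ (sym (⟪⟫-suc d)) (sym (vol-suc d)) ⟩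
      ⟪ suc d ⟫ * vol (suc d) ∎
      where
      open ℚₚ.≤-Reasoning
      S₁ S₂ : ℚ
      S₁ = Σ (pts d) (vsum ψ)
      S₂ = Σ (pts d) (λ ω → vsum ψ ω * vsum ψ ω)

    module _ {d} (f : Fun d) where
      Away : ℕ → Vec A d → ℚ
      Away s ω = Sub (L ω) s (λ T → ι (f ω xor f (app T ω)))

      bdry : Vec A d → ℚ
      bdry z = elemSum (L z) (λ i → ι (f z xor f (flipAt z i)))

      0≤bdry : ∀ z → 0ℚ ≤ bdry z
      0≤bdry z = Σ-nonNeg (allFin d) (λ i → 0≤ι (lookup (L z) i) ⊛ 0≤ι (f z xor f (flipAt z i)))

      -- Let i be the last step of T. If f has changed after T, then it had changed before i or it
      -- changes along i. In the first case the shorter set has |L ω| - s continuations, in the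
      -- second the last edge is a boundary edge at the point reached before.
      Away-step : ∀ s ω → ⟪ suc s ⟫ * Away (suc s) ω ≤ (⟪ countTrue (L ω) ⟫ - ⟪ s ⟫) * Away s ω + Sub (L ω) s (λ T → bdry (app T ω))
      Away-step s ω = begin
        ⟪ suc s ⟫ * Away (suc s) ω
          ≡⟨ sym (Sub-*ˡ (L ω) (suc s) _ _) ⟩
        Sub (L ω) (suc s) (λ T → ⟪ suc s ⟫ * ι (f ω xor f (app T ω)))
          ≡⟨ Sub-cong-on (L ω) (suc s) (λ T _ e → trans (cong (λ k → ⟪ k ⟫ * ι (f ω xor f (app T ω))) (sym e)) (sym (elemSum-const T _))) ⟩
        Sub (L ω) (suc s) (λ T → elemSum T (λ _ → ι (f ω xor f (app T ω))))
          ≤⟨ Sub-mono-on (L ω) (suc s) (λ T _ _ → Σ-mono (allFin d) (λ i → ι*-mono (lookup T i) (λ e →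
               subst (λ y → ι (f ω xor f y) ≤ g i (T [ i ]≔ false)) (sym (app-flip T ω i e)) (ι-xor-triangle (f ω) (f (app (T [ i ]≔ false) ω)) _)))) ⟩
        Sub (L ω) (suc s) (λ T → elemSum T (λ i → g i (T [ i ]≔ false)))
          ≡⟨ Sub-pointed (L ω) s g ⟩
        Pt (L ω) s g
          ≡⟨ Pt-+ (L ω) s (λ _ T → ι (f ω xor f (app T ω))) _ ⟩
        Pt (L ω) s (λ _ T → ι (f ω xor f (app T ω))) + Pt (L ω) s (λ i T → ι (f (app T ω) xor f (flipAt (app T ω) i)))
          ≡⟨ cong₂ _+_ (Pt-const (L ω) s (λ T → ι (f ω xor f (app T ω)))) (trans (Pt-dual (L ω) s _) (Sub-cong-on (L ω) s (λ T e _ → cong (λ S → elemSum S (λ i → ι (f (app T ω) xor f (flipAt (app T ω) i)))) (sym (L-app T ω e))))) ⟩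
        (⟪ countTrue (L ω) ⟫ - ⟪ s ⟫) * Away s ω + Sub (L ω) s (λ T → bdry (app T ω)) ∎
        where
        open ℚₚ.≤-Reasoning
        g : Fin d → Cube d → ℚ
        g i T = ι (f ω xor f (app T ω)) + ι (f (app T ω) xor f (flipAt (app T ω) i))

      -- The chance that f is 0 after s random steps up from ω (0 if there are fewer than s ways up).
      Good : ℕ → Vec A d → ℚ
      Good s ω = rc (bin (countTrue (L ω)) s) * Sub (L ω) s (λ T → ι (not (f (app T ω))))

      0≤Good : ∀ s ω → 0ℚ ≤ Good s ω
      0≤Good s ω = 0≤rc (bin (countTrue (L ω)) s) ⊛ Sub-nonNeg (L ω) s (λ T → 0≤ι (not (f (app T ω))))

  8ℚ 16ℚ 32ℚ 64ℚ 128ℚ 4096ℚ : ℚ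
  8ℚ = pos 8 / 1
  16ℚ = pos 16 / 1
  32ℚ = pos 32 / 1
  64ℚ = pos 64 / 1
  128ℚ = pos 128 / 1
  4096ℚ = pos 4096 / 1

  ∧-true : ∀ {a b} → a ∧ b ≡ true → a ≡ true × b ≡ true
  ∧-true {true} e = refl , e

  module Typical (d τ : ℕ) (large : 128 ℕ.* (τ ℕ.* τ) ℕ.≤ d) where
    -- There are at least d/8 ways up, and at most d/(64τ) more ways down than up; truncated
    -- subtraction admits any excess of ways up.
    typ : ℕ → ℕ → Bool
    typ l u = (d ℕ.≤ᵇ 8 ℕ.* l) ∧ (64 ℕ.* (τ ℕ.* (u ℕ.∸ l)) ℕ.≤ᵇ d)

    -- The weight of one edge as step j + 1 of a walk from a typical point: 1 / bin l j for the set
    -- used so far and 1 / (l - j) for the next direction.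
    ρ : ℕ → ℕ → ℕ → ℚ
    ρ j l u = ι (typ l u) * rc ((l ℕ.∸ j) ℕ.* bin l j)

    δ : ℚ
    δ = rc d

    large′ : 128ℚ * (⟪ τ ⟫ * ⟪ τ ⟫) ≤ ⟪ d ⟫
    large′ = subst (_≤ ⟪ d ⟫) (trans (⟪⟫-* 128 _) (cong₂ _*_ (⟪⟫-def 128) (⟪⟫-* τ τ))) (⟪⟫-mono large)

    0<d : ∀ {j} → j ℕ.< τ → 0 ℕ.< d
    0<d j<τ = ℕₚ.≤-trans (ℕₚ.*-mono-≤ {1} {128} (s≤s z≤n) (ℕₚ.*-mono-≤ {1} {τ} {1} {τ} (ℕₚ.≤-trans (s≤s z≤n) j<τ) (ℕₚ.≤-trans (s≤s z≤n) j<τ))) large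

    typ-l : ∀ {l u} → typ l u ≡ true → ⟪ d ⟫ ≤ 8ℚ * ⟪ l ⟫
    typ-l {l} {u} e = subst (⟪ d ⟫ ≤_) (trans (⟪⟫-* 8 l) (cong (_* ⟪ l ⟫) (⟪⟫-def 8))) (⟪⟫-mono (≤ᵇ-true (proj₁ (∧-true {d ℕ.≤ᵇ 8 ℕ.* l} e))))

    typ-u : ∀ {l u} → typ l u ≡ true → 64ℚ * (⟪ τ ⟫ * ⟪ u ℕ.∸ l ⟫) ≤ ⟪ d ⟫
    typ-u {l} {u} e = subst (_≤ ⟪ d ⟫) (trans (⟪⟫-* 64 _) (cong₂ _*_ (⟪⟫-def 64) (⟪⟫-* τ _))) (⟪⟫-mono (≤ᵇ-true (proj₂ (∧-true {d ℕ.≤ᵇ 8 ℕ.* l} e))))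

    suc≤ : ∀ {j} → j ℕ.< τ → 1ℚ + ⟪ j ⟫ ≤ ⟪ τ ⟫
    suc≤ {j} j<τ = subst (_≤ ⟪ τ ⟫) (⟪⟫-suc j) (⟪⟫-mono j<τ)

    0<⟪d⟫ : ∀ {j} → j ℕ.< τ → 0ℚ < ⟪ d ⟫
    0<⟪d⟫ j<τ = ⟪⟫-pos (0<d j<τ)

    typ-< : ∀ {j l u} → j ℕ.< τ → typ l u ≡ true → j ℕ.< l
    typ-< {j} {l} {u} j<τ e = ⟪⟫-cancel (subst (_≤ ⟪ l ⟫) (sym (⟪⟫-suc j)) (*-cancelˡ {8ℚ} (ℚₚ.positive⁻¹ 8ℚ)
      (le 4 (λ j t d l → con 8ℚ :* (con 1ℚ :+ j) ⊑ con 8ℚ :* l by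
          (con 8ℚ :* l :- d) :+ (d :- con 128ℚ :* (t :* t)) :+ con 128ℚ :* ((t :- (con 1ℚ :+ j)) :* (t :+ (con 1ℚ :+ j))) :+ (con (pos 120 / 1) :+ con (pos 248 / 1) :* j :+ con 128ℚ :* (j :* j)))
        refl (⟪ j ⟫ ∷ ⟪ τ ⟫ ∷ ⟪ d ⟫ ∷ ⟪ l ⟫ ∷ [])
        (slack (typ-l {l} {u} e) ⊕ slack large′ ⊕ 128ℚ · (slack (suc≤ j<τ) ⊛ (0≤⟪⟫ τ ⊕ (0≤1 ⊕ 0≤⟪⟫ j))) ⊕ (const≥0 (pos 120 / 1) ⊕ (pos 248 / 1) · 0≤⟪⟫ j ⊕ 128ℚ · (0≤⟪⟫ j ⊛ 0≤⟪⟫ j))))))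

    -- A point with v ways up and w ways down is reached by bin w j walks of length j, each from a
    -- point with v + j ways up. As w exceeds v by little, bin w j ≤ 2 bin (v + j) j, so the total
    -- weight is at most 2/v ≤ 32/d.
    density : ∀ v w j → j ℕ.< τ → ⟪ bin w j ⟫ * ρ j (v ℕ.+ j) (w ℕ.∸ j) ≤ 32ℚ * δ
    density v w j j<τ = case (typ (v ℕ.+ j) (w ℕ.∸ j)) refl
      where
      r : ℚ
      r = rc (((v ℕ.+ j) ℕ.∸ j) ℕ.* bin (v ℕ.+ j) j)
      0≤r : 0ℚ ≤ r
      0≤r = 0≤rc (((v ℕ.+ j) ℕ.∸ j) ℕ.* bin (v ℕ.+ j) j)
      case : ∀ b → typ (v ℕ.+ j) (w ℕ.∸ j) ≡ b → ⟪ bin w j ⟫ * (ι (typ (v ℕ.+ j) (w ℕ.∸ j)) * r) ≤ 32ℚ * δ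
      case false e = subst (_≤ 32ℚ * δ) (sym (trans (cong (λ b → ⟪ bin w j ⟫ * (ι b * r)) e) (trans (cong (⟪ bin w j ⟫ *_) (*-zeroˡ r)) (*-zeroʳ _)))) (32ℚ · 0≤rc d)
      case true e = begin
        ⟪ bin w j ⟫ * (ι (typ (v ℕ.+ j) (w ℕ.∸ j)) * r)  ≡⟨ cong (λ b → ⟪ bin w j ⟫ * (ι b * r)) e ⟩
        ⟪ bin w j ⟫ * (1ℚ * r)                ≤⟨ le 3 (λ a r b → a :* (con 1ℚ :* r) ⊑ con 2ℚ :* (b :* r) by (con 2ℚ :* b :- a) :* r) refl (⟪ bin w j ⟫ ∷ r ∷ ⟪ b ⟫ ∷ []) (slack double ⊛ 0≤r) ⟩
        2ℚ * (⟪ b ⟫ * r)                      ≡⟨ sym (trans (cong (2ℚ * (⟪ b ⟫ * r) *_) (rc-inverse (0<d j<τ))) (*-identityʳ _)) ⟩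
        2ℚ * (⟪ b ⟫ * r) * (δ * ⟪ d ⟫)        ≤⟨ le 5 (λ b r δ d v → con 2ℚ :* (b :* r) :* (δ :* d) ⊑ con 32ℚ :* δ :* (r :* (v :* b)) by con 2ℚ :* (b :* r :* δ :* (con 16ℚ :* v :- d))) refl
                                                    (⟪ b ⟫ ∷ r ∷ δ ∷ ⟪ d ⟫ ∷ ⟪ v ⟫ ∷ []) (2ℚ · (0≤⟪⟫ b ⊛ 0≤r ⊛ 0≤rc d ⊛ slack 16v)) ⟩
        32ℚ * δ * (r * (⟪ v ⟫ * ⟪ b ⟫))       ≡⟨ cong (32ℚ * δ *_) (trans (cong₂ _*_ (cong (λ z → rc (z ℕ.* b)) (ℕₚ.m+n∸n≡m v j)) (sym (⟪⟫-* v b))) (rc-inverse {v ℕ.* b} (ℕₚ.*-mono-≤ {1} {v} {1} {b} 0<v (bin-pos (ℕₚ.m≤n+m j v))))) ⟩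
        32ℚ * δ * 1ℚ                          ≡⟨ *-identityʳ _ ⟩
        32ℚ * δ                               ∎
        where
        open ℚₚ.≤-Reasoning
        b D : ℕ
        b = bin (v ℕ.+ j) j
        D = (w ℕ.∸ j) ℕ.∸ (v ℕ.+ j)
        l≥ : ⟪ d ⟫ ≤ 8ℚ * (⟪ v ⟫ + ⟪ j ⟫)
        l≥ = subst (λ z → ⟪ d ⟫ ≤ 8ℚ * z) (⟪⟫-+ v j) (typ-l {v ℕ.+ j} {w ℕ.∸ j} e)
        128j : 128ℚ * ⟪ j ⟫ ≤ ⟪ d ⟫
        128j = le 3 (λ j t d → con 128ℚ :* j ⊑ d by (d :- con 128ℚ :* (t :* t)) :+ con 128ℚ :* ((t :- (con 1ℚ :+ j)) :* (t :+ (con 1ℚ :+ j)) :+ (con 1ℚ :+ j :+ j :* j)))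
          refl (⟪ j ⟫ ∷ ⟪ τ ⟫ ∷ ⟪ d ⟫ ∷ []) (slack large′ ⊕ 128ℚ · (slack (suc≤ j<τ) ⊛ (0≤⟪⟫ τ ⊕ (0≤1 ⊕ 0≤⟪⟫ j)) ⊕ (0≤1 ⊕ 0≤⟪⟫ j ⊕ 0≤⟪⟫ j ⊛ 0≤⟪⟫ j)))
        16v : ⟪ d ⟫ ≤ 16ℚ * ⟪ v ⟫
        16v = le 3 (λ d v j → d ⊑ con 16ℚ :* v by con 2ℚ :* (con 8ℚ :* (v :+ j) :- d) :+ (d :- con 128ℚ :* j) :+ con (pos 112 / 1) :* j) refl (⟪ d ⟫ ∷ ⟪ v ⟫ ∷ ⟪ j ⟫ ∷ [])
          (2ℚ · slack l≥ ⊕ slack 128j ⊕ (pos 112 / 1) · 0≤⟪⟫ j)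
        0<v : 0 ℕ.< v
        0<v = pos′ v 16v
          where
          pos′ : ∀ v → ⟪ d ⟫ ≤ 16ℚ * ⟪ v ⟫ → 0 ℕ.< v
          pos′ zero q = ⊥-elim (ℚₚ.<-irrefl refl (ℚₚ.<-≤-trans (0<⟪d⟫ j<τ) (subst (⟪ d ⟫ ≤_) (trans (cong (16ℚ *_) ⟪0⟫) (*-zeroʳ 16ℚ)) q)))
          pos′ (suc v) q = s≤s z≤n
        j≤τ : ⟪ j ⟫ ≤ ⟪ τ ⟫
        j≤τ = ⟪⟫-mono (ℕₚ.<⇒≤ j<τ)
        -- The constants 128 and 64 are tuned to this condition of `bin-double`: 8 · 2j(2j + D) = 32
        -- j² + 16 jD is at most d/4 + d/4, while 8v ≥ d - 8j ≥ d - d/16.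
        small : 2 ℕ.* (j ℕ.* (2 ℕ.* j ℕ.+ D)) ℕ.≤ v
        small = ⟪⟫-cancel (subst (_≤ ⟪ v ⟫) (sym (trans (⟪⟫-* 2 _) (cong₂ _*_ (⟪⟫-def 2) (trans (⟪⟫-* j _) (cong (⟪ j ⟫ *_) (trans (⟪⟫-+ (2 ℕ.* j) D) (cong (_+ ⟪ D ⟫) (trans (⟪⟫-* 2 j) (cong (_* ⟪ j ⟫) (⟪⟫-def 2))))))))))
          (*-cancelˡ {8ℚ} (ℚₚ.positive⁻¹ 8ℚ) (le 5 (λ j D t d v → con 8ℚ :* (con 2ℚ :* (j :* (con 2ℚ :* j :+ D))) ⊑ con 8ℚ :* v by
              (con 8ℚ :* (v :+ j) :- d) :+ con (pos 1 / 4) :* (d :- con 128ℚ :* (t :* t)) :+ con 32ℚ :* ((t :- j) :* (t :+ j)) :+ con (pos 1 / 4) :* (d :- con 64ℚ :* (t :* D)) :+ con 16ℚ :* ((t :- j) :* D) :+ con (pos 1 / 16) :* (d :- con 128ℚ :* j) :+ con (pos 7 / 16) :* d)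
            refl (⟪ j ⟫ ∷ ⟪ D ⟫ ∷ ⟪ τ ⟫ ∷ ⟪ d ⟫ ∷ ⟪ v ⟫ ∷ [])
            (slack l≥ ⊕ (pos 1 / 4) · slack large′ ⊕ 32ℚ · (slack j≤τ ⊛ (0≤⟪⟫ τ ⊕ 0≤⟪⟫ j)) ⊕ (pos 1 / 4) · slack (typ-u {v ℕ.+ j} {w ℕ.∸ j} e) ⊕ 16ℚ · (slack j≤τ ⊛ 0≤⟪⟫ D) ⊕ (pos 1 / 16) · slack 128j ⊕ (pos 7 / 16) · 0≤⟪⟫ d))))
        w≤ : w ℕ.≤ v ℕ.+ (2 ℕ.* j ℕ.+ D)
        w≤ = ℕₚ.≤-trans (ℕₚ.m≤n+m∸n w j) (ℕₚ.≤-trans (ℕₚ.+-monoʳ-≤ j (ℕₚ.m≤n+m∸n (w ℕ.∸ j) (v ℕ.+ j)))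
          (ℕₚ.≤-reflexive (rearrange j v D)))
          where
          rearrange : ∀ j v D → j ℕ.+ ((v ℕ.+ j) ℕ.+ D) ≡ v ℕ.+ (2 ℕ.* j ℕ.+ D)
          rearrange = +-*-Solver.solve 3 (λ j v D → j +-*-Solver.:+ ((v +-*-Solver.:+ j) +-*-Solver.:+ D) +-*-Solver.:= v +-*-Solver.:+ (+-*-Solver.con 2 +-*-Solver.:* j +-*-Solver.:+ D)) refl
        double : ⟪ bin w j ⟫ ≤ 2ℚ * ⟪ b ⟫
        double = subst (⟪ bin w j ⟫ ≤_) (trans (⟪⟫-* 2 b) (cong (_* ⟪ b ⟫) (⟪⟫-def 2))) (⟪⟫-mono (bin-double v w j (2 ℕ.* j ℕ.+ D) 0<v w≤ small))

  bin-next : ∀ l j → suc j ℕ.* bin l (suc j) ≡ (l ℕ.∸ j) ℕ.* bin l j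
  bin-next l j = trans (sym (ℕₚ.m+n∸n≡m (suc j ℕ.* bin l (suc j)) (j ℕ.* bin l j))) (trans (cong (ℕ._∸ (j ℕ.* bin l j)) (bin-step l j)) (sym (ℕₚ.*-distribʳ-∸ (bin l j) l j)))

  ⟪⟫-∸ : ∀ {a b} → b ℕ.≤ a → ⟪ a ℕ.∸ b ⟫ ≡ ⟪ a ⟫ - ⟪ b ⟫
  ⟪⟫-∸ {a} {b} b≤a = trans (rg 2 (λ x b → x := (x :+ b) :- b) refl (⟪ a ℕ.∸ b ⟫ ∷ ⟪ b ⟫ ∷ [])) (cong (_- ⟪ b ⟫) (trans (sym (⟪⟫-+ (a ℕ.∸ b) b)) (cong ⟪_⟫ (ℕₚ.m∸n+n≡m b≤a))))

  module WalkBound {A : Set} (𝓛 : Line A) {d} (f : Vec A d → Bool) (τ : ℕ) (large : 128 ℕ.* (τ ℕ.* τ) ℕ.≤ d) where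
    open Sorting 𝓛
    open Walk 𝓛
    open Typical d τ large

    l u : Vec A d → ℕ
    l ω = countTrue (L ω)
    u ω = countTrue (U ω)

    typical : Vec A d → Bool
    typical ω = typ (l ω) (u ω)

    ∂ : ℚ
    ∂ = Σ (pts d) (bdry f)

    -- Reversing the walks by `change` collects at each end point z the total weight bounded in
    -- `density`.
    flow : ∀ j → j ℕ.< τ → Σ (pts d) (λ ω → ρ j (l ω) (u ω) * Sub (L ω) j (λ T → bdry f (app T ω))) ≤ 32ℚ * δ * ∂
    flow j j<τ = begin
      Σ (pts d) (λ ω → ρ j (l ω) (u ω) * Sub (L ω) j (λ T → bdry f (app T ω)))
        ≡⟨ Σ-cong (pts d) (λ ω → sym (Sub-*ˡ (L ω) j (ρ j (l ω) (u ω)) _)) ⟩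
      Σ (pts d) (λ ω → Sub (L ω) j (λ T → ρ j (l ω) (u ω) * bdry f (app T ω)))
        ≡⟨ change j (λ _ ω z → ρ j (l ω) (u ω) * bdry f z) ⟩
      Σ (pts d) (λ z → Sub (U z) j (λ T → ρ j (l (app T z)) (u (app T z)) * bdry f z))
        ≡⟨ Σ-cong (pts d) (λ z → trans (Sub-cong-on (U z) j (λ T e c → cong₂ (λ a b → ρ j a b * bdry f z)
             (trans (countL-app T z e) (cong (l z ℕ.+_) c)) (trans (sym (ℕₚ.m+n∸n≡m (u (app T z)) (countTrue T))) (cong₂ ℕ._∸_ (countU-app T z e) c))))
             (Sub-const (U z) j (ρ j (l z ℕ.+ j) (u z ℕ.∸ j) * bdry f z))) ⟩
      Σ (pts d) (λ z → ⟪ bin (u z) j ⟫ * (ρ j (l z ℕ.+ j) (u z ℕ.∸ j) * bdry f z))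
        ≤⟨ Σ-mono (pts d) (λ z → ≤-trans (≤-reflexive (sym (*-assoc _ _ _))) (*-monoʳ (0≤bdry f z) (density (l z) (u z) j j<τ))) ⟩
      Σ (pts d) (λ z → 32ℚ * δ * bdry f z)
        ≡⟨ Σ-*ˡ (pts d) (32ℚ * δ) (bdry f) ⟩
      32ℚ * δ * ∂ ∎
      where open ℚₚ.≤-Reasoning

    -- The chance that f has a different value after s steps up than at ω.
    stay : ℕ → Vec A d → ℚ
    stay s ω = rc (bin (l ω) s) * Away f s ω

    stay-step : ∀ j → j ℕ.< τ → ∀ ω → ι (typical ω) * stay (suc j) ω ≤ ι (typical ω) * stay j ω + ρ j (l ω) (u ω) * Sub (L ω) j (λ T → bdry f (app T ω))
    stay-step j j<τ ω = go (typical ω) refl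
      where
      r G : ℚ
      r = rc ((l ω ℕ.∸ j) ℕ.* bin (l ω) j)
      G = Sub (L ω) j (λ T → bdry f (app T ω))
      go : ∀ b → typical ω ≡ b → ι b * stay (suc j) ω ≤ ι b * stay j ω + ι b * r * G
      go false _ = ≤-reflexive (rg 4 (λ x y r g → con 0ℚ :* x := con 0ℚ :* y :+ con 0ℚ :* r :* g) refl (stay (suc j) ω ∷ stay j ω ∷ r ∷ G ∷ []))
      go true e = begin
        1ℚ * stay (suc j) ω            ≡⟨ cong (λ z → 1ℚ * (z * Away f (suc j) ω)) (sym (rc-unique (bin-pos j<l) (trans (rg 3 (λ r s b → r :* s :* b := r :* (s :* b)) refl (r ∷ ⟪ suc j ⟫ ∷ ⟪ bin (l ω) (suc j) ⟫ ∷ [])) (trans (cong (r *_) (trans (sym (⟪⟫-* (suc j) _)) (cong ⟪_⟫ (bin-next (l ω) j)))) unit)))) ⟩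
        1ℚ * (r * ⟪ suc j ⟫ * Away f (suc j) ω)   ≡⟨ rg 3 (λ r s a → con 1ℚ :* (r :* s :* a) := r :* (s :* a)) refl (r ∷ ⟪ suc j ⟫ ∷ Away f (suc j) ω ∷ []) ⟩
        r * (⟪ suc j ⟫ * Away f (suc j) ω)        ≤⟨ *-monoˡ 0≤r (Away-step f j ω) ⟩
        r * ((⟪ l ω ⟫ - ⟪ j ⟫) * Away f j ω + G)   ≡⟨ rg 4 (λ r k a g → r :* (k :* a :+ g) := con 1ℚ :* (r :* k :* a) :+ con 1ℚ :* r :* g) refl (r ∷ ⟪ l ω ⟫ - ⟪ j ⟫ ∷ Away f j ω ∷ G ∷ []) ⟩
        1ℚ * (r * (⟪ l ω ⟫ - ⟪ j ⟫) * Away f j ω) + 1ℚ * r * G   ≡⟨ cong (λ z → 1ℚ * (z * Away f j ω) + 1ℚ * r * G) (rc-unique (bin-pos (ℕₚ.<⇒≤ j<l)) (trans (cong (λ z → r * z * ⟪ bin (l ω) j ⟫) (sym (⟪⟫-∸ (ℕₚ.<⇒≤ j<l)))) (trans (*-assoc r _ _) (trans (cong (r *_) (sym (⟪⟫-* (l ω ℕ.∸ j) _))) unit)))) ⟩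
        1ℚ * stay j ω + 1ℚ * r * G     ∎
        where
        open ℚₚ.≤-Reasoning
        j<l : j ℕ.< l ω
        j<l = typ-< {j} {l ω} {u ω} j<τ e
        0≤r : 0ℚ ≤ r
        0≤r = 0≤rc ((l ω ℕ.∸ j) ℕ.* bin (l ω) j)
        unit : r * ⟪ (l ω ℕ.∸ j) ℕ.* bin (l ω) j ⟫ ≡ 1ℚ
        unit = rc-inverse (ℕₚ.*-mono-≤ {1} {l ω ℕ.∸ j} {1} {bin (l ω) j} (ℕₚ.m<n⇒0<n∸m j<l) (bin-pos (ℕₚ.<⇒≤ j<l)))

    stay-bound : ∀ s → s ℕ.≤ τ → Σ (pts d) (λ ω → ι (typical ω) * stay s ω) ≤ ⟪ s ⟫ * (32ℚ * δ * ∂)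
    stay-bound zero _ = ≤-reflexive (trans (trans (Σ-cong (pts d) (λ ω → trans (cong (λ z → ι (typical ω) * (rc (bin (l ω) 0) * z)) (Away-0 ω)) (rg 2 (λ a b → a :* (b :* con 0ℚ) := con 0ℚ) refl (ι (typical ω) ∷ rc (bin (l ω) 0) ∷ [])))) (Σ-0 (pts d))) (sym (trans (cong (_* (32ℚ * δ * ∂)) ⟪0⟫) (*-zeroˡ _))))
      where
      Away-0 : ∀ ω → Away f 0 ω ≡ 0ℚ
      Away-0 ω = trans (Sub-zero (L ω) _) (trans (cong (λ z → ι (f ω xor f z)) (app-empty ω)) (cong ι (Boolₚ.xor-same (f ω))))
    stay-bound (suc j) j<τ = begin
      Σ (pts d) (λ ω → ι (typical ω) * stay (suc j) ω)    ≤⟨ Σ-mono (pts d) (stay-step j j<τ) ⟩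
      Σ (pts d) (λ ω → ι (typical ω) * stay j ω + ρ j (l ω) (u ω) * Sub (L ω) j (λ T → bdry f (app T ω)))  ≡⟨ Σ-+ (pts d) _ _ ⟩
      Σ (pts d) (λ ω → ι (typical ω) * stay j ω) + Σ (pts d) (λ ω → ρ j (l ω) (u ω) * Sub (L ω) j (λ T → bdry f (app T ω)))  ≤⟨ +-mono-≤ (stay-bound j (ℕₚ.<⇒≤ j<τ)) (flow j j<τ) ⟩
      ⟪ j ⟫ * (32ℚ * δ * ∂) + 32ℚ * δ * ∂   ≡⟨ rg 2 (λ j x → j :* x :+ x := (con 1ℚ :+ j) :* x) refl (⟪ j ⟫ ∷ 32ℚ * δ * ∂ ∷ []) ⟩
      (1ℚ + ⟪ j ⟫) * (32ℚ * δ * ∂)          ≡⟨ cong (_* (32ℚ * δ * ∂)) (sym (⟪⟫-suc j)) ⟩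
      ⟪ suc j ⟫ * (32ℚ * δ * ∂)             ∎
      where open ℚₚ.≤-Reasoning

    bad-bound : ∀ s → s ℕ.< τ → Σ (pts d) (λ ω → ι (not (f ω)) * (1ℚ - Good f s ω)) ≤ Σ (pts d) (λ ω → ι (not (typical ω))) + ⟪ s ⟫ * (32ℚ * δ * ∂)
    bad-bound s s<τ = ≤-trans (Σ-mono (pts d) (λ ω → point ω (typical ω) refl (f ω) refl)) (≤-trans (≤-reflexive (Σ-+ (pts d) _ _)) (+-monoʳ-≤ _ (stay-bound s (ℕₚ.<⇒≤ s<τ))))
      where
      0≤stay : ∀ ω → 0ℚ ≤ stay s ω
      0≤stay ω = 0≤rc (bin (l ω) s) ⊛ Sub-nonNeg (L ω) s (λ T → 0≤ι (f ω xor f (app T ω)))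
      point : ∀ ω b → typical ω ≡ b → ∀ c → f ω ≡ c → ι (not c) * (1ℚ - Good f s ω) ≤ ι (not b) + ι b * stay s ω
      point ω b _ true _ = ≤-trans (≤-reflexive (*-zeroˡ _)) (0≤ι (not b) ⊕ 0≤ι b ⊛ 0≤stay ω)
      point ω false _ false _ = le 2 (λ g x → con 1ℚ :* (con 1ℚ :- g) ⊑ con 1ℚ :+ con 0ℚ :* x by g) refl (Good f s ω ∷ stay s ω ∷ []) (0≤Good f s ω)
      point ω true e false fω = ≤-reflexive (trans (cong (λ z → 1ℚ * (z - Good f s ω)) (sym total)) (rg 2 (λ g x → con 1ℚ :* ((g :+ x) :- g) := con 0ℚ :+ con 1ℚ :* x) refl (Good f s ω ∷ stay s ω ∷ [])))
        where
        total : Good f s ω + stay s ω ≡ 1ℚ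
        total = trans (sym (*-distribˡ-+ (rc (bin (l ω) s)) _ _)) (trans (cong (rc (bin (l ω) s) *_) (trans (sym (Sub-+ (L ω) s _ _)) (trans (Sub-cong (L ω) s (λ T → trans (cong (λ z → ι (not (f (app T ω))) + ι (z xor f (app T ω))) fω) (one (f (app T ω))))) (Sub-one (L ω) s))))
          (rc-inverse (bin-pos (ℕₚ.<⇒≤ (typ-< {s} {l ω} {u ω} s<τ e)))))
          where
          one : ∀ b → ι (not b) + ι b ≡ 1ℚ
          one true = +-identityˡ 1ℚ
          one false = +-identityʳ 1ℚ

    drift : A → ℚ
    drift p = ι (isHi (st p)) - ι (isLo (st p))

    -- The bichromatic edges number twice the violated ones plus the excess of increasing over
    -- violated ones. That excess is the sum of f(top) - f(bottom) over all edges, so each ω with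
    -- f(ω) = 1 contributes its ways down minus its ways up.
    ∂-split : ∂ ≡ 2ℚ * Viol (full d) f + Σ (pts d) (λ ω → ι (f ω) * vsum drift ω)
    ∂-split = begin
      Σ (pts d) (λ z → Σ (allFin d) (λ i → ι (lookup (L z) i) * ι (f z xor f (flipAt z i))))
        ≡⟨ Σ-cong (pts d) (λ z → trans (Σ-cong (allFin d) (λ i → trans (cong (λ b → ι b * ι (f z xor f (flipAt z i))) (Vecₚ.lookup-map i (isLo ∘ st) z)) (table (isLo (st (lookup z i))) (f z) (f (flipAt z i)))))
             (trans (Σ-+ (allFin d) _ _) (cong₂ _+_ (Σ-*ˡ (allFin d) 2ℚ _) (Σ-- (allFin d) (λ i → lo′ z i * ι (f (flipAt z i))) (λ i → lo′ z i * ι (f z)))))) ⟩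
      Σ (pts d) (λ z → 2ℚ * Σ (allFin d) (λ i → ι (isViol f z i)) + (Σ (allFin d) (λ i → lo′ z i * ι (f (flipAt z i))) - Σ (allFin d) (λ i → lo′ z i * ι (f z))))
        ≡⟨ trans (Σ-+ (pts d) _ _) (cong₂ _+_ (trans (Σ-*ˡ (pts d) 2ℚ _) (cong (2ℚ *_) (sym (Viol-edges f)))) (Σ-- (pts d) _ _)) ⟩
      2ℚ * Viol (full d) f + (Σ (pts d) (λ z → Σ (allFin d) (λ i → lo′ z i * ι (f (flipAt z i)))) - Σ (pts d) (λ z → Σ (allFin d) (λ i → lo′ z i * ι (f z))))
        ≡⟨ cong (λ x → 2ℚ * Viol (full d) f + (x - Σ (pts d) (λ z → Σ (allFin d) (λ i → lo′ z i * ι (f z))))) (trans (Σ-swap (pts d) (allFin d) _) (trans (Σ-cong (allFin d) flipped) (sym (Σ-swap (pts d) (allFin d) _)))) ⟩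
      2ℚ * Viol (full d) f + (Σ (pts d) (λ z → Σ (allFin d) (λ i → hi′ z i * ι (f z))) - Σ (pts d) (λ z → Σ (allFin d) (λ i → lo′ z i * ι (f z))))
        ≡⟨ cong (2ℚ * Viol (full d) f +_) (trans (sym (Σ-- (pts d) _ _)) (Σ-cong (pts d) (λ z → trans (sym (Σ-- (allFin d) _ _)) (trans (Σ-cong (allFin d) (λ i → rg 3 (λ h l f → h :* f :- l :* f := f :* (h :- l)) refl (hi′ z i ∷ lo′ z i ∷ ι (f z) ∷ []))) (Σ-*ˡ (allFin d) (ι (f z)) _))))) ⟩
      2ℚ * Viol (full d) f + Σ (pts d) (λ ω → ι (f ω) * vsum drift ω) ∎
      where
      open ≡-Reasoning
      lo′ hi′ : Vec A d → Fin d → ℚ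
      lo′ z i = ι (isLo (st (lookup z i)))
      hi′ z i = ι (isHi (st (lookup z i)))
      table : ∀ b a c → ι b * ι (a xor c) ≡ 2ℚ * ι (b ∧ (a ∧ not c)) + (ι b * ι c - ι b * ι a)
      table false a c = rg 3 (λ x a c → con 0ℚ :* x := con 2ℚ :* con 0ℚ :+ (con 0ℚ :* c :- con 0ℚ :* a)) refl (ι (a xor c) ∷ ι a ∷ ι c ∷ [])
      table true true true = rg 0 (con 1ℚ :* con 0ℚ := con 2ℚ :* con 0ℚ :+ (con 1ℚ :* con 1ℚ :- con 1ℚ :* con 1ℚ)) refl []
      table true true false = rg 0 (con 1ℚ :* con 1ℚ := con 2ℚ :* con 1ℚ :+ (con 1ℚ :* con 0ℚ :- con 1ℚ :* con 1ℚ)) refl []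
      table true false true = rg 0 (con 1ℚ :* con 1ℚ := con 2ℚ :* con 0ℚ :+ (con 1ℚ :* con 1ℚ :- con 1ℚ :* con 0ℚ)) refl []
      table true false false = rg 0 (con 1ℚ :* con 0ℚ := con 2ℚ :* con 0ℚ :+ (con 1ℚ :* con 0ℚ :- con 1ℚ :* con 0ℚ)) refl []
      flipped : ∀ i → Σ (pts d) (λ z → lo′ z i * ι (f (flipAt z i))) ≡ Σ (pts d) (λ z → hi′ z i * ι (f z))
      flipped i = trans (Σ-cong (pts d) (λ z → cong (λ b → ι b * ι (f (flipAt z i))) (trans (sym (isHi-π (lookup z i))) (cong (isHi ∘ st) (sym (lookup-flipAt z i))))))
        (Enum.Σ-involution (Enum-Vec enum d) (λ z → flipAt z i) (λ z → flipAt-inv z i) (λ z → hi′ z i * ι (f z)))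

    drift-mean : Σ xs drift ≡ 0ℚ
    drift-mean = trans (Σ-- xs _ _) (trans (cong (_- Σ xs (λ p → ι (isLo (st p)))) (trans (sym (Enum.Σ-involution enum π π-inv _)) (Σ-cong xs (λ p → cong ι (isHi-π p))))) (+-inverseʳ _))

    drift² : ∀ p → drift p * drift p ≤ 1ℚ
    drift² p with st p
    ... | lo = ≤-reflexive (rg 0 ((con 0ℚ :- con 1ℚ) :* (con 0ℚ :- con 1ℚ) := con 1ℚ) refl [])
    ... | hi = ≤-reflexive (rg 0 ((con 1ℚ :- con 0ℚ) :* (con 1ℚ :- con 0ℚ) := con 1ℚ) refl [])
    ... | fx = ≤-trans (≤-reflexive (rg 0 ((con 0ℚ :- con 0ℚ) :* (con 0ℚ :- con 0ℚ) := con 0ℚ) refl [])) 0≤1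

    -- The drift has second moment at most d, so its correlation with f is O(√d) on average; `amgm`
    -- states this without the root.
    ∂-bound : ∀ {k κ} → 0ℚ ≤ k → 0ℚ ≤ κ → k * κ ≡ 1ℚ → 2ℚ * ∂ ≤ 4ℚ * Viol (full d) f + (k * (⟪ d ⟫ * vol d) + κ * vol d)
    ∂-bound {k} {κ} 0≤k 0≤κ kκ = begin
      2ℚ * ∂                    ≡⟨ cong (2ℚ *_) ∂-split ⟩
      2ℚ * (2ℚ * Viol (full d) f + X)   ≡⟨ rg 2 (λ v x → con 2ℚ :* (con 2ℚ :* v :+ x) := con 4ℚ :* v :+ con 2ℚ :* x) refl (Viol (full d) f ∷ X ∷ []) ⟩
      4ℚ * Viol (full d) f + 2ℚ * X     ≤⟨ +-monoʳ-≤ _ (≤-trans (≤-reflexive (sym (Σ-*ˡ (pts d) 2ℚ _))) (≤-trans (Σ-mono (pts d) (λ ω → point (f ω) (vsum drift ω)))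
            (≤-trans (≤-reflexive (trans (Σ-+ (pts d) _ _) (cong₂ _+_ (Σ-*ˡ (pts d) k _) (trans (Σ-const-vol d κ) (*-comm _ κ))))) (+-monoˡ-≤ _ (*-monoˡ 0≤k (second-moment drift drift-mean drift² d)))))) ⟩
      4ℚ * Viol (full d) f + (k * (⟪ d ⟫ * vol d) + κ * vol d) ∎
      where
      open ℚₚ.≤-Reasoning
      X : ℚ
      X = Σ (pts d) (λ ω → ι (f ω) * vsum drift ω)
      point : ∀ b v → 2ℚ * (ι b * v) ≤ k * (v * v) + κ
      point true v = ≤-trans (≤-reflexive (cong (2ℚ *_) (*-identityˡ v))) (amgm v 0≤k kκ)
      point false v = ≤-trans (≤-reflexive (rg 1 (λ v → con 2ℚ :* (con 0ℚ :* v) := con 0ℚ) refl (v ∷ []))) (0≤k ⊛ sq-nonNeg v ⊕ 0≤κ)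

    module _ {q} (mean : Σ xs (λ p → ι (isLo (st p))) ≡ q * Σ xs (λ _ → 1ℚ)) (1≤4q : 1ℚ ≤ 4ℚ * q) (q≤1 : q ≤ 1ℚ) where
      0≤q : 0ℚ ≤ q
      0≤q = *-cancelˡ {4ℚ} (ℚₚ.positive⁻¹ 4ℚ) (≤-trans (≤-reflexive (*-zeroʳ 4ℚ)) (≤-trans 0≤1 1≤4q))

      dev : A → ℚ
      dev p = ι (isLo (st p)) - q

      dev-mean : Σ xs dev ≡ 0ℚ
      dev-mean = trans (Σ-- xs _ _) (trans (cong₂ _-_ mean (trans (Σ-cong xs (λ _ → sym (*-identityʳ q))) (Σ-*ˡ xs q _))) (+-inverseʳ _))

      dev² : ∀ p → dev p * dev p ≤ 1ℚ
      dev² p = go (isLo (st p))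
        where
        go : ∀ b → (ι b - q) * (ι b - q) ≤ 1ℚ
        go true = le 1 (λ q → (con 1ℚ :- q) :* (con 1ℚ :- q) ⊑ con 1ℚ by q :* (con 1ℚ :- q) :+ q) refl (q ∷ []) (0≤q ⊛ slack q≤1 ⊕ 0≤q)
        go false = le 1 (λ q → (con 0ℚ :- q) :* (con 0ℚ :- q) ⊑ con 1ℚ by (con 1ℚ :- q) :* (con 1ℚ :+ q)) refl (q ∷ []) (slack q≤1 ⊛ (0≤1 ⊕ 0≤q))

      vsum-dev : ∀ ω → vsum dev ω ≡ ⟪ l ω ⟫ - q * ⟪ d ⟫
      vsum-dev ω = trans (Σ-- (allFin d) _ _) (cong₂ _-_ (vsum-count (isLo ∘ st) ω) (trans (Σ-const (allFin d) q) (trans (cong (λ z → ⟪ z ⟫ * q) (Listₚ.length-tabulate id)) (*-comm _ q))))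

      vsum-drift : ∀ ω → vsum drift ω ≡ ⟪ u ω ⟫ - ⟪ l ω ⟫
      vsum-drift ω = trans (Σ-- (allFin d) _ _) (cong₂ _-_ (vsum-count (isHi ∘ st) ω) (vsum-count (isLo ∘ st) ω))

      -- With fewer than d/8 ways up, their number is at least d/8 below its mean qd ≥ d/4. With too
      -- large an excess of ways down, 64τ times the drift exceeds d. Squaring gives the constants
      -- 64 and 4096τ².
      chebyshev : ∀ ω → ⟪ d ⟫ * ⟪ d ⟫ * ι (not (typical ω)) ≤ 64ℚ * (vsum dev ω * vsum dev ω) + 4096ℚ * (⟪ τ ⟫ * ⟪ τ ⟫) * (vsum drift ω * vsum drift ω)
      chebyshev ω = go (d ℕ.≤ᵇ 8 ℕ.* l ω) refl (64 ℕ.* (τ ℕ.* (u ω ℕ.∸ l ω)) ℕ.≤ᵇ d) refl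
        where
        X Y : ℚ
        X = 64ℚ * (vsum dev ω * vsum dev ω)
        Y = 4096ℚ * (⟪ τ ⟫ * ⟪ τ ⟫) * (vsum drift ω * vsum drift ω)
        0≤X : 0ℚ ≤ X
        0≤X = 64ℚ · sq-nonNeg (vsum dev ω)
        0≤Y : 0ℚ ≤ Y
        0≤Y = 4096ℚ · sq-nonNeg ⟪ τ ⟫ ⊛ sq-nonNeg (vsum drift ω)
        go : ∀ b → (d ℕ.≤ᵇ 8 ℕ.* l ω) ≡ b → ∀ c → (64 ℕ.* (τ ℕ.* (u ω ℕ.∸ l ω)) ℕ.≤ᵇ d) ≡ c → ⟪ d ⟫ * ⟪ d ⟫ * ι (not (b ∧ c)) ≤ X + Y
        go true _ true _ = ≤-trans (≤-reflexive (*-zeroʳ _)) (0≤X ⊕ 0≤Y)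
        go false e c _ = ≤-trans (≤-reflexive (*-identityʳ _)) (≤-trans (square-mono (0≤⟪⟫ d) dist)
          (≤-trans (≤-reflexive (trans (cong (λ z → 8ℚ * (0ℚ - z) * (8ℚ * (0ℚ - z))) (sym (vsum-dev ω))) (rg 1 (λ v → con 8ℚ :* (con 0ℚ :- v) :* (con 8ℚ :* (con 0ℚ :- v)) := con 64ℚ :* (v :* v)) refl (vsum dev ω ∷ []))))
            (le 2 (λ x y → x ⊑ x :+ y by y) refl (X ∷ Y ∷ []) 0≤Y)))
          where
          8l : 8ℚ * ⟪ l ω ⟫ ≤ ⟪ d ⟫
          8l = subst (_≤ ⟪ d ⟫) (trans (⟪⟫-* 8 (l ω)) (cong (_* ⟪ l ω ⟫) (⟪⟫-def 8))) (⟪⟫-mono (ℕₚ.<⇒≤ (≤ᵇ-false e)))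
          dist : ⟪ d ⟫ ≤ 8ℚ * (0ℚ - (⟪ l ω ⟫ - q * ⟪ d ⟫))
          dist = le 3 (λ d l q → d ⊑ con 8ℚ :* (con 0ℚ :- (l :- q :* d)) by con 2ℚ :* ((con 4ℚ :* q :- con 1ℚ) :* d) :+ (d :- con 8ℚ :* l)) refl (⟪ d ⟫ ∷ ⟪ l ω ⟫ ∷ q ∷ []) (2ℚ · (slack 1≤4q ⊛ 0≤⟪⟫ d) ⊕ slack 8l)
        go true _ false e = ≤-trans (≤-reflexive (*-identityʳ _)) (≤-trans (square-mono (0≤⟪⟫ d) dist)
          (≤-trans (≤-reflexive (trans (cong (λ z → 64ℚ * (⟪ τ ⟫ * z) * (64ℚ * (⟪ τ ⟫ * z))) (sym (vsum-drift ω))) (rg 2 (λ t v → con 64ℚ :* (t :* v) :* (con 64ℚ :* (t :* v)) := con 4096ℚ :* (t :* t) :* (v :* v)) refl (⟪ τ ⟫ ∷ vsum drift ω ∷ []))))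
            (le 2 (λ x y → y ⊑ x :+ y by x) refl (X ∷ Y ∷ []) 0≤X)))
          where
          gap : d ℕ.< 64 ℕ.* (τ ℕ.* (u ω ℕ.∸ l ω))
          gap = ≤ᵇ-false e
          l≤u : l ω ℕ.≤ u ω
          l≤u with l ω ℕ.≤? u ω
          ... | yes q = q
          ... | no q = ⊥-elim (ℕₚ.n≮0 (subst (d ℕ.<_) (trans (cong (λ z → 64 ℕ.* (τ ℕ.* z)) (ℕₚ.m≤n⇒m∸n≡0 (ℕₚ.<⇒≤ (ℕₚ.≰⇒> q)))) (cong (64 ℕ.*_) (ℕₚ.*-zeroʳ τ))) gap))
          dist : ⟪ d ⟫ ≤ 64ℚ * (⟪ τ ⟫ * (⟪ u ω ⟫ - ⟪ l ω ⟫))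
          dist = subst (⟪ d ⟫ ≤_) (trans (⟪⟫-* 64 _) (cong₂ _*_ (⟪⟫-def 64) (trans (⟪⟫-* τ _) (cong (⟪ τ ⟫ *_) (⟪⟫-∸ l≤u))))) (⟪⟫-mono (ℕₚ.<⇒≤ gap))

      atypical-bound : 0 ℕ.< d → ⟪ d ⟫ * Σ (pts d) (λ ω → ι (not (typical ω))) ≤ (64ℚ + 4096ℚ * (⟪ τ ⟫ * ⟪ τ ⟫)) * vol d
      atypical-bound 0<d = *-cancelˡ (⟪⟫-pos 0<d) (begin
        ⟪ d ⟫ * (⟪ d ⟫ * Σ (pts d) (λ ω → ι (not (typical ω))))   ≡⟨ trans (sym (*-assoc _ _ _)) (sym (Σ-*ˡ (pts d) _ _)) ⟩
        Σ (pts d) (λ ω → ⟪ d ⟫ * ⟪ d ⟫ * ι (not (typical ω)))      ≤⟨ Σ-mono (pts d) chebyshev ⟩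
        Σ (pts d) (λ ω → 64ℚ * (vsum dev ω * vsum dev ω) + K * (vsum drift ω * vsum drift ω))   ≡⟨ trans (Σ-+ (pts d) _ _) (cong₂ _+_ (Σ-*ˡ (pts d) 64ℚ _) (Σ-*ˡ (pts d) K _)) ⟩
        64ℚ * Σ (pts d) (λ ω → vsum dev ω * vsum dev ω) + K * Σ (pts d) (λ ω → vsum drift ω * vsum drift ω)
          ≤⟨ +-mono-≤ (*-monoˡ (const≥0 64ℚ) (second-moment dev dev-mean dev² d)) (*-monoˡ (4096ℚ · sq-nonNeg ⟪ τ ⟫) (second-moment drift drift-mean drift² d)) ⟩
        64ℚ * (⟪ d ⟫ * vol d) + K * (⟪ d ⟫ * vol d)   ≡⟨ rg 3 (λ d v k → con 64ℚ :* (d :* v) :+ k :* (d :* v) := d :* ((con 64ℚ :+ k) :* v)) refl (⟪ d ⟫ ∷ vol d ∷ K ∷ []) ⟩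
        ⟪ d ⟫ * ((64ℚ + K) * vol d)   ∎)
        where
        open ℚₚ.≤-Reasoning
        K : ℚ
        K = 4096ℚ * (⟪ τ ⟫ * ⟪ τ ⟫)

  Σ-unzip : ∀ {A B : Set} (xs : List A) (ys : List B) d (F : Vec (A × B) d → ℚ) →
    Σ (allVecs (pairs xs ys) d) F ≡ Σ (allVecs xs d) (λ x → Σ (allVecs ys d) (λ y → F (Vec.zip x y)))
  Σ-unzip xs ys zero F = sym (+-identityʳ _)
  Σ-unzip xs ys (suc d) F = begin
    Σ (allVecs (pairs xs ys) (suc d)) F
      ≡⟨ trans (Σ-vec (pairs xs ys) d F) (Σ-pairs xs ys _) ⟩
    Σ xs (λ a → Σ ys (λ b → Σ (allVecs (pairs xs ys) d) (λ v → F ((a , b) ∷ v))))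
      ≡⟨ Σ-cong xs (λ a → trans (Σ-cong ys (λ b → Σ-unzip xs ys d (λ v → F ((a , b) ∷ v)))) (Σ-swap ys (allVecs xs d) _)) ⟩
    Σ xs (λ a → Σ (allVecs xs d) (λ x → Σ ys (λ b → Σ (allVecs ys d) (λ y → F ((a , b) ∷ Vec.zip x y)))))
      ≡⟨ sym (trans (Σ-vec xs d _) (Σ-cong xs (λ a → Σ-cong (allVecs xs d) (λ x → Σ-vec ys d _)))) ⟩
    Σ (allVecs xs (suc d)) (λ x → Σ (allVecs ys (suc d)) (λ y → F (Vec.zip x y))) ∎
    where open ≡-Reasoning

  Σ-allFin-term : ∀ (i : Fin d) {g : Fin d → ℚ} → (∀ j → 0ℚ ≤ g j) → g i ≤ Σ (allFin d) g
  Σ-allFin-term {suc d} zero {g} 0≤g = subst (g zero ≤_) (sym (Σ-allFin-suc d g)) (le 2 (λ a s → a ⊑ a :+ s by s) refl (g zero ∷ _ ∷ []) (Σ-nonNeg (allFin d) (0≤g ∘ suc)))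
  Σ-allFin-term {suc d} (suc i) {g} 0≤g = subst (g (suc i) ≤_) (sym (Σ-allFin-suc d g)) (≤-trans (Σ-allFin-term i (0≤g ∘ suc)) (le 2 (λ a s → s ⊑ a :+ s by a) refl (g zero ∷ _ ∷ []) (0≤g zero)))

  subset-lookup : ∀ (T S : Cube d) i → subsetᵇ T S ≡ true → lookup S i ≡ false → lookup T i ≡ false
  subset-lookup (false ∷ T) (b ∷ S) zero _ _ = refl
  subset-lookup (true ∷ T) (true ∷ S) zero _ ()
  subset-lookup (false ∷ T) (b ∷ S) (suc i) e s = subset-lookup T S i e s
  subset-lookup (true ∷ T) (true ∷ S) (suc i) e s = subset-lookup T S i e s

  -- T ↦ T ∪ {i} maps the s-sets avoiding i injectively to (s+1)-sets.
  Sub-insert : ∀ (S : Cube d) s i → lookup S i ≡ true → ∀ {g : Cube d → ℚ} → (∀ T → 0ℚ ≤ g T) → Sub (S [ i ]≔ false) s (λ T → g (T [ i ]≔ true)) ≤ Sub S (suc s) g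
  Sub⁺-insert : ∀ (S : Cube d) s i → lookup S i ≡ true → ∀ {g : Cube d → ℚ} → (∀ T → 0ℚ ≤ g T) → Sub⁺ (S [ i ]≔ false) s (λ T → g (T [ i ]≔ true)) ≤ Sub S s g
  Sub-insert (true ∷ S) s zero e {g} 0≤g = le 3 (λ x y z → x :+ con 0ℚ :* y ⊑ z :+ con 1ℚ :* x by z) refl (Sub S s (g ∘ (true ∷_)) ∷ _ ∷ Sub S (suc s) (g ∘ (false ∷_)) ∷ []) (Sub-nonNeg S (suc s) (λ T → 0≤g (false ∷ T)))
  Sub-insert (b ∷ S) s (suc i) e 0≤g = +-mono-≤ (Sub-insert S s i e (λ T → 0≤g (false ∷ T))) (*-monoˡ (0≤ι b) (Sub⁺-insert S s i e (λ T → 0≤g (true ∷ T))))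
  Sub⁺-insert S zero i e 0≤g = Sub-nonNeg S zero 0≤g
  Sub⁺-insert S (suc s) i e 0≤g = Sub-insert S s i e 0≤g

  countTrue-remove : ∀ (S : Cube d) i → lookup S i ≡ true → countTrue S ≡ suc (countTrue (S [ i ]≔ false))
  countTrue-remove (true ∷ S) zero e = refl
  countTrue-remove (true ∷ S) (suc i) e = cong suc (countTrue-remove S i e)
  countTrue-remove (false ∷ S) (suc i) e = countTrue-remove S i e

  countTrue≤ : ∀ (S : Cube d) → countTrue S ℕ.≤ d
  countTrue≤ [] = z≤n
  countTrue≤ (true ∷ S) = s≤s (countTrue≤ S)
  countTrue≤ (false ∷ S) = ℕₚ.m≤n⇒m≤1+n (countTrue≤ S)

  -- A random class in every direction

  rc-bin : ∀ l s → ⟪ suc s ⟫ * rc (bin l s) ≤ ⟪ suc l ⟫ * rc (bin (suc l) (suc s))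
  rc-bin l s = go (bin l s) (bin (suc l) (suc s)) (bin-absorb l s)
    where
    go : ∀ b′ b → suc s ℕ.* b ≡ suc l ℕ.* b′ → ⟪ suc s ⟫ * rc b′ ≤ ⟪ suc l ⟫ * rc b
    go zero b e = ≤-trans (≤-reflexive (*-zeroʳ _)) (0≤⟪⟫ (suc l) ⊛ 0≤rc b)
    go (suc b′) zero e with () ← trans (sym e) (ℕₚ.*-zeroʳ (suc s))
    go (suc b′) (suc b) e = ≤-reflexive (begin
      S * r′                               ≡⟨ sym (*-identityʳ _) ⟩
      S * r′ * 1ℚ                          ≡⟨ cong (S * r′ *_) (sym (rc-inverse {suc b} (s≤s z≤n))) ⟩
      S * r′ * (r * ⟪ suc b ⟫)             ≡⟨ rg 4 (λ s r′ r b → s :* r′ :* (r :* b) := r′ :* r :* (s :* b)) refl (S ∷ r′ ∷ r ∷ ⟪ suc b ⟫ ∷ []) ⟩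
      r′ * r * (S * ⟪ suc b ⟫)             ≡⟨ cong (r′ * r *_) (trans (sym (⟪⟫-* (suc s) (suc b))) (trans (cong ⟪_⟫ e) (⟪⟫-* (suc l) (suc b′)))) ⟩
      r′ * r * (⟪ suc l ⟫ * ⟪ suc b′ ⟫)    ≡⟨ rg 4 (λ r′ r l b → r′ :* r :* (l :* b) := l :* r :* (r′ :* b)) refl (r′ ∷ r ∷ ⟪ suc l ⟫ ∷ ⟪ suc b′ ⟫ ∷ []) ⟩
      ⟪ suc l ⟫ * r * (r′ * ⟪ suc b′ ⟫)    ≡⟨ trans (cong (⟪ suc l ⟫ * r *_) (rc-inverse {suc b′} (s≤s z≤n))) (*-identityʳ _) ⟩
      ⟪ suc l ⟫ * r                        ∎)
      where
      open ≡-Reasoning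
      S r r′ : ℚ
      S = ⟪ suc s ⟫
      r = rc (suc b)
      r′ = rc (suc b′)

  rc*≤1 : ∀ b → rc b * ⟪ b ⟫ ≤ 1ℚ
  rc*≤1 zero = ≤-trans (≤-reflexive (*-zeroˡ _)) 0≤1
  rc*≤1 (suc b) = ≤-reflexive (rc-inverse {suc b} (s≤s z≤n))

  map-proj₁-zip : ∀ {A B : Set} (x : Vec A d) (y : Vec B d) → Vec.map proj₁ (Vec.zip x y) ≡ x
  map-proj₁-zip [] [] = refl
  map-proj₁-zip (a ∷ x) (b ∷ y) = cong (a ∷_) (map-proj₁-zip x y)

  zip-update : ∀ {A B : Set} (x : Vec A d) (y : Vec B d) i b → Vec.zip x (y [ i ]≔ b) ≡ Vec.zip x y [ i ]≔ (lookup x i , b)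
  zip-update (a ∷ x) (_ ∷ y) zero b = refl
  zip-update (a ∷ x) (c ∷ y) (suc i) b = cong ((a , c) ∷_) (zip-update x y i b)

  module Family {A H : Set} (EA : Enum A) (EH : Enum H) (ℓ : H → Line A) where
    -- Each coordinate of a point carries its own class, and moving does not change it. The randomly
    -- chosen matchings of the tester thereby become one matching on A × H, to which everything
    -- proved for a single line applies.
    Ω : Line (A × H)
    Ω = record
      { enum = Enum-× EA EH
      ; π = λ (p , h) → Line.π (ℓ h) p , h
      ; st = λ (p , h) → Line.st (ℓ h) p
      ; π-inv = λ (p , h) → cong (_, h) (Line.π-inv (ℓ h) p)
      ; st-lo = λ (p , h) → Line.st-lo (ℓ h) p
      ; st-hi = λ (p , h) → Line.st-hi (ℓ h) p
      ; st-fx = λ (p , h) e → cong (_, h) (Line.st-fx (ℓ h) p e) }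

    open Sorting Ω hiding (M)
    open Walk Ω
    module I = Independent (elems EH)
    open I using (M; 0≤M)

    X : Vec (A × H) d → Vec A d
    X = Vec.map proj₁

    flip : H → Vec A d → Fin d → Vec A d
    flip h = Sorting.flipAt (ℓ h)

    X-flip : ∀ (ω : Vec (A × H) d) i → X (flipAt ω i) ≡ flip (proj₂ (lookup ω i)) (X ω) i
    X-flip (q ∷ ω) zero = refl
    X-flip (q ∷ ω) (suc i) = cong (proj₁ q ∷_) (X-flip ω i)

    L-flip : ∀ (ω : Vec (A × H) d) i → lookup (L ω) i ≡ true → L (flipAt ω i) ≡ L ω [ i ]≔ false
    L-flip (q ∷ ω) zero e = cong (_∷ L ω) (isLo-π-lo {q} e)
    L-flip (q ∷ ω) (suc i) e = cong (isLo (st q) ∷_) (L-flip ω i e)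

    app-insert : ∀ T (ω : Vec (A × H) d) i → lookup T i ≡ false → app (T [ i ]≔ true) ω ≡ app T (flipAt ω i)
    app-insert (false ∷ T) (q ∷ ω) zero e = refl
    app-insert (b ∷ T) (q ∷ ω) (suc i) e = cong (act b q ∷_) (app-insert T ω i e)

    X-app : ∀ T (ω : Vec (A × H) d) i → lookup T i ≡ false → ∀ {q q′} → proj₁ q ≡ proj₁ q′ → X (app T (ω [ i ]≔ q)) ≡ X (app T (ω [ i ]≔ q′))
    X-app (false ∷ T) (_ ∷ ω) zero e eq = cong (_∷ X (app T ω)) eq
    X-app (b ∷ T) (q ∷ ω) (suc i) e eq = cong (proj₁ (act b q) ∷_) (X-app T ω i e eq)

    module _ {d} (f : Vec A d → Bool) where
      f̂ : Vec (A × H) d → Bool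
      f̂ ω = f (X ω)

      isViol-Ω : ∀ ω i → isViol f̂ ω i ≡ Sorting.isViol (ℓ (proj₂ (lookup ω i))) f (X ω) i
      isViol-Ω ω i = cong₂ (λ p y → isLo (Line.st (ℓ (proj₂ (lookup ω i))) p) ∧ (f (X ω) ∧ not (f y))) (sym (Vecₚ.lookup-map i proj₁ ω)) (X-flip ω i)

      steps : ℕ → Vec (A × H) d → ℚ
      steps τ ω = rc (bin (countTrue (L ω)) τ) * Sub (L ω) τ (λ T → ι (f̂ ω ∧ not (f̂ (app T ω))))

      0≤steps : ∀ τ ω → 0ℚ ≤ steps τ ω
      0≤steps τ ω = 0≤rc (bin (countTrue (L ω)) τ) ⊛ Sub-nonNeg (L ω) τ (λ T → 0≤ι (f̂ ω ∧ not (f̂ (app T ω))))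

      bin-1 : ∀ n → bin n 1 ≡ n
      bin-1 zero = refl
      bin-1 (suc n) = cong suc (bin-1 n)

      Sub-1 : ∀ ω → Sub (L ω) 1 (λ T → ι (f̂ ω ∧ not (f̂ (app T ω)))) ≡ Σ (allFin d) (λ i → ι (isViol f̂ ω i))
      Sub-1 ω = begin
        Sub (L ω) 1 (λ T → ι (f̂ ω ∧ not (f̂ (app T ω))))
          ≡⟨ Sub-cong-on (L ω) 1 (λ T _ c → trans (sym (trans (elemSum-const T _) (trans (cong (λ k → ⟪ k ⟫ * ι (f̂ ω ∧ not (f̂ (app T ω)))) c) (trans (cong (_* ι (f̂ ω ∧ not (f̂ (app T ω)))) ⟪1⟫) (*-identityˡ _)))))
               (Σ-cong (allFin d) (λ i → on (lookup T i) (λ e → cong (λ y → ι (f̂ ω ∧ not (f̂ y))) (app-flip T ω i e))))) ⟩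
        Sub (L ω) 1 (λ T → elemSum T (λ i → g i (T [ i ]≔ false)))
          ≡⟨ Sub-pointed (L ω) 0 g ⟩
        Pt (L ω) 0 g
          ≡⟨ Σ-cong (allFin d) (λ i → trans (cong₂ (λ b z → ι b * z) (Vecₚ.lookup-map i (isLo ∘ st) ω) (trans (Sub-zero (L ω [ i ]≔ false) (g i)) (cong (λ y → ι (f̂ ω ∧ not (f̂ (flipAt y i)))) (app-empty ω)))) (sym (ι-∧ (isLo (st (lookup ω i))) _))) ⟩
        Σ (allFin d) (λ i → ι (isViol f̂ ω i)) ∎
        where
        open ≡-Reasoning
        g : Fin d → Cube d → ℚ
        g i T = ι (f̂ ω ∧ not (f̂ (flipAt (app T ω) i)))
        on : ∀ b {x y : ℚ} → (b ≡ true → x ≡ y) → ι b * x ≡ ι b * y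
        on true q = cong (1ℚ *_) (q refl)
        on false {x} {y} q = trans (*-zeroˡ x) (sym (*-zeroˡ y))

      -- A walk of length 1 takes each way up with probability 1 / |L ω|, which is at least 1/d.
      step-one : ∀ ω → Σ (allFin d) (λ i → ι (isViol f̂ ω i)) ≤ ⟪ d ⟫ * steps 1 ω
      step-one ω = go (countTrue (L ω)) refl
        where
        v : ℚ
        v = Σ (allFin d) (λ i → ι (isViol f̂ ω i))
        0≤v : 0ℚ ≤ v
        0≤v = Σ-nonNeg (allFin d) (λ i → 0≤ι (isViol f̂ ω i))
        v≤l : v ≤ ⟪ countTrue (L ω) ⟫
        v≤l = ≤-trans (Σ-mono (allFin d) (λ i → ≤-trans (≤-reflexive (ι-∧ (isLo (st (lookup ω i))) _)) (≤-trans (*-monoˡ (0≤ι (isLo (st (lookup ω i)))) (ι≤1 (f̂ ω ∧ not (f̂ (flipAt ω i))))) (≤-reflexive (*-identityʳ _))))) (≤-reflexive (vsum-count (isLo ∘ st) ω))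
        go : ∀ l → countTrue (L ω) ≡ l → v ≤ ⟪ d ⟫ * steps 1 ω
        go zero e = ≤-trans v≤l (≤-trans (≤-reflexive (trans (cong ⟪_⟫ e) ⟪0⟫)) (0≤⟪⟫ d ⊛ 0≤steps 1 ω))
        go (suc l) e = begin
          v                                   ≡⟨ sym (*-identityˡ v) ⟩
          1ℚ * v                              ≡⟨ cong (_* v) (sym (rc-inverse {suc l} (s≤s z≤n))) ⟩
          rc (suc l) * ⟪ suc l ⟫ * v          ≤⟨ le 4 (λ r l v d → r :* l :* v ⊑ d :* (r :* v) by (d :- l) :* (r :* v)) refl (rc (suc l) ∷ ⟪ suc l ⟫ ∷ v ∷ ⟪ d ⟫ ∷ [])
                                                   (slack (⟪⟫-mono (subst (ℕ._≤ d) e (countTrue≤ (L ω)))) ⊛ (0≤rc (suc l) ⊛ 0≤v)) ⟩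
          ⟪ d ⟫ * (rc (suc l) * v)            ≡⟨ cong (⟪ d ⟫ *_) (cong₂ _*_ (cong rc (sym (trans (bin-1 _) e))) (sym (Sub-1 ω))) ⟩
          ⟪ d ⟫ * steps 1 ω                   ∎
          where open ℚₚ.≤-Reasoning

      Good≤1 : ∀ s ω → Good f̂ s ω ≤ 1ℚ
      Good≤1 s ω = ≤-trans (*-monoˡ (0≤rc (bin (countTrue (L ω)) s)) (≤-trans (Sub-mono-on (L ω) s (λ T _ _ → ι≤1 (not (f̂ (app T ω))))) (≤-reflexive (Sub-one (L ω) s)))) (rc*≤1 (bin (countTrue (L ω)) s))

      -- A set of s + 1 ways up contains i with probability (s + 1) / |L ω| ≥ (s + 1)/d. Steps in
      -- different directions commute, so i may come first; it leads to a zero of f, and the other s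
      -- steps form a uniform walk from there.
      step-hit : ∀ s ω i → isViol f̂ ω i ≡ true → ⟪ suc s ⟫ * Good f̂ s (flipAt ω i) ≤ ⟪ d ⟫ * steps (suc s) ω
      step-hit s ω i v = begin
        ⟪ suc s ⟫ * Good f̂ s (flipAt ω i)
          ≡⟨ cong (⟪ suc s ⟫ *_) (trans (cong (λ S → rc (bin (countTrue S) s) * Sub S s (λ T → ι (not (f̂ (app T (flipAt ω i)))))) (L-flip ω i lo′))
               (cong (rc (bin l′ s) *_) (Sub-cong-on S′ s (λ T e _ → cong₂ (λ a y → ι (a ∧ not (f̂ y))) (sym fω) (sym (app-insert T ω i (subset-lookup T S′ i e (Vecₚ.lookup∘update i (L ω) false)))))))) ⟩
        ⟪ suc s ⟫ * (rc (bin l′ s) * SG)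
          ≤⟨ ≤-trans (≤-reflexive (sym (*-assoc _ _ SG))) (*-monoʳ 0≤SG (rc-bin l′ s)) ⟩
        ⟪ suc l′ ⟫ * rc (bin (suc l′) (suc s)) * SG
          ≡⟨ cong (λ k → ⟪ k ⟫ * rc (bin k (suc s)) * SG) (sym (countTrue-remove (L ω) i lo′)) ⟩
        ⟪ countTrue (L ω) ⟫ * rc b * SG
          ≤⟨ le 5 (λ l r g d t → l :* r :* g ⊑ d :* (r :* t) by (d :- l) :* (r :* t) :+ l :* (r :* (t :- g))) refl (⟪ countTrue (L ω) ⟫ ∷ rc b ∷ SG ∷ ⟪ d ⟫ ∷ SB ∷ [])
               (slack (⟪⟫-mono (countTrue≤ (L ω))) ⊛ (0≤rc b ⊛ Sub-nonNeg (L ω) (suc s) nn) ⊕ 0≤⟪⟫ (countTrue (L ω)) ⊛ (0≤rc b ⊛ slack (Sub-insert (L ω) s i lo′ nn))) ⟩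
        ⟪ d ⟫ * steps (suc s) ω ∎
        where
        open ℚₚ.≤-Reasoning
        lo′ : lookup (L ω) i ≡ true
        lo′ = trans (Vecₚ.lookup-map i (isLo ∘ st) ω) (proj₁ (∧-true v))
        fω : f̂ ω ≡ true
        fω = proj₁ (∧-true {f̂ ω} (proj₂ (∧-true {isLo (st (lookup ω i))} v)))
        S′ : Cube d
        S′ = L ω [ i ]≔ false
        l′ b : ℕ
        l′ = countTrue S′
        b = bin (countTrue (L ω)) (suc s)
        nn : ∀ T → 0ℚ ≤ ι (f̂ ω ∧ not (f̂ (app T ω)))
        nn T = 0≤ι (f̂ ω ∧ not (f̂ (app T ω)))
        SG SB : ℚ
        SG = Sub S′ s (λ T → ι (f̂ ω ∧ not (f̂ (app (T [ i ]≔ true) ω))))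
        SB = Sub (L ω) (suc s) (λ T → ι (f̂ ω ∧ not (f̂ (app T ω))))
        0≤SG : 0ℚ ≤ SG
        0≤SG = Sub-nonNeg S′ s (λ T → 0≤ι (f̂ ω ∧ not (f̂ (app (T [ i ]≔ true) ω))))

      -- A coordinate that cannot move up does not influence the walk.
      Good-resample : ∀ s ω i {q q′} → proj₁ q ≡ proj₁ q′ → isLo (st q) ≡ false → isLo (st q′) ≡ false → Good f̂ s (ω [ i ]≔ q) ≡ Good f̂ s (ω [ i ]≔ q′)
      Good-resample s ω i {q} {q′} eq n n′ = begin
        Good f̂ s (ω [ i ]≔ q)   ≡⟨ cong (λ S → rc (bin (countTrue S) s) * Sub S s (λ T → ι (not (f̂ (app T (ω [ i ]≔ q)))))) (removed q n) ⟩
        rc (bin (countTrue S′) s) * Sub S′ s (λ T → ι (not (f̂ (app T (ω [ i ]≔ q)))))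
          ≡⟨ cong (rc (bin (countTrue S′) s) *_) (Sub-cong-on S′ s (λ T e _ → cong (λ x → ι (not (f x))) (X-app T ω i (subset-lookup T S′ i e (Vecₚ.lookup∘update i (L ω) false)) eq))) ⟩
        rc (bin (countTrue S′) s) * Sub S′ s (λ T → ι (not (f̂ (app T (ω [ i ]≔ q′)))))
          ≡⟨ cong (λ S → rc (bin (countTrue S) s) * Sub S s (λ T → ι (not (f̂ (app T (ω [ i ]≔ q′)))))) (sym (removed q′ n′)) ⟩
        Good f̂ s (ω [ i ]≔ q′)  ∎
        where
        open ≡-Reasoning
        S′ : Cube d
        S′ = L ω [ i ]≔ false
        removed : ∀ q → isLo (st q) ≡ false → L (ω [ i ]≔ q) ≡ S′
        removed q n = trans (Vecₚ.map-[]≔ (isLo ∘ st) ω i) (cong (L ω [ i ]≔_) n)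

      Σ-independent : ∀ (φ : Vec A d → Fin d → H → ℚ) → ∀ x v → Σ (allFin d) (λ i → φ (X (Vec.zip x v)) i (proj₂ (lookup (Vec.zip x v) i))) ≡ I.total (φ x) v
      Σ-independent φ x v = Σ-cong (allFin d) (λ i → cong₂ (λ y q → φ y i (proj₂ q)) (map-proj₁-zip x v) (Vecₚ.lookup-zip i x v))

      mean-Ω : ∀ (φ : Vec A d → Fin d → H → ℚ) →
        M * Σ (pts d) (λ ω → Σ (allFin d) (λ i → φ (X ω) i (proj₂ (lookup ω i)))) ≡ I.vol d * Σ (allVecs (elems EA) d) (λ x → I.weight (φ x))
      mean-Ω φ = trans (cong (M *_) (trans (Σ-unzip (elems EA) (elems EH) d _) (Σ-cong pts₁ (λ x → Σ-cong (allVecs (elems EH) d) (Σ-independent φ x)))))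
        (trans (sym (Σ-*ˡ pts₁ M _)) (trans (Σ-cong pts₁ (λ x → I.total-mean (φ x))) (Σ-*ˡ pts₁ (I.vol d) _)))
        where
        pts₁ : List (Vec A d)
        pts₁ = allVecs (elems EA) d

      Viol-mean : M * Viol (full d) f̂ ≡ I.vol d * Σ (allVecs (elems EA) d) (λ x → I.weight (λ i h → ι (Sorting.isViol (ℓ h) f x i)))
      Viol-mean = trans (cong (M *_) (trans (Viol-edges f̂) (Σ-cong (pts d) (λ ω → Σ-cong (allFin d) (λ i → cong ι (isViol-Ω ω i)))))) (mean-Ω (λ x i h → ι (Sorting.isViol (ℓ h) f x i)))

      -- `free` says that at every position at least half of the classes offer no way up. It makes
      -- the resampling in `spread` possible.
      module Matched
        (wb : H → Vec A d → Fin d → Bool)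
        (w-viol : ∀ h x i → wb h x i ≡ true → Sorting.isViol (ℓ h) f x i ≡ true)
        (w-bot : ∀ h x → Σ (allFin d) (λ i → ι (wb h x i)) ≤ 1ℚ)
        (w-top : ∀ h y → Σ (allFin d) (λ i → ι (wb h (flip h y i) i)) ≤ 1ℚ)
        (free : ∀ p → M ≤ 2ℚ * Σ (elems EH) (λ h → ι (not (isLo (Line.st (ℓ h) p)))))
        (0<M : 0ℚ < M) where

        hs : List H
        hs = elems EH

        pts₁ : List (Vec A d)
        pts₁ = allVecs (elems EA) d

        vecs : List (Vec H d)
        vecs = allVecs hs d

        w : Vec (A × H) d → Fin d → Bool
        w ω i = wb (proj₂ (lookup ω i)) (X ω) i

        k : Vec (A × H) d → ℚ
        k ω = Σ (allFin d) (λ i → ι (w ω i))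

        bad : ℕ → Vec (A × H) d → ℚ
        bad s ω = 1ℚ - Good f̂ s ω

        0≤bad : ∀ s ω → 0ℚ ≤ bad s ω
        0≤bad s ω = slack (Good≤1 s ω)

        -- Since k - k²/4 ≤ 1 for every k, a single matched edge gives the bound through `step-hit`,
        -- the terms of the other edges being nonnegative. The quadratic form lets the bound be
        -- summed over ω by means of second moments.
        step-many : ∀ s ω → ⟪ suc s ⟫ * (k ω - (pos 1 / 4) * (k ω * k ω) - Σ (allFin d) (λ i → ι (w ω i) * bad s (flipAt ω i))) ≤ ⟪ d ⟫ * steps (suc s) ω
        step-many s ω with Finₚ.any? (λ i → w ω i Boolₚ.≟ true)
        ... | yes (i , e) = ≤-trans (*-monoˡ (0≤⟪⟫ (suc s)) (le 3 (λ k m g → k :- con (pos 1 / 4) :* (k :* k) :- m ⊑ g by (con 1ℚ :- con ½ :* k) :* (con 1ℚ :- con ½ :* k) :+ (m :- (con 1ℚ :- g))) refl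
                (k ω ∷ m ∷ Good f̂ s (flipAt ω i) ∷ []) (sq-nonNeg _ ⊕ slack term)))
              (step-hit s ω i (trans (isViol-Ω ω i) (w-viol _ (X ω) i e)))
          where
          m : ℚ
          m = Σ (allFin d) (λ i → ι (w ω i) * bad s (flipAt ω i))
          term : bad s (flipAt ω i) ≤ m
          term = subst (_≤ m) (trans (cong (λ b → ι b * bad s (flipAt ω i)) e) (*-identityˡ _)) (Σ-allFin-term i (λ j → 0≤ι (w ω j) ⊛ 0≤bad s (flipAt ω j)))
        ... | no none = ≤-trans (≤-reflexive (trans (cong₂ (λ a b → ⟪ suc s ⟫ * (a - (pos 1 / 4) * (a * a) - b)) k≡0 m≡0) (rg 1 (λ s → s :* (con 0ℚ :- con (pos 1 / 4) :* (con 0ℚ :* con 0ℚ) :- con 0ℚ) := con 0ℚ) refl (⟪ suc s ⟫ ∷ [])))) (0≤⟪⟫ d ⊛ 0≤steps (suc s) ω)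
          where
          w≡0 : ∀ i → ι (w ω i) ≡ 0ℚ
          w≡0 i = cong ι (Boolₚ.¬-not (λ e → none (i , e)))
          k≡0 : k ω ≡ 0ℚ
          k≡0 = trans (Σ-cong (allFin d) w≡0) (Σ-0 (allFin d))
          m≡0 : Σ (allFin d) (λ i → ι (w ω i) * bad s (flipAt ω i)) ≡ 0ℚ
          m≡0 = trans (Σ-cong (allFin d) (λ i → trans (cong (_* bad s (flipAt ω i)) (w≡0 i)) (*-zeroˡ _))) (Σ-0 (allFin d))

        φ : Vec A d → Fin d → H → ℚ
        φ x i h = ι (wb h x i)

        weight≤M : ∀ x → I.weight (φ x) ≤ M
        weight≤M x = ≤-trans (≤-reflexive (Σ-swap (allFin d) hs _)) (Σ-mono hs (λ h → w-bot h x))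

        ι-idem : ∀ b → ι b * ι b ≤ ι b
        ι-idem true = ≤-reflexive (*-identityˡ 1ℚ)
        ι-idem false = ≤-reflexive (*-zeroˡ 0ℚ)

        -- For a fixed point x the terms of `k` are independent and their means add up to at most 1
        -- (`weight≤M`), so mean + mean² ≤ 2 mean.
        k-square : Σ (pts d) (λ ω → k ω * k ω) ≤ 2ℚ * Σ (pts d) k
        k-square = *-cancelˡ (*-pos 0<M 0<M) (begin
          M * M * Σ (pts d) (λ ω → k ω * k ω)
            ≡⟨ cong (M * M *_) (trans (Σ-unzip (elems EA) hs d _) (Σ-cong pts₁ (λ x → Σ-cong vecs (λ v → cong (λ z → z * z) (Σ-independent φ x v))))) ⟩
          M * M * Σ pts₁ (λ x → Σ vecs (λ v → I.total (φ x) v * I.total (φ x) v))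
            ≡⟨ sym (Σ-*ˡ pts₁ (M * M) _) ⟩
          Σ pts₁ (λ x → M * M * Σ vecs (λ v → I.total (φ x) v * I.total (φ x) v))
            ≤⟨ Σ-mono pts₁ (λ x → ≤-trans (I.total-square (φ x) (λ i h → ι-idem (wb h x i)))
                 (le 3 (λ v m q → v :* (m :* q :+ q :* q) ⊑ con 2ℚ :* m :* (v :* q) by v :* (q :* (m :- q))) refl (I.vol d ∷ M ∷ I.weight (φ x) ∷ [])
                   (I.0≤vol d ⊛ (Σ-nonNeg (allFin d) (λ i → Σ-nonNeg hs (λ h → 0≤ι (wb h x i))) ⊛ slack (weight≤M x))))) ⟩
          Σ pts₁ (λ x → 2ℚ * M * (I.vol d * I.weight (φ x)))
            ≡⟨ trans (Σ-*ˡ pts₁ (2ℚ * M) _) (cong (2ℚ * M *_) (Σ-*ˡ pts₁ (I.vol d) _)) ⟩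
          2ℚ * M * (I.vol d * Σ pts₁ (λ x → I.weight (φ x)))
            ≡⟨ cong (2ℚ * M *_) (sym (mean-Ω φ)) ⟩
          2ℚ * M * (M * Σ (pts d) k)
            ≡⟨ rg 2 (λ m k → con 2ℚ :* m :* (m :* k) := m :* m :* (con 2ℚ :* k)) refl (M ∷ Σ (pts d) k ∷ []) ⟩
          M * M * (2ℚ * Σ (pts d) k) ∎)
          where open ℚₚ.≤-Reasoning

        -- Whether y is the upper end of a matched edge of class h in direction i.
        cb : H → Vec A d → Fin d → Bool
        cb h y i = wb h (flip h y i) i

        cb-hi : ∀ h y i → cb h y i ≡ true → isLo (Line.st (ℓ h) (lookup y i)) ≡ false
        cb-hi h y i e = cong isLo (trans (cong (Line.st (ℓ h)) (sym (Line.π-inv (ℓ h) (lookup y i)))) (Line.st-lo (ℓ h) _ (isLo⇒lo (trans (cong (isLo ∘ Line.st (ℓ h)) (sym (Sorting.lookup-flipAt (ℓ h) y i))) (proj₁ (∧-true (w-viol h _ i e)))))))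

        cb-zero : ∀ h y i → cb h y i ≡ true → not (f y) ≡ true
        cb-zero h y i e = trans (cong (not ∘ f) (sym (Sorting.flipAt-inv (ℓ h) y i))) (proj₂ (∧-true {f (flip h y i)} (proj₂ (∧-true {isLo (Line.st (ℓ h) (lookup (flip h y i) i))} (w-viol h _ i e)))))

        module _ (s : ℕ) where
          g : Vec A d → Vec H d → ℚ
          g y v = bad s (Vec.zip y v)

          c̄ : Vec A d → Fin d → ℚ
          c̄ y i = Σ hs (λ h → ι (cb h y i))

          -- In class h there is no way up from y in direction i, and by `free` this holds for at
          -- least half of all classes. The walk from y is the same for all of these
          -- (`Good-resample`), so the particular class h may be replaced by an average over all
          -- classes at the cost of a factor 2.
          spread : ∀ y v i h → cb h y i ≡ true → M * g y (v [ i ]≔ h) ≤ 2ℚ * (ι (not (f y)) * Σ hs (λ h′ → g y (v [ i ]≔ h′)))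
          spread y v i h e = begin
            M * g y (v [ i ]≔ h)
              ≤⟨ *-monoʳ (0≤bad s (Vec.zip y (v [ i ]≔ h))) (free (lookup y i)) ⟩
            2ℚ * Σ hs (λ h′ → ι (not (lo′ h′))) * g y (v [ i ]≔ h)
              ≡⟨ trans (*-assoc _ _ _) (cong (2ℚ *_) (sym (Σ-*ʳ hs _ _))) ⟩
            2ℚ * Σ hs (λ h′ → ι (not (lo′ h′)) * g y (v [ i ]≔ h))
              ≤⟨ *-monoˡ (const≥0 2ℚ) (Σ-mono hs (λ h′ → same h′ (lo′ h′) refl)) ⟩
            2ℚ * Σ hs (λ h′ → g y (v [ i ]≔ h′))
              ≡⟨ cong (2ℚ *_) (sym (trans (cong (λ b → ι b * Σ hs (λ h′ → g y (v [ i ]≔ h′))) (cb-zero h y i e)) (*-identityˡ _))) ⟩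
            2ℚ * (ι (not (f y)) * Σ hs (λ h′ → g y (v [ i ]≔ h′))) ∎
            where
            open ℚₚ.≤-Reasoning
            lo′ : H → Bool
            lo′ h′ = isLo (Line.st (ℓ h′) (lookup y i))
            same : ∀ h′ b → lo′ h′ ≡ b → ι (not b) * g y (v [ i ]≔ h) ≤ g y (v [ i ]≔ h′)
            same h′ true _ = ≤-trans (≤-reflexive (*-zeroˡ _)) (0≤bad s (Vec.zip y (v [ i ]≔ h′)))
            same h′ false n = ≤-reflexive (trans (*-identityˡ _) (cong (λ z → 1ℚ - z) (trans (cong (Good f̂ s) (zip-update y v i h))
              (trans (Good-resample s (Vec.zip y v) i {lookup y i , h} {lookup y i , h′} refl (cb-hi h y i e) n) (cong (Good f̂ s) (sym (zip-update y v i h′)))))))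

          transfer : ∀ y i → M * Σ vecs (λ v → ι (cb (lookup v i) y i) * g y v) ≤ c̄ y i * (2ℚ * (ι (not (f y)) * Σ vecs (g y)))
          transfer y i = *-cancelˡ 0<M (begin
            M * (M * Σ vecs (λ v → ι (cb (lookup v i) y i) * g y v))
              ≡⟨ cong (M *_) (trans (I.resample i _) (Σ-cong vecs (λ v → Σ-cong hs (λ h → cong (λ h″ → ι (cb h″ y i) * g y (v [ i ]≔ h)) (Vecₚ.lookup∘update i v h))))) ⟩
            M * Σ vecs (λ v → Σ hs (λ h → ι (cb h y i) * g y (v [ i ]≔ h)))
              ≡⟨ trans (sym (Σ-*ˡ vecs M _)) (Σ-cong vecs (λ v → trans (sym (Σ-*ˡ hs M _)) (Σ-cong hs (λ h → rg 3 (λ m c g → m :* (c :* g) := c :* (m :* g)) refl (M ∷ ι (cb h y i) ∷ g y (v [ i ]≔ h) ∷ []))))) ⟩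
            Σ vecs (λ v → Σ hs (λ h → ι (cb h y i) * (M * g y (v [ i ]≔ h))))
              ≤⟨ Σ-mono vecs (λ v → Σ-mono hs (λ h → ι*-mono (cb h y i) (spread y v i h))) ⟩
            Σ vecs (λ v → Σ hs (λ h → ι (cb h y i) * (2ℚ * (z * Σ hs (λ h′ → g y (v [ i ]≔ h′))))))
              ≡⟨ Σ-cong vecs (λ v → trans (Σ-*ʳ hs _ _) (rg 3 (λ c z x → c :* (con 2ℚ :* (z :* x)) := c :* (con 2ℚ :* z) :* x) refl (c̄ y i ∷ z ∷ Σ hs (λ h′ → g y (v [ i ]≔ h′)) ∷ []))) ⟩
            Σ vecs (λ v → c̄ y i * (2ℚ * z) * Σ hs (λ h′ → g y (v [ i ]≔ h′)))
              ≡⟨ trans (Σ-*ˡ vecs _ _) (cong (c̄ y i * (2ℚ * z) *_) (sym (I.resample i (g y)))) ⟩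
            c̄ y i * (2ℚ * z) * (M * Σ vecs (g y))
              ≡⟨ rg 4 (λ c z m x → c :* (con 2ℚ :* z) :* (m :* x) := m :* (c :* (con 2ℚ :* (z :* x)))) refl (c̄ y i ∷ z ∷ M ∷ Σ vecs (g y) ∷ []) ⟩
            M * (c̄ y i * (2ℚ * (z * Σ vecs (g y)))) ∎)
            where
            open ℚₚ.≤-Reasoning
            z : ℚ
            z = ι (not (f y))

          β : ℚ
          β = Σ (pts d) (λ ω → ι (not (f̂ ω)) * bad s ω)

          flip-w : ∀ ω i → w ω i ≡ cb (proj₂ (lookup (flipAt ω i) i)) (X (flipAt ω i)) i
          flip-w ω i = sym (trans (cong₂ (λ h x → cb h x i) (cong proj₂ (lookup-flipAt ω i)) (X-flip ω i)) (cong (λ x → wb (proj₂ (lookup ω i)) x i) (Sorting.flipAt-inv (ℓ (proj₂ (lookup ω i))) (X ω) i)))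

          -- Flipping the matched edge moves the sum to its upper end y. There `transfer` makes the
          -- class of direction i random again, and `w-top` allows only one matched edge per class
          -- to arrive at y.
          bad-sum : Σ (pts d) (λ ω → Σ (allFin d) (λ i → ι (w ω i) * bad s (flipAt ω i))) ≤ 2ℚ * β
          bad-sum = *-cancelˡ 0<M (begin
            M * Σ (pts d) (λ ω → Σ (allFin d) (λ i → ι (w ω i) * bad s (flipAt ω i)))
              ≡⟨ cong (M *_) (trans (Σ-swap (pts d) (allFin d) _) (trans (Σ-cong (allFin d) (λ i → trans (Σ-cong (pts d) (λ ω → cong (λ b → ι b * bad s (flipAt ω i)) (flip-w ω i)))
                   (Enum.Σ-involution (Enum-Vec enum d) (λ ω → flipAt ω i) (λ ω → flipAt-inv ω i) (λ ω → ι (cb (proj₂ (lookup ω i)) (X ω) i) * bad s ω)))) (Σ-cong (allFin d) (λ i → trans (Σ-unzip (elems EA) hs d _)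
                     (Σ-cong pts₁ (λ y → Σ-cong vecs (λ v → cong₂ (λ q x → ι (cb (proj₂ q) x i) * g y v) (Vecₚ.lookup-zip i y v) (map-proj₁-zip y v)))))))) ⟩
            M * Σ (allFin d) (λ i → Σ pts₁ (λ y → Σ vecs (λ v → ι (cb (lookup v i) y i) * g y v)))
              ≡⟨ trans (cong (M *_) (Σ-swap (allFin d) pts₁ _)) (trans (sym (Σ-*ˡ pts₁ M _)) (Σ-cong pts₁ (λ y → sym (Σ-*ˡ (allFin d) M _)))) ⟩
            Σ pts₁ (λ y → Σ (allFin d) (λ i → M * Σ vecs (λ v → ι (cb (lookup v i) y i) * g y v)))
              ≤⟨ Σ-mono pts₁ (λ y → Σ-mono (allFin d) (transfer y)) ⟩
            Σ pts₁ (λ y → Σ (allFin d) (λ i → c̄ y i * (2ℚ * (ι (not (f y)) * Σ vecs (g y)))))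
              ≡⟨ Σ-cong pts₁ (λ y → Σ-*ʳ (allFin d) _ _) ⟩
            Σ pts₁ (λ y → Σ (allFin d) (c̄ y) * (2ℚ * (ι (not (f y)) * Σ vecs (g y))))
              ≤⟨ Σ-mono pts₁ (λ y → *-monoʳ (2ℚ · (0≤ι (not (f y)) ⊛ Σ-nonNeg vecs (λ v → 0≤bad s (Vec.zip y v)))) (≤-trans (≤-reflexive (Σ-swap (allFin d) hs _)) (Σ-mono hs (λ h → w-top h y)))) ⟩
            Σ pts₁ (λ y → M * (2ℚ * (ι (not (f y)) * Σ vecs (g y))))
              ≡⟨ trans (Σ-*ˡ pts₁ M _) (cong (M *_) (trans (Σ-*ˡ pts₁ 2ℚ _) (cong (2ℚ *_) (sym (trans (Σ-unzip (elems EA) hs d _) (Σ-cong pts₁ (λ y → trans (Σ-cong vecs (λ v → cong (λ x → ι (not (f x)) * g y v) (map-proj₁-zip y v))) (Σ-*ˡ vecs _ (g y))))))))) ⟩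
            M * (2ℚ * β) ∎)
            where open ℚₚ.≤-Reasoning

          -- The sum of `step-many` over ω: by `k-square` the quadratic term takes away at most half
          -- of the sum of `k`.
          reject-bound : ⟪ suc s ⟫ * (½ * Σ (pts d) k - 2ℚ * β) ≤ ⟪ d ⟫ * Σ (pts d) (steps (suc s))
          reject-bound = begin
            ⟪ suc s ⟫ * (½ * K - 2ℚ * β)
              ≤⟨ *-monoˡ (0≤⟪⟫ (suc s)) (le 4 (λ k q m b → con ½ :* k :- con 2ℚ :* b ⊑ k :- con (pos 1 / 4) :* q :- m by con (pos 1 / 4) :* (con 2ℚ :* k :- q) :+ (con 2ℚ :* b :- m)) refl (K ∷ Q ∷ m ∷ β ∷ []) ((pos 1 / 4) · slack k-square ⊕ slack bad-sum)) ⟩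
            ⟪ suc s ⟫ * (K - (pos 1 / 4) * Q - m)
              ≡⟨ sym (trans (Σ-*ˡ (pts d) ⟪ suc s ⟫ _) (cong (⟪ suc s ⟫ *_) (trans (Σ-- (pts d) _ _) (cong (_- m) (trans (Σ-- (pts d) _ _) (cong (λ z → K - z) (Σ-*ˡ (pts d) (pos 1 / 4) _))))))) ⟩
            Σ (pts d) (λ ω → ⟪ suc s ⟫ * (k ω - (pos 1 / 4) * (k ω * k ω) - Σ (allFin d) (λ i → ι (w ω i) * bad s (flipAt ω i))))
              ≤⟨ Σ-mono (pts d) (step-many s) ⟩
            Σ (pts d) (λ ω → ⟪ d ⟫ * steps (suc s) ω)
              ≡⟨ Σ-*ˡ (pts d) ⟪ d ⟫ _ ⟩
            ⟪ d ⟫ * Σ (pts d) (steps (suc s)) ∎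
            where
            open ℚₚ.≤-Reasoning
            K Q m : ℚ
            K = Σ (pts d) k
            Q = Σ (pts d) (λ ω → k ω * k ω)
            m = Σ (pts d) (λ ω → Σ (allFin d) (λ i → ι (w ω i) * bad s (flipAt ω i)))

  -- The tester

  avg-Σ : ∀ {A : Set} (g : A → ℚ) (ys : List A) → ⟪ length ys ⟫ * avg (List.map g ys) ≡ Σ ys g
  avg-Σ g [] = trans (cong (_* 0ℚ) ⟪0⟫) (*-zeroˡ 0ℚ)
  avg-Σ g (y ∷ ys) = begin
    ⟪ suc (length ys) ⟫ * avg (List.map g (y ∷ ys))
      ≡⟨ cong₂ (λ a k → ⟪ suc (length ys) ⟫ * (a ℚ.* (pos 1 / suc k))) (sum-Σ (y ∷ ys)) (Listₚ.length-map g ys) ⟩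
    ⟪ suc (length ys) ⟫ * (Σ (y ∷ ys) g ℚ.* (pos 1 / suc (length ys)))
      ≡⟨ cong (⟪ suc (length ys) ⟫ *_) (sym (*-def _ _)) ⟩
    ⟪ suc (length ys) ⟫ * (Σ (y ∷ ys) g * rc (suc (length ys)))
      ≡⟨ rg 3 (λ l s r → l :* (s :* r) := s :* (r :* l)) refl (⟪ suc (length ys) ⟫ ∷ Σ (y ∷ ys) g ∷ rc (suc (length ys)) ∷ []) ⟩
    Σ (y ∷ ys) g * (rc (suc (length ys)) * ⟪ suc (length ys) ⟫)
      ≡⟨ trans (cong (Σ (y ∷ ys) g *_) (rc-inverse {suc (length ys)} (s≤s z≤n))) (*-identityʳ _) ⟩
    Σ (y ∷ ys) g ∎
    where
    open ≡-Reasoning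
    sum-Σ : ∀ zs → sumℚ (List.map g zs) ≡ Σ zs g
    sum-Σ [] = refl
    sum-Σ (z ∷ zs) = trans (sym (+-def _ _)) (cong (g z +_) (sum-Σ zs))

  Σ-filter : ∀ {A : Set} (p : A → Bool) (xs : List A) (g : A → ℚ) → Σ (filterᵇ p xs) g ≡ Σ xs (λ x → ι (p x) * g x)
  Σ-filter p [] g = refl
  Σ-filter p (x ∷ xs) g with p x
  ... | true = cong₂ _+_ (sym (*-identityˡ _)) (Σ-filter p xs g)
  ... | false = trans (Σ-filter p xs g) (trans (sym (+-identityˡ _)) (cong (_+ Σ xs (λ x → ι (p x) * g x)) (sym (*-zeroˡ _))))

  ratio-rc : ∀ a b → ratio a b ≡ rc b * ⟪ a ⟫
  ratio-rc a zero = sym (*-zeroˡ _)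
  ratio-rc a (suc b) = begin
    ratio a (suc b)                                  ≡⟨ sym (trans (cong (ratio a (suc b) *_) (rc-inverse {suc b} (s≤s z≤n))) (*-identityʳ _)) ⟩
    ratio a (suc b) * (rc (suc b) * ⟪ suc b ⟫)        ≡⟨ rg 3 (λ x r b → x :* (r :* b) := r :* (x :* b)) refl (ratio a (suc b) ∷ rc (suc b) ∷ ⟪ suc b ⟫ ∷ []) ⟩
    rc (suc b) * (ratio a (suc b) * ⟪ suc b ⟫)        ≡⟨ cong (rc (suc b) *_) (ratio-* a b) ⟩
    rc (suc b) * ⟪ a ⟫                               ∎
    where open ≡-Reasoning

  ⟪⟫-injective : ∀ {a b} → ⟪ a ⟫ ≡ ⟪ b ⟫ → a ≡ b
  ⟪⟫-injective e = ℕₚ.≤-antisym (⟪⟫-cancel (≤-reflexive e)) (⟪⟫-cancel (≤-reflexive (sym e)))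

  bin-above : ∀ {l s} → l ℕ.< s → bin l s ≡ 0
  bin-above {zero} {suc s} _ = refl
  bin-above {suc l} {suc s} (s≤s q) = cong₂ ℕ._+_ (bin-above q) (bin-above (ℕₚ.m≤n⇒m≤1+n q))

  <ᵇ-true⁻¹ : ∀ {a b} → (a ℕ.<ᵇ b) ≡ true → a ℕ.< b
  <ᵇ-true⁻¹ {a} {b} e = ℕₚ.<ᵇ⇒< a b (subst T (sym e) tt)

  isLo-stN : ∀ n a c k → isLo (Match.stN n a c k) ≡ lowerEndpoint n (suc k) a c
  isLo-stN n a c k = table (Match.cls n a c k) (k ℕ.+ 2 ℕ.^ a ℕ.<ᵇ n) (k ℕ.<ᵇ 2 ℕ.^ a)
    where
    table : ∀ x y z → isLo (Match.sel n a c lo hi fx x y z) ≡ y ∧ x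
    table true true z = refl
    table true false z = refl
    table false true true = refl
    table false true false = refl
    table false false true = refl
    table false false false = refl

  -- Here b is the chance that a random start is a zero of f from which the walk of s steps does not
  -- end at a zero. The first bound adds the atypical starts and the boundary edges met on the way,
  -- the second is `reject-bound` divided by the number of outcomes.
  WalkEstimate : ℕ → ℚ → ℚ → (ℕ → ℚ) → Set
  WalkEstimate d e Γ P = ∀ s → let τ = ⟪ suc s ⟫ in 128 ℕ.* (suc s ℕ.* suc s) ℕ.≤ d → ∀ {k κ} → 0ℚ ≤ k → 0ℚ ≤ κ → k * κ ≡ 1ℚ →
    ∃ λ b → (⟪ d ⟫ * b ≤ 64ℚ + 4096ℚ * (τ * τ) + ⟪ s ⟫ * (16ℚ * (4ℚ * e + (k * ⟪ d ⟫ + κ)))) × (τ * (½ * Γ - 2ℚ * b) ≤ ⟪ d ⟫ * P (suc s))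

  module Tester (m : ℕ) {d : ℕ} (f : Vec (Fin (2 ℕ.^ m)) d → Bool) where
    n : ℕ
    n = 2 ℕ.^ m

    Class : Set
    Class = Fin m × Bool

    ℓ : Class → Line (Fin n)
    ℓ (a , c) = Match.line n (toℕ a) c

    EH : Enum Class
    EH = Enum-× (Enum-Fin m) Enum-Bool

    module Fam = Family (Enum-Fin n) EH ℓ
    open Fam using (Ω; X; steps)
    open Walk Ω using (L; app)

    S-L : ∀ {d} (x : Vec (Fin n) d) a c → setS {m} x a c ≡ L (Vec.zip x (Vec.zip a c))
    S-L [] [] [] = refl
    S-L (p ∷ x) (a ∷ as) (c ∷ cs) = cong₂ _∷_ (sym (isLo-stN n (toℕ a) c (toℕ p))) (S-L x as cs)

    -- A `lo` end has its partner in range, so the fallback of `toFin` is not reached.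
    toFin-π : ∀ a c p → isLo (Match.stN n a c (toℕ p)) ≡ true → toFin (toℕ p ℕ.+ 2 ℕ.^ a) p ≡ Match.πF n a c p
    toFin-π a c p e with Match.view n a c (toℕ p)
    ... | Match.is-hi _ _ h _ with () ← trans (sym e) (cong isLo h)
    ... | Match.is-fx h _ with () ← trans (sym e) (cong isLo h)
    ... | Match.is-lo _ q _ π≡ with toℕ p ℕ.+ 2 ℕ.^ a ℕ.<? n
    ...   | yes q′ = Finₚ.toℕ-injective (trans (Finₚ.toℕ-fromℕ< q′) (trans (sym π≡) (sym (Match.toℕ-π n a c p))))
    ...   | no ¬q = ⊥-elim (¬q q)

    move-app : ∀ {d} (x : Vec (Fin n) d) a c T → subsetᵇ T (L (Vec.zip x (Vec.zip a c))) ≡ true → moveUp {m} x a T ≡ X (app T (Vec.zip x (Vec.zip a c)))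
    move-app [] [] [] [] e = refl
    move-app (p ∷ x) (a ∷ as) (c ∷ cs) (false ∷ T) e = cong (p ∷_) (move-app x as cs T e)
    move-app (p ∷ x) (a ∷ as) (c ∷ cs) (true ∷ T) e = let l , e′ = subset-cons _ {T} {L (Vec.zip x (Vec.zip as cs))} e in
      cong₂ _∷_ (toFin-π (toℕ a) c p l) (move-app x as cs T e′)

    stepsFiveSix-steps : ∀ τ x a c → stepsFiveSix {m} f τ x a c ≡ steps f τ (Vec.zip x (Vec.zip a c))
    stepsFiveSix-steps τ x a c = go (countTrue S ℕ.<ᵇ τ) refl
      where
      ω : Vec (Fin n × Class) d
      ω = Vec.zip x (Vec.zip a c)
      S : Cube d
      S = setS {m} x a c
      Ts : List (Cube d)
      Ts = filterᵇ (λ T → subsetᵇ T S ∧ (countTrue T ≡ᵇ τ)) (allVecs bools d)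
      viol : Cube d → Bool
      viol T = violates (f x) (f (moveUp {m} x a T))
      self : ∀ b → (if b ∧ not b then 1ℚ else 0ℚ) ≡ 0ℚ
      self true = refl
      self false = refl
      length-Ts : length Ts ≡ bin (countTrue S) τ
      length-Ts = ⟪⟫-injective (trans (⟪⟫-filter _ (allVecs bools d)) (trans (Σ-cong (allVecs bools d) (λ T → sym (*-identityʳ _))) (trans (Sub-list S τ (λ _ → 1ℚ)) (Sub-one S τ))))
      count-hits : ⟪ length (filterᵇ viol Ts) ⟫ ≡ Sub S τ (ι ∘ viol)
      count-hits = trans (⟪⟫-filter viol Ts) (trans (Σ-filter _ (allVecs bools d) (ι ∘ viol)) (Sub-list S τ (ι ∘ viol)))
      steps-S : steps f τ ω ≡ rc (bin (countTrue S) τ) * Sub S τ (ι ∘ viol)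
      steps-S = trans (cong (λ S → rc (bin (countTrue S) τ) * Sub S τ (λ T → ι (f (X ω) ∧ not (f (X (app T ω)))))) (sym (S-L x a c)))
        (cong (rc (bin (countTrue S) τ) *_) (Sub-cong-on S τ (λ T e _ → cong₂ (λ y z → ι (f y ∧ not (f z))) (map-proj₁-zip x (Vec.zip a c)) (sym (move-app x a c T (subst (λ S → subsetᵇ T S ≡ true) (S-L x a c) e))))))
      go : ∀ b → (countTrue S ℕ.<ᵇ τ) ≡ b → (if b then (if violates (f x) (f x) then 1ℚ else 0ℚ) else ratio (length (filterᵇ viol Ts)) (length Ts)) ≡ steps f τ ω
      -- With fewer than τ directions the tester compares f x with itself and accepts; `steps`
      -- agrees because the binomial is 0 and `rc 0` is 0.
      go true e = trans (self (f x)) (sym (trans steps-S (trans (cong (λ k → rc k * Sub S τ (ι ∘ viol)) (bin-above {countTrue S} {τ} (<ᵇ-true⁻¹ {countTrue S} {τ} e))) (*-zeroˡ _))))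
      go false e = trans (ratio-rc _ (length Ts)) (trans (cong₂ (λ k z → rc k * z) length-Ts count-hits) (sym steps-S))

    P : ℕ → ℚ
    P τ = avg (List.map (λ x → avg (List.map (λ a → avg (List.map (λ c → stepsFiveSix {m} f τ x a c) (allVecs bools d))) (allVecs (allFin m) d))) (allPoints n d))

    Z : ℚ
    Z = Σ (allVecs (pairs (allFin n) (pairs (allFin m) bools)) d) (λ _ → 1ℚ)

    Σ-Ω : ∀ (F : Vec (Fin n × Class) d → ℚ) → Σ (allVecs (pairs (allFin n) (pairs (allFin m) bools)) d) F
      ≡ Σ (allPoints n d) (λ x → Σ (allVecs (allFin m) d) (λ a → Σ (allVecs bools d) (λ c → F (Vec.zip x (Vec.zip a c)))))
    Σ-Ω F = trans (Σ-unzip (allFin n) (pairs (allFin m) bools) d F) (Σ-cong (allPoints n d) (λ x → Σ-unzip (allFin m) bools d (λ v → F (Vec.zip x v))))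

    Z-P : ∀ τ → Z * P τ ≡ Σ (allVecs (pairs (allFin n) (pairs (allFin m) bools)) d) (steps f τ)
    Z-P τ = begin
      Z * P τ
        ≡⟨ cong (_* P τ) (trans (Σ-Ω (λ _ → 1ℚ)) (trans (Σ-cong xs (λ _ → trans (Σ-cong as (λ _ → trans (Σ-const cs 1ℚ) (*-identityʳ _))) (Σ-const as _))) (Σ-const xs _))) ⟩
      (⟪ length xs ⟫ * (⟪ length as ⟫ * ⟪ length cs ⟫)) * P τ
        ≡⟨ rg 4 (λ x a c p → (x :* (a :* c)) :* p := (a :* c) :* (x :* p)) refl (⟪ length xs ⟫ ∷ ⟪ length as ⟫ ∷ ⟪ length cs ⟫ ∷ P τ ∷ []) ⟩
      (⟪ length as ⟫ * ⟪ length cs ⟫) * (⟪ length xs ⟫ * P τ)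
        ≡⟨ trans (cong ((⟪ length as ⟫ * ⟪ length cs ⟫) *_) (avg-Σ _ xs)) (sym (Σ-*ˡ xs _ _)) ⟩
      Σ xs (λ x → (⟪ length as ⟫ * ⟪ length cs ⟫) * avg (List.map (λ a → avg (List.map (λ c → stepsFiveSix {m} f τ x a c) cs)) as))
        ≡⟨ Σ-cong xs (λ x → trans (rg 3 (λ a c p → (a :* c) :* p := c :* (a :* p)) refl (⟪ length as ⟫ ∷ ⟪ length cs ⟫ ∷ _ ∷ [])) (trans (cong (⟪ length cs ⟫ *_) (avg-Σ _ as)) (trans (sym (Σ-*ˡ as _ _)) (Σ-cong as (λ a → avg-Σ _ cs))))) ⟩
      Σ xs (λ x → Σ as (λ a → Σ cs (λ c → stepsFiveSix {m} f τ x a c)))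
        ≡⟨ Σ-cong xs (λ x → Σ-cong as (λ a → Σ-cong cs (λ c → stepsFiveSix-steps τ x a c))) ⟩
      Σ xs (λ x → Σ as (λ a → Σ cs (λ c → steps f τ (Vec.zip x (Vec.zip a c)))))
        ≡⟨ sym (Σ-Ω (steps f τ)) ⟩
      Σ (allVecs (pairs (allFin n) (pairs (allFin m) bools)) d) (steps f τ) ∎
      where
      open ≡-Reasoning
      xs : List (Vec (Fin n) d)
      xs = allPoints n d
      as : List (Vec (Fin m) d)
      as = allVecs (allFin m) d
      cs : List (Cube d)
      cs = allVecs bools d

    classes : List Class
    classes = pairs (allFin m) bools

    module I = Independent classes
    module J = Independent (pairs (allFin n) classes)
    open I using (M)

    M-value : M ≡ 2ℚ * ⟪ m ⟫
    M-value = trans (Σ-pairs (allFin m) bools _) (trans (Σ-const (allFin m) _) (trans (cong (λ k → ⟪ k ⟫ * (1ℚ + (1ℚ + 0ℚ))) (Listₚ.length-tabulate id)) (rg 1 (λ m → m :* (con 1ℚ :+ (con 1ℚ :+ con 0ℚ)) := con 2ℚ :* m) refl (⟪ m ⟫ ∷ []))))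

    isLo-class : ∀ a (p : Fin n) (F : Bool → ℚ) → Σ bools (λ c → F (isLo (Match.stN n a c (toℕ p)))) ≡ F ((toℕ p ℕ.+ 2 ℕ.^ a ℕ.<ᵇ n) ∧ low a (suc (toℕ p))) + (F ((toℕ p ℕ.+ 2 ℕ.^ a ℕ.<ᵇ n) ∧ not (low a (suc (toℕ p)))) + 0ℚ)
    isLo-class a p F = cong₂ (λ x y → F x + (F y + 0ℚ)) (isLo-stN n a false (toℕ p)) (isLo-stN n a true (toℕ p))

    -- For each step length 2^a at most one of the two classes has p as a lower endpoint.
    free : ∀ p → M ≤ 2ℚ * Σ classes (λ h → ι (not (isLo (Line.st (ℓ h) p))))
    free p = ≤-trans (≤-reflexive (Σ-pairs (allFin m) bools _)) (≤-trans (Σ-mono (allFin m) (λ a → ≤-trans (table (toℕ p ℕ.+ 2 ℕ.^ toℕ a ℕ.<ᵇ n) (low (toℕ a) (suc (toℕ p)))) (≤-reflexive (cong (2ℚ *_) (sym (isLo-class (toℕ a) p (ι ∘ not)))))))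
      (≤-reflexive (trans (Σ-*ˡ (allFin m) 2ℚ _) (cong (2ℚ *_) (sym (Σ-pairs (allFin m) bools _))))))
      where
      table : ∀ y b → 1ℚ + (1ℚ + 0ℚ) ≤ 2ℚ * (ι (not (y ∧ b)) + (ι (not (y ∧ not b)) + 0ℚ))
      table true true = ≤-reflexive (rg 0 (con 1ℚ :+ (con 1ℚ :+ con 0ℚ) := con 2ℚ :* (con 0ℚ :+ (con 1ℚ :+ con 0ℚ))) refl [])
      table true false = ≤-reflexive (rg 0 (con 1ℚ :+ (con 1ℚ :+ con 0ℚ) := con 2ℚ :* (con 1ℚ :+ (con 0ℚ :+ con 0ℚ))) refl [])
      table false b = le 0 (con 1ℚ :+ (con 1ℚ :+ con 0ℚ) ⊑ con 2ℚ :* (con 1ℚ :+ (con 1ℚ :+ con 0ℚ)) by con 2ℚ) refl [] (const≥0 2ℚ)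

    room : ∀ n s → ⟪ n ⟫ ≤ Σ (allFin n) (λ p → ι (toℕ p ℕ.+ s ℕ.<ᵇ n)) + ⟪ s ⟫
    room zero s = ≤-trans (≤-reflexive ⟪0⟫) (≤-trans (0≤⟪⟫ s) (≤-reflexive (sym (+-identityˡ _))))
    room (suc n) s = ≤-trans (go (ℕₚ.<-≤-connex s (suc n))) (≤-reflexive (cong (_+ ⟪ s ⟫) (sym (Σ-allFin-suc n _))))
      where
      C : ℚ
      C = Σ (allFin n) (λ p → ι (toℕ p ℕ.+ s ℕ.<ᵇ n))
      go : s ℕ.< suc n ⊎ suc n ℕ.≤ s → ⟪ suc n ⟫ ≤ (ι (s ℕ.<ᵇ suc n) + C) + ⟪ s ⟫
      go (inj₁ q) = subst₂ (λ x b → x ≤ (ι b + C) + ⟪ s ⟫) (sym (⟪⟫-suc n)) (sym (<ᵇ-true q)) (≤-trans (+-monoʳ-≤ 1ℚ (room n s)) (≤-reflexive (sym (+-assoc 1ℚ C ⟪ s ⟫))))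
      go (inj₂ q) = ≤-trans (⟪⟫-mono q) (le 3 (λ b c s → s ⊑ (b :+ c) :+ s by b :+ c) refl (ι (s ℕ.<ᵇ suc n) ∷ C ∷ ⟪ s ⟫ ∷ []) (0≤ι (s ℕ.<ᵇ suc n) ⊕ Σ-nonNeg (allFin n) (λ p → 0≤ι (toℕ p ℕ.+ s ℕ.<ᵇ n))))

    geometric : ∀ m → Σ (allFin m) (λ a → ⟪ 2 ℕ.^ toℕ a ⟫) + 1ℚ ≡ ⟪ 2 ℕ.^ m ⟫
    geometric zero = trans (+-identityˡ 1ℚ) (sym ⟪1⟫)
    geometric (suc m) = trans (cong (_+ 1ℚ) (trans (Σ-allFin-suc m _) (cong₂ _+_ ⟪1⟫ (trans (Σ-cong (allFin m) (λ a → trans (⟪⟫-* 2 _) (cong (_* ⟪ 2 ℕ.^ toℕ a ⟫) (⟪⟫-def 2)))) (Σ-*ˡ (allFin m) 2ℚ _)))))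
      (trans (rg 1 (λ s → con 1ℚ :+ con 2ℚ :* s :+ con 1ℚ := con 2ℚ :* (s :+ con 1ℚ)) refl (_ ∷ [])) (trans (cong (2ℚ *_) (geometric m)) (sym (trans (⟪⟫-* 2 _) (cong (_* ⟪ 2 ℕ.^ m ⟫) (⟪⟫-def 2))))))

    loΩ total : ℚ
    loΩ = Σ (pairs (allFin n) classes) (λ q → ι (isLo (Line.st Ω q)))
    total = Σ (pairs (allFin n) classes) (λ _ → 1ℚ)

    total-value : total ≡ ⟪ n ⟫ * (2ℚ * ⟪ m ⟫)
    total-value = trans (Σ-pairs (allFin n) classes _) (trans (Σ-const (allFin n) _) (cong₂ (λ k z → ⟪ k ⟫ * z) (Listₚ.length-tabulate id) M-value))

    -- For each a the two classes share the positions with room for a step of 2^a, at least n - 2^a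
    -- of them, and the powers of two add up to n - 1.
    loΩ-≥ : ⟪ m ⟫ * ⟪ n ⟫ ≤ loΩ + (⟪ n ⟫ - 1ℚ)
    loΩ-≥ = begin
      ⟪ m ⟫ * ⟪ n ⟫
        ≡⟨ sym (trans (Σ-const (allFin m) _) (cong (λ k → ⟪ k ⟫ * ⟪ n ⟫) (Listₚ.length-tabulate id))) ⟩
      Σ (allFin m) (λ _ → ⟪ n ⟫)
        ≤⟨ Σ-mono (allFin m) (λ a → room n (2 ℕ.^ toℕ a)) ⟩
      Σ (allFin m) (λ a → Σ (allFin n) (λ p → ι (toℕ p ℕ.+ 2 ℕ.^ toℕ a ℕ.<ᵇ n)) + ⟪ 2 ℕ.^ toℕ a ⟫)
        ≡⟨ Σ-+ (allFin m) _ _ ⟩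
      Σ (allFin m) (λ a → Σ (allFin n) (λ p → ι (toℕ p ℕ.+ 2 ℕ.^ toℕ a ℕ.<ᵇ n))) + Σ (allFin m) (λ a → ⟪ 2 ℕ.^ toℕ a ⟫)
        ≡⟨ cong₂ _+_ (trans (Σ-swap (allFin m) (allFin n) _) (sym (trans (Σ-pairs (allFin n) classes _) (Σ-cong (allFin n) (λ p → trans (Σ-pairs (allFin m) bools _) (Σ-cong (allFin m) (λ a → trans (isLo-class (toℕ a) p ι) (table (toℕ p ℕ.+ 2 ℕ.^ toℕ a ℕ.<ᵇ n) (low (toℕ a) (suc (toℕ p))))))))))) (trans (rg 1 (λ s → s := (s :+ con 1ℚ) :- con 1ℚ) refl (_ ∷ [])) (cong (_- 1ℚ) (geometric m))) ⟩
      loΩ + (⟪ n ⟫ - 1ℚ) ∎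
      where
      open ℚₚ.≤-Reasoning
      table : ∀ y b → ι (y ∧ b) + (ι (y ∧ not b) + 0ℚ) ≡ ι y
      table true true = rg 0 (con 1ℚ :+ (con 0ℚ :+ con 0ℚ) := con 1ℚ) refl []
      table true false = rg 0 (con 0ℚ :+ (con 1ℚ :+ con 0ℚ) := con 1ℚ) refl []
      table false b = rg 0 (con 0ℚ :+ (con 0ℚ :+ con 0ℚ) := con 0ℚ) refl []

    -- At least mn - n + 1 of the 2mn pairs of a position and a class are lower endpoints, and this
    -- is at least mn/2 for m ≥ 1. There is equality at m = 1, which is why `small` treats that case
    -- by itself.
    quarter : 0 ℕ.< m → total ≤ 4ℚ * loΩ
    quarter 0<m = subst (_≤ 4ℚ * loΩ) (sym total-value) (le 3 (λ n m x → n :* (con 2ℚ :* m) ⊑ con 4ℚ :* x by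
        con 4ℚ :* (x :+ (n :- con 1ℚ) :- m :* n) :+ (con 2ℚ :* m :* n :+ con 4ℚ :- con 4ℚ :* n)) refl (⟪ n ⟫ ∷ ⟪ m ⟫ ∷ loΩ ∷ []) (4ℚ · slack loΩ-≥ ⊕ slack (small m 0<m)))
      where
      small : ∀ m → 0 ℕ.< m → 4ℚ * ⟪ 2 ℕ.^ m ⟫ ≤ 2ℚ * ⟪ m ⟫ * ⟪ 2 ℕ.^ m ⟫ + 4ℚ
      small (suc zero) _ = ≤-reflexive (trans (cong (4ℚ *_) (⟪⟫-def 2)) (trans (rg 0 (con 4ℚ :* con 2ℚ := con 2ℚ :* con 1ℚ :* con 2ℚ :+ con 4ℚ) refl []) (cong₂ (λ x y → 2ℚ * x * y + 4ℚ) (sym ⟪1⟫) (sym (⟪⟫-def 2)))))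
      small (suc (suc m)) _ = le 2 (λ m n → con 4ℚ :* n ⊑ con 2ℚ :* m :* n :+ con 4ℚ by con 2ℚ :* ((m :- con 2ℚ) :* n) :+ con 4ℚ) refl (⟪ suc (suc m) ⟫ ∷ ⟪ 2 ℕ.^ suc (suc m) ⟫ ∷ [])
        (2ℚ · (slack (subst (_≤ ⟪ suc (suc m) ⟫) (⟪⟫-def 2) (⟪⟫-mono {2} (s≤s (s≤s z≤n)))) ⊛ 0≤⟪⟫ (2 ℕ.^ suc (suc m))) ⊕ const≥0 4ℚ)

    module Estimates (0<m : 0 ℕ.< m) (0<d : 0 ℕ.< d) where
      open Sorting Ω using (pts; Viol; Viol-edges)

      module Mt (h : Class) = Matching (ℓ h) ∈-allFin

      wb : Class → Vec (Fin n) d → Fin d → Bool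
      wb h = Mt.inMatching h f

      0<M : 0ℚ < M
      0<M = subst (0ℚ <_) (sym M-value) (*-pos {2ℚ} (ℚₚ.positive⁻¹ 2ℚ) (⟪⟫-pos 0<m))

      module Mat = Fam.Matched f wb (λ h → Mt.inMatching-viol h f) (λ h → Mt.inMatching-bots h f) (λ h → Mt.inMatching-tops h f) free 0<M

      Nv E W : ℚ
      Nv = Σ (allPoints n d) (λ _ → 1ℚ)
      E = Σ (allPoints n d) (λ x → I.weight (λ i h → ι (Sorting.isViol (ℓ h) f x i)))
      W = Σ (allPoints n d) (λ x → I.weight (Mat.φ x))

      0<n : 0ℚ < ⟪ n ⟫
      0<n = ⟪⟫-pos (ℕₚ.m^n>0 2 m)

      Nv-value : Nv ≡ ⟪ n ℕ.^ d ⟫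
      Nv-value = trans (Independent.vol-power (allFin n) d) (trans (cong (_^^ d) (trans (Σ-const (allFin n) 1ℚ) (trans (*-identityʳ _) (cong ⟪_⟫ (Listₚ.length-tabulate id))))) (sym (⟪⟫-^ n d)))

      0<Nv : 0ℚ < Nv
      0<Nv = subst (0ℚ <_) (trans (sym (⟪⟫-^ n d)) (sym Nv-value)) (^^-pos d 0<n)

      0<total : 0ℚ < total
      0<total = subst (0ℚ <_) (sym total-value) (*-pos 0<n (*-pos {2ℚ} (ℚₚ.positive⁻¹ 2ℚ) (⟪⟫-pos 0<m)))

      0<Z : 0ℚ < Z
      0<Z = subst (0ℚ <_) (sym (J.vol-power d)) (^^-pos d 0<total)

      Z-value : Z ≡ Nv * I.vol d
      Z-value = trans (Σ-unzip (allFin n) classes d _) (trans (Σ-cong (allPoints n d) (λ _ → sym (*-identityˡ _))) (Σ-*ʳ (allPoints n d) (I.vol d) (λ _ → 1ℚ)))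

      E-swap : ∀ (φ : Vec (Fin n) d → Fin d → Class → ℚ) → Σ (allPoints n d) (λ x → I.weight (φ x)) ≡ Σ classes (λ h → Σ (allPoints n d) (λ x → Σ (allFin d) (λ i → φ x i h)))
      E-swap φ = trans (Σ-cong (allPoints n d) (λ x → Σ-swap (allFin d) classes (φ x))) (Σ-swap (allPoints n d) classes _)

      E-value : E ≡ Matchings.E m d f
      E-value = trans (E-swap (λ x i h → ι (Sorting.isViol (ℓ h) f x i))) (Σ-cong classes (λ h → sym (Sorting.Viol-edges (ℓ h) f)))

      W-value : Matchings.W m d f ≤ W
      W-value = ≤-trans (Σ-mono classes (λ h → Mt.msize≤ h f)) (≤-reflexive (sym (E-swap Mat.φ)))

      0≤W : 0ℚ ≤ W
      0≤W = Σ-nonNeg (allPoints n d) (λ x → Σ-nonNeg (allFin d) (λ i → Σ-nonNeg classes (λ h → 0≤ι (wb h x i))))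

      W≤E : W ≤ E
      W≤E = Σ-mono (allPoints n d) (λ x → Σ-mono (allFin d) (λ i → Σ-mono classes (λ h → imply (wb h x i) (Mt.inMatching-viol h f x i))))
        where
        imply : ∀ a {b} → (a ≡ true → b ≡ true) → ι a ≤ ι b
        imply true q = ≤-reflexive (cong ι (sym (q refl)))
        imply false {b} q = 0≤ι b

      W≤MN : W ≤ M * Nv
      W≤MN = ≤-trans (Σ-mono (allPoints n d) Mat.weight≤M) (≤-reflexive (trans (Σ-cong (allPoints n d) (λ _ → sym (*-identityʳ M))) (Σ-*ˡ (allPoints n d) M _)))

      unit : ∃ λ u → (0ℚ < u) × (M * Nv * u ≡ 1ℚ)
      unit = inverse (*-pos 0<M 0<Nv)

      u : ℚ
      u = proj₁ unit

      0≤u : 0ℚ ≤ u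
      0≤u = <⇒≤ (proj₁ (proj₂ unit))

      MNu : M * Nv * u ≡ 1ℚ
      MNu = proj₂ (proj₂ unit)

      -- The densities of the violating edges and of the matched ones, among all M·N pairs (class, point).
      e Γ : ℚ
      e = E * u
      Γ = W * u

      0≤Γ : 0ℚ ≤ Γ
      0≤Γ = 0≤W ⊛ 0≤u

      Γ≤e : Γ ≤ e
      Γ≤e = *-monoʳ 0≤u W≤E

      Γ≤1 : Γ ≤ 1ℚ
      Γ≤1 = subst (Γ ≤_) MNu (*-monoʳ 0≤u W≤MN)

      normalised : ∀ {S S̄} → M * S ≡ I.vol d * S̄ → S ≡ Z * (S̄ * u)
      normalised {S} {S̄} eq = sym (begin
        Z * (S̄ * u)                   ≡⟨ cong (_* (S̄ * u)) Z-value ⟩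
        Nv * I.vol d * (S̄ * u)        ≡⟨ rg 4 (λ n v s u → n :* v :* (s :* u) := n :* u :* (v :* s)) refl (Nv ∷ I.vol d ∷ S̄ ∷ u ∷ []) ⟩
        Nv * u * (I.vol d * S̄)        ≡⟨ cong (Nv * u *_) (sym eq) ⟩
        Nv * u * (M * S)              ≡⟨ rg 4 (λ n u m s → n :* u :* (m :* s) := m :* n :* u :* s) refl (Nv ∷ u ∷ M ∷ S ∷ []) ⟩
        M * Nv * u * S                ≡⟨ trans (cong (_* S) MNu) (*-identityˡ S) ⟩
        S                             ∎)
        where open ≡-Reasoning

      Viol-value : Viol (full d) (Fam.f̂ f) ≡ Z * e
      Viol-value = normalised (Fam.Viol-mean f)

      K-value : Σ (pts d) Mat.k ≡ Z * Γ
      K-value = normalised (Fam.mean-Ω f Mat.φ)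

      e-bound : e ≤ ⟪ d ⟫ * P 1
      e-bound = *-cancelˡ 0<Z (begin
        Z * e                                   ≡⟨ sym Viol-value ⟩
        Viol (full d) (Fam.f̂ f)                 ≡⟨ Viol-edges (Fam.f̂ f) ⟩
        Σ (pts d) (λ ω → Σ (allFin d) (λ i → ι (Sorting.isViol Ω (Fam.f̂ f) ω i)))   ≤⟨ Σ-mono (pts d) (Fam.step-one f) ⟩
        Σ (pts d) (λ ω → ⟪ d ⟫ * steps f 1 ω)    ≡⟨ trans (Σ-*ˡ (pts d) ⟪ d ⟫ _) (cong (⟪ d ⟫ *_) (sym (Z-P 1))) ⟩
        ⟪ d ⟫ * (Z * P 1)                       ≡⟨ rg 3 (λ d z p → d :* (z :* p) := z :* (d :* p)) refl (⟪ d ⟫ ∷ Z ∷ P 1 ∷ []) ⟩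
        Z * (⟪ d ⟫ * P 1)                       ∎)
        where open ℚₚ.≤-Reasoning

      0≤P : ∀ τ → 0ℚ ≤ P τ
      0≤P τ = *-cancelˡ 0<Z (≤-trans (≤-reflexive (*-zeroʳ Z)) (≤-trans (Σ-nonNeg (pts d) (Fam.0≤steps f τ)) (≤-reflexive (sym (Z-P τ)))))

      module WalkAverage (s : ℕ) (large : 128 ℕ.* (suc s ℕ.* suc s) ℕ.≤ d) {k κ : ℚ} (0≤k : 0ℚ ≤ k) (0≤κ : 0ℚ ≤ κ) (kκ : k * κ ≡ 1ℚ)
        {z : ℚ} (0<z : 0ℚ < z) (Zz : Z * z ≡ 1ℚ) {t : ℚ} (0<t : 0ℚ < t) (total*t : total * t ≡ 1ℚ) where
        open ℚₚ.≤-Reasoning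
        module WB = WalkBound Ω (Fam.f̂ f) (suc s) large
        τ q NT δ : ℚ
        τ = ⟪ suc s ⟫
        q = loΩ * t
        NT = Σ (pts d) (λ ω → ι (not (WB.typical ω)))
        δ = rc d
        limit : ℚ
        limit = 64ℚ + 4096ℚ * (τ * τ) + ⟪ s ⟫ * (16ℚ * (4ℚ * e + (k * ⟪ d ⟫ + κ)))
        0≤t : 0ℚ ≤ t
        0≤t = <⇒≤ 0<t
        mean : loΩ ≡ q * total
        mean = sym (trans (rg 3 (λ l t n → l :* t :* n := l :* (n :* t)) refl (loΩ ∷ t ∷ total ∷ [])) (trans (cong (loΩ *_) total*t) (*-identityʳ _)))
        1≤4q : 1ℚ ≤ 4ℚ * q
        1≤4q = subst₂ _≤_ total*t (*-assoc 4ℚ loΩ t) (*-monoʳ 0≤t (quarter 0<m))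
        q≤1 : q ≤ 1ℚ
        q≤1 = subst (q ≤_) total*t (*-monoʳ 0≤t (Σ-mono (pairs (allFin n) classes) (λ h → ι≤1 (isLo (Line.st Ω h)))))
        few : ⟪ d ⟫ * NT ≤ (64ℚ + 4096ℚ * (τ * τ)) * Z
        few = WB.atypical-bound mean 1≤4q q≤1 0<d
        dβ : ⟪ d ⟫ * Mat.β s ≤ limit * Z
        dβ = begin
          ⟪ d ⟫ * Mat.β s
            ≤⟨ *-monoˡ (0≤⟪⟫ d) (WB.bad-bound s ℕₚ.≤-refl) ⟩
          ⟪ d ⟫ * (NT + ⟪ s ⟫ * (32ℚ * δ * WB.∂))
            ≡⟨ rg 5 (λ d n s δ x → d :* (n :+ s :* (con 32ℚ :* δ :* x)) := d :* n :+ s :* (con 16ℚ :* ((δ :* d) :* (con 2ℚ :* x)))) refl (⟪ d ⟫ ∷ NT ∷ ⟪ s ⟫ ∷ δ ∷ WB.∂ ∷ []) ⟩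
          ⟪ d ⟫ * NT + ⟪ s ⟫ * (16ℚ * ((δ * ⟪ d ⟫) * (2ℚ * WB.∂)))
            ≡⟨ cong (λ y → ⟪ d ⟫ * NT + ⟪ s ⟫ * (16ℚ * y)) (trans (cong (_* (2ℚ * WB.∂)) (rc-inverse 0<d)) (*-identityˡ _)) ⟩
          ⟪ d ⟫ * NT + ⟪ s ⟫ * (16ℚ * (2ℚ * WB.∂))
            ≤⟨ +-mono-≤ few (*-monoˡ (0≤⟪⟫ s) (*-monoˡ (const≥0 16ℚ) (≤-trans (WB.∂-bound 0≤k 0≤κ kκ) (≤-reflexive (cong (λ v → 4ℚ * v + (k * (⟪ d ⟫ * Z) + κ * Z)) Viol-value))))) ⟩
          (64ℚ + 4096ℚ * (τ * τ)) * Z + ⟪ s ⟫ * (16ℚ * (4ℚ * (Z * e) + (k * (⟪ d ⟫ * Z) + κ * Z)))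
            ≡⟨ rg 7 (λ a s e k d κ z → a :* z :+ s :* (con 16ℚ :* (con 4ℚ :* (z :* e) :+ (k :* (d :* z) :+ κ :* z))) := (a :+ s :* (con 16ℚ :* (con 4ℚ :* e :+ (k :* d :+ κ)))) :* z) refl
                 (64ℚ + 4096ℚ * (τ * τ) ∷ ⟪ s ⟫ ∷ e ∷ k ∷ ⟪ d ⟫ ∷ κ ∷ Z ∷ []) ⟩
          (64ℚ + 4096ℚ * (τ * τ) + ⟪ s ⟫ * (16ℚ * (4ℚ * e + (k * ⟪ d ⟫ + κ)))) * Z ∎
        first : ⟪ d ⟫ * (Mat.β s * z) ≤ limit
        first = subst₂ _≤_ (*-assoc ⟪ d ⟫ (Mat.β s) z) (trans (*-assoc limit Z z) (trans (cong (limit *_) Zz) (*-identityʳ limit))) (*-monoʳ (<⇒≤ 0<z) dβ)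
        second : τ * (½ * Γ - 2ℚ * (Mat.β s * z)) ≤ ⟪ d ⟫ * P (suc s)
        second = *-cancelˡ 0<Z (begin
          Z * (τ * (½ * Γ - 2ℚ * (Mat.β s * z)))
            ≡⟨ rg 5 (λ t g b z y → z :* (t :* (con ½ :* g :- con 2ℚ :* (b :* y))) := t :* (con ½ :* (z :* g) :- con 2ℚ :* (b :* (z :* y)))) refl (τ ∷ Γ ∷ Mat.β s ∷ Z ∷ z ∷ []) ⟩
          τ * (½ * (Z * Γ) - 2ℚ * (Mat.β s * (Z * z)))
            ≡⟨ cong₂ (λ x y → τ * (½ * x - 2ℚ * y)) (sym K-value) (trans (cong (Mat.β s *_) Zz) (*-identityʳ _)) ⟩
          τ * (½ * Σ (pts d) Mat.k - 2ℚ * Mat.β s)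
            ≤⟨ Mat.reject-bound s ⟩
          ⟪ d ⟫ * Σ (pts d) (steps f (suc s))
            ≡⟨ trans (cong (⟪ d ⟫ *_) (sym (Z-P (suc s)))) (rg 3 (λ d z p → d :* (z :* p) := z :* (d :* p)) refl (⟪ d ⟫ ∷ Z ∷ P (suc s) ∷ [])) ⟩
          Z * (⟪ d ⟫ * P (suc s)) ∎)

      walk-bound : WalkEstimate d e Γ P
      walk-bound s large 0≤k 0≤κ kκ = let z , 0<z , Zz = inverse 0<Z
                                          t , 0<t , tt′ = inverse 0<total
                                          open WalkAverage s large 0≤k 0≤κ kκ 0<z Zz 0<t tt′
                                      in Mat.β s * z , first , second

  -- The choice of the walk length

  -- The search loop of pOf is local to its definition; unification recovers a name for it.
  search : ℕ → ℕ → ℕ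
  pOf-search : ∀ k → pOf (suc k) ≡ (if pValid (suc k) (suc k) then suc k else search (suc k) k)
  search = _
  pOf-search k with suc k
  ... | w = refl

  search-max : ∀ w k q → q ℕ.≤ k → pValid w q ≡ true → q ℕ.≤ search w k
  search-max w zero q q≤ v = q≤
  search-max w (suc k) q q≤ v = go (pValid w (suc k)) refl
    where
    go : ∀ b → pValid w (suc k) ≡ b → q ℕ.≤ (if b then suc k else search w k)
    go true _ = q≤
    go false e = search-max w k q (ℕₚ.≤-pred (ℕₚ.≤∧≢⇒< q≤ (λ { refl → true≢false (trans (sym v) e) }))) v
      where
      true≢false : true ≢ false
      true≢false ()

  search-valid : ∀ w k → search w k ≡ 0 ⊎ pValid w (search w k) ≡ true
  search-valid w zero = inj₁ refl
  search-valid w (suc k) = go (pValid w (suc k)) refl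
    where
    go : ∀ b → pValid w (suc k) ≡ b → (if b then suc k else search w k) ≡ 0 ⊎ pValid w (if b then suc k else search w k) ≡ true
    go true e = inj₂ e
    go false _ = search-valid w k

  pOf-max : ∀ {d q} → 0 ℕ.< d → q ℕ.≤ d → pValid d q ≡ true → q ℕ.≤ pOf d
  pOf-max {suc k} {q} _ q≤ v = subst (q ℕ.≤_) (sym (pOf-search k)) (search-max (suc k) (suc k) q q≤ v)

  pOf-valid : ∀ {d} → 0 ℕ.< d → pOf d ≡ 0 ⊎ pValid d (pOf d) ≡ true
  pOf-valid {suc k} _ = subst (λ p → p ≡ 0 ⊎ pValid (suc k) p ≡ true) (sym (pOf-search k)) (search-valid (suc k) (suc k))

  log-≥ : ∀ {k d} → 2 ℕ.^ k ℕ.≤ d → k ℕ.≤ ⌊log₂ d ⌋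
  log-≥ {k} {d} q = subst (ℕ._≤ ⌊log₂ d ⌋) (⌊log₂[2^n]⌋≡n k) (⌊log₂⌋-mono-≤ q)

  <-2^log : ∀ d → d ℕ.< 2 ℕ.^ suc ⌊log₂ d ⌋
  <-2^log d = ℕₚ.≰⇒> (λ q → ℕₚ.<-irrefl refl (log-≥ {suc ⌊log₂ d ⌋} q))

  n<2^n : ∀ n → n ℕ.< 2 ℕ.^ n
  n<2^n zero = s≤s z≤n
  n<2^n (suc n) = ℕₚ.≤-trans (s≤s (n<2^n n)) (ℕₚ.≤-trans (ℕₚ.+-monoˡ-≤ (2 ℕ.^ n) (ℕₚ.m^n>0 2 n)) (ℕₚ.≤-reflexive (cong (2 ℕ.^ n ℕ.+_) (sym (ℕₚ.+-identityʳ _)))))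

  4^≡ : ∀ t → 4 ℕ.^ t ≡ 2 ℕ.^ t ℕ.* 2 ℕ.^ t
  4^≡ t = trans (ℕₚ.^-*-assoc 2 2 t) (trans (cong (2 ℕ.^_) (trans (ℕₚ.*-comm 2 t) (trans (ℕₚ.*-suc t 1) (cong (t ℕ.+_) (ℕₚ.*-identityʳ t))))) (ℕₚ.^-distribˡ-+-* 2 t t))

  -- Because d < 2^(⌊log₂ d⌋ + 1), the power on the left of the test is at most 2^(10 · 4^q · (⌊log₂
  -- d⌋ + 1)).
  pValid-small : ∀ {d} q → 10 ℕ.* 4 ℕ.^ q ℕ.* suc ⌊log₂ d ⌋ ℕ.≤ d → pValid d q ≡ true
  pValid-small {d} q small = T⇒true (ℕₚ.≤⇒≤ᵇ (ℕₚ.≤-trans (ℕₚ.^-monoˡ-≤ (10 ℕ.* 4 ℕ.^ q) (ℕₚ.<⇒≤ (<-2^log d)))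
    (ℕₚ.≤-trans (ℕₚ.≤-reflexive (trans (ℕₚ.^-*-assoc 2 (suc ⌊log₂ d ⌋) (10 ℕ.* 4 ℕ.^ q)) (cong (2 ℕ.^_) (ℕₚ.*-comm (suc ⌊log₂ d ⌋) (10 ℕ.* 4 ℕ.^ q))))) (ℕₚ.^-monoʳ-≤ 2 small))))
    where
    T⇒true : ∀ {b} → T b → b ≡ true
    T⇒true {true} _ = refl

  -- A valid p satisfies 10 · 4^p ≤ d, and 2^(p+1) ≤ 10 · 4^p. Drawing t at random instead of
  -- knowing the best walk length therefore costs at most a factor ⌊log₂ d⌋.
  pOf<log : ∀ {d} → 2 ℕ.≤ d → suc (pOf d) ℕ.≤ ⌊log₂ d ⌋
  pOf<log {d} 2≤d = go (pOf d) (pOf-valid (ℕₚ.≤-trans (s≤s z≤n) 2≤d))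
    where
    go : ∀ p → p ≡ 0 ⊎ pValid d p ≡ true → suc p ℕ.≤ ⌊log₂ d ⌋
    go p (inj₁ refl) = log-≥ {1} 2≤d
    go p (inj₂ v) = log-≥ {suc p} {d} (ℕₚ.≤-trans (ℕₚ.*-mono-≤ {2} {10} {2 ℕ.^ p} {4 ℕ.^ p} (s≤s (s≤s z≤n)) (subst (2 ℕ.^ p ℕ.≤_) (sym (4^≡ p)) (ℕₚ.m≤m*n (2 ℕ.^ p) (2 ℕ.^ p) {{ℕₚ.m^n≢0 2 p}})))
      (ℕₚ.≮⇒≥ (λ d< → ℕₚ.<⇒≱ (ℕₚ.^-monoʳ-< 2 (s≤s (s≤s z≤n)) d<) (ℕₚ.≤-trans (ℕₚ.^-monoˡ-≤ (10 ℕ.* 4 ℕ.^ p) 2≤d) (≤ᵇ-true {d ℕ.^ (10 ℕ.* 4 ℕ.^ p)} {2 ℕ.^ d} v)))))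

  square-cancel : ∀ {x y} → 0ℚ ≤ y → x * x ≤ y * y → x ≤ y
  square-cancel {x} {y} 0≤y q with x ℚₚ.≤? y
  ... | yes x≤y = x≤y
  ... | no x≰y = *-cancelˡ (ℚₚ.≤-<-trans 0≤y (ℚₚ.≰⇒> x≰y)) (≤-trans q (*-monoʳ 0≤y (<⇒≤ (ℚₚ.≰⇒> x≰y))))

  10ℚ 1024ℚ : ℚ
  10ℚ = pos 10 / 1
  1024ℚ = pos 1024 / 1

  -- The length τ = s + 1 of the walk is such that c²τ² ≤ Γ²D; the walk bound is then applied with k = Γ / (cτ).
  module Balance {D c Γ e s : ℚ} (1024≤c : 1024ℚ ≤ c) (0≤D : 0ℚ < D) (0<Γ : 0ℚ < Γ) (Γ≤1 : Γ ≤ 1ℚ) (0≤e : 0ℚ ≤ e) (0≤s : 0ℚ ≤ s)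
    (e²≤D : e * e ≤ D) (τ²≤ : (c * (1ℚ + s)) * (c * (1ℚ + s)) ≤ Γ * Γ * D) where

    τ : ℚ
    τ = 1ℚ + s

    0<c : 0ℚ < c
    0<c = ℚₚ.<-≤-trans (ℚₚ.positive⁻¹ 1024ℚ) 1024≤c

    0<τ : 0ℚ < τ
    0<τ = +-pos (ℚₚ.positive⁻¹ 1ℚ) 0≤s

    g h k κ : ℚ
    g = proj₁ (inverse 0<Γ)
    h = proj₁ (inverse (*-pos 0<c 0<τ))
    k = Γ * h
    κ = (c * τ) * g

    Γg : Γ * g ≡ 1ℚ
    Γg = proj₂ (proj₂ (inverse 0<Γ))

    cτh : (c * τ) * h ≡ 1ℚ
    cτh = proj₂ (proj₂ (inverse (*-pos 0<c 0<τ)))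

    0≤g : 0ℚ ≤ g
    0≤g = <⇒≤ (proj₁ (proj₂ (inverse 0<Γ)))

    0≤k : 0ℚ ≤ k
    0≤k = <⇒≤ 0<Γ ⊛ <⇒≤ (proj₁ (proj₂ (inverse (*-pos 0<c 0<τ))))

    0≤κ : 0ℚ ≤ κ
    0≤κ = <⇒≤ (*-pos 0<c 0<τ) ⊛ 0≤g

    kκ : k * κ ≡ 1ℚ
    kκ = trans (rg 4 (λ G h x g → (G :* h) :* (x :* g) := (x :* h) :* (G :* g)) refl (Γ ∷ h ∷ c * τ ∷ g ∷ [])) (trans (cong₂ _*_ cτh Γg) (*-identityˡ 1ℚ))

    X : ℚ
    X = Γ * D

    0≤X : 0ℚ ≤ X
    0≤X = <⇒≤ 0<Γ ⊛ <⇒≤ 0≤D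

    bound₁ : 1024ℚ * (τ * k * D) ≤ X
    bound₁ = ≤-trans (*-monoʳ (<⇒≤ 0<τ ⊛ 0≤k ⊛ <⇒≤ 0≤D) 1024≤c)
      (≤-reflexive (trans (rg 5 (λ c t G h D → c :* (t :* (G :* h) :* D) := (c :* t) :* h :* (G :* D)) refl (c ∷ τ ∷ Γ ∷ h ∷ D ∷ [])) (trans (cong (_* X) cτh) (*-identityˡ X))))

    bound₂ : 1024ℚ * (τ * κ) ≤ X
    bound₂ = ≤-trans (*-monoʳ (<⇒≤ 0<τ ⊛ 0≤κ) 1024≤c) (≤-trans (≤-reflexive (rg 3 (λ c t g → c :* (t :* ((c :* t) :* g)) := (c :* t) :* (c :* t) :* g) refl (c ∷ τ ∷ g ∷ [])))
      (≤-trans (*-monoʳ 0≤g τ²≤) (≤-reflexive (trans (rg 3 (λ G g D → G :* G :* D :* g := (G :* g) :* (G :* D)) refl (Γ ∷ g ∷ D ∷ [])) (trans (cong (_* X) Γg) (*-identityˡ X))))))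

    bound₃ : (pos 260 / 1) * (1024ℚ * (τ * τ)) ≤ X
    bound₃ = ≤-trans (*-monoˡ (const≥0 (pos 260 / 1)) (*-monoʳ (sq-nonNeg τ) 1024≤c))
      (≤-trans (*-monoʳ (<⇒≤ 0<c ⊛ sq-nonNeg τ) (≤-trans (≤ᵇ⇒≤ tt) 1024≤c))
      (≤-trans (≤-reflexive (rg 2 (λ c t → c :* (c :* (t :* t)) := (c :* t) :* (c :* t)) refl (c ∷ τ ∷ []))) (≤-trans τ²≤
        (le 2 (λ G D → G :* G :* D ⊑ G :* D by (con 1ℚ :- G) :* (G :* D)) refl (Γ ∷ D ∷ []) (slack Γ≤1 ⊛ 0≤X)))))

    -- Here e² ≤ D enters: (cτe)² ≤ Γ²D · D = X².
    bound₄ : 1024ℚ * (τ * e) ≤ X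
    bound₄ = ≤-trans (*-monoʳ (<⇒≤ 0<τ ⊛ 0≤e) 1024≤c) (square-cancel 0≤X
      (≤-trans (≤-reflexive (rg 3 (λ c t e → c :* (t :* e) :* (c :* (t :* e)) := (c :* t) :* (c :* t) :* (e :* e)) refl (c ∷ τ ∷ e ∷ [])))
      (≤-trans (*-mono (sq-nonNeg (c * τ)) (sq-nonNeg e) τ²≤ e²≤D) (≤-reflexive (rg 2 (λ G D → G :* G :* D :* D := (G :* D) :* (G :* D)) refl (Γ ∷ D ∷ []))))))

    -- Each of the four bounds pays for one part of 8Db. The part 8(64 + 4096τ²) ≤ 33280τ² takes an
    -- eighth of X, which explains the 260 in `bound₃` since 260 · 1024 = 8 · 33280. The terms with
    -- kD and κ take an eighth each and 512τe takes a half, so 7/8 of X is used.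
    small : ∀ {b} → D * b ≤ 64ℚ + 4096ℚ * (τ * τ) + s * (16ℚ * (4ℚ * e + (k * D + κ))) → 8ℚ * b ≤ Γ
    small {b} q = *-cancelˡ 0≤D (≤-trans (le 8 (λ D b s e k κ X τ → D :* (con 8ℚ :* b) ⊑ X by
        con 8ℚ :* (con 64ℚ :+ con 4096ℚ :* (τ :* τ) :+ s :* (con 16ℚ :* (con 4ℚ :* e :+ (k :* D :+ κ))) :- D :* b)
        :+ con (pos 512 / 1) :* ((τ :- con 1ℚ) :* (τ :+ con 1ℚ))
        :+ (τ :- s) :* (con 8ℚ :* (con 16ℚ :* (con 4ℚ :* e :+ (k :* D :+ κ))))
        :+ con (pos 1 / 8) :* (X :- con (pos 260 / 1) :* (con 1024ℚ :* (τ :* τ)))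
        :+ con (pos 1 / 8) :* (X :- con 1024ℚ :* (τ :* k :* D))
        :+ con (pos 1 / 8) :* (X :- con 1024ℚ :* (τ :* κ))
        :+ con ½ :* (X :- con 1024ℚ :* (τ :* e))
        :+ con (pos 1 / 8) :* X) refl (D ∷ b ∷ s ∷ e ∷ k ∷ κ ∷ X ∷ τ ∷ [])
        (8ℚ · slack q ⊕ (pos 512 / 1) · (slack 1≤τ ⊛ (<⇒≤ 0<τ ⊕ 0≤1)) ⊕ slack s≤τ ⊛ (8ℚ · (16ℚ · (4ℚ · 0≤e ⊕ (0≤k ⊛ <⇒≤ 0≤D ⊕ 0≤κ))))
          ⊕ (pos 1 / 8) · slack bound₃ ⊕ (pos 1 / 8) · slack bound₁ ⊕ (pos 1 / 8) · slack bound₂ ⊕ ½ · slack bound₄ ⊕ (pos 1 / 8) · 0≤X))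
      (≤-reflexive (*-comm Γ D)))
      where
      1≤τ : 1ℚ ≤ τ
      1≤τ = le 1 (λ s → con 1ℚ ⊑ con 1ℚ :+ s by s) refl (s ∷ []) 0≤s
      s≤τ : s ≤ τ
      s≤τ = le 1 (λ s → s ⊑ con 1ℚ :+ s by con 1ℚ) refl (s ∷ []) 0≤1

    gain : ∀ {b p} → D * b ≤ 64ℚ + 4096ℚ * (τ * τ) + s * (16ℚ * (4ℚ * e + (k * D + κ))) → τ * (½ * Γ - 2ℚ * b) ≤ p → τ * Γ ≤ 4ℚ * p
    gain {b} {p} q r = le 4 (λ t G b p → t :* G ⊑ con 4ℚ :* p by con 4ℚ :* (p :- t :* (con ½ :* G :- con 2ℚ :* b)) :+ t :* (G :- con 8ℚ :* b)) refl (τ ∷ Γ ∷ b ∷ p ∷ []) (4ℚ · slack r ⊕ <⇒≤ 0<τ ⊛ slack (small q))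

  -- The target is D(Γe)⁴ ≤ 64Ky⁶, where y will be d times the sum of the rejection probabilities
  -- over t. Walks of length 1 suffice if e² ≥ D or Γ²D ≤ K; otherwise a length τ with τ²K of the
  -- order of Γ²D is used.
  module Endgame {D Γ e y K : ℚ} (0≤D : 0ℚ ≤ D) (0≤Γ : 0ℚ ≤ Γ) (Γ≤1 : Γ ≤ 1ℚ) (Γ≤e : Γ ≤ e) (e≤y : e ≤ y) (1≤K : 1ℚ ≤ K) where
    E Y G V : ℚ
    E = e * e
    Y = y * y
    G = Γ * Γ
    V = (G * E) * (G * E)

    0≤e : 0ℚ ≤ e
    0≤e = ≤-trans 0≤Γ Γ≤e

    0≤E : 0ℚ ≤ E
    0≤E = sq-nonNeg e

    0≤G : 0ℚ ≤ G
    0≤G = sq-nonNeg Γ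

    G≤1 : G ≤ 1ℚ
    G≤1 = subst (G ≤_) (*-identityˡ 1ℚ) (square-mono 0≤Γ Γ≤1)

    G≤E : G ≤ E
    G≤E = square-mono 0≤Γ Γ≤e

    E≤Y : E ≤ Y
    E≤Y = square-mono 0≤e e≤y

    0≤K : 0ℚ ≤ K
    0≤K = ≤-trans 0≤1 1≤K

    E³≤Y³ : E * (E * E) ≤ Y * (Y * Y)
    E³≤Y³ = *-mono 0≤E (0≤E ⊛ 0≤E) E≤Y (square-mono 0≤E E≤Y)

    0≤Y³ : 0ℚ ≤ Y * (Y * Y)
    0≤Y³ = sq-nonNeg y ⊛ (sq-nonNeg y ⊛ sq-nonNeg y)

    manyEdges : D ≤ E → D * V ≤ 64ℚ * (K * (Y * (Y * Y)))
    manyEdges D≤E = ≤-trans (*-mono 0≤D (sq-nonNeg (G * E)) D≤E (square-mono (0≤G ⊛ 0≤E) (le 2 (λ g e → g :* e ⊑ e by (con 1ℚ :- g) :* e) refl (G ∷ E ∷ []) (slack G≤1 ⊛ 0≤E))))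
      (≤-trans E³≤Y³ (le 2 (λ k y → y ⊑ con 64ℚ :* (k :* y) by con 64ℚ :* ((k :- con 1ℚ) :* y) :+ con (pos 63 / 1) :* y) refl (K ∷ Y * (Y * Y) ∷ []) (64ℚ · (slack 1≤K ⊛ 0≤Y³) ⊕ (pos 63 / 1) · 0≤Y³)))

    smallMatching : G * D ≤ K → D * V ≤ 64ℚ * (K * (Y * (Y * Y)))
    smallMatching GD≤K = ≤-trans (≤-reflexive (rg 3 (λ d g e → d :* ((g :* e) :* (g :* e)) := (g :* d) :* (e :* (g :* e))) refl (D ∷ G ∷ E ∷ [])))
      (≤-trans (*-mono (0≤G ⊛ 0≤D) (0≤E ⊛ (0≤G ⊛ 0≤E)) GD≤K (≤-trans (*-monoˡ 0≤E (*-monoʳ 0≤E G≤E)) E³≤Y³))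
        (le 2 (λ k y → k :* y ⊑ con 64ℚ :* (k :* y) by con (pos 63 / 1) :* (k :* y)) refl (K ∷ Y * (Y * Y) ∷ []) ((pos 63 / 1) · (0≤K ⊛ 0≤Y³))))

    longWalk : ∀ {τ} → 0ℚ ≤ τ → τ * Γ ≤ 4ℚ * y → G * D ≤ 4ℚ * (τ * τ * K) → D * V ≤ 64ℚ * (K * (Y * (Y * Y)))
    longWalk {τ} 0≤τ gain top = begin
      D * V                               ≡⟨ rg 3 (λ d g e → d :* ((g :* e) :* (g :* e)) := (g :* d) :* (g :* (e :* e))) refl (D ∷ G ∷ E ∷ []) ⟩
      (G * D) * (G * (E * E))             ≤⟨ *-monoʳ (0≤G ⊛ (0≤E ⊛ 0≤E)) top ⟩
      4ℚ * (τ * τ * K) * (Γ * Γ * (E * E))   ≡⟨ rg 4 (λ t k g e → con 4ℚ :* (t :* t :* k) :* (g :* g :* (e :* e)) := con 4ℚ :* (k :* (((t :* g) :* (t :* g)) :* (e :* e)))) refl (τ ∷ K ∷ Γ ∷ E ∷ []) ⟩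
      4ℚ * (K * (((τ * Γ) * (τ * Γ)) * (E * E)))   ≤⟨ *-monoˡ (const≥0 4ℚ) (*-monoˡ 0≤K (*-mono (sq-nonNeg (τ * Γ)) (0≤E ⊛ 0≤E) (square-mono (0≤τ ⊛ 0≤Γ) gain) (square-mono 0≤E E≤Y))) ⟩
      4ℚ * (K * ((4ℚ * y) * (4ℚ * y) * (Y * Y)))   ≡⟨ rg 3 (λ k y z → con 4ℚ :* (k :* ((con 4ℚ :* y) :* (con 4ℚ :* y) :* z)) := con 64ℚ :* (k :* (y :* y :* z))) refl (K ∷ y ∷ Y * Y ∷ []) ⟩
      64ℚ * (K * (Y * (Y * Y)))           ∎
      where open ℚₚ.≤-Reasoning

  ⟪2^_⟫² : ℕ → ℚ
  ⟪2^ t ⟫² = ⟪ 2 ℕ.^ t ⟫ * ⟪ 2 ℕ.^ t ⟫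

  -- Finds a power 4^t within a factor 4 of x/K; the second alternative only says that the search up
  -- to J was too short.
  threshold : ∀ {K x} J → K ≤ x → (∃ λ t → (⟪2^ t ⟫² * K ≤ x) × (x ≤ 4ℚ * (⟪2^ t ⟫² * K))) ⊎ (⟪2^ J ⟫² * K ≤ x)
  threshold {K} {x} zero K≤x = inj₂ (≤-trans (≤-reflexive (trans (cong (λ z → z * z * K) ⟪1⟫) (rg 1 (λ k → con 1ℚ :* con 1ℚ :* k := k) refl (K ∷ [])))) K≤x)
  threshold {K} {x} (suc J) K≤x with threshold J K≤x
  ... | inj₁ r = inj₁ r
  ... | inj₂ q with ⟪2^ suc J ⟫² * K ℚₚ.≤? x
  ...   | yes r = inj₂ r
  ...   | no r = inj₁ (J , q , ≤-trans (<⇒≤ (ℚₚ.≰⇒> r)) (≤-reflexive (trans (cong (λ z → z * z * K) (trans (⟪⟫-* 2 (2 ℕ.^ J)) (cong (_* ⟪ 2 ℕ.^ J ⟫) (⟪⟫-def 2)))) (rg 2 (λ t k → (con 2ℚ :* t) :* (con 2ℚ :* t) :* k := con 4ℚ :* (t :* t :* k)) refl (⟪ 2 ℕ.^ J ⟫ ∷ K ∷ [])))))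

  Σ-upTo-term : ∀ {g : ℕ → ℚ} → (∀ t → 0ℚ ≤ g t) → ∀ k t → t ℕ.< k → g t ≤ Σ (upTo k) g
  Σ-upTo-term {g} 0≤g k t t<k = go id k t t<k
    where
    go : ∀ (h : ℕ → ℕ) k t → t ℕ.< k → g (h t) ≤ Σ (List.applyUpTo h k) g
    go h (suc k) zero _ = le 2 (λ a s → a ⊑ a :+ s by s) refl (g (h 0) ∷ Σ (List.applyUpTo (h ∘ suc) k) g ∷ []) (Σ-nonNeg (List.applyUpTo (h ∘ suc) k) 0≤g)
    go h (suc k) (suc t) (s≤s q) = ≤-trans (go (h ∘ suc) k t q) (le 2 (λ a s → s ⊑ a :+ s by a) refl (g (h 0) ∷ Σ (List.applyUpTo (h ∘ suc) k) g ∷ []) (0≤g (h 0)))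

  module Conclusion {d : ℕ} (2≤d : 2 ℕ.≤ d) {e Γ r : ℚ} {P : ℕ → ℚ} (0≤Γ : 0ℚ ≤ Γ) (Γ≤e : Γ ≤ e) (Γ≤1 : Γ ≤ 1ℚ)
    (0≤P : ∀ τ → 0ℚ ≤ P τ) (e-bound : e ≤ ⟪ d ⟫ * P 1)
    (walk-bound : WalkEstimate d e Γ P)
    (Q-sum : ⟪ suc (pOf d) ⟫ * r ≡ Σ (upTo (suc (pOf d))) (λ t → P (2 ℕ.^ t))) where

    0<d : 0 ℕ.< d
    0<d = ℕₚ.≤-trans (s≤s z≤n) 2≤d

    L p : ℕ
    L = ⌊log₂ d ⌋
    p = pOf d

    D Q y K : ℚ
    D = ⟪ d ⟫
    Q = ⟪ suc p ⟫ * r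
    y = D * Q
    -- The square of 1024 is the c² of `Balance`. The logarithm ensures 10 · 4^t (⌊log₂ d⌋ + 1) ≤ d,
    -- so that the length found by `threshold` is among those drawn by the tester.
    K = 1024ℚ * 1024ℚ * ⟪ L ⟫

    P≤Q : ∀ t → t ℕ.≤ p → P (2 ℕ.^ t) ≤ Q
    P≤Q t t≤p = subst (P (2 ℕ.^ t) ≤_) (sym Q-sum) (Σ-upTo-term (λ t → 0≤P (2 ℕ.^ t)) (suc p) t (s≤s t≤p))

    0<D : 0ℚ < D
    0<D = ⟪⟫-pos 0<d

    e≤y : e ≤ y
    e≤y = ≤-trans e-bound (*-monoˡ (<⇒≤ 0<D) (P≤Q 0 z≤n))

    1≤L : 1ℚ ≤ ⟪ L ⟫
    1≤L = subst (_≤ ⟪ L ⟫) ⟪1⟫ (⟪⟫-mono (log-≥ {1} {d} 2≤d))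

    1≤1024 : 1ℚ ≤ 1024ℚ
    1≤1024 = ≤ᵇ⇒≤ tt

    1024L≤K : 1024ℚ * ⟪ L ⟫ ≤ K
    1024L≤K = *-monoʳ (0≤⟪⟫ L) (subst (_≤ 1024ℚ * 1024ℚ) (*-identityʳ 1024ℚ) (*-monoˡ (const≥0 1024ℚ) 1≤1024))

    1024≤K : 1024ℚ ≤ K
    1024≤K = ≤-trans (subst (_≤ 1024ℚ * ⟪ L ⟫) (*-identityʳ 1024ℚ) (*-monoˡ (const≥0 1024ℚ) 1≤L)) 1024L≤K

    open Endgame {D} {Γ} {e} {y} {K} (<⇒≤ 0<D) 0≤Γ Γ≤1 Γ≤e e≤y (≤-trans 1≤1024 1024≤K)

    GD≤D : G * D ≤ D
    GD≤D = ≤-trans (*-monoʳ (<⇒≤ 0<D) G≤1) (≤-reflexive (*-identityˡ D))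

    module Long (t : ℕ) (lower : ⟪2^ t ⟫² * K ≤ G * D) (upper : G * D ≤ 4ℚ * (⟪2^ t ⟫² * K)) (e²≤D : E ≤ D) (K≤ : K ≤ G * D) where
      ⟪τ⟫ : ℚ
      ⟪τ⟫ = ⟪ 2 ℕ.^ t ⟫

      0≤τ² : 0ℚ ≤ ⟪2^ t ⟫²
      0≤τ² = sq-nonNeg ⟪τ⟫

      large : 128 ℕ.* (2 ℕ.^ t ℕ.* 2 ℕ.^ t) ℕ.≤ d
      large = ⟪⟫-cancel (≤-trans (≤-reflexive (trans (⟪⟫-* 128 _) (cong₂ _*_ (⟪⟫-def 128) (⟪⟫-* (2 ℕ.^ t) (2 ℕ.^ t)))))
        (≤-trans (≤-reflexive (*-comm 128ℚ _)) (≤-trans (*-monoˡ 0≤τ² (≤-trans (≤ᵇ⇒≤ tt) 1024≤K)) (≤-trans lower GD≤D))))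

      t≤d : t ℕ.≤ d
      t≤d = ℕₚ.≤-trans (ℕₚ.<⇒≤ (n<2^n t)) (ℕₚ.≤-trans (ℕₚ.m≤m*n (2 ℕ.^ t) (2 ℕ.^ t) {{ℕₚ.m^n≢0 2 t}}) (ℕₚ.≤-trans (ℕₚ.m≤n*m _ 128) large))

      20L≤K : 10ℚ * (1ℚ + ⟪ L ⟫) ≤ K
      20L≤K = ≤-trans (le 1 (λ l → con 10ℚ :* (con 1ℚ :+ l) ⊑ con 1024ℚ :* l by con 10ℚ :* (l :- con 1ℚ) :+ con (pos 1004 / 1) :* l) refl (⟪ L ⟫ ∷ []) (10ℚ · slack 1≤L ⊕ (pos 1004 / 1) · 0≤⟪⟫ L)) 1024L≤K

      t≤p : t ℕ.≤ p
      t≤p = pOf-max 0<d t≤d (pValid-small {d} t (⟪⟫-cancel (≤-trans (≤-reflexive (trans (⟪⟫-* (10 ℕ.* 4 ℕ.^ t) (suc L)) (trans (cong₂ _*_ (trans (⟪⟫-* 10 (4 ℕ.^ t)) (cong₂ _*_ (⟪⟫-def 10) (trans (cong ⟪_⟫ (4^≡ t)) (⟪⟫-* (2 ℕ.^ t) (2 ℕ.^ t))))) (⟪⟫-suc L))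
          (rg 2 (λ t l → con 10ℚ :* t :* l := t :* (con 10ℚ :* l)) refl (⟪2^ t ⟫² ∷ 1ℚ + ⟪ L ⟫ ∷ [])))))
        (≤-trans (*-monoˡ 0≤τ² 20L≤K) (≤-trans lower GD≤D)))))

      0<Γ : 0ℚ < Γ
      0<Γ = ℚₚ.≰⇒> (λ Γ≤0 → ℚₚ.<-irrefl refl (ℚₚ.<-≤-trans (ℚₚ.<-≤-trans (ℚₚ.positive⁻¹ 1024ℚ) 1024≤K) (≤-trans K≤
        (≤-reflexive (trans (cong (λ g → g * g * D) (ℚₚ.≤-antisym Γ≤0 0≤Γ)) (rg 1 (λ d → con 0ℚ :* con 0ℚ :* d := con 0ℚ) refl (D ∷ [])))))))

      c²τ² : (1024ℚ * ⟪τ⟫) * (1024ℚ * ⟪τ⟫) ≤ Γ * Γ * D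
      c²τ² = ≤-trans (le 3 (λ c t l → (c :* t) :* (c :* t) ⊑ (t :* t) :* (c :* c :* l) by (t :* t) :* ((c :* c) :* (l :- con 1ℚ))) refl (1024ℚ ∷ ⟪τ⟫ ∷ ⟪ L ⟫ ∷ []) (0≤τ² ⊛ (sq-nonNeg 1024ℚ ⊛ slack 1≤L))) lower

      τΓ : ∀ s → 2 ℕ.^ t ≡ suc s → ⟪τ⟫ * Γ ≤ 4ℚ * y
      τΓ s eq = subst (λ z → z * Γ ≤ 4ℚ * y) (sym τ≡) (≤-trans (gain (subst (λ z → D * b ≤ 64ℚ + 4096ℚ * (z * z) + ⟪ s ⟫ * (16ℚ * (4ℚ * e + (k * D + κ)))) (⟪⟫-suc s) first) (subst (λ z → z * (½ * Γ - 2ℚ * b) ≤ D * P (suc s)) (⟪⟫-suc s) second))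
        (*-monoˡ (const≥0 4ℚ) (*-monoˡ (<⇒≤ 0<D) (subst (λ z → P z ≤ Q) eq (P≤Q t t≤p)))))
        where
        τ≡ : ⟪τ⟫ ≡ 1ℚ + ⟪ s ⟫
        τ≡ = trans (cong ⟪_⟫ eq) (⟪⟫-suc s)
        open Balance {D} {1024ℚ} {Γ} {e} {⟪ s ⟫} ≤-refl 0<D 0<Γ Γ≤1 0≤e (0≤⟪⟫ s) e²≤D (subst (λ z → (1024ℚ * z) * (1024ℚ * z) ≤ Γ * Γ * D) τ≡ c²τ²)
        wb : ∃ λ b → (D * b ≤ 64ℚ + 4096ℚ * (⟪ suc s ⟫ * ⟪ suc s ⟫) + ⟪ s ⟫ * (16ℚ * (4ℚ * e + (k * D + κ)))) × (⟪ suc s ⟫ * (½ * Γ - 2ℚ * b) ≤ D * P (suc s))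
        wb = walk-bound s (subst (λ τ → 128 ℕ.* (τ ℕ.* τ) ℕ.≤ d) eq large) 0≤k 0≤κ kκ
        b = proj₁ wb
        first = proj₁ (proj₂ wb)
        second = proj₂ (proj₂ wb)

      result : D * V ≤ 64ℚ * (K * (Y * (Y * Y)))
      result = longWalk (0≤⟪⟫ (2 ℕ.^ t)) (τΓ (ℕ.pred (2 ℕ.^ t)) (sym (ℕₚ.suc-pred (2 ℕ.^ t) {{ℕₚ.m^n≢0 2 t}}))) upper

    key : D * V ≤ 64ℚ * (K * (Y * (Y * Y)))
    key = edges (ℚₚ.≤-total D E)
      where
      walk : E ≤ D → K ≤ G * D → (∃ λ t → (⟪2^ t ⟫² * K ≤ G * D) × (G * D ≤ 4ℚ * (⟪2^ t ⟫² * K))) ⊎ (⟪2^ d ⟫² * K ≤ G * D) → D * V ≤ 64ℚ * (K * (Y * (Y * Y)))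
      walk E≤D K≤ (inj₁ (t , lower , upper)) = Long.result t lower upper E≤D K≤
      -- 4^d K ≤ Γ²D ≤ d is impossible, so a search up to d does find t.
      walk E≤D K≤ (inj₂ tooMuch) = ⊥-elim (ℕₚ.<⇒≱ (n<2^n d) (⟪⟫-cancel (≤-trans (le 2 (λ t k → t ⊑ t :* t :* k by t :* t :* (k :- con 1ℚ) :+ t :* (t :- con 1ℚ)) refl (⟪ 2 ℕ.^ d ⟫ ∷ K ∷ [])
        (sq-nonNeg ⟪ 2 ℕ.^ d ⟫ ⊛ slack (≤-trans 1≤1024 1024≤K) ⊕ 0≤⟪⟫ (2 ℕ.^ d) ⊛ slack (subst (_≤ ⟪ 2 ℕ.^ d ⟫) ⟪1⟫ (⟪⟫-mono (ℕₚ.m^n>0 2 d))))) (≤-trans tooMuch GD≤D))))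
      matching : E ≤ D → G * D ≤ K ⊎ K ≤ G * D → D * V ≤ 64ℚ * (K * (Y * (Y * Y)))
      matching _ (inj₁ GD≤K) = smallMatching GD≤K
      matching E≤D (inj₂ K≤) = walk E≤D K≤ (threshold d K≤)
      edges : D ≤ E ⊎ E ≤ D → D * V ≤ 64ℚ * (K * (Y * (Y * Y)))
      edges (inj₁ D≤E) = manyEdges D≤E
      edges (inj₂ E≤D) = matching E≤D (ℚₚ.≤-total (G * D) K)

  -- Combining isoperimetry with the bounds on the tester

  pow : ∀ {n} → ℕ → Polynomial n → Polynomial n
  pow zero x = con 1ℚ
  pow (suc k) x = x :* pow k x

  ^^-mono : ∀ {x y} k → 0ℚ ≤ x → x ≤ y → x ^^ k ≤ y ^^ k
  ^^-mono zero 0≤x x≤y = ≤-refl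
  ^^-mono (suc k) 0≤x x≤y = *-mono 0≤x (^^-nonNeg k 0≤x) x≤y (^^-mono k 0≤x x≤y)

  powℚ-^^ : ∀ q k → powℚ q k ≡ q ^^ k
  powℚ-^^ q zero = refl
  powℚ-^^ q (suc k) = trans (sym (*-def q (powℚ q k))) (cong (q *_) (powℚ-^^ q k))

  differ-xor : ∀ a b → differ a b ≡ a xor b
  differ-xor true true = refl
  differ-xor true false = refl
  differ-xor false true = refl
  differ-xor false false = refl

  far-distance : ∀ {n d} {ε : ℚ} {f : Vec (Fin n) d → Bool} → FarFromMonotone ε f → ∀ g → Monotone g → ε * ⟪ n ℕ.^ d ⟫ ≤ Descent.D n f g
  far-distance {n} {d} {ε} {f} far g mono = subst₂ _≤_
    (trans (sym (*-def ε _)) (cong (ε *_) (sym (⟪⟫-def (n ℕ.^ d)))))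
    (trans (sym (⟪⟫-def _)) (trans (⟪⟫-filter _ (allPoints n d)) (Σ-cong (allPoints n d) (λ x → cong ι (differ-xor (f x) (g x))))))
    (far g mono)

  -- `α` is the constant of `isoperimetric`, `γ` comes from the K of `Conclusion`, 64 from
  -- `Endgame`, and 2⁸ from the 2m classes in each direction.
  α γ C₀ : ℚ
  α = 4ℚ * ((pos 12296 / 1) * (pos 12296 / 1))
  γ = 1024ℚ * 1024ℚ
  C₀ = α ^^ 4 * 2ℚ ^^ 8 * 64ℚ * γ

  0<C₀ : 0ℚ < C₀
  0<C₀ = *-pos (*-pos (*-pos (^^-pos 4 (*-pos {4ℚ} (ℚₚ.positive⁻¹ 4ℚ) (*-pos {pos 12296 / 1} {pos 12296 / 1} (ℚₚ.positive⁻¹ (pos 12296 / 1)) (ℚₚ.positive⁻¹ (pos 12296 / 1))))) (^^-pos 8 (ℚₚ.positive⁻¹ 2ℚ))) (ℚₚ.positive⁻¹ 64ℚ)) (*-pos {1024ℚ} {1024ℚ} (ℚₚ.positive⁻¹ 1024ℚ) (ℚₚ.positive⁻¹ 1024ℚ))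

  -- Chains the isoperimetric inequality ε² ≤ α(2m)²Γe with D(Γe)⁴ ≤ 64γL(DQ)⁶ and Q ≤ Lr.
  assemble : ∀ {ε m Γ e D L Q r} → 0ℚ < D → 1ℚ ≤ L → 0ℚ ≤ m → 0ℚ ≤ Q → 0ℚ ≤ r → 0ℚ ≤ Γ → 0ℚ ≤ e → Q ≤ L * r →
    ε * ε ≤ α * ((2ℚ * m) * (2ℚ * m)) * (Γ * e) →
    D * ((Γ * Γ * (e * e)) * (Γ * Γ * (e * e))) ≤ 64ℚ * (γ * L * ((D * Q) * (D * Q) * (((D * Q) * (D * Q)) * ((D * Q) * (D * Q))))) →
    ε ^^ 8 ≤ C₀ * (r ^^ 6 * (D ^^ 5 * L ^^ 9 * m ^^ 8))
  assemble {ε} {m} {Γ} {e} {D} {L} {Q} {r} 0<D 1≤L 0≤m 0≤Q 0≤r 0≤Γ 0≤e Q≤ iso end = go α γ 2ℚ 0≤α 0≤γ (const≥0 2ℚ) iso end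
    where
    0≤α : 0ℚ ≤ α
    0≤α = 4ℚ · sq-nonNeg (pos 12296 / 1)
    0≤γ : 0ℚ ≤ γ
    0≤γ = sq-nonNeg 1024ℚ
    0≤L : 0ℚ ≤ L
    0≤L = ≤-trans 0≤1 1≤L
    go : ∀ α γ t → 0ℚ ≤ α → 0ℚ ≤ γ → 0ℚ ≤ t → ε * ε ≤ α * ((t * m) * (t * m)) * (Γ * e) →
      D * ((Γ * Γ * (e * e)) * (Γ * Γ * (e * e))) ≤ 64ℚ * (γ * L * ((D * Q) * (D * Q) * (((D * Q) * (D * Q)) * ((D * Q) * (D * Q))))) →
      ε ^^ 8 ≤ α ^^ 4 * t ^^ 8 * 64ℚ * γ * (r ^^ 6 * (D ^^ 5 * L ^^ 9 * m ^^ 8))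
    go α γ t 0≤α 0≤γ 0≤t iso end = begin
      ε ^^ 8
        ≡⟨ rg 1 (λ x → pow 8 x := pow 4 (x :* x)) refl (ε ∷ []) ⟩
      (ε * ε) ^^ 4
        ≤⟨ ^^-mono 4 (sq-nonNeg ε) iso ⟩
      (Θ * (Γ * e)) ^^ 4
        ≡⟨ rg 3 (λ a g e → pow 4 (a :* (g :* e)) := pow 4 a :* ((g :* g :* (e :* e)) :* (g :* g :* (e :* e)))) refl (Θ ∷ Γ ∷ e ∷ []) ⟩
      Θ ^^ 4 * ((Γ * Γ * (e * e)) * (Γ * Γ * (e * e)))
        ≤⟨ *-monoˡ (^^-nonNeg 4 0≤Θ) cancelled ⟩
      Θ ^^ 4 * (64ℚ * (γ * L * (D ^^ 5 * Q ^^ 6)))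
        ≤⟨ *-monoˡ (^^-nonNeg 4 0≤Θ) (*-monoˡ (const≥0 64ℚ) (*-monoˡ (0≤γ ⊛ 0≤L) (*-monoˡ (^^-nonNeg 5 (<⇒≤ 0<D)) (^^-mono 6 0≤Q Q≤)))) ⟩
      Θ ^^ 4 * (64ℚ * (γ * L * (D ^^ 5 * (L * r) ^^ 6)))
        ≡⟨ cong (Θ ^^ 4 *_) (rg 4 (λ g l d r → con 64ℚ :* (g :* l :* (d :* pow 6 (l :* r))) := con 64ℚ :* g :* (pow 6 r :* (d :* pow 7 l))) refl (γ ∷ L ∷ D ^^ 5 ∷ r ∷ [])) ⟩
      Θ ^^ 4 * (64ℚ * γ * (r ^^ 6 * (D ^^ 5 * L ^^ 7)))
        -- The argument gives seven logarithms, one from K and six from Q ≤ L r; the ninth power is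
        -- log^(3/2) d before sixth roots are taken.
        ≤⟨ *-monoˡ (^^-nonNeg 4 0≤Θ) (*-monoˡ (64ℚ · 0≤γ) (*-monoˡ (^^-nonNeg 6 0≤r) (*-monoˡ (^^-nonNeg 5 (<⇒≤ 0<D)) L⁷≤L⁹))) ⟩
      Θ ^^ 4 * (64ℚ * γ * (r ^^ 6 * (D ^^ 5 * L ^^ 9)))
        ≡⟨ cong (_* (64ℚ * γ * (r ^^ 6 * (D ^^ 5 * L ^^ 9)))) (rg 3 (λ a t m → pow 4 (a :* ((t :* m) :* (t :* m))) := pow 4 a :* pow 8 t :* pow 8 m) refl (α ∷ t ∷ m ∷ [])) ⟩
      α ^^ 4 * t ^^ 8 * m ^^ 8 * (64ℚ * γ * (r ^^ 6 * (D ^^ 5 * L ^^ 9)))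
        ≡⟨ rg 6 (λ a t m g r x → a :* t :* m :* (con 64ℚ :* g :* (r :* x)) := a :* t :* con 64ℚ :* g :* (r :* (x :* m))) refl (α ^^ 4 ∷ t ^^ 8 ∷ m ^^ 8 ∷ γ ∷ r ^^ 6 ∷ D ^^ 5 * L ^^ 9 ∷ []) ⟩
      α ^^ 4 * t ^^ 8 * 64ℚ * γ * (r ^^ 6 * (D ^^ 5 * L ^^ 9 * m ^^ 8)) ∎
      where
      open ℚₚ.≤-Reasoning
      Θ : ℚ
      Θ = α * ((t * m) * (t * m))
      0≤Θ : 0ℚ ≤ Θ
      0≤Θ = 0≤α ⊛ ((0≤t ⊛ 0≤m) ⊛ (0≤t ⊛ 0≤m))
      cancelled : (Γ * Γ * (e * e)) * (Γ * Γ * (e * e)) ≤ 64ℚ * (γ * L * (D ^^ 5 * Q ^^ 6))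
      cancelled = *-cancelˡ 0<D (≤-trans end (≤-reflexive (rg 3 (λ d q g → con 64ℚ :* (g :* ((d :* q) :* (d :* q) :* (((d :* q) :* (d :* q)) :* ((d :* q) :* (d :* q))))) := d :* (con 64ℚ :* (g :* (pow 5 d :* pow 6 q)))) refl (D ∷ Q ∷ γ * L ∷ []))))
      L⁷≤L⁹ : L ^^ 7 ≤ L ^^ 9
      L⁷≤L⁹ = le 2 (λ l p → p ⊑ l :* (l :* p) by ((l :- con 1ℚ) :* (l :+ con 1ℚ)) :* p) refl (L ∷ L ^^ 7 ∷ []) (slack 1≤L ⊛ (0≤L ⊕ 0≤1) ⊛ ^^-nonNeg 7 0≤L)

  module FarFunction (m d : ℕ) {ε : ℚ} (f : Vec (Fin (2 ℕ.^ m)) d → Bool) (0<ε : 0ℚ < ε) (far : FarFromMonotone ε f) where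
    n : ℕ
    n = 2 ℕ.^ m

    δ : ℚ
    δ = ε * ⟪ n ℕ.^ d ⟫

    0<δ : 0ℚ < δ
    0<δ = *-pos 0<ε (⟪⟫-pos (ℕₚ.m^n>0 n {{ℕₚ.m^n≢0 2 m}} d))

    isoperimetry : δ * δ ≤ α * (Matchings.W m d f * Matchings.E m d f)
    isoperimetry = Matchings.isoperimetric m d f 0<δ (far-distance far)

    module Positive (0<m : 0 ℕ.< m) (2≤d : 2 ℕ.≤ d) where
      0<d : 0 ℕ.< d
      0<d = ℕₚ.≤-trans (s≤s z≤n) 2≤d
      open Tester m f using (P; M-value)
      open Tester.Estimates m f 0<m 0<d

      module I = Independent (pairs (allFin m) bools)

      Q-sum : ⟪ suc (pOf d) ⟫ * rejectProb m d f ≡ Σ (upTo (suc (pOf d))) (λ t → P (2 ℕ.^ t))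
      Q-sum = trans (cong (λ k → ⟪ k ⟫ * rejectProb m d f) (sym (Listₚ.length-upTo (suc (pOf d))))) (avg-Σ (λ t → P (2 ℕ.^ t)) (upTo (suc (pOf d))))

      0≤Q : 0ℚ ≤ ⟪ suc (pOf d) ⟫ * rejectProb m d f
      0≤Q = subst (0ℚ ≤_) (sym Q-sum) (Σ-nonNeg (upTo (suc (pOf d))) (λ t → 0≤P (2 ℕ.^ t)))

      0≤r : 0ℚ ≤ rejectProb m d f
      0≤r = *-cancelˡ (0<⟪⟫ (pOf d)) (≤-trans (≤-reflexive (*-zeroʳ _)) 0≤Q)

      density : ∀ S → S ≡ (S * u) * (I.M * Nv)
      density S = sym (trans (rg 3 (λ s u x → (s :* u) :* x := s :* (x :* u)) refl (S ∷ u ∷ I.M * Nv ∷ [])) (trans (cong (S *_) MNu) (*-identityʳ S)))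

      isoperimetry′ : ε * ε ≤ α * ((2ℚ * ⟪ m ⟫) * (2ℚ * ⟪ m ⟫)) * (Γ * e)
      isoperimetry′ = *-cancelˡ (*-pos 0<Nv 0<Nv) (begin
        Nv * Nv * (ε * ε)
          ≡⟨ rg 2 (λ n x → n :* n :* (x :* x) := (x :* n) :* (x :* n)) refl (Nv ∷ ε ∷ []) ⟩
        (ε * Nv) * (ε * Nv)
          ≡⟨ cong (λ z → (ε * z) * (ε * z)) Nv-value ⟩
        δ * δ
          ≤⟨ isoperimetry ⟩
        α * (Matchings.W m d f * Matchings.E m d f)
          ≤⟨ *-monoˡ (4ℚ · sq-nonNeg (pos 12296 / 1)) (*-monoʳ (Matchings.0≤E m d f) W-value) ⟩
        α * (W * Matchings.E m d f)
          ≡⟨ cong (α *_) (cong₂ _*_ (density W) (trans (sym E-value) (density E))) ⟩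
        α * ((Γ * (I.M * Nv)) * (e * (I.M * Nv)))
          ≡⟨ cong (λ M → α * ((Γ * (M * Nv)) * (e * (M * Nv)))) M-value ⟩
        α * ((Γ * ((2ℚ * ⟪ m ⟫) * Nv)) * (e * ((2ℚ * ⟪ m ⟫) * Nv)))
          ≡⟨ rg 5 (λ a g e m n → a :* ((g :* (m :* n)) :* (e :* (m :* n))) := n :* n :* (a :* (m :* m) :* (g :* e))) refl (α ∷ Γ ∷ e ∷ 2ℚ * ⟪ m ⟫ ∷ Nv ∷ []) ⟩
        Nv * Nv * (α * ((2ℚ * ⟪ m ⟫) * (2ℚ * ⟪ m ⟫)) * (Γ * e)) ∎)
        where open ℚₚ.≤-Reasoning

      bound : ε ^^ 8 ≤ C₀ * (rejectProb m d f ^^ 6 * (⟪ d ⟫ ^^ 5 * ⟪ ⌊log₂ d ⌋ ⟫ ^^ 9 * ⟪ m ⟫ ^^ 8))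
      bound = assemble (⟪⟫-pos 0<d) (Conclusion.1≤L 2≤d 0≤Γ Γ≤e Γ≤1 0≤P e-bound walk-bound Q-sum) (0≤⟪⟫ m) 0≤Q 0≤r 0≤Γ (≤-trans 0≤Γ Γ≤e) (*-monoʳ 0≤r (⟪⟫-mono (pOf<log 2≤d)))
        isoperimetry′ (Conclusion.key 2≤d 0≤Γ Γ≤e Γ≤1 0≤P e-bound walk-bound Q-sum)

  rejection-bound : ∀ m d {ε} (f : Vec (Fin (2 ℕ.^ m)) d → Bool) → 2 ℕ.≤ d → 0ℚ < ε → FarFromMonotone ε f →
    ε ^^ 8 ≤ C₀ * (rejectProb m d f ^^ 6 * (⟪ d ⟫ ^^ 5 * ⟪ ⌊log₂ d ⌋ ⟫ ^^ 9 * ⟪ m ⟫ ^^ 8))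
  -- For n = 1 there are no classes, so isoperimetry would give δ² ≤ 0: no function is far from
  -- monotone.
  rejection-bound zero d f 2≤d 0<ε far = ⊥-elim (ℚₚ.<-irrefl refl (ℚₚ.<-≤-trans (*-pos (FarFunction.0<δ 0 d f 0<ε far) (FarFunction.0<δ 0 d f 0<ε far))
    (≤-trans (FarFunction.isoperimetry 0 d f 0<ε far) (≤-reflexive (trans (cong (α *_) (*-zeroˡ _)) (*-zeroʳ α))))))
  rejection-bound (suc m) d f 2≤d 0<ε far = FarFunction.Positive.bound (suc m) d f 0<ε far (s≤s z≤n) 2≤d

  -- Raised to the sixth power, the exponents 4/3, 5/6, 3/2 and 4/3 of ε, d, log d and log n become
  -- the integers 8, 5, 9 and 8.
  lower-bound : ∃ (λ c → (0ℚ < c) × (∀ (m d : ℕ) (ε : ℚ) (f : Point (2 ℕ.^ m) d → Bool) → 2 ℕ.≤ d → d ℕ.^ 10 ℕ.≤ 2 ℕ.^ d → 0ℚ < ε → FarFromMonotone ε f → c ℚ.* powℚ ε 8 ≤ powℚ (rejectProb m d f) 6 ℚ.* ℕtoℚ (d ℕ.^ 5 ℕ.* ⌊log₂ d ⌋ ℕ.^ 9 ℕ.* m ℕ.^ 8)))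
  lower-bound = proj₁ inv , proj₁ (proj₂ inv) , λ m d ε f 2≤d _ 0<ε far → subst₂ _≤_
      (trans (cong (proj₁ inv *_) (sym (powℚ-^^ ε 8))) (*-def _ _))
      (trans (cong₂ _*_ (sym (powℚ-^^ (rejectProb m d f) 6)) (trans (sym (denominator m d)) (⟪⟫-def _))) (*-def _ _))
      (≤-trans (*-monoˡ (<⇒≤ (proj₁ (proj₂ inv))) (rejection-bound m d f 2≤d 0<ε far))
        (≤-reflexive (trans (sym (*-assoc (proj₁ inv) C₀ _)) (trans (cong (_* (rejectProb m d f ^^ 6 * (⟪ d ⟫ ^^ 5 * ⟪ ⌊log₂ d ⌋ ⟫ ^^ 9 * ⟪ m ⟫ ^^ 8))) (trans (*-comm (proj₁ inv) C₀) (proj₂ (proj₂ inv)))) (*-identityˡ _)))))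
    where
    inv : Σ[ q ∈ ℚ ] (0ℚ < q) × (C₀ * q ≡ 1ℚ)
    inv = inverse 0<C₀
    denominator : ∀ m d → ⟪ d ℕ.^ 5 ℕ.* ⌊log₂ d ⌋ ℕ.^ 9 ℕ.* m ℕ.^ 8 ⟫ ≡ ⟪ d ⟫ ^^ 5 * ⟪ ⌊log₂ d ⌋ ⟫ ^^ 9 * ⟪ m ⟫ ^^ 8
    denominator m d = trans (⟪⟫-* (d ℕ.^ 5 ℕ.* ⌊log₂ d ⌋ ℕ.^ 9) (m ℕ.^ 8)) (cong₂ _*_ (trans (⟪⟫-* (d ℕ.^ 5) (⌊log₂ d ⌋ ℕ.^ 9)) (cong₂ _*_ (⟪⟫-^ d 5) (⟪⟫-^ ⌊log₂ d ⌋ 9))) (⟪⟫-^ m 8))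

open import Data.Bool using (Bool)
open import Data.Nat using (ℕ; _^_) renaming (_≤_ to _≤ℕ_; _*_ to _*ℕ_)
open import Data.Nat.Logarithm using (⌊log₂_⌋)
open import Data.Product using (Σ; _×_)
open import Data.Rational using (ℚ; 0ℚ; _<_; _≤_; _*_)

theorem1p2 : Σ ℚ (λ c → (0ℚ < c) × (∀ (m d : ℕ) (ε : ℚ) (f : Point (2 ^ m) d → Bool) → 2 ≤ℕ d → d ^ 10 ≤ℕ 2 ^ d → 0ℚ < ε → FarFromMonotone ε f → c * powℚ ε 8 ≤ powℚ (rejectProb m d f) 6 * ℕtoℚ (d ^ 5 *ℕ ⌊log₂ d ⌋ ^ 9 *ℕ m ^ 8)))
theorem1p2 = Development.lower-bound
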